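{- Let $n$ be a positive integer, $0\le n_0\le n$ an integer, $a=(a_1,\dots,a_n)$ a sequence of positive integers, $v=(v_1,\dots,v_n)\in\mathbb{Z}^n$ and $\lambda$ a partition with $|\lambda|=|v|$. Define $r:=\max\big(\{v_i-n+n_0: i\le n_0\}\cup\{v_i: i\ge n_0+1\}\big)$, $S_1:=\{i: 1\le i\le n_0,\ v_i-n+n_0=r\}$, $S_2:=\{i: n_0+1\le i\le n,\ v_i=r\}$, $s_1:=|S_1|$, $s_2:=|S_2|$, and $\widetilde a:=(a_1-1,\dots,a_{n_0}-1,a_{n_0+1},\dots,a_n)$. \begin{enumerate} \item If $\max\{v_i-n+n_0: i\le n_0\}\ge\max\{v_i: i\ge n_0+1\}+s_1$ and $\lambda_1=\cdots=\lambda_{s_1}=r$, then \[ D_{v,\lambda}(a;n,n_0)=(-1)^{s_1(n-n_0)}\frac{\begin{bmatrix}|\widetilde a|+r-1\\ \widetilde a,\,r-1\end{bmatrix}}{\begin{bmatrix}|\widetilde a|-\widetilde a_{S_1}+r-1\\ \widetilde a^{(S_1)},\,r-1\end{bmatrix}}\sum_{\emptyset\ne J\subseteq S_1}(-1)^{|S_1\setminus J|}q^{L_{n_0,S_1,J}(\widetilde a)}\frac{1-q^{\widetilde a_J}}{1-q^{|\widetilde a|-\widetilde a_J+r}}\,D_{(v+s_1\alpha)^{(S_1)},\lambda^{([s_1])}}\big(a^{(S_1)};n-s_1,n_0-s_1\big), \] where $\alpha=(0,\dots,0,1,\dots,1)$ has $n_0$ zeros followed by $n-n_0$ ones. \item If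 $\max\{v_i: i\ge n_0+1\}\ge\max\{v_i-n+n_0: i\le n_0\}+s_2$ and $\lambda_1=\cdots=\lambda_{s_2}=r$, then \[ D_{v,\lambda}(a;n,n_0)=\frac{\begin{bmatrix}|\widetilde a|+r-1\\ \widetilde a,\,r-1\end{bmatrix}}{\begin{bmatrix}|\widetilde a|-\widetilde a_{S_2}+r-1\\ \widetilde a^{(S_2)},\,r-1\end{bmatrix}}\sum_{\emptyset\ne J\subseteq S_2}(-1)^{|S_2\setminus J|}q^{L_{n,S_2,J}(\widetilde a)}\frac{1-q^{\widetilde a_J}}{1-q^{|\widetilde a|-\widetilde a_J+r}}\,D_{v^{(S_2)},\lambda^{([s_2])}}\big(a^{(S_2)};n-s_2,n_0\big). \end{enumerate}
   Context: For a nonnegative integer $k$, $(z)_k:=(1-z)(1-zq)\cdots(1-zq^{k-1})$. For $N$ and a nonnegative integer sequence $t=(t_1,\dots,t_k)$, the $q$-multinomial coefficient is $\begin{bmatrix}N\\ t\end{bmatrix}:=(q)_N/\big((q)_{t_1}\cdots(q)_{t_k}\big)$; $\begin{bmatrix}N\\ \widetilde a, r-1\end{bmatrix}$ means $t$ is the sequence $\widetilde a$ followed by $r-1$. For a sequence $s=(s_1,\dots,s_n)$ and $I\subseteq\{1,\dots,n\}$, $s^{(I)}$ is the sequence obtained from $s$ by deleting the entries with indices in $I$, $s_I:=\sum_{i\in I}s_i$, and $|s|$ is the sum of all entries. $[m]=\{1,\dots,m\}$, so $\lambda^{([s])}=(\lambda_{s+1},\lambda_{s+2},\dots)$. For $m$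 a positive integer, a sequence $b$ and $I,J\subseteq\{1,\dots,n\}$, $L_{m,I,J}(b):=\sum b_j$, the sum over pairs $(i,j)$ with $1\le i\le j\le m$, $i\in I$, $j\notin J$. A partition is a weakly decreasing sequence of nonnegative integers with finitely many nonzero entries. Complete symmetric functions: $\sum_{r\ge0}z^rh_r(X)=\prod_{x\in X}(1-zx)^{ -1}$, $h_\lambda:=h_{\lambda_1}h_{\lambda_2}\cdots$. For positive integers $a=(a_1,\dots,a_n)$ and $0\le n_0\le n$, let $X^{(a;n_0)}=\{x_iq^{k}: 1\le i\le n_0,\ 0\le k\le a_i-2\}\cup\{x_iq^k: n_0+1\le i\le n,\ 0\le k\le a_i-1\}$, and with $\chi(i\le n_0)=1$ if $i\le n_0$ and $0$ otherwise, for $v\in\mathbb{Z}^n$ and a partition $\lambda$ with $|\lambda|=|v|$ define \[ D_{v,\lambda}(a;n,n_0):=\operatorname{CT}_{x}\; x^{ -v}\,h_\lambda\big(X^{(a;n_0)}\big)\prod_{1\le i<j\le n}(x_i/x_j)_{a_i-\chi(i\le n_0)}(qx_j/x_i)_{a_j-\chi(i\le n_0)}, \] where $x^{ -v}=x_1^{ -v_1}\cdots x_n^{ -v_n}$ and $\operatorname{CT}_x$ is the constant term in $x_1,\dots,x_n$. -}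

module Defs where

open import Data.Nat as ℕ using (ℕ; zero; suc; _∸_; _<ᵇ_; _≡ᵇ_)
open import Data.Integer as ℤ using (ℤ; +_; -_)
open import Data.Bool using (Bool; true; false; if_then_else_; _∧_; not)
open import Data.List using (List; []; _∷_; _++_; map; concatMap; foldr; filter; length; drop; upTo; replicate; zipWith)
open import Data.Nat.ListAction using (sum)
open import Data.Product using (_×_; _,_)
open import Data.Maybe using (Maybe; just; nothing)
open import Data.Unit using (⊤)
open import Data.Empty using (⊥)
open import Relation.Nullary.Decidable using (⌊_⌋)
open import Relation.Binary.PropositionalEquality using (_≡_)

nthD : {A : Set} → A → List A → ℕ → A
nthD d []       _       = d
nthD d (x ∷ xs) zero    = x
nthD d (x ∷ xs) (suc i) = nthD d xs i

imap : {A B : Set} → (ℕ → A → B) → List A → List B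
imap f = go 0
  where
  go : _ → _ → _
  go k []       = []
  go k (x ∷ xs) = f k x ∷ go (suc k) xs

anyᵇ : {A : Set} → (A → Bool) → List A → Bool
anyᵇ f []       = false
anyᵇ f (x ∷ xs) = if f x then true else anyᵇ f xs

allᵇ : {A : Set} → (A → Bool) → List A → Bool
allᵇ f []       = true
allᵇ f (x ∷ xs) = if f x then allᵇ f xs else false

infix 4 _∈ᵇ_
_∈ᵇ_ : ℕ → List ℕ → Bool
i ∈ᵇ I = anyᵇ (λ j → i ≡ᵇ j) I

deleteIdx : {A : Set} → List ℕ → List A → List A
deleteIdx I xs = go 0 xs
  where
  go : ℕ → _ → _
  go k []       = []
  go k (x ∷ xs) = if k ∈ᵇ I then go (suc k) xs else x ∷ go (suc k) xs

sumIdx : List ℕ → List ℕ → ℕ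
sumIdx I b = sum (imap (λ k x → if k ∈ᵇ I then x else 0) b)

subsets : {A : Set} → List A → List (List A)
subsets []       = [] ∷ []
subsets (x ∷ xs) = let r = subsets xs in map (x ∷_) r ++ r

sumℤ : List ℤ → ℤ
sumℤ = foldr ℤ._+_ (+ 0)

-- maximum of a list of integers, nothing for the empty list (= -∞)
maxL : List ℤ → Maybe ℤ
maxL []       = nothing
maxL (x ∷ xs) with maxL xs
... | nothing = just x
... | just m  = just (x ℤ.⊔ m)

-- ordering on ℤ ∪ {-∞} (nothing = -∞)
infix 4 _≥∞_
_≥∞_ : Maybe ℤ → Maybe ℤ → Set
just x  ≥∞ just y  = y ℤ.≤ x
just x  ≥∞ nothing = ⊤
nothing ≥∞ just y  = ⊥
nothing ≥∞ nothing = ⊤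

infixl 6 _+∞_
_+∞_ : Maybe ℤ → ℤ → Maybe ℤ
just x  +∞ k = just (x ℤ.+ k)
nothing +∞ k = nothing

-- partitions: weakly decreasing lists of naturals (trailing zeros allowed)
Partition : List ℕ → Set
Partition []           = ⊤
Partition (x ∷ [])     = ⊤
Partition (x ∷ y ∷ xs) = (y ℕ.≤ x) × Partition (y ∷ xs)

-- Polynomials in q with integer coefficients: formal sums  Σ c q^e

Poly : Set
Poly = List (ℤ × ℕ)

coeff : ℕ → Poly → ℤ
coeff k []             = + 0
coeff k ((c , e) ∷ p)  = (if k ≡ᵇ e then c else + 0) ℤ.+ coeff k p

infix 4 _≈ₚ_
_≈ₚ_ : Poly → Poly → Set
p ≈ₚ p' = ∀ k → coeff k p ≡ coeff k p'

infixl 6 _+ₚ_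
_+ₚ_ : Poly → Poly → Poly
_+ₚ_ = _++_

infixl 7 _*ₚ_
_*ₚ_ : Poly → Poly → Poly
p *ₚ p' = concatMap (λ { (c , e) → map (λ { (c' , e') → (c ℤ.* c' , e ℕ.+ e') }) p' }) p

constₚ : ℤ → Poly
constₚ c = (c , 0) ∷ []

qpow : ℕ → Poly
qpow m = (+ 1 , m) ∷ []

oneMinusQ : ℕ → Poly
oneMinusQ m = (+ 1 , 0) ∷ (- (+ 1) , m) ∷ []

prodₚ : List Poly → Poly
prodₚ = foldr _*ₚ_ (constₚ (+ 1))

qPoch : ℕ → Poly
qPoch k = prodₚ (map (λ t → oneMinusQ (suc t)) (upTo k))

-- Rational functions in q: formal fractions num / den, compared in the
-- field of fractions Q(q) by cross multiplication.  (All denominators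
-- used below are nonzero products of factors 1 - q^m with m ≥ 1.)

Frac : Set
Frac = Poly × Poly

polyF : Poly → Frac
polyF p = (p , constₚ (+ 1))

infixl 7 _*f_
_*f_ : Frac → Frac → Frac
(a , b) *f (c , d) = (a *ₚ c , b *ₚ d)

infixl 7 _/f_
_/f_ : Frac → Frac → Frac
(a , b) /f (c , d) = (a *ₚ d , b *ₚ c)

infixl 6 _+f_
_+f_ : Frac → Frac → Frac
(a , b) +f (c , d) = ((a *ₚ d) +ₚ (c *ₚ b) , b *ₚ d)

zeroF : Frac
zeroF = polyF []

sumF : List Frac → Frac
sumF = foldr _+f_ zeroF

infix 4 _≈f_
_≈f_ : Frac → Frac → Set
(a , b) ≈f (c , d) = (a *ₚ d) ≈ₚ (c *ₚ b)

qMultinom : ℕ → List ℕ → Frac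
qMultinom N t = (qPoch N , prodₚ (map qPoch t))

-- Laurent polynomials in x_1..x_n with coefficients in Z[q]:
-- formal sums of terms  c q^e x^m  with m ∈ Z^n (a list of length n).

LTerm : Set
LTerm = ℤ × ℕ × List ℤ

LPoly : Set
LPoly = List LTerm

infixl 7 _*ₗ_
_*ₗ_ : LPoly → LPoly → LPoly
p *ₗ p' = concatMap (λ { (c , e , m) → map (λ { (c' , e' , m') → (c ℤ.* c' , e ℕ.+ e' , zipWith ℤ._+_ m m') }) p' }) p

zeroVec : ℕ → List ℤ
zeroVec n = replicate n (+ 0)

unitVec : ℕ → ℕ → List ℤ
unitVec n i = map (λ k → if k ≡ᵇ i then + 1 else + 0) (upTo n)

oneₗ : ℕ → LPoly
oneₗ n = (+ 1 , 0 , zeroVec n) ∷ []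

prodₗ : ℕ → List LPoly → LPoly
prodₗ n = foldr _*ₗ_ (oneₗ n)

powₗ : ℕ → LPoly → ℕ → LPoly
powₗ n p zero    = oneₗ n
powₗ n p (suc k) = p *ₗ powₗ n p k

isZeroVec : List ℤ → Bool
isZeroVec = allᵇ (λ z → ⌊ z ℤ.≟ + 0 ⌋)

filterᵇ : {A : Set} → (A → Bool) → List A → List A
filterᵇ f []       = []
filterᵇ f (x ∷ xs) = if f x then x ∷ filterᵇ f xs else filterᵇ f xs

CT : LPoly → Poly
CT p = map (λ { (c , e , m) → (c , e) }) (filterᵇ (λ { (c , e , m) → isZeroVec m }) p)

-- The constant term D_{v,λ}(a; n, n0), with n = length a.
-- Indices are 0-based: paper's index i (1 ≤ i ≤ n) is our i-1, and
-- "i ≤ n0" becomes "i < n0".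

chi : ℕ → ℕ → ℕ
chi n0 i = if i <ᵇ n0 then 1 else 0

-- complete homogeneous symmetric function h_r of a finite list of
-- monomials (each monomial a single term):  h_r(y,Y) = Σ_{m ≤ r} y^m h_{r-m}(Y)
hᵣ : ℕ → ℕ → List LTerm → LPoly
hᵣ n r []       = if r ≡ᵇ 0 then oneₗ n else []
hᵣ n r (y ∷ ys) = concatMap (λ m → powₗ n (y ∷ []) m *ₗ hᵣ n (r ∸ m) ys) (upTo (suc r))

hλ : ℕ → List ℕ → List LTerm → LPoly
hλ n lam X = prodₗ n (map (λ r → hᵣ n r X) lam)

alphabet : ℕ → List ℕ → List LTerm
alphabet n0 a = concatMap (λ i → map (λ k → (+ 1 , k , unitVec (length a) i))
                                       (upTo (nthD 0 a i ∸ chi n0 i)))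
                          (upTo (length a))

pochX : ℕ → ℕ → ℕ → ℕ → ℕ → LPoly
pochX n s i j k = prodₗ n (map (λ t → (+ 1 , 0 , zeroVec n) ∷
                                       (- (+ 1) , s ℕ.+ t , zipWith ℤ._-_ (unitVec n i) (unitVec n j)) ∷ [])
                               (upTo k))

pairsLt : ℕ → List (ℕ × ℕ)
pairsLt n = concatMap (λ j → map (λ i → (i , j)) (upTo j)) (upTo n)

kernel : ℕ → List ℕ → LPoly
kernel n0 a = prodₗ n (map (λ { (i , j) → pochX n 0 i j (nthD 0 a i ∸ chi n0 i)
                                        *ₗ pochX n 1 j i (nthD 0 a j ∸ chi n0 i) })
                           (pairsLt n))
  where n = length a

D : List ℤ → List ℕ → List ℕ → ℕ → Poly
D v lam a n0 = CT (((+ 1 , 0 , map ℤ.-_ v) ∷ []) *ₗ (hλ (length a) lam (alphabet n0 a) *ₗ kernel n0 a))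

tildeA : ℕ → List ℕ → List ℕ
tildeA n0 a = imap (λ i x → x ∸ chi n0 i) a

Lsum : ℕ → List ℕ → List ℕ → List ℕ → ℕ
Lsum m I J b = sum (concatMap (λ j → map (λ i → if (i ∈ᵇ I) ∧ not (j ∈ᵇ J) then nthD 0 b j else 0)
                                        (upTo (suc j)))
                              (upTo m))

firstVals : ℕ → ℕ → List ℤ → List ℤ
firstVals n n0 v = map (λ i → nthD (+ 0) v i ℤ.- + n ℤ.+ + n0) (upTo n0)

secondVals : ℕ → ℕ → List ℤ → List ℤ
secondVals n n0 v = map (λ i → nthD (+ 0) v (n0 ℕ.+ i)) (upTo (n ∸ n0))

S₁ : ℕ → ℕ → List ℤ → ℤ → List ℕ
S₁ n n0 v r = filterᵇ (λ i → (i <ᵇ n0) ∧ ⌊ (nthD (+ 0) v i ℤ.- + n ℤ.+ + n0) ℤ.≟ r ⌋) (upTo n)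

S₂ : ℕ → ℕ → List ℤ → ℤ → List ℕ
S₂ n n0 v r = filterᵇ (λ i → not (i <ᵇ n0) ∧ ⌊ nthD (+ 0) v i ℤ.≟ r ⌋) (upTo n)

signPow : ℕ → ℤ
signPow zero    = + 1
signPow (suc k) = - signPow k

nonemptySubsets : List ℕ → List (List ℕ)
nonemptySubsets S = filterᵇ (λ J → not (length J ≡ᵇ 0)) (subsets S)

-- The right-hand side common to both parts:
--   ε · [|ã|+r-1 ; ã, r-1] / [|ã|-ã_S+r-1 ; ã^{(S)}, r-1]
--     · Σ_{∅≠J⊆S} (-1)^{|S∖J|} q^{L_{m,S,J}(ã)} (1-q^{ã_J})/(1-q^{|ã|-ã_J+r}) · Dsub
-- where r = ρ is given as a natural number (ρ ≥ 1).
rhsFormula : ℤ → ℕ → List ℕ → List ℕ → ℕ → Poly → Frac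
rhsFormula ε m S at ρ Dsub =
  polyF (constₚ ε)
  *f ((qMultinom (sum at ℕ.+ ρ ∸ 1) (at ++ (ρ ∸ 1) ∷ [])
       /f qMultinom (sum at ∸ sumIdx S at ℕ.+ ρ ∸ 1) (deleteIdx S at ++ (ρ ∸ 1) ∷ []))
  *f sumF (map (λ J → polyF (constₚ (signPow (length S ∸ length J)) *ₚ qpow (Lsum m S J at))
                       *f ((oneMinusQ (sumIdx J at) , oneMinusQ (sum at ∸ sumIdx J at ℕ.+ ρ))
                       *f polyF Dsub))
               (nonemptySubsets S)))

addAlpha : ℕ → ℕ → List ℤ → List ℤ
addAlpha n0 s v = imap (λ i x → if i <ᵇ n0 then x else x ℤ.+ + s) v

{-# OPTIONS --safe #-}
module Submission where

-- Put b = ã.  In the product of the kernel K with the partial fraction decomposition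
--     h_r(X) = Σ_{u∈X} u^r Π_{u'≠u} (1 - u'/u)⁻¹,
-- look at the summand of u = x_i q^j: the part of K that involves x_i cancels
-- all factors 1 - u'/u with u' = x_l q^k,
-- l ≠ i, and leaves a polynomial in the x_i/x_l.  Hence if r is the maximum of
-- the statement, the summand of x_i q^j has no constant term unless i ∈ S₁ ∪ S₂,
-- and for such i its constant term is read off at x_i = 0.  As
-- Σ_j q^{jN} Π_{k≠j} (1 - q^{k-j})⁻¹ = h_N(1, …, q^{b_i-1}), this removes one part
-- r from λ and one variable:
--     D_{v,r∷λ} = Σ_i ± q^{Σ_{l>i} b_l} h_N(1, …, q^{b_i-1}) D_{v',λ}(a^{(i)}),   N = r + |b| - b_i.
-- Under the dominance hypotheses this can be iterated until S₁ (or S₂) is used up,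
-- and the resulting sum over orderings of S collapses to the sum over subsets J by
--     1/(1 - q^{T-x-y}) - q^y/(1 - q^{T-x}) = (1 - q^y)(1 - q^{T-x})⁻¹(1 - q^{T-x-y})⁻¹
-- and Σ_{J⊆S} (-1)^{|J|} q^{L_{S,J} + b_J} = 0 for S ≠ ∅.

-- Partial fractions live in a field, the constant term only in the Laurent ring. So no quotient is
-- formed: the decomposition is multiplied by the kernel and by one constant `Δ b` per variable,
-- every summand becomes a Laurent polynomial (`residue`), and the constants are cancelled at the
-- end because they are not zero divisors. Setting x_i = 0 under the constant term requires that no
-- negative power of x_i is left: v_i is at most r plus the number of second-block variables behind
-- i if i is in the first block, and at most r if i is in the second. This is why n - n_0 is
-- subtracted in the maximum. Removing a first-block variable leaves a factor -x_i/x_l for every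
-- second-block l. It raises v_l by one, whence α and the sign; the gap s_1 keeps the raised
-- exponents below r during all s_1 removals. Removing a second-block variable changes no exponent
-- but lowers the bound r + n - n_0 of the first block by one, whence the gap s_2. Both cases are
-- instances of one abstract recursion. It is solved in total fractions, where every 1 - q^m with m
-- positive is invertible.

open import Defs
open import Algebra.Bundles using (AbelianGroup; CommutativeRing)
import Algebra.Properties.AbelianGroup
import Algebra.Properties.CommutativeSemigroup
import Algebra.Properties.CommutativeSemiring.Exp
import Algebra.Properties.Group
import Algebra.Properties.Ring
import Algebra.Properties.Semiring.Exp
import Algebra.Properties.Semiring.Mult
import Algebra.Solver.Ring
open import Algebra.Solver.Ring.AlmostCommutativeRing using (_-Raw-AlmostCommutative⟶_; fromCommutativeRing)
open import Data.Bool as Bool using (Bool; _∧_; false; if_then_else_; not; true)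
import Data.Bool.Properties as Boolₚ
open import Data.Fin using (Fin; suc; zero)
import Data.Fin.Properties as Finₚ
open import Data.Integer as ℤ using (+<+; +_; +≤+; -[1+_]; ℤ)
import Data.Integer.Properties as ℤₚ
open import Data.List using (List; []; _++_; _∷_; allFin; applyUpTo; concatMap; drop; length; map; replicate; take; upTo; zipWith)
open import Data.List.Membership.Propositional using (_∈_)
open import Data.List.Membership.Propositional.Properties using (∈-++⁺ʳ; ∈-++⁺ˡ; ∈-++⁻; ∈-map⁺; ∈-map⁻; ∈-upTo⁻)
import Data.List.Properties as Listₚ
open import Data.List.Relation.Unary.All as All using (All; []; _∷_)
import Data.List.Relation.Unary.All.Properties as Allₚ
open import Data.List.Relation.Unary.AllPairs as AllPairs using (AllPairs; []; _∷_)
import Data.List.Relation.Unary.AllPairs.Properties as AllPairsₚ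
open import Data.List.Relation.Unary.Any using (here; there)
open import Data.List.Relation.Unary.Unique.Propositional using (Unique)
open import Data.List.Relation.Unary.Unique.Propositional.Properties using (allFin⁺; upTo⁺)
open import Data.Maybe using (Maybe; just; nothing)
open import Data.Nat as ℕ using (_<ᵇ_; _∸_; _≡ᵇ_; suc; zero; ℕ)
open import Data.Nat.ListAction using (sum)
open import Data.Nat.ListAction.Properties using (sum-++)
import Data.Nat.Properties as ℕₚ
open import Data.Product using (_,_; _×_; proj₁; proj₂; Σ; ∃)
open import Data.Sum using (_⊎_; inj₁; inj₂; swap)
open import Data.Unit using (tt)
open import Data.Vec as Vec using (Vec; []; _∷_; lookup)
import Data.Vec.Properties as Vecₚ
open import Function using (_on_; _∘_; id)
open import Level using (0ℓ)
open import Relation.Binary using (DecidableEquality; Tri; tri<; tri>; tri≈)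
open import Relation.Binary.PropositionalEquality as ≡ using (_≡_; _≢_)
import Relation.Binary.Reasoning.Setoid
open import Relation.Nullary using (Dec; contradiction; does; no; yes; ¬_)
open import Relation.Nullary.Decidable using (⌊_⌋)

-- Integer coefficients for the ring solver

module IntegerMorphism (R : CommutativeRing 0ℓ 0ℓ) where
  open CommutativeRing R
  open Algebra.Properties.Semiring.Mult semiring using (×1-homo-*; ×-homo-+) renaming (_×_ to _·_)
  open Algebra.Properties.Ring ring using (-‿distribˡ-*; -‿distribʳ-*; -‿involutive; -0#≈0#)
  open Algebra.Properties.AbelianGroup +-abelianGroup using (⁻¹-∙-comm)
  open Relation.Binary.Reasoning.Setoid setoid

  fromℤ : ℤ → Carrier
  fromℤ (+ n)      = n · 1#
  fromℤ (-[1+ n ]) = - (suc n · 1#)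

  fromℤ-neg : ∀ z → fromℤ (ℤ.- z) ≈ - fromℤ z
  fromℤ-neg (+ zero)     = sym -0#≈0#
  fromℤ-neg (+ suc n)    = refl
  fromℤ-neg (-[1+ n ])   = sym (-‿involutive _)

  fromℤ-⊖ : ∀ m n → fromℤ (m ℤ.⊖ n) ≈ m · 1# + - (n · 1#)
  fromℤ-⊖ m zero = sym (trans (+-congˡ -0#≈0#) (+-identityʳ _))
  fromℤ-⊖ zero (suc n) = sym (+-identityˡ _)
  fromℤ-⊖ (suc m) (suc n) = begin
    fromℤ (suc m ℤ.⊖ suc n)               ≡⟨ ≡.cong fromℤ (ℤₚ.[1+m]⊖[1+n]≡m⊖n m n) ⟩
    fromℤ (m ℤ.⊖ n)                       ≈⟨ fromℤ-⊖ m n ⟩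
    m · 1# + - (n · 1#)                   ≈⟨ +-identityˡ _ ⟨
    0# + (m · 1# + - (n · 1#))            ≈⟨ +-congʳ (-‿inverseʳ 1#) ⟨
    (1# + - 1#) + (m · 1# + - (n · 1#))   ≈⟨ +-assoc _ _ _ ⟩
    1# + (- 1# + (m · 1# + - (n · 1#)))   ≈⟨ +-congˡ (+-assoc _ _ _) ⟨
    1# + ((- 1# + m · 1#) + - (n · 1#))   ≈⟨ +-congˡ (+-congʳ (+-comm _ _)) ⟩
    1# + ((m · 1# + - 1#) + - (n · 1#))   ≈⟨ +-congˡ (+-assoc _ _ _) ⟩
    1# + (m · 1# + (- 1# + - (n · 1#)))   ≈⟨ +-assoc _ _ _ ⟨
    (1# + m · 1#) + (- 1# + - (n · 1#))   ≈⟨ +-congˡ (⁻¹-∙-comm _ _) ⟩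
    (1# + m · 1#) + - (1# + n · 1#)       ∎

  fromℤ-+ : ∀ y z → fromℤ (y ℤ.+ z) ≈ fromℤ y + fromℤ z
  fromℤ-+ (+ m) (+ n)           = ×-homo-+ 1# m n
  fromℤ-+ (+ m) (-[1+ n ])      = fromℤ-⊖ m (suc n)
  fromℤ-+ (-[1+ m ]) (+ n)      = trans (fromℤ-⊖ n (suc m)) (+-comm _ _)
  fromℤ-+ (-[1+ m ]) (-[1+ n ]) = begin
    - (suc (suc (m ℕ.+ n)) · 1#)     ≡⟨ ≡.cong (λ k → - (suc k · 1#)) (≡.sym (ℕₚ.+-suc m n)) ⟩
    - ((suc m ℕ.+ suc n) · 1#)       ≈⟨ -‿cong (×-homo-+ 1# (suc m) (suc n)) ⟩
    - (suc m · 1# + suc n · 1#)      ≈⟨ ⁻¹-∙-comm _ _ ⟨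
    - (suc m · 1#) + - (suc n · 1#)  ∎

  fromℤ-*ℕ : ∀ m n → fromℤ (+ m ℤ.* + n) ≈ fromℤ (+ m) * fromℤ (+ n)
  fromℤ-*ℕ m n = trans (reflexive (≡.cong fromℤ (≡.sym (ℤₚ.pos-* m n)))) (×1-homo-* m n)

  fromℤ-* : ∀ y z → fromℤ (y ℤ.* z) ≈ fromℤ y * fromℤ z
  fromℤ-* (+ m) (+ n)           = fromℤ-*ℕ m n
  fromℤ-* (+ m) (-[1+ n ])      = begin
    fromℤ (+ m ℤ.* -[1+ n ])          ≡⟨ ≡.cong fromℤ (≡.sym (ℤₚ.neg-distribʳ-* (+ m) (+ suc n))) ⟩
    fromℤ (ℤ.- (+ m ℤ.* + suc n))     ≈⟨ fromℤ-neg (+ m ℤ.* + suc n) ⟩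
    - fromℤ (+ m ℤ.* + suc n)         ≈⟨ -‿cong (fromℤ-*ℕ m (suc n)) ⟩
    - (m · 1# * (suc n · 1#))         ≈⟨ -‿distribʳ-* _ _ ⟩
    m · 1# * - (suc n · 1#)           ∎
  fromℤ-* (-[1+ m ]) (+ n)      = begin
    fromℤ (-[1+ m ] ℤ.* + n)          ≡⟨ ≡.cong fromℤ (≡.sym (ℤₚ.neg-distribˡ-* (+ suc m) (+ n))) ⟩
    fromℤ (ℤ.- (+ suc m ℤ.* + n))     ≈⟨ fromℤ-neg (+ suc m ℤ.* + n) ⟩
    - fromℤ (+ suc m ℤ.* + n)         ≈⟨ -‿cong (fromℤ-*ℕ (suc m) n) ⟩
    - (suc m · 1# * (n · 1#))         ≈⟨ -‿distribˡ-* _ _ ⟩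
    - (suc m · 1#) * (n · 1#)         ∎
  fromℤ-* (-[1+ m ]) (-[1+ n ]) = begin
    fromℤ (+ suc m ℤ.* + suc n)           ≈⟨ fromℤ-*ℕ (suc m) (suc n) ⟩
    suc m · 1# * (suc n · 1#)             ≈⟨ -‿involutive _ ⟨
    - - (suc m · 1# * (suc n · 1#))       ≈⟨ -‿cong (-‿distribʳ-* _ _) ⟩
    - (suc m · 1# * - (suc n · 1#))       ≈⟨ -‿distribˡ-* _ _ ⟩
    - (suc m · 1#) * - (suc n · 1#)       ∎

  -- Sends ±1 to ± 1# on the nose, so that the solver's constants compute.
  fromℤ′ : ℤ → Carrier
  fromℤ′ (+ 1)      = 1#
  fromℤ′ (-[1+ 0 ]) = - 1#
  fromℤ′ z          = fromℤ z

  fromℤ′≈ : ∀ z → fromℤ′ z ≈ fromℤ z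
  fromℤ′≈ (+ 0)          = refl
  fromℤ′≈ (+ 1)          = sym (+-identityʳ 1#)
  fromℤ′≈ (+ suc (suc n)) = refl
  fromℤ′≈ (-[1+ 0 ])     = -‿cong (sym (+-identityʳ 1#))
  fromℤ′≈ (-[1+ suc n ]) = refl

  morphism : CommutativeRing.rawRing ℤₚ.+-*-commutativeRing -Raw-AlmostCommutative⟶ fromCommutativeRing R
  morphism = record
    { ⟦_⟧    = fromℤ′
    ; +-homo = λ y z → trans (fromℤ′≈ (y ℤ.+ z)) (trans (fromℤ-+ y z) (sym (+-cong (fromℤ′≈ y) (fromℤ′≈ z))))
    ; *-homo = λ y z → trans (fromℤ′≈ (y ℤ.* z)) (trans (fromℤ-* y z) (sym (*-cong (fromℤ′≈ y) (fromℤ′≈ z))))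
    ; -‿homo = λ z → trans (fromℤ′≈ (ℤ.- z)) (trans (fromℤ-neg z) (-‿cong (sym (fromℤ′≈ z))))
    ; 0-homo = refl
    ; 1-homo = refl
    }

  coeff≟ : ∀ y z → Maybe (fromℤ′ y ≈ fromℤ′ z)
  coeff≟ y z with y ℤ.≟ z
  ... | yes y≡z = just (reflexive (≡.cong fromℤ′ y≡z))
  ... | no  _   = nothing

  -- The carrier has no decidable equality, so the coefficients of the solver are integers, compared
  -- in ℤ and mapped into the ring; cancellation of opposite terms is then decided by computation.
  module Solver = Algebra.Solver.Ring _ _ morphism coeff≟

-- Finite sums, finite products and regular elements

module RingLemmas (R : CommutativeRing 0ℓ 0ℓ) where
  open CommutativeRing R public
  open IntegerMorphism R public using (module Solver)
  open Solver public using (solve; _:=_; con) renaming (_:+_ to _⊞_; _:*_ to _⊠_; _:-_ to _⊟_; :-_ to ⊖_)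
  𝟙 : ∀ {n} → Solver.Polynomial n
  𝟙 = con (+ 1)
  module ≈R = Relation.Binary.Reasoning.Setoid setoid
  open ≈R
  open Algebra.Properties.Ring ring public using (-‿distribˡ-*; -‿distribʳ-*; -‿involutive; -0#≈0#)

  private variable
    A B : Set

  ∑ ∏ : List A → (A → Carrier) → Carrier
  ∑ []       f = 0#
  ∑ (x ∷ xs) f = f x + ∑ xs f
  ∏ []       f = 1#
  ∏ (x ∷ xs) f = f x * ∏ xs f

  ∑-cong : (xs : List A) {f g : A → Carrier} → (∀ {x} → x ∈ xs → f x ≈ g x) → ∑ xs f ≈ ∑ xs g
  ∑-cong []       e = refl
  ∑-cong (x ∷ xs) e = +-cong (e (here ≡.refl)) (∑-cong xs (e ∘ there))

  ∏-cong : (xs : List A) {f g : A → Carrier} → (∀ {x} → x ∈ xs → f x ≈ g x) → ∏ xs f ≈ ∏ xs g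
  ∏-cong []       e = refl
  ∏-cong (x ∷ xs) e = *-cong (e (here ≡.refl)) (∏-cong xs (e ∘ there))

  ∑-++ : (xs ys : List A) {f : A → Carrier} → ∑ (xs ++ ys) f ≈ ∑ xs f + ∑ ys f
  ∑-++ []       ys = sym (+-identityˡ _)
  ∑-++ (x ∷ xs) ys = trans (+-congˡ (∑-++ xs ys)) (sym (+-assoc _ _ _))

  ∏-++ : (xs ys : List A) {f : A → Carrier} → ∏ (xs ++ ys) f ≈ ∏ xs f * ∏ ys f
  ∏-++ []       ys = sym (*-identityˡ _)
  ∏-++ (x ∷ xs) ys = trans (*-congˡ (∏-++ xs ys)) (sym (*-assoc _ _ _))

  ∑-map : (h : A → B) (xs : List A) {f : B → Carrier} → ∑ (map h xs) f ≈ ∑ xs (f ∘ h)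
  ∑-map h []       = refl
  ∑-map h (x ∷ xs) = +-congˡ (∑-map h xs)

  ∏-map : (h : A → B) (xs : List A) {f : B → Carrier} → ∏ (map h xs) f ≈ ∏ xs (f ∘ h)
  ∏-map h []       = refl
  ∏-map h (x ∷ xs) = *-congˡ (∏-map h xs)

  ∑-concatMap : (h : A → List B) (xs : List A) {f : B → Carrier} → ∑ (concatMap h xs) f ≈ ∑ xs (λ x → ∑ (h x) f)
  ∑-concatMap h []       = refl
  ∑-concatMap h (x ∷ xs) = trans (∑-++ (h x) _) (+-congˡ (∑-concatMap h xs))

  ∏-concatMap : (h : A → List B) (xs : List A) {f : B → Carrier} → ∏ (concatMap h xs) f ≈ ∏ xs (λ x → ∏ (h x) f)
  ∏-concatMap h []       = refl
  ∏-concatMap h (x ∷ xs) = trans (∏-++ (h x) _) (*-congˡ (∏-concatMap h xs))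

  ∑-+ : (xs : List A) {f g : A → Carrier} → ∑ xs (λ x → f x + g x) ≈ ∑ xs f + ∑ xs g
  ∑-+ []       = sym (+-identityˡ _)
  ∑-+ (x ∷ xs) {f} {g} = trans (+-congˡ (∑-+ xs))
    (solve 4 (λ a b c d → (a ⊞ b) ⊞ (c ⊞ d) := (a ⊞ c) ⊞ (b ⊞ d)) refl (f x) (g x) (∑ xs f) (∑ xs g))

  ∏-* : (xs : List A) {f g : A → Carrier} → ∏ xs (λ x → f x * g x) ≈ ∏ xs f * ∏ xs g
  ∏-* []       = sym (*-identityˡ _)
  ∏-* (x ∷ xs) {f} {g} = trans (*-congˡ (∏-* xs))
    (solve 4 (λ a b c d → (a ⊠ b) ⊠ (c ⊠ d) := (a ⊠ c) ⊠ (b ⊠ d)) refl (f x) (g x) (∏ xs f) (∏ xs g))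

  *-∑ : (c : Carrier) (xs : List A) {f : A → Carrier} → c * ∑ xs f ≈ ∑ xs (λ x → c * f x)
  *-∑ c []       = zeroʳ c
  *-∑ c (x ∷ xs) = trans (distribˡ _ _ _) (+-congˡ (*-∑ c xs))

  ∑-0 : (xs : List A) {f : A → Carrier} → (∀ {x} → x ∈ xs → f x ≈ 0#) → ∑ xs f ≈ 0#
  ∑-0 []       e = refl
  ∑-0 (x ∷ xs) e = trans (+-cong (e (here ≡.refl)) (∑-0 xs (e ∘ there))) (+-identityˡ _)

  -- Not a zero divisor. The Laurent ring is never shown to be a domain: regularity is established
  -- for the particular factors that get cancelled.
  Regular : Carrier → Set
  Regular a = ∀ {b} → a * b ≈ 0# → b ≈ 0#

  Regular-resp : ∀ {a b} → a ≈ b → Regular a → Regular b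
  Regular-resp e r p = r (trans (*-congʳ e) p)

  Regular-1 : Regular 1#
  Regular-1 p = trans (sym (*-identityˡ _)) p

  Regular-* : ∀ {a b} → Regular a → Regular b → Regular (a * b)
  Regular-* r s p = s (r (trans (sym (*-assoc _ _ _)) p))

  Regular-∏ : (xs : List A) {f : A → Carrier} → (∀ {x} → x ∈ xs → Regular (f x)) → Regular (∏ xs f)
  Regular-∏ []       r = Regular-1
  Regular-∏ (x ∷ xs) r = Regular-* (r (here ≡.refl)) (Regular-∏ xs (r ∘ there))

  +-cancel : ∀ {a b} → a + - b ≈ 0# → a ≈ b
  +-cancel {a} {b} p = begin
    a               ≈⟨ solve 2 (λ a b → a := (a ⊟ b) ⊞ b) refl a b ⟩
    (a + - b) + b   ≈⟨ +-congʳ p ⟩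
    0# + b          ≈⟨ +-identityˡ b ⟩
    b               ∎

  cancel : ∀ {a} → Regular a → ∀ {b c} → a * b ≈ a * c → b ≈ c
  cancel {a} r {b} {c} p = +-cancel (r (begin
    a * (b + - c)      ≈⟨ solve 3 (λ a b c → a ⊠ (b ⊟ c) := a ⊠ b ⊟ a ⊠ c) refl a b c ⟩
    a * b + - (a * c)  ≈⟨ +-congʳ p ⟩
    a * c + - (a * c)  ≈⟨ -‿inverseʳ _ ⟩
    0#                 ∎))

-- Complete symmetric functions and partial fractions

module CompleteSymmetric (R : CommutativeRing 0ℓ 0ℓ) where
  open RingLemmas R
  open Algebra.Properties.Semiring.Exp semiring public using (_^_; ^-homo-*; ^-congˡ)
  open ≈R

  -- The recursion is (1 - zy) H(y, Y) = H(Y) for the generating function H, compared at z^{r+1}.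
  h : ℕ → List Carrier → Carrier
  h zero    Y       = 1#
  h (suc r) []      = 0#
  h (suc r) (y ∷ Y) = h (suc r) Y + y * h r (y ∷ Y)

  -- Unfolding the two leading letters in turn, with the induction hypothesis at the two smaller
  -- degrees, gives expressions symmetric in a and b.
  h-swap : ∀ r a b Y → h r (a ∷ b ∷ Y) ≈ h r (b ∷ a ∷ Y)
  h-swap zero a b Y = refl
  h-swap (suc zero) a b Y =
    solve 3 (λ a b y → (y ⊞ b ⊠ 𝟙) ⊞ a ⊠ 𝟙 := (y ⊞ a ⊠ 𝟙) ⊞ b ⊠ 𝟙) refl a b (h 1 Y)
  h-swap (suc (suc r)) a b Y = begin
    (y + b * hb) + a * h (suc r) (a ∷ b ∷ Y)      ≈⟨ +-congˡ (*-congˡ (h-swap (suc r) a b Y)) ⟩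
    (y + b * hb) + a * (ha + b * h r (b ∷ a ∷ Y)) ≈⟨ solve 6 (λ a b y ha hb t → (y ⊞ b ⊠ hb) ⊞ a ⊠ (ha ⊞ b ⊠ t)
                                                        := (y ⊞ a ⊠ ha) ⊞ b ⊠ (hb ⊞ a ⊠ t)) refl a b y ha hb (h r (b ∷ a ∷ Y)) ⟩
    (y + a * ha) + b * (hb + a * h r (b ∷ a ∷ Y)) ≈⟨ +-congˡ (*-congˡ (+-congˡ (*-congˡ (h-swap r a b Y)))) ⟨
    (y + a * ha) + b * h (suc r) (a ∷ b ∷ Y)      ≈⟨ +-congˡ (*-congˡ (h-swap (suc r) a b Y)) ⟩
    (y + a * ha) + b * h (suc r) (b ∷ a ∷ Y)      ∎
    where
    y ha hb : Carrier
    y  = h (suc (suc r)) Y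
    ha = h (suc r) (a ∷ Y)
    hb = h (suc r) (b ∷ Y)

  -- Unfold h_{r+1}(a, b, Y) by its first letter in both orders and subtract. This divided
  -- difference is what lowers the number of letters in `partialFractions`.
  h-difference : ∀ r a b Y → (a + - b) * h r (a ∷ b ∷ Y) ≈ h (suc r) (a ∷ Y) + - h (suc r) (b ∷ Y)
  h-difference r a b Y = begin
    (a + - b) * t                            ≈⟨ solve 5 (λ a b t ha hb → (a ⊟ b) ⊠ t
                                                  := ((hb ⊞ a ⊠ t) ⊟ (ha ⊞ b ⊠ t)) ⊞ (ha ⊟ hb)) refl a b t ha hb ⟩
    (h (suc r) (a ∷ b ∷ Y) + - (ha + b * t)) + (ha + - hb)
      ≈⟨ +-congʳ (+-cong (h-swap (suc r) a b Y) (-‿cong (+-congˡ (*-congˡ (h-swap r a b Y))))) ⟩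
    (h (suc r) (b ∷ a ∷ Y) + - h (suc r) (b ∷ a ∷ Y)) + (ha + - hb) ≈⟨ +-congʳ (-‿inverseʳ _) ⟩
    0# + (ha + - hb)                         ≈⟨ +-identityˡ _ ⟩
    ha + - hb                                ∎
    where
    t ha hb : Carrier
    t  = h r (a ∷ b ∷ Y)
    ha = h (suc r) (a ∷ Y)
    hb = h (suc r) (b ∷ Y)

  h-tail : ∀ {X Y} → (∀ r → h r X ≈ h r Y) → ∀ y r → h r (y ∷ X) ≈ h r (y ∷ Y)
  h-tail e y zero    = refl
  h-tail e y (suc r) = +-cong (e (suc r)) (*-congˡ (h-tail e y r))

  h-head : ∀ {x y} → x ≈ y → ∀ Y r → h r (x ∷ Y) ≈ h r (y ∷ Y)
  h-head e Y zero    = refl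
  h-head e Y (suc r) = +-congˡ (*-cong e (h-head e Y r))

  h-map-cong : {A : Set} (L : List A) {f g : A → Carrier} → (∀ {x} → x ∈ L → f x ≈ g x) → ∀ r → h r (map f L) ≈ h r (map g L)
  h-map-cong []      e r = refl
  h-map-cong (x ∷ L) e r = trans (h-head (e (here ≡.refl)) _ r) (h-tail (h-map-cong L (e ∘ there)) _ r)

  h-scale : ∀ c r Y → h r (map (c *_) Y) ≈ c ^ r * h r Y
  h-scale c zero    Y       = sym (*-identityˡ _)
  h-scale c (suc r) []      = sym (zeroʳ _)
  h-scale c (suc r) (y ∷ Y) = begin
    h (suc r) (map (c *_) Y) + (c * y) * h r (map (c *_) (y ∷ Y)) ≈⟨ +-cong (h-scale c (suc r) Y) (*-congˡ (h-scale c r (y ∷ Y))) ⟩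
    c * c ^ r * h (suc r) Y + (c * y) * (c ^ r * h r (y ∷ Y))
      ≈⟨ solve 5 (λ c k a y b → (c ⊠ k) ⊠ a ⊞ (c ⊠ y) ⊠ (k ⊠ b) := (c ⊠ k) ⊠ (a ⊞ y ⊠ b)) refl c (c ^ r) (h (suc r) Y) y (h r (y ∷ Y)) ⟩
    c * c ^ r * (h (suc r) Y + y * h r (y ∷ Y))                   ∎

  h-singleton : ∀ r y → h r (y ∷ []) ≈ y ^ r
  h-singleton zero    y = refl
  h-singleton (suc r) y = trans (+-identityˡ _) (*-congˡ (h-singleton r y))

  -- `w` is kept abstract instead of being 1 - u_y/u_x: then `w x x` can be 1, products may run over
  -- the whole list, and the letters need no inverses.
  module PartialFractions {I : Set} (u : I → Carrier) (w : I → I → Carrier) where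

    -- The relation w_{xy} = 1 - u_y/u_x multiplied by u_x, in both directions, for two letters
    -- whose difference can be cancelled.
    record Separated (x y : I) : Set where
      constructor separated
      field
        w-xy    : w x y * u x ≈ u x + - u y
        w-yx    : w y x * u y ≈ u y + - u x
        regular : Regular (u x + - u y)
    open Separated

    -- With w x y = 1 - u_y/u_x this is the partial fraction decomposition
    -- h_r(u) = Σ_x u_x^r Π_{y≠x} (1 - u_y/u_x)⁻¹, cleared of denominators.
    partialFractions : (∀ x → w x x ≈ 1#) → ∀ L → AllPairs Separated L → (E : Carrier) (e : I → Carrier) →
      (∀ {x} → x ∈ L → E ≈ e x * ∏ L (w x)) → ∀ r → E * h (suc r) (map u L) ≈ ∑ L (λ x → u x ^ suc r * e x)
    partialFractions w-xx [] ps E e H r = zeroʳ E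
    partialFractions w-xx (x ∷ []) ps E e H r = begin
      E * h (suc r) (u x ∷ [])                     ≈⟨ *-cong (H (here ≡.refl)) (h-singleton (suc r) (u x)) ⟩
      (e x * (w x x * 1#)) * u x ^ suc r           ≈⟨ *-congʳ (*-congˡ (trans (*-identityʳ _) (w-xx x))) ⟩
      (e x * 1#) * u x ^ suc r                     ≈⟨ *-congʳ (*-identityʳ _) ⟩
      e x * u x ^ suc r                            ≈⟨ *-comm _ _ ⟩
      u x ^ suc r * e x                            ≈⟨ +-identityʳ _ ⟨
      u x ^ suc r * e x + 0#                       ∎
    -- After multiplication by u_a - u_b, `h-difference` turns the left side into two instances of
    -- the statement with one letter less and one degree more. The weight of the omitted letter is
    -- absorbed into `e`.
    partialFractions w-xx (a ∷ b ∷ Y) ((ab ∷ aY) ∷ (bY ∷ ps)) E e H r = cancel (regular ab) (begin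
      d * (E * h (suc r) (map u (a ∷ b ∷ Y)))          ≈⟨ solve 3 (λ d E t → d ⊠ (E ⊠ t) := E ⊠ (d ⊠ t)) refl d E (h (suc r) (map u (a ∷ b ∷ Y))) ⟩
      E * (d * h (suc r) (map u (a ∷ b ∷ Y)))          ≈⟨ *-congˡ (h-difference (suc r) (u a) (u b) (map u Y)) ⟩
      E * (h (2 ℕ.+ r) (map u (a ∷ Y)) + - h (2 ℕ.+ r) (map u (b ∷ Y)))
        ≈⟨ solve 3 (λ E s t → E ⊠ (s ⊟ t) := E ⊠ s ⊟ E ⊠ t) refl E _ _ ⟩
      E * h (2 ℕ.+ r) (map u (a ∷ Y)) + - (E * h (2 ℕ.+ r) (map u (b ∷ Y)))
        ≈⟨ +-cong (partialFractions w-xx (a ∷ Y) (aY ∷ ps) E (λ x → e x * w x b) H₁ (suc r))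
                  (-‿cong (partialFractions w-xx (b ∷ Y) (bY ∷ ps) E (λ x → e x * w x a) H₂ (suc r))) ⟩
      (t b a + ∑ Y (t b)) + - (t a b + ∑ Y (t a))      ≈⟨ +-cong (+-cong (t≈ b a (w-xy ab)) ∑-Y) (-‿cong (+-congʳ (t≈ a b (w-yx ab)))) ⟩
      (f a * (u a + - u b) + (d * ∑ Y f + ∑ Y (t a))) + - (f b * (u b + - u a) + ∑ Y (t a))
        ≈⟨ solve 6 (λ fa fb ua ub s k → (fa ⊠ (ua ⊟ ub) ⊞ ((ua ⊟ ub) ⊠ s ⊞ k)) ⊟ (fb ⊠ (ub ⊟ ua) ⊞ k)
                                       := (ua ⊟ ub) ⊠ (fa ⊞ (fb ⊞ s))) refl (f a) (f b) (u a) (u b) (∑ Y f) (∑ Y (t a)) ⟩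
      d * ∑ (a ∷ b ∷ Y) f                              ∎)
      where
      d : Carrier
      d = u a + - u b
      f : I → Carrier
      f x = u x ^ suc r * e x
      t : I → I → Carrier
      t y x = u x ^ (2 ℕ.+ r) * (e x * w x y)
      t≈ : ∀ y x → w x y * u x ≈ u x + - u y → t y x ≈ f x * (u x + - u y)
      t≈ y x p = trans (solve 4 (λ u k e w → (u ⊠ k) ⊠ (e ⊠ w) := (k ⊠ e) ⊠ (w ⊠ u)) refl (u x) (u x ^ suc r) (e x) (w x y)) (*-congˡ p)
      -- For x in Y the two instances differ by the factor (u_x - u_b) - (u_x - u_a) = u_a - u_b =
      -- d, the same for all x.
      ∑-Y : ∑ Y (t b) ≈ d * ∑ Y f + ∑ Y (t a)
      ∑-Y = begin
        ∑ Y (t b)                         ≈⟨ ∑-cong Y (λ {x} x∈ → begin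
          t b x                             ≈⟨ t≈ b x (w-yx (All.lookup bY x∈)) ⟩
          f x * (u x + - u b)               ≈⟨ solve 4 (λ f x a b → f ⊠ (x ⊟ b) := (a ⊟ b) ⊠ f ⊞ f ⊠ (x ⊟ a)) refl (f x) (u x) (u a) (u b) ⟩
          d * f x + f x * (u x + - u a)     ≈⟨ +-congˡ (t≈ a x (w-yx (All.lookup aY x∈))) ⟨
          d * f x + t a x                   ∎) ⟩
        ∑ Y (λ x → d * f x + t a x)       ≈⟨ ∑-+ Y ⟩
        ∑ Y (λ x → d * f x) + ∑ Y (t a)   ≈⟨ +-congʳ (*-∑ d Y) ⟨
        d * ∑ Y f + ∑ Y (t a)             ∎
      H₁ : ∀ {x} → x ∈ a ∷ Y → E ≈ (e x * w x b) * ∏ (a ∷ Y) (w x)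
      H₁ {x} x∈ = trans (H (skip x∈)) (solve 4 (λ e wa wb p → e ⊠ (wa ⊠ (wb ⊠ p)) := (e ⊠ wb) ⊠ (wa ⊠ p)) refl (e x) (w x a) (w x b) (∏ Y (w x)))
        where
        skip : ∀ {x} → x ∈ a ∷ Y → x ∈ a ∷ b ∷ Y
        skip (here p)  = here p
        skip (there p) = there (there p)
      H₂ : ∀ {x} → x ∈ b ∷ Y → E ≈ (e x * w x a) * ∏ (b ∷ Y) (w x)
      H₂ {x} x∈ = trans (H (there x∈)) (sym (*-assoc _ _ _))

-- q-shifted factorials and the principal specialisation

module QPochhammer (R : CommutativeRing 0ℓ 0ℓ) (q : CommutativeRing.Carrier R) where
  open RingLemmas R
  open CompleteSymmetric R
  open ≈R

  poch : Carrier → ℕ → Carrier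
  poch z zero    = 1#
  poch z (suc n) = (1# + - z) * poch (q * z) n

  poch-cong : ∀ {y z} n → y ≈ z → poch y n ≈ poch z n
  poch-cong zero    e = refl
  poch-cong (suc n) e = *-cong (+-congˡ (-‿cong e)) (poch-cong n (*-congˡ e))

  q^-suc : ∀ n z → q ^ n * (q * z) ≈ q ^ suc n * z
  q^-suc n z = solve 3 (λ q k z → k ⊠ (q ⊠ z) := (q ⊠ k) ⊠ z) refl q (q ^ n) z

  poch-+ : ∀ z m n → poch z (m ℕ.+ n) ≈ poch z m * poch (q ^ m * z) n
  poch-+ z zero    n = trans (poch-cong n (sym (*-identityˡ z))) (sym (*-identityˡ _))
  poch-+ z (suc m) n = begin
    (1# + - z) * poch (q * z) (m ℕ.+ n)                          ≈⟨ *-congˡ (poch-+ (q * z) m n) ⟩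
    (1# + - z) * (poch (q * z) m * poch (q ^ m * (q * z)) n)     ≈⟨ *-assoc _ _ _ ⟨
    (1# + - z) * poch (q * z) m * poch (q ^ m * (q * z)) n       ≈⟨ *-congˡ (poch-cong n (q^-suc m z)) ⟩
    (1# + - z) * poch (q * z) m * poch (q ^ suc m * z) n         ∎

  poch-last : ∀ z n → poch z (suc n) ≈ poch z n * (1# + - (q ^ n * z))
  poch-last z n = begin
    poch z (suc n)                              ≡⟨ ≡.cong (poch z) (≡.sym (ℕₚ.+-comm n 1)) ⟩
    poch z (n ℕ.+ 1)                            ≈⟨ poch-+ z n 1 ⟩
    poch z n * ((1# + - (q ^ n * z)) * 1#)      ≈⟨ *-congˡ (*-identityʳ _) ⟩
    poch z n * (1# + - (q ^ n * z))             ∎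

  -- `applyUpTo` recurses by composing its function with `suc`, so the induction must allow f k = k
  -- + i; the constant c is the resulting q^i.
  ∏-poch : ∀ n (f : ℕ → ℕ) (c z : Carrier) → (∀ k → q ^ f k ≈ q ^ k * c) →
    ∏ (applyUpTo f n) (λ k → 1# + - (q ^ k * z)) ≈ poch (c * z) n
  ∏-poch zero    f c z H = refl
  ∏-poch (suc n) f c z H = *-cong
    (+-congˡ (-‿cong (*-congʳ (trans (H 0) (*-identityˡ c)))))
    (trans (∏-poch n (f ∘ suc) (q * c) z (λ k → trans (H (suc k)) (trans (*-congʳ (*-comm q _)) (*-assoc _ _ _))))
      (poch-cong n (*-assoc _ _ _)))

  poch-∏ : ∀ n z → ∏ (upTo n) (λ k → 1# + - (q ^ k * z)) ≈ poch z n
  poch-∏ n z = trans (∏-poch n id 1# z (λ k → sym (*-identityʳ _))) (poch-cong n (*-identityˡ z))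

  -- With z = 1/y, (1 - y)(-z) = 1 - z. This flip is the source of the sign and of the monomial
  -- x_i/x_l contributed by a mixed pair.
  poch-inverse-suc : ∀ {y z} → y * z ≈ 1# → ∀ b → poch y (suc b) * - z ≈ poch (q * y) b * (1# + - z)
  poch-inverse-suc {y} {z} yz b = begin
    ((1# + - y) * p) * - z       ≈⟨ solve 3 (λ p y z → ((𝟙 ⊟ y) ⊠ p) ⊠ (⊖ z) := p ⊠ (y ⊠ z ⊟ z)) refl p y z ⟩
    p * (y * z + - z)            ≈⟨ *-congˡ (+-congʳ yz) ⟩
    p * (1# + - z)               ∎
    where
    p : Carrier
    p = poch (q * y) b

  -- This is (y)_b (1 - q^b y) = (1 - y)(qy)_b multiplied by -z, where z = 1/y: the factor 1 - q^b y
  -- becomes q^b - z, and 1 - y becomes 1 - z.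
  poch-inverse-step : ∀ {y z} → y * z ≈ 1# → ∀ b → poch y b * (q ^ b + - z) ≈ poch (q * y) b * (1# + - z)
  poch-inverse-step {y} {z} yz b = begin
    poch y b * (q ^ b + - z)                      ≈⟨ *-congˡ (+-congʳ (trans (sym (*-identityʳ _)) (*-congˡ (sym yz)))) ⟩
    poch y b * (q ^ b * (y * z) + - z)            ≈⟨ solve 4 (λ p k y z → p ⊠ (k ⊠ (y ⊠ z) ⊟ z) := (p ⊠ (𝟙 ⊟ k ⊠ y)) ⊠ (⊖ z)) refl (poch y b) (q ^ b) y z ⟩
    (poch y b * (1# + - (q ^ b * y))) * - z       ≈⟨ *-congʳ (poch-last y b) ⟨
    poch y (suc b) * - z                          ≈⟨ poch-inverse-suc yz b ⟩
    poch (q * y) b * (1# + - z)                   ∎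

  twist : ℕ → ℕ → Carrier → Carrier
  twist b zero    z = 1#
  twist b (suc j) z = twist b j z * (q ^ b + - (q ^ suc j * z))

  module _ (qi : Carrier) (q*qi : q * qi ≈ 1#) where

    q^*qi^ : ∀ j → q ^ j * qi ^ j ≈ 1#
    q^*qi^ zero    = *-identityˡ 1#
    q^*qi^ (suc j) = trans (solve 4 (λ q k p l → (q ⊠ k) ⊠ (p ⊠ l) := (q ⊠ p) ⊠ (k ⊠ l)) refl q (q ^ j) qi (qi ^ j))
      (trans (*-cong q*qi (q^*qi^ j)) (*-identityˡ 1#))

    poch-twist : ∀ {y z} → y * z ≈ 1# → ∀ b j → poch (qi ^ j * y) b * twist b j z ≈ poch y b * poch (q * z) j
    poch-twist {y} yz b zero    = *-congʳ (poch-cong b (*-identityˡ y))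
    poch-twist {y} {z} yz b (suc j) = begin
      poch w b * (t * (q ^ b + - c))                   ≈⟨ solve 3 (λ p t s → p ⊠ (t ⊠ s) := (p ⊠ s) ⊠ t) refl _ _ _ ⟩
      (poch w b * (q ^ b + - c)) * t                   ≈⟨ *-congʳ (poch-inverse-step wc b) ⟩
      (poch (q * w) b * (1# + - c)) * t                ≈⟨ *-congʳ (*-congʳ (poch-cong b q*w)) ⟩
      (poch (qi ^ j * y) b * (1# + - c)) * t           ≈⟨ solve 3 (λ p t s → (p ⊠ s) ⊠ t := (p ⊠ t) ⊠ s) refl _ _ _ ⟩
      (poch (qi ^ j * y) b * t) * (1# + - c)           ≈⟨ *-cong (poch-twist yz b j) (+-congˡ (-‿cong (sym (q^-suc j z)))) ⟩
      (poch y b * poch (q * z) j) * (1# + - (q ^ j * (q * z))) ≈⟨ *-assoc _ _ _ ⟩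
      poch y b * (poch (q * z) j * (1# + - (q ^ j * (q * z)))) ≈⟨ *-congˡ (poch-last (q * z) j) ⟨
      poch y b * poch (q * z) (suc j)                  ∎
      where
      w c t : Carrier
      w = qi ^ suc j * y
      c = q ^ suc j * z
      t = twist b j z
      q*w : q * w ≈ qi ^ j * y
      q*w = trans (solve 4 (λ q p l y → q ⊠ ((p ⊠ l) ⊠ y) := (q ⊠ p) ⊠ (l ⊠ y)) refl q qi (qi ^ j) y) (trans (*-congʳ q*qi) (*-identityˡ _))
      wc : w * c ≈ 1#
      wc = trans (solve 4 (λ p y k z → (p ⊠ y) ⊠ (k ⊠ z) := (k ⊠ p) ⊠ (y ⊠ z)) refl (qi ^ suc j) y (q ^ suc j) z)
        (trans (*-cong (q^*qi^ (suc j)) yz) (*-identityˡ 1#))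

  geometric : ℕ → List Carrier
  geometric zero    = []
  geometric (suc m) = 1# ∷ map (q *_) (geometric m)

  geometric-upTo : ∀ m → map (q ^_) (upTo m) ≡ geometric m
  geometric-upTo zero    = ≡.refl
  geometric-upTo (suc m) = ≡.cong (1# ∷_) (≡.trans (shift m id) (≡.cong (map (q *_)) (geometric-upTo m)))
    where
    shift : ∀ m f → map (q ^_) (applyUpTo (suc ∘ f) m) ≡ map (q *_) (map (q ^_) (applyUpTo f m))
    shift zero    f = ≡.refl
    shift (suc m) f = ≡.cong (_ ∷_) (shift m (f ∘ suc))

  -- h_n(1, q, ..., q^m) is the q-binomial coefficient of n + m over n, here with its denominators
  -- multiplied out. Splitting off the letter 1 and pulling q out of the other letters is the
  -- q-Pascal rule.
  h-geometric : ∀ n m → poch q n * poch q m * h n (geometric (suc m)) ≈ poch q (n ℕ.+ m)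
  h-geometric zero m = trans (*-identityʳ _) (*-identityˡ _)
  h-geometric (suc n) zero = begin
    poch q (suc n) * 1# * h (suc n) (1# ∷ [])       ≈⟨ *-cong (*-identityʳ _) (ones (suc n)) ⟩
    poch q (suc n) * 1#                             ≈⟨ *-identityʳ _ ⟩
    poch q (suc n)                                  ≡⟨ ≡.cong (poch q) (≡.sym (ℕₚ.+-identityʳ (suc n))) ⟩
    poch q (suc n ℕ.+ 0)                            ∎
    where
    ones : ∀ k → h k (1# ∷ []) ≈ 1#
    ones zero    = refl
    ones (suc k) = trans (+-identityˡ _) (trans (*-identityˡ _) (ones k))
  h-geometric (suc n) (suc m) = begin
    poch q (suc n) * poch q (suc m) * (h (suc n) (map (q *_) (geometric (suc m))) + 1# * h n (geometric (2 ℕ.+ m)))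
      ≈⟨ *-congˡ (+-cong (h-scale q (suc n) (geometric (suc m))) (*-identityˡ _)) ⟩
    poch q (suc n) * poch q (suc m) * (q ^ suc n * s + t)
      ≈⟨ solve 5 (λ A B k s t → A ⊠ B ⊠ (k ⊠ s ⊞ t) := k ⊠ (A ⊠ B ⊠ s) ⊞ A ⊠ B ⊠ t) refl _ _ _ _ _ ⟩
    q ^ suc n * (poch q (suc n) * poch q (suc m) * s) + poch q (suc n) * poch q (suc m) * t
      ≈⟨ +-cong (*-congˡ (*-congʳ (*-congˡ (poch-last q m)))) (*-congʳ (*-congʳ (poch-last q n))) ⟩
    q ^ suc n * (poch q (suc n) * (poch q m * (1# + - (q ^ m * q))) * s) + poch q n * (1# + - (q ^ n * q)) * poch q (suc m) * t
      ≈⟨ solve 9 (λ k A b u s a v B t → k ⊠ (A ⊠ (b ⊠ u) ⊠ s) ⊞ a ⊠ v ⊠ B ⊠ t := k ⊠ u ⊠ (A ⊠ b ⊠ s) ⊞ v ⊠ (a ⊠ B ⊠ t)) refl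
           _ _ _ _ _ _ _ _ _ ⟩
    q ^ suc n * (1# + - (q ^ m * q)) * (poch q (suc n) * poch q m * s) + (1# + - (q ^ n * q)) * (poch q n * poch q (suc m) * t)
      ≈⟨ +-cong (*-congˡ (h-geometric (suc n) m)) (*-congˡ (trans (h-geometric n (suc m)) (reflexive (≡.cong (poch q) (ℕₚ.+-suc n m))))) ⟩
    q ^ suc n * (1# + - (q ^ m * q)) * P + (1# + - (q ^ n * q)) * P
      ≈⟨ solve 4 (λ k l q P → (q ⊠ k) ⊠ (𝟙 ⊟ l ⊠ q) ⊠ P ⊞ (𝟙 ⊟ k ⊠ q) ⊠ P := P ⊠ (𝟙 ⊟ (q ⊠ k ⊠ l) ⊠ q)) refl (q ^ n) (q ^ m) q P ⟩
    P * (1# + - (q ^ suc n * q ^ m * q))            ≈⟨ *-congˡ (+-congˡ (-‿cong (*-congʳ (^-homo-* q (suc n) m)))) ⟨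
    P * (1# + - (q ^ (suc n ℕ.+ m) * q))            ≈⟨ poch-last q (suc n ℕ.+ m) ⟨
    poch q (suc (suc n ℕ.+ m))                      ≡⟨ ≡.cong (poch q ∘ suc) (≡.sym (ℕₚ.+-suc n m)) ⟩
    poch q (suc n ℕ.+ suc m)                        ∎
    where
    s t P : Carrier
    s = h (suc n) (geometric (suc m))
    t = h n (geometric (2 ℕ.+ m))
    P = poch q (suc n ℕ.+ m)

-- Lists with a distinguished entry

record Focus (A : Set) : Set where
  constructor focus
  field
    before : List A
    item   : A
    after  : List A
open Focus

module _ {A : Set} where

  push : A → Focus A → Focus A
  push x f = focus (x ∷ before f) (item f) (after f)

  foci : List A → List (Focus A)
  foci []       = []
  foci (x ∷ xs) = focus [] x xs ∷ map (push x) (foci xs)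

  rest : Focus A → List A
  rest f = before f ++ after f

  foci-item : ∀ xs → map item (foci xs) ≡ xs
  foci-item []       = ≡.refl
  foci-item (x ∷ xs) = ≡.cong (x ∷_) (≡.trans (≡.sym (Listₚ.map-∘ (foci xs))) (foci-item xs))

  foci-split : ∀ {xs f} → f ∈ foci xs → xs ≡ before f ++ item f ∷ after f
  foci-split {x ∷ xs} (here ≡.refl) = ≡.refl
  foci-split {x ∷ xs} (there f∈) with ∈-map⁻ (push x) f∈
  ... | g , g∈ , ≡.refl = ≡.cong (x ∷_) (foci-split g∈)

-- An axiomatic Laurent polynomial ring with constant term

record LaurentSystem (V : Set) : Set₁ where
  field
    R : CommutativeRing 0ℓ 0ℓ
  open RingLemmas R
  open CompleteSymmetric R
  field
    q qi  : Carrier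
    q*qi  : q * qi ≈ 1#
    X     : V → ℤ → Carrier
    X-+   : ∀ v y z → X v (y ℤ.+ z) ≈ X v y * X v z
    X-0   : ∀ v → X v (+ 0) ≈ 1#

    -- `NonNeg v`: no negative power of x_v occurs; `Pos v`: only positive powers do. `Pos v` is an
    -- ideal over `NonNeg v`, and a difference lying in it means equal values at x_v = 0.
    NonNeg Pos : V → Carrier → Set
    NonNeg-resp : ∀ {v f g} → f ≈ g → NonNeg v f → NonNeg v g
    NonNeg-1    : ∀ {v} → NonNeg v 1#
    NonNeg-+    : ∀ {v f g} → NonNeg v f → NonNeg v g → NonNeg v (f + g)
    NonNeg-*    : ∀ {v f g} → NonNeg v f → NonNeg v g → NonNeg v (f * g)
    NonNeg-neg  : ∀ {v f} → NonNeg v f → NonNeg v (- f)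
    NonNeg-q    : ∀ {v} → NonNeg v q
    NonNeg-qi   : ∀ {v} → NonNeg v qi
    NonNeg-X≢   : ∀ {v w} → v ≢ w → ∀ z → NonNeg v (X w z)
    Pos⇒NonNeg  : ∀ {v f} → Pos v f → NonNeg v f
    Pos-resp    : ∀ {v f g} → f ≈ g → Pos v f → Pos v g
    Pos-0       : ∀ {v} → Pos v 0#
    Pos-+       : ∀ {v f g} → Pos v f → Pos v g → Pos v (f + g)
    Pos-*       : ∀ {v f g} → NonNeg v f → Pos v g → Pos v (f * g)
    Pos-X       : ∀ {v} n → Pos v (X v (+ suc n))

    -- Elements free of all x_v, that is, Laurent polynomials in q alone; `ct` is linear over them.
    Const     : Carrier → Set
    Const-1   : Const 1#
    Const-+   : ∀ {f g} → Const f → Const g → Const (f + g)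
    Const-*   : ∀ {f g} → Const f → Const g → Const (f * g)
    Const-neg : ∀ {f} → Const f → Const (- f)
    Const-q   : Const q
    Const-qi  : Const qi

    Const-0   : Const 0#

    ct      : Carrier → Carrier
    ct-cong : ∀ {f g} → f ≈ g → ct f ≈ ct g
    ct-+    : ∀ f g → ct (f + g) ≈ ct f + ct g
    ct-*    : ∀ {c} → Const c → ∀ f → ct (c * f) ≈ c * ct f
    ct-Pos  : ∀ {v f} → Pos v f → ct f ≈ 0#

    regular-X : ∀ {v w j k} → v ≢ w → Regular (q ^ j * X v (+ 1) + - (q ^ k * X w (+ 1)))
    regular-q : ∀ {j k} → j ≢ k → Regular (q ^ j + - (q ^ k))

    -- Homogeneity in x_v. It serves to recognise monomials without constant term when the formal
    -- sums of the statement are interpreted in the ring.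
    Degree   : V → ℤ → Carrier → Set
    Degree-1 : ∀ {v} → Degree v (+ 0) 1#
    Degree-* : ∀ {v y z f g} → Degree v y f → Degree v z g → Degree v (y ℤ.+ z) (f * g)
    Degree-X : ∀ v z → Degree v z (X v z)
    Degree-X≢ : ∀ {v w} → v ≢ w → ∀ z → Degree v (+ 0) (X w z)
    ct-Degree : ∀ {v z f} → z ≢ + 0 → Degree v z f → ct f ≈ 0#
    ct-1      : ct 1# ≈ 1#

    const       : ℤ → Carrier
    const-1     : const (+ 1) ≈ 1#
    const-neg   : ∀ z → const (ℤ.- z) ≈ - const z
    const-*     : ∀ y z → const (y ℤ.* z) ≈ const y * const z
    Const-const : ∀ z → Const (const z)

  polynomial : Poly → Carrier
  polynomial p = ∑ p (λ t → const (proj₁ t) * q ^ proj₂ t)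

  field
    -- The way back from identities in the ring to the coefficientwise equality of the statement.
    polynomial-injective : ∀ p p′ → polynomial p ≈ polynomial p′ → p ≈ₚ p′

-- One variable of the constant term: `size` is its entry of ã, which is also the number of its
-- letters in the alphabet, `expo` its entry of v, and `first` records whether its index is at most
-- n_0. Naming the variable keeps it meaningful after deletions.
record Item (V : Set) : Set where
  constructor mkItem
  field
    var   : V
    size  : ℕ
    expo  : ℤ
    first : Bool
open Item public

-- The constant term attached to a list of items

module DysonProduct {V : Set} (S : LaurentSystem V) where
  open LaurentSystem S
  open RingLemmas R
  open CompleteSymmetric R
  open QPochhammer R q

  mixed : Item V → Item V → Bool
  mixed d l = first d ∧ not (first l)

  -- The second factorial of the kernel has length a_l - χ(d ≤ n_0), whereas `size l` is a_l - χ(l ≤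
  -- n_0). For d before l these differ, by one, exactly if d is in the first block and l in the
  -- second.
  χ : Item V → Item V → ℕ
  χ d l = if mixed d l then 1 else 0

  ratio : Item V → Item V → Carrier
  ratio d l = X (var d) (+ 1) * X (var l) -[1+ 0 ]

  pair : Item V → Item V → Carrier
  pair d l = poch (ratio d l) (size d) * poch (q * ratio l d) (size l ∸ χ d l)

  dysonKernel : List (Item V) → Carrier
  dysonKernel []       = 1#
  dysonKernel (d ∷ ds) = ∏ ds (pair d) * dysonKernel ds

  letters : List (Item V) → List Carrier
  letters = concatMap (λ d → map (λ k → q ^ k * X (var d) (+ 1)) (upTo (size d)))

  monomial : List (Item V) → Carrier
  monomial ds = ∏ ds (λ d → X (var d) (ℤ.- expo d))

  hh : List ℕ → List Carrier → Carrier
  hh lam Y = ∏ lam (λ r → h r Y)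

  𝔇 : List (Item V) → List ℕ → Carrier
  𝔇 ds lam = ct (monomial ds * (hh lam (letters ds) * dysonKernel ds))

  -- Removing d leaves a factor x_d/x_l for a mixed pair; its 1/x_l counts as one more in the
  -- exponent of l.
  shift : Item V → Item V → Item V
  shift d l = record l { expo = expo l ℤ.+ + χ d l }

  crossings : Item V → List (Item V) → ℕ
  crossings d []       = 0
  crossings d (l ∷ ls) = χ d l ℕ.+ crossings d ls

  sizes : List (Item V) → ℕ
  sizes ds = sum (map size ds)

  -- A later item that is not mixed with d contributes q^{b_l}, the value of q^{b_l} - x_d/x_l at
  -- x_d = 0. A mixed one contributes a sign and a monomial instead.
  parallel : Item V → List (Item V) → ℕ
  parallel d []       = 0
  parallel d (l ∷ ls) = (if mixed d l then 0 else size l) ℕ.+ parallel d ls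

  -- The contributions of all letters of one variable taken together: a sign for every mixed later
  -- item, the q-power of `parallel`, and the sum over j of q^{jN} over its constant denominators,
  -- where N = r + |b| - b_i.
  coefficient : ℕ → Focus (Item V) → Carrier
  coefficient r f = (- 1#) ^ crossings d (after f) * q ^ parallel d (after f) * h (r ℕ.+ sizes (rest f)) (geometric (size d))
    where d = item f

  reduced : Focus (Item V) → List (Item V)
  reduced f = before f ++ map (shift (item f)) (after f)

-- Removing one variable and one part

module DysonStep {V : Set} (S : LaurentSystem V) (_≟_ : DecidableEquality V) where
  open LaurentSystem S
  open RingLemmas R
  open CompleteSymmetric R
  open QPochhammer R q
  open DysonProduct S
  open Algebra.Properties.CommutativeSemiring.Exp commutativeSemiring using (^-distrib-*; ^-assocʳ)
  open ≈R

  kernel-focus : ∀ xs d ys → dysonKernel (xs ++ d ∷ ys) ≈ dysonKernel (xs ++ ys) * (∏ xs (λ l → pair l d) * ∏ ys (pair d))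
  kernel-focus []       d ys = trans (*-comm _ _) (*-congˡ (sym (*-identityˡ _)))
  kernel-focus (x ∷ xs) d ys = begin
    ∏ (xs ++ d ∷ ys) (pair x) * dysonKernel (xs ++ d ∷ ys)
      ≈⟨ *-cong (∏-++ xs (d ∷ ys)) (kernel-focus xs d ys) ⟩
    ∏ xs (pair x) * (pair x d * ∏ ys (pair x)) * (dysonKernel (xs ++ ys) * (∏ xs (λ l → pair l d) * ∏ ys (pair d)))
      ≈⟨ solve 6 (λ a b c k s t → a ⊠ (b ⊠ c) ⊠ (k ⊠ (s ⊠ t)) := a ⊠ c ⊠ k ⊠ (b ⊠ s ⊠ t)) refl _ _ _ _ _ _ ⟩
    ∏ xs (pair x) * ∏ ys (pair x) * dysonKernel (xs ++ ys) * (pair x d * ∏ xs (λ l → pair l d) * ∏ ys (pair d))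
      ≈⟨ *-congʳ (*-congʳ (∏-++ xs ys)) ⟨
    ∏ (xs ++ ys) (pair x) * dysonKernel (xs ++ ys) * (pair x d * ∏ xs (λ l → pair l d) * ∏ ys (pair d)) ∎

  kernel-shift : ∀ d xs ys → dysonKernel (xs ++ ys) ≈ dysonKernel (xs ++ map (shift d) ys)
  kernel-shift d (x ∷ xs) ys = *-cong
    (trans (∏-++ xs ys) (trans (*-congˡ (sym (∏-map (shift d) ys {pair x}))) (sym (∏-++ xs _)))) (kernel-shift d xs ys)
  kernel-shift d [] []       = refl
  kernel-shift d [] (y ∷ ys) = *-cong (sym (∏-map (shift d) ys {pair y})) (kernel-shift d [] ys)

  letters-shift : ∀ d xs ys → letters (xs ++ map (shift d) ys) ≡ letters (xs ++ ys)
  letters-shift d (x ∷ xs) ys = ≡.cong (_ ++_) (letters-shift d xs ys)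
  letters-shift d [] []       = ≡.refl
  letters-shift d [] (y ∷ ys) = ≡.cong (_ ++_) (letters-shift d [] ys)

  unless : {P : Set} → Dec P → Carrier → Carrier
  unless p? c = if does p? then 1# else c

  unless-elim : {P : Set} (p? : Dec P) {c : Carrier} (Q : Carrier → Set) → (P → Q 1#) → (¬ P → Q c) → Q (unless p? c)
  unless-elim (yes p) Q q₁ q₂ = q₁ p
  unless-elim (no ¬p) Q q₁ q₂ = q₂ ¬p

  unless-yes : {P : Set} (p? : Dec P) {c : Carrier} → P → unless p? c ≈ 1#
  unless-yes p? {c} p = unless-elim p? (_≈ 1#) (λ _ → refl) (λ ¬p → contradiction p ¬p)

  unless-no : {P : Set} (p? : Dec P) {c : Carrier} → ¬ P → unless p? c ≈ c
  unless-no p? {c} ¬p = unless-elim p? (_≈ c) (λ p → contradiction p ¬p) (λ _ → refl)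

  module Weights where

    -- The weight 1 - q^{k-j} between two letters x q^j and x q^k of the same variable; x itself has
    -- cancelled.
    wq : ℕ → ℕ → Carrier
    wq j k = unless (j ℕ.≟ k) (1# + - (q ^ k * qi ^ j))

    wq-refl : ∀ j → wq j j ≈ 1#
    wq-refl j = unless-yes (j ℕ.≟ j) ≡.refl

    wq-≢ : ∀ {j k} → j ≢ k → wq j k ≈ 1# + - (q ^ k * qi ^ j)
    wq-≢ {j} {k} = unless-no (j ℕ.≟ k)

    wq-*-q : ∀ {j k} → j ≢ k → wq j k * q ^ j ≈ q ^ j + - (q ^ k)
    wq-*-q {j} {k} j≢k = begin
      wq j k * q ^ j                          ≈⟨ *-congʳ (wq-≢ j≢k) ⟩
      (1# + - (q ^ k * qi ^ j)) * q ^ j       ≈⟨ solve 3 (λ a b c → (𝟙 ⊟ b ⊠ c) ⊠ a := a ⊟ b ⊠ (a ⊠ c)) refl (q ^ j) (q ^ k) (qi ^ j) ⟩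
      q ^ j + - (q ^ k * (q ^ j * qi ^ j))    ≈⟨ +-congˡ (-‿cong (trans (*-congˡ (q^*qi^ qi q*qi j)) (*-identityʳ _))) ⟩
      q ^ j + - (q ^ k)                       ∎

    regular-qi^ : ∀ j → Regular (qi ^ j)
    regular-qi^ j {b} p = begin
      b                       ≈⟨ *-identityˡ b ⟨
      1# * b                  ≈⟨ *-congʳ (q^*qi^ qi q*qi j) ⟨
      (q ^ j * qi ^ j) * b    ≈⟨ *-assoc _ _ _ ⟩
      q ^ j * (qi ^ j * b)    ≈⟨ *-congˡ p ⟩
      q ^ j * 0#              ≈⟨ zeroʳ _ ⟩
      0#                      ∎

    regular-wq : ∀ j k → Regular (wq j k)
    regular-wq j k = unless-elim (j ℕ.≟ k) Regular (λ _ → Regular-1) (λ j≢k → Regular-resp (begin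
      qi ^ j * (q ^ j + - (q ^ k))            ≈⟨ solve 3 (λ a b c → c ⊠ (a ⊟ b) := a ⊠ c ⊟ b ⊠ c) refl (q ^ j) (q ^ k) (qi ^ j) ⟩
      q ^ j * qi ^ j + - (q ^ k * qi ^ j)     ≈⟨ +-congʳ (q^*qi^ qi q*qi j) ⟩
      1# + - (q ^ k * qi ^ j)                 ∎) (Regular-* (regular-qi^ j) (regular-q j≢k)))

    δ : ℕ → ℕ → Carrier
    δ b j = ∏ (upTo b) (wq j)

    -- A common multiple of the `δ b j`: it clears the constant denominators of all letters of one
    -- variable at once, with `κ b j` as cofactor.
    Δ : ℕ → Carrier
    Δ b = ∏ (upTo b) (δ b)

    κ : ℕ → ℕ → Carrier
    κ b j = ∏ (upTo b) (λ i → unless (i ℕ.≟ j) (δ b i))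

    regular-Δ : ∀ b → Regular (Δ b)
    regular-Δ b = Regular-∏ (upTo b) (λ {j} _ → Regular-∏ (upTo b) (λ {k} _ → regular-wq j k))

    ∏-remove : ∀ {xs x} → Unique xs → x ∈ xs → {f : ℕ → Carrier} →
      ∏ xs f ≈ ∏ xs (λ i → unless (i ℕ.≟ x) (f i)) * f x
    ∏-remove {y ∷ xs} (y≢ ∷ u) (here ≡.refl) {f} =
      trans (*-comm _ _) (*-congʳ (trans (∏-cong xs (λ {i} i∈ → sym (unless-no (i ℕ.≟ y) (All.lookup y≢ i∈ ∘ ≡.sym))))
        (sym (trans (*-congʳ (unless-yes (y ℕ.≟ y) ≡.refl)) (*-identityˡ _)))))
    ∏-remove {y ∷ xs} {x} (y≢ ∷ u) (there x∈) =
      trans (*-cong (sym (unless-no (y ℕ.≟ x) (All.lookup y≢ x∈))) (∏-remove u x∈)) (sym (*-assoc _ _ _))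

    κ*δ : ∀ {b j} → j ∈ upTo b → Δ b ≈ κ b j * δ b j
    κ*δ {b} j∈ = ∏-remove (upTo⁺ b) j∈

    -- Partial fractions for the alphabet 1, q, ..., q^{b-1}, to be read from right to left: it
    -- evaluates the sum over j that remains once x_i has been set to 0.
    ∑-κ : ∀ b r → Δ b * h (suc r) (geometric b) ≈ ∑ (upTo b) (λ j → (q ^ j) ^ suc r * κ b j)
    ∑-κ b r = begin
      Δ b * h (suc r) (geometric b)               ≡⟨ ≡.cong (λ Y → Δ b * h (suc r) Y) (≡.sym (geometric-upTo b)) ⟩
      Δ b * h (suc r) (map (q ^_) (upTo b))       ≈⟨ partialFractions wq-refl (upTo b) seps (Δ b) (κ b) κ*δ r ⟩
      ∑ (upTo b) (λ j → (q ^ j) ^ suc r * κ b j)  ∎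
      where
      open PartialFractions (q ^_) wq
      seps : AllPairs Separated (upTo b)
      seps = AllPairs.map
        (λ j≢k → separated (wq-*-q j≢k) (wq-*-q (j≢k ∘ ≡.sym)) (regular-q j≢k)) (upTo⁺ b)

    Const-∏ : {A : Set} (xs : List A) {f : A → Carrier} → (∀ x → Const (f x)) → Const (∏ xs f)
    Const-∏ []       c = Const-1
    Const-∏ (x ∷ xs) c = Const-* (c x) (Const-∏ xs c)

    Const-^ : ∀ {c} n → Const c → Const (c ^ n)
    Const-^ zero    p = Const-1
    Const-^ (suc n) p = Const-* p (Const-^ n p)

    Const-wq : ∀ j k → Const (wq j k)
    Const-wq j k = unless-elim (j ℕ.≟ k) Const (λ _ → Const-1)
      (λ _ → Const-+ Const-1 (Const-neg (Const-* (Const-^ k Const-q) (Const-^ j Const-qi))))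

    Const-δ : ∀ b j → Const (δ b j)
    Const-δ b j = Const-∏ (upTo b) (Const-wq j)

    Const-Δ : ∀ b → Const (Δ b)
    Const-Δ b = Const-∏ (upTo b) (Const-δ b)

    Const-κ : ∀ b j → Const (κ b j)
    Const-κ b j = Const-∏ (upTo b) (λ i → unless-elim (i ℕ.≟ j) Const (λ _ → Const-1) (λ _ → Const-δ b i))

  open Weights

  module Evaluation (v : V) where

    NonNeg-^ : ∀ {f} n → NonNeg v f → NonNeg v (f ^ n)
    NonNeg-^ zero    p = NonNeg-1
    NonNeg-^ (suc n) p = NonNeg-* p (NonNeg-^ n p)

    NonNeg-1- : ∀ {f} → NonNeg v f → NonNeg v (1# + - f)
    NonNeg-1- p = NonNeg-+ NonNeg-1 (NonNeg-neg p)

    NonNeg-0 : NonNeg v 0#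
    NonNeg-0 = Pos⇒NonNeg Pos-0

    NonNeg-∏ : {A : Set} (xs : List A) {f : A → Carrier} → (∀ {x} → x ∈ xs → NonNeg v (f x)) → NonNeg v (∏ xs f)
    NonNeg-∏ []       p = NonNeg-1
    NonNeg-∏ (x ∷ xs) p = NonNeg-* (p (here ≡.refl)) (NonNeg-∏ xs (p ∘ there))

    NonNeg-poch : ∀ {z} n → NonNeg v z → NonNeg v (poch z n)
    NonNeg-poch zero    p = NonNeg-1
    NonNeg-poch (suc n) p = NonNeg-* (NonNeg-1- p) (NonNeg-poch n (NonNeg-* NonNeg-q p))

    NonNeg-h : ∀ r {Y} → All (NonNeg v) Y → NonNeg v (h r Y)
    NonNeg-h zero    ps       = NonNeg-1
    NonNeg-h (suc r) []       = NonNeg-0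
    NonNeg-h (suc r) (p ∷ ps) = NonNeg-+ (NonNeg-h (suc r) ps) (NonNeg-* p (NonNeg-h r (p ∷ ps)))

    -- f ↘ g: f and g are polynomials in x_v with the same value at x_v = 0.
    infix 4 _↘_
    record _↘_ (f g : Carrier) : Set where
      constructor mk↘
      field
        nonNegˡ : NonNeg v f
        nonNegʳ : NonNeg v g
        pos     : Pos v (f + - g)
    open _↘_ public

    ↘-refl : ∀ {f} → NonNeg v f → f ↘ f
    ↘-refl p = mk↘ p p (Pos-resp (sym (-‿inverseʳ _)) Pos-0)

    ↘-resp : ∀ {f f′ g g′} → f ≈ f′ → g ≈ g′ → f ↘ g → f′ ↘ g′
    ↘-resp e e′ (mk↘ p p′ d) = mk↘ (NonNeg-resp e p) (NonNeg-resp e′ p′) (Pos-resp (+-cong e (-‿cong e′)) d)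

    ↘-0 : ∀ {f} → Pos v f → f ↘ 0#
    ↘-0 p = mk↘ (Pos⇒NonNeg p) NonNeg-0 (Pos-resp (solve 1 (λ f → f := f ⊟ con (+ 0)) refl _) p)

    ↘-+ : ∀ {f f′ g g′} → f ↘ g → f′ ↘ g′ → f + f′ ↘ g + g′
    ↘-+ (mk↘ p q d) (mk↘ p′ q′ d′) = mk↘ (NonNeg-+ p p′) (NonNeg-+ q q′)
      (Pos-resp (solve 4 (λ f f′ g g′ → (f ⊟ g) ⊞ (f′ ⊟ g′) := (f ⊞ f′) ⊟ (g ⊞ g′)) refl _ _ _ _) (Pos-+ d d′))

    ↘-neg : ∀ {f g} → f ↘ g → - f ↘ - g
    ↘-neg (mk↘ p q d) = mk↘ (NonNeg-neg p) (NonNeg-neg q)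
      (Pos-resp (solve 2 (λ f g → (⊖ 𝟙) ⊠ (f ⊟ g) := (⊖ f) ⊟ (⊖ g)) refl _ _) (Pos-* (NonNeg-neg NonNeg-1) d))

    ↘-* : ∀ {f f′ g g′} → f ↘ g → f′ ↘ g′ → f * f′ ↘ g * g′
    ↘-* (mk↘ p q d) (mk↘ p′ q′ d′) = mk↘ (NonNeg-* p p′) (NonNeg-* q q′)
      (Pos-resp (solve 4 (λ f f′ g g′ → f ⊠ (f′ ⊟ g′) ⊞ g′ ⊠ (f ⊟ g) := f ⊠ f′ ⊟ g ⊠ g′) refl _ _ _ _)
        (Pos-+ (Pos-* p d′) (Pos-* q′ d)))

    ↘-∏ : {A : Set} (xs : List A) {f g : A → Carrier} → (∀ {x} → x ∈ xs → f x ↘ g x) → ∏ xs f ↘ ∏ xs g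
    ↘-∏ []       p = ↘-refl NonNeg-1
    ↘-∏ (x ∷ xs) p = ↘-* (p (here ≡.refl)) (↘-∏ xs (p ∘ there))

    ↘-1- : ∀ {z} → Pos v z → 1# + - z ↘ 1#
    ↘-1- p = ↘-resp refl (solve 1 (λ o → o ⊟ con (+ 0) := o) refl _) (↘-+ (↘-refl NonNeg-1) (↘-neg (↘-0 p)))

    ↘-poch : ∀ {z} n → Pos v z → poch z n ↘ 1#
    ↘-poch zero    p = ↘-refl NonNeg-1
    ↘-poch (suc n) p = ↘-resp refl (*-identityˡ 1#) (↘-* (↘-1- p) (↘-poch n (Pos-* NonNeg-q p)))

    ↘-q^- : ∀ b {z} → Pos v z → q ^ b + - z ↘ q ^ b
    ↘-q^- b p = ↘-resp refl (solve 1 (λ o → o ⊟ con (+ 0) := o) refl _) (↘-+ (↘-refl (NonNeg-^ b NonNeg-q)) (↘-neg (↘-0 p)))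

    ↘-twist : ∀ b j {z} → Pos v z → twist b j z ↘ (q ^ b) ^ j
    ↘-twist b zero    p = ↘-refl NonNeg-1
    ↘-twist b (suc j) p = ↘-resp refl (*-comm _ _)
      (↘-* (↘-twist b j p) (↘-q^- b (Pos-* (NonNeg-^ (suc j) NonNeg-q) p)))

    ↘-h-skip : ∀ {y Y Y′} → Pos v y → (∀ r → h r Y ↘ h r Y′) → ∀ r → h r (y ∷ Y) ↘ h r Y′
    ↘-h-skip p e zero    = ↘-refl NonNeg-1
    ↘-h-skip p e (suc r) = ↘-resp refl (solve 2 (λ a b → a ⊞ con (+ 0) ⊠ b := a) refl _ _)
      (↘-+ (e (suc r)) (↘-* (↘-0 p) (↘-h-skip p e r)))

    ↘-h-keep : ∀ {y Y Y′} → NonNeg v y → (∀ r → h r Y ↘ h r Y′) → ∀ r → h r (y ∷ Y) ↘ h r (y ∷ Y′)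
    ↘-h-keep p e zero    = ↘-refl NonNeg-1
    ↘-h-keep p e (suc r) = ↘-+ (e (suc r)) (↘-* (↘-refl p) (↘-h-keep p e r))

    ↘-h : ∀ {A U B} → All (NonNeg v) A → All (Pos v) U → All (NonNeg v) B → ∀ r → h r (A ++ U ++ B) ↘ h r (A ++ B)
    ↘-h []       []       bs r = ↘-refl (NonNeg-h r bs)
    ↘-h []       (u ∷ us) bs r = ↘-h-skip u (↘-h [] us bs) r
    ↘-h (a ∷ as) us       bs r = ↘-h-keep a (↘-h as us bs) r

    NonNeg-ratio : ∀ {l l′} → v ≢ var l → v ≢ var l′ → NonNeg v (ratio l l′)
    NonNeg-ratio p p′ = NonNeg-* (NonNeg-X≢ p _) (NonNeg-X≢ p′ _)

    NonNeg-pair : ∀ {l l′} → v ≢ var l → v ≢ var l′ → NonNeg v (pair l l′)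
    NonNeg-pair {l} {l′} p p′ = NonNeg-* (NonNeg-poch (size l) (NonNeg-ratio {l} {l′} p p′))
      (NonNeg-poch (size l′ ∸ χ l l′) (NonNeg-* NonNeg-q (NonNeg-ratio {l′} {l} p′ p)))

    NonNeg-kernel : ∀ {ds} → All (λ l → v ≢ var l) ds → NonNeg v (dysonKernel ds)
    NonNeg-kernel []       = NonNeg-1
    NonNeg-kernel {d ∷ ds} (p ∷ ps) = NonNeg-* (NonNeg-∏ ds (λ {l} l∈ → NonNeg-pair {d} {l} p (All.lookup ps l∈))) (NonNeg-kernel ps)

    NonNeg-monomial : ∀ {ds} → All (λ l → v ≢ var l) ds → NonNeg v (monomial ds)
    NonNeg-monomial {ds} ps = NonNeg-∏ ds (λ l∈ → NonNeg-X≢ (All.lookup ps l∈) _)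

    NonNeg-letters : ∀ {ds} → All (λ l → v ≢ var l) ds → All (NonNeg v) (letters ds)
    NonNeg-letters {[]}     []       = []
    NonNeg-letters {d ∷ ds} (p ∷ ps) = Allₚ.++⁺
      (Allₚ.map⁺ (All.universal (λ k → NonNeg-* (NonNeg-^ k NonNeg-q) (NonNeg-X≢ p _)) (upTo (size d))))
      (NonNeg-letters ps)

    -- The difference w(f - g) has only positive powers of x_v, hence no constant term. The factor w
    -- may contain the other variables with arbitrary exponents.
    ct-↘ : ∀ {f g w} → NonNeg v w → f ↘ g → ct (w * f) ≈ ct (w * g)
    ct-↘ {f} {g} {w} p e = begin
      ct (w * f)                          ≈⟨ ct-cong (solve 3 (λ w f g → w ⊠ f := w ⊠ g ⊞ w ⊠ (f ⊟ g)) refl w f g) ⟩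
      ct (w * g + w * (f + - g))          ≈⟨ ct-+ _ _ ⟩
      ct (w * g) + ct (w * (f + - g))     ≈⟨ +-congˡ (ct-Pos (Pos-* p (pos e))) ⟩
      ct (w * g) + 0#                     ≈⟨ +-identityʳ _ ⟩
      ct (w * g)                          ∎

  ratio-inverse : ∀ d l → ratio l d * ratio d l ≈ 1#
  ratio-inverse d l = begin
    (X (var l) (+ 1) * X (var d) -[1+ 0 ]) * (X (var d) (+ 1) * X (var l) -[1+ 0 ])
      ≈⟨ solve 4 (λ a b c e → (a ⊠ b) ⊠ (c ⊠ e) := (a ⊠ e) ⊠ (c ⊠ b)) refl _ _ _ _ ⟩
    (X (var l) (+ 1) * X (var l) -[1+ 0 ]) * (X (var d) (+ 1) * X (var d) -[1+ 0 ])  ≈⟨ *-cong (inv (var l)) (inv (var d)) ⟩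
    1# * 1#                                                        ≈⟨ *-identityˡ 1# ⟩
    1#                                                             ∎
    where
    inv : ∀ v → X v (+ 1) * X v -[1+ 0 ] ≈ 1#
    inv v = trans (sym (X-+ v _ _)) (X-0 v)

  -- For l ≠ d, the pair factor of d and l is (q^{-j} x_l/x_d)_{b_l} times
  -- cofactorBefore or cofactorAfter, a polynomial in x_d/x_l.
  cofactorBefore : Item V → ℕ → Item V → Carrier
  cofactorBefore d j l = twist (size l) j (ratio d l) * poch (q ^ suc j * ratio d l) ((size d ∸ χ l d) ∸ j)

  cofactorAfter : Bool → Item V → ℕ → Item V → Carrier
  cofactorAfter m d j l = (if m then 1# else q ^ size l + - ratio d l) *
    (twist (size l) j (ratio d l) * poch (q ^ suc j * ratio d l) (size d ∸ suc j))

  -- All weights 1 - u'/u between u = x_d q^j and the letters u' of l, collected into one q-shifted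
  -- factorial.
  pole : Item V → ℕ → Item V → Carrier
  pole d j l = poch (qi ^ j * ratio l d) (size l)

  χ≤1 : ∀ d l → χ d l ℕ.≤ 1
  χ≤1 d l with mixed d l
  ... | true  = ℕₚ.≤-refl
  ... | false = ℕ.z≤n

  -- The first j factors of the second factorial are split off as (q x_d/x_l)_j. Together with
  -- (x_l/x_d)_{b_l} they are the right side of `poch-twist`.
  pair-before : ∀ {d j} l → j ℕ.< size d → pair l d ≈ pole d j l * cofactorBefore d j l
  pair-before {d} {j} l j< = begin
    poch y b * poch (q * z) m                          ≡⟨ ≡.cong (λ m → poch y b * poch (q * z) m) (≡.sym (ℕₚ.m+[n∸m]≡n j≤)) ⟩
    poch y b * poch (q * z) (j ℕ.+ (m ∸ j))            ≈⟨ *-congˡ (poch-+ (q * z) j (m ∸ j)) ⟩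
    poch y b * (poch (q * z) j * poch (q ^ j * (q * z)) (m ∸ j)) ≈⟨ *-assoc _ _ _ ⟨
    poch y b * poch (q * z) j * poch (q ^ j * (q * z)) (m ∸ j)
      ≈⟨ *-cong (sym (poch-twist qi q*qi (ratio-inverse d l) b j)) (poch-cong (m ∸ j) (q^-suc j z)) ⟩
    pole d j l * twist b j z * poch (q ^ suc j * z) (m ∸ j)  ≈⟨ *-assoc _ _ _ ⟩
    pole d j l * cofactorBefore d j l                  ∎
    where
    y z : Carrier
    y = ratio l d
    z = ratio d l
    b m : ℕ
    b = size l
    m = size d ∸ χ l d
    -- Since j is strictly below `size d` and χ is at most 1, the factorial of a mixed pair, shorter
    -- by one, still has j factors.
    j≤ : j ℕ.≤ m
    j≤ = ℕₚ.≤-trans (ℕₚ.∸-monoˡ-≤ 1 j<) (ℕₚ.∸-monoʳ-≤ (size d) (χ≤1 l d))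

  -- The factor 1 - z of the first factorial, z = x_d/x_l = 1/y, is spent on the second: (qy)_b (1 -
  -- z) = (y)_b (q^b - z), and (qy)_{b-1} (1 - z) = (y)_b (-z) for a mixed pair. The next j factors
  -- then combine with (y)_b as in `pair-before`.
  pair-after : ∀ {d j} l → j ℕ.< size d → ∀ m → (m ≡ true → 1 ℕ.≤ size l) →
    poch (ratio d l) (size d) * poch (q * ratio l d) (size l ∸ (if m then 1 else 0))
      ≈ pole d j l * ((if m then - ratio d l else 1#) * cofactorAfter m d j l)
  pair-after {d} {j} l j< m m⇒ = begin
    poch z (size d) * poch (q * y) (b ∸ c)          ≡⟨ ≡.cong (λ n → poch z n * poch (q * y) (b ∸ c)) (≡.sym (ℕₚ.m+[n∸m]≡n j<)) ⟩
    poch z (suc j ℕ.+ k) * poch (q * y) (b ∸ c)     ≈⟨ *-congʳ (poch-+ z (suc j) k) ⟩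
    ((1# + - z) * poch (q * z) j) * t * poch (q * y) (b ∸ c)
      ≈⟨ solve 4 (λ o p t s → o ⊠ p ⊠ t ⊠ s := (s ⊠ o) ⊠ p ⊠ t) refl _ _ _ _ ⟩
    (poch (q * y) (b ∸ c) * (1# + - z)) * poch (q * z) j * t     ≈⟨ *-congʳ (*-congʳ (key m b m⇒)) ⟨
    poch y b * (s * s′) * poch (q * z) j * t        ≈⟨ solve 5 (λ p s s′ o t → p ⊠ (s ⊠ s′) ⊠ o ⊠ t := p ⊠ o ⊠ (s ⊠ s′ ⊠ t)) refl _ _ _ _ _ ⟩
    poch y b * poch (q * z) j * (s * s′ * t)        ≈⟨ *-congʳ (poch-twist qi q*qi (ratio-inverse d l) b j) ⟨
    pole d j l * twist b j z * (s * s′ * t)         ≈⟨ solve 5 (λ p w s s′ t → p ⊠ w ⊠ (s ⊠ s′ ⊠ t) := p ⊠ (s ⊠ (s′ ⊠ (w ⊠ t)))) refl _ _ _ _ _ ⟩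
    pole d j l * (s * cofactorAfter m d j l)        ∎
    where
    y z s s′ t : Carrier
    y = ratio l d
    z = ratio d l
    s = if m then - z else 1#
    s′ = if m then 1# else q ^ size l + - z
    b c k : ℕ
    b = size l
    c = if m then 1 else 0
    k = size d ∸ suc j
    t = poch (q ^ suc j * z) k
    key : ∀ m b → (m ≡ true → 1 ℕ.≤ b) →
      poch y b * ((if m then - z else 1#) * (if m then 1# else q ^ b + - z)) ≈ poch (q * y) (b ∸ (if m then 1 else 0)) * (1# + - z)
    key false b       p = trans (*-congˡ (*-identityˡ _)) (poch-inverse-step (ratio-inverse d l) b)
    -- For b = 0 the truncated b - 1 is again 0 and the claim would read -z = 1 - z; a mixed pair
    -- therefore needs b positive.
    key true  zero    p with p ≡.refl
    ... | ()
    key true  (suc b) p = trans (*-congˡ (*-identityʳ _)) (poch-inverse-suc (ratio-inverse d l) b)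

  choose : {P : Set} → Dec P → Carrier → Carrier → Carrier
  choose p? c c′ = if does p? then c else c′

  choose-yes : {P : Set} (p? : Dec P) {c c′ : Carrier} → P → choose p? c c′ ≈ c
  choose-yes (yes _) p = refl
  choose-yes (no ¬p) p = contradiction p ¬p

  choose-no : {P : Set} (p? : Dec P) {c c′ : Carrier} → ¬ P → choose p? c c′ ≈ c′
  choose-no (yes p) ¬p = contradiction p ¬p
  choose-no (no _)  ¬p = refl

  X-inverse : ∀ v → X v (+ 1) * X v -[1+ 0 ] ≈ 1#
  X-inverse v = trans (sym (X-+ v _ _)) (X-0 v)

  X-^ : ∀ v n → X v (+ 1) ^ n ≈ X v (+ n)
  X-^ v zero    = sym (X-0 v)
  X-^ v (suc n) = trans (*-congˡ (X-^ v n)) (sym (X-+ v (+ 1) (+ n)))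

  regular-Xv : ∀ v → Regular (X v (+ 1))
  regular-Xv v {b} p = begin
    b                                      ≈⟨ *-identityˡ b ⟨
    1# * b                                 ≈⟨ *-congʳ (X-inverse v) ⟨
    (X v (+ 1) * X v -[1+ 0 ]) * b         ≈⟨ solve 3 (λ x y b → (x ⊠ y) ⊠ b := y ⊠ (x ⊠ b)) refl _ _ _ ⟩
    X v -[1+ 0 ] * (X v (+ 1) * b)         ≈⟨ *-congˡ p ⟩
    X v -[1+ 0 ] * 0#                      ≈⟨ zeroʳ _ ⟩
    0#                                     ∎

  -- A letter x_d q^j is indexed by the focus at d and not by d alone, because its residue treats
  -- the items before and behind d differently.
  Index : Set
  Index = Focus (Item V) × ℕ

  letter : Item V → ℕ → Carrier
  letter d k = q ^ k * X (var d) (+ 1)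

  u : Index → Carrier
  u (f , j) = letter (item f) j

  weight : Item V → ℕ → Item V → ℕ → Carrier
  weight d j l k = choose (var d ≟ var l) (wq j k) (1# + - (q ^ k * (qi ^ j * ratio l d)))

  w : Index → Index → Carrier
  w (f , j) (g , k) = weight (item f) j (item g) k

  data Apart : Index → Index → Set where
    vars : ∀ {f g j k} → var (item f) ≢ var (item g) → Apart (f , j) (g , k)
    powers : ∀ {f j k} → j ≢ k → Apart (f , j) (f , k)

  Apart-sym : ∀ {x y} → Apart x y → Apart y x
  Apart-sym (vars p)   = vars (p ∘ ≡.sym)
  Apart-sym (powers p) = powers (p ∘ ≡.sym)

  w-* : ∀ {x y} → Apart x y → w x y * u x ≈ u x + - u y
  w-* (vars {f} {g} {j} {k} p) = begin
    w (f , j) (g , k) * u (f , j)      ≈⟨ *-congʳ (choose-no (var (item f) ≟ var (item g)) p) ⟩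
    (1# + - (q ^ k * (qi ^ j * (xg * xfi)))) * (q ^ j * xf)
      ≈⟨ solve 6 (λ a b c xf xfi xg → (𝟙 ⊟ b ⊠ (c ⊠ (xg ⊠ xfi))) ⊠ (a ⊠ xf) := a ⊠ xf ⊟ (b ⊠ xg) ⊠ ((a ⊠ c) ⊠ (xf ⊠ xfi)))
           refl (q ^ j) (q ^ k) (qi ^ j) xf xfi xg ⟩
    q ^ j * xf + - (q ^ k * xg * ((q ^ j * qi ^ j) * (xf * xfi)))
      ≈⟨ +-congˡ (-‿cong (*-congˡ (trans (*-cong (q^*qi^ qi q*qi j) (X-inverse _)) (*-identityˡ 1#)))) ⟩
    q ^ j * xf + - (q ^ k * xg * 1#)   ≈⟨ +-congˡ (-‿cong (*-identityʳ _)) ⟩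
    u (f , j) + - u (g , k)            ∎
    where
    xf xfi xg : Carrier
    xf  = X (var (item f)) (+ 1)
    xfi = X (var (item f)) -[1+ 0 ]
    xg  = X (var (item g)) (+ 1)
  w-* (powers {f} {j} {k} p) = begin
    w (f , j) (f , k) * u (f , j)      ≈⟨ *-congʳ (choose-yes (var (item f) ≟ var (item f)) ≡.refl) ⟩
    wq j k * (q ^ j * xf)              ≈⟨ *-assoc _ _ _ ⟨
    wq j k * q ^ j * xf                ≈⟨ *-congʳ (wq-*-q p) ⟩
    (q ^ j + - (q ^ k)) * xf           ≈⟨ solve 3 (λ a b x → (a ⊟ b) ⊠ x := a ⊠ x ⊟ b ⊠ x) refl _ _ _ ⟩
    u (f , j) + - u (f , k)            ∎
    where
    xf : Carrier
    xf = X (var (item f)) (+ 1)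

  regular-u : ∀ {x y} → Apart x y → Regular (u x + - u y)
  regular-u (vars {f} {g} {j} {k} p) = regular-X {var (item f)} {var (item g)} {j} {k} p
  regular-u (powers {f} {j} {k} p) = Regular-resp
    (solve 3 (λ a b x → x ⊠ (a ⊟ b) := a ⊠ x ⊟ b ⊠ x) refl _ _ _)
    (Regular-* (regular-Xv (var (item f))) (regular-q p))

  w-refl : ∀ x → w x x ≈ 1#
  w-refl (f , j) = trans (choose-yes (var (item f) ≟ var (item f)) ≡.refl) (wq-refl j)

  open PartialFractions u w

  indicesAt : Focus (Item V) → List Index
  indicesAt f = map (f ,_) (upTo (size (item f)))

  indices : List (Item V) → List Index
  indices ds = concatMap indicesAt (foci ds)

  Distinct : List (Item V) → Set
  Distinct = AllPairs (λ d l → var d ≢ var l)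

  indices-separated : ∀ {ds} → Distinct ds → AllPairs Separated (indices ds)
  indices-separated {ds} dist = AllPairs.map (λ {x} {y} p → separated {x} {y} (w-* p) (w-* (Apart-sym p)) (regular-u p))
    (AllPairsₚ.concat⁺
      (Allₚ.map⁺ (All.universal (λ f → AllPairsₚ.map⁺ (AllPairs.map (powers {f}) (upTo⁺ (size (item f))))) (foci ds)))
      (AllPairsₚ.map⁺ (AllPairs.map
        (λ {f} {g} p → Allₚ.map⁺ (All.universal (λ j → Allₚ.map⁺ (All.universal (λ k → vars {f} {g} {j} {k} p) (upTo (size (item g))))) (upTo (size (item f)))))
        (AllPairsₚ.map⁻ (≡.subst (AllPairs _) (≡.sym (foci-item ds)) dist)))))

  letters-indices : ∀ ds → map u (indices ds) ≡ letters ds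
  letters-indices ds = ≡.trans (Listₚ.map-concatMap u indicesAt (foci ds))
    (≡.trans (Listₚ.concatMap-cong (λ f → ≡.sym (Listₚ.map-∘ (upTo (size (item f))))) (foci ds))
    (≡.trans (≡.sym (Listₚ.concatMap-map (λ d → map (letter d) (upTo (size d))) item (foci ds)))
      (≡.cong letters (foci-item ds))))

  ΠΔ : List (Item V) → Carrier
  ΠΔ ds = ∏ ds (Δ ∘ size)

  regular-ΠΔ : ∀ ds → Regular (ΠΔ ds)
  regular-ΠΔ ds = Regular-∏ ds (λ {d} _ → regular-Δ (size d))

  Const-ΠΔ : ∀ ds → Const (ΠΔ ds)
  Const-ΠΔ ds = Const-∏ ds (λ d → Const-Δ (size d))

  crossFactor : Item V → Item V → Carrier
  crossFactor d l = if mixed d l then - ratio d l else 1#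

  -- The product of kernel and clearing constants divided by all weights of the letter x_d q^j: what
  -- is left is the kernel of the other variables, one cofactor for each of them, and constants in
  -- q.
  residue : Index → Carrier
  residue (f , j) = (ΠΔ (rest f) * κ (size d) j) *
    (dysonKernel (rest f) * (∏ (before f) (cofactorBefore d j) * ∏ (after f) (λ l → crossFactor d l * cofactorAfter (mixed d l) d j l)))
    where d = item f

  -- An item l mixed with an earlier one must own a letter, since its factorial of length b_l - 1 is
  -- completed to one of length b_l. First-block items may have size 0, which happens for a_i = 1.
  record Admissible (ds : List (Item V)) : Set where
    field
      distinct : Distinct ds
      nonempty : ∀ {f} → f ∈ foci ds → ∀ {l} → l ∈ after f → mixed (item f) l ≡ true → 1 ℕ.≤ size l
  open Admissible public

  distinct-before : ∀ {xs d ys} → Distinct (xs ++ d ∷ ys) → All (λ l → var d ≢ var l) xs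
  distinct-before {[]}     ps       = []
  distinct-before {x ∷ xs} (p ∷ ps) = (All.lookup p (∈-++⁺ʳ xs (here ≡.refl)) ∘ ≡.sym) ∷ distinct-before ps

  distinct-after : ∀ xs {d ys} → Distinct (xs ++ d ∷ ys) → All (λ l → var d ≢ var l) ys
  distinct-after []       (p ∷ _)  = p
  distinct-after (x ∷ xs) (_ ∷ ps) = distinct-after xs ps

  ∏-weight-≢ : ∀ {d l} j → var d ≢ var l → ∏ (upTo (size l)) (weight d j l) ≈ pole d j l
  ∏-weight-≢ {d} {l} j p = trans (∏-cong (upTo (size l)) (λ _ → choose-no (var d ≟ var l) p)) (poch-∏ (size l) _)

  ∏-weight-refl : ∀ d j → ∏ (upTo (size d)) (weight d j d) ≈ δ (size d) j
  ∏-weight-refl d j = ∏-cong (upTo (size d)) (λ _ → choose-yes (var d ≟ var d) ≡.refl)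

  ∏-w : ∀ {ds f} → f ∈ foci ds → Distinct ds → ∀ j →
    ∏ (indices ds) (w (f , j)) ≈ ∏ (before f) (pole (item f) j) * (δ (size (item f)) j * ∏ (after f) (pole (item f) j))
  ∏-w {ds} {f} f∈ dist j = begin
    ∏ (indices ds) (w (f , j))                          ≈⟨ ∏-concatMap indicesAt (foci ds) ⟩
    ∏ (foci ds) (λ g → ∏ (indicesAt g) (w (f , j)))     ≈⟨ ∏-cong (foci ds) (λ {g} _ → ∏-map (g ,_) (upTo (size (item g)))) ⟩
    ∏ (foci ds) (W ∘ item)                              ≈⟨ ∏-map item (foci ds) ⟨
    ∏ (map item (foci ds)) W                            ≡⟨ ≡.cong (λ xs → ∏ xs W) (≡.trans (foci-item ds) (foci-split f∈)) ⟩
    ∏ (before f ++ d ∷ after f) W                       ≈⟨ ∏-++ (before f) (d ∷ after f) ⟩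
    ∏ (before f) W * (W d * ∏ (after f) W)
      ≈⟨ *-cong (∏-cong (before f) (λ {l} l∈ → ∏-weight-≢ {d} {l} j (All.lookup (distinct-before dist′) l∈)))
           (*-cong (∏-weight-refl d j) (∏-cong (after f) (λ {l} l∈ → ∏-weight-≢ {d} {l} j (All.lookup (distinct-after (before f) dist′) l∈)))) ⟩
    ∏ (before f) (pole d j) * (δ (size d) j * ∏ (after f) (pole d j)) ∎
    where
    d = item f
    dist′ = ≡.subst Distinct (foci-split f∈) dist
    W : Item V → Carrier
    W l = ∏ (upTo (size l)) (weight d j l)

  -- This is the divisibility hypothesis of `partialFractions`: for every letter, the kernel times
  -- the constants contains the product of all its weights, so no pole survives.
  residue-*-w : ∀ {ds} → Admissible ds → ∀ {x} → x ∈ indices ds → ΠΔ ds * dysonKernel ds ≈ residue x * ∏ (indices ds) (w x)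
  residue-*-w {ds} adm x∈ with ∈-concatMap⁻′ (foci ds) x∈
    where
    ∈-concatMap⁻′ : ∀ fs {x} → x ∈ concatMap indicesAt fs → Σ (Focus (Item V)) (λ f → Σ ℕ (λ j → (f ∈ fs) × (j ∈ upTo (size (item f))) × (x ≡ (f , j))))
    ∈-concatMap⁻′ (f ∷ fs) x∈ with ∈-++⁻ (indicesAt f) x∈
    ... | inj₁ y∈ with ∈-map⁻ (f ,_) y∈
    ...   | j , j∈ , ≡.refl = f , j , here ≡.refl , j∈ , ≡.refl
    ∈-concatMap⁻′ (f ∷ fs) x∈ | inj₂ y∈ with ∈-concatMap⁻′ fs y∈
    ...   | g , j , g∈ , j∈ , e = g , j , there g∈ , j∈ , e
  ... | f , j , f∈ , j∈ , ≡.refl = begin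
    ΠΔ ds * dysonKernel ds                                    ≡⟨ ≡.cong (λ ds → ΠΔ ds * dysonKernel ds) (foci-split f∈) ⟩
    ΠΔ (xs ++ d ∷ ys) * dysonKernel (xs ++ d ∷ ys)            ≈⟨ *-cong (∏-++ xs (d ∷ ys)) (kernel-focus xs d ys) ⟩
    (ΠΔ xs * (Δ (size d) * ΠΔ ys)) * (dysonKernel (xs ++ ys) * (∏ xs (λ l → pair l d) * ∏ ys (pair d)))
      ≈⟨ *-cong (*-congˡ (*-congʳ (κ*δ j∈))) (*-congˡ (*-cong
           (trans (∏-cong xs (λ {l} _ → pair-before {d} l (∈-upTo⁻ j∈))) (∏-* xs))
           (trans (∏-cong ys (λ {l} l∈ → pair-after {d} l (∈-upTo⁻ j∈) (mixed d l) (nonempty adm f∈ l∈))) (∏-* ys)))) ⟩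
    (ΠΔ xs * ((κ (size d) j * δ (size d) j) * ΠΔ ys)) * (dysonKernel (xs ++ ys) * ((px * cx) * (py * cy)))
      ≈⟨ solve 9 (λ a k e b K px cx py cy → (a ⊠ ((k ⊠ e) ⊠ b)) ⊠ (K ⊠ ((px ⊠ cx) ⊠ (py ⊠ cy)))
           := ((a ⊠ b) ⊠ k) ⊠ (K ⊠ (cx ⊠ cy)) ⊠ (px ⊠ (e ⊠ py))) refl _ _ _ _ _ _ _ _ _ ⟩
    ((ΠΔ xs * ΠΔ ys) * κ (size d) j) * (dysonKernel (xs ++ ys) * (cx * cy)) * (px * (δ (size d) j * py))
      ≈⟨ *-cong (*-congʳ (*-congʳ (sym (∏-++ xs ys)))) (sym (∏-w f∈ (distinct adm) j)) ⟩
    residue (f , j) * ∏ (indices ds) (w (f , j))         ∎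
    where
    xs = before f
    d  = item f
    ys = after f
    px py cx cy : Carrier
    px = ∏ xs (pole d j)
    py = ∏ ys (pole d j)
    cx = ∏ xs (cofactorBefore d j)
    cy = ∏ ys (λ l → crossFactor d l * cofactorAfter (mixed d l) d j l)

  splitting : ∀ {ds} → Admissible ds → ∀ r →
    (ΠΔ ds * dysonKernel ds) * h (suc r) (letters ds) ≈ ∑ (foci ds) (λ f → ∑ (upTo (size (item f))) (λ j → u (f , j) ^ suc r * residue (f , j)))
  splitting {ds} adm r = begin
    (ΠΔ ds * dysonKernel ds) * h (suc r) (letters ds)           ≡⟨ ≡.cong (λ Y → (ΠΔ ds * dysonKernel ds) * h (suc r) Y) (≡.sym (letters-indices ds)) ⟩
    (ΠΔ ds * dysonKernel ds) * h (suc r) (map u (indices ds))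
      ≈⟨ partialFractions w-refl (indices ds) (indices-separated (distinct adm)) _ residue (residue-*-w adm) r ⟩
    ∑ (indices ds) (λ x → u x ^ suc r * residue x)         ≈⟨ ∑-concatMap indicesAt (foci ds) ⟩
    ∑ (foci ds) (λ f → ∑ (indicesAt f) (λ x → u x ^ suc r * residue x))
      ≈⟨ ∑-cong (foci ds) (λ {f} _ → ∑-map (f ,_) (upTo (size (item f)))) ⟩
    ∑ (foci ds) (λ f → ∑ (upTo (size (item f))) (λ j → u (f , j) ^ suc r * residue (f , j))) ∎

  -- The power of x_i standing in front of a polynomial in x_i: r from u^r, one from each crossing,
  -- and -v_i from the monomial.
  excess : ℕ → Focus (Item V) → ℤ
  excess r f = + (r ℕ.+ crossings (item f) (after f)) ℤ.- expo (item f)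

  contribution : List ℕ → ℕ → Focus (Item V) → Carrier
  contribution lam r f = choose (excess r f ℤ.≟ + 0) (coefficient r f * 𝔇 (reduced f) lam) 0#

  module AtFocus (f : Focus (Item V)) (dist : Distinct (before f ++ item f ∷ after f)) (lam : List ℕ) (r : ℕ) where

    private
      d : Item V
      d = item f
      xs ys zs : List (Item V)
      xs = before f
      ys = after f
      zs = map (shift d) ys
      c : ℕ
      c = crossings d ys
      ds : List (Item V)
      ds = xs ++ d ∷ ys
      v : V
      v = var d

    open Evaluation v

    distinct-rest : All (λ l → v ≢ var l) (xs ++ ys)
    distinct-rest = Allₚ.++⁺ (distinct-before dist) (distinct-after xs dist)

    ↘-cofactorBefore : ∀ j {l} → v ≢ var l → cofactorBefore d j l ↘ (q ^ size l) ^ j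
    ↘-cofactorBefore j {l} p = ↘-resp refl (*-identityʳ _)
      (↘-* (↘-twist (size l) j Pos-ratio) (↘-poch ((size d ∸ χ l d) ∸ j) (Pos-* (NonNeg-^ (suc j) NonNeg-q) Pos-ratio)))
      where
      Pos-ratio : Pos v (ratio d l)
      Pos-ratio = Pos-resp (*-comm _ _) (Pos-* (NonNeg-X≢ p _) (Pos-X 0))

    ↘-cofactorAfter : ∀ m j {l} → v ≢ var l →
      cofactorAfter m d j l ↘ q ^ (if m then 0 else size l) * (q ^ size l) ^ j
    ↘-cofactorAfter m j {l} p = ↘-* (side m) (↘-resp refl (*-identityʳ _)
      (↘-* (↘-twist (size l) j Pos-ratio) (↘-poch (size d ∸ suc j) (Pos-* (NonNeg-^ (suc j) NonNeg-q) Pos-ratio))))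
      where
      Pos-ratio : Pos v (ratio d l)
      Pos-ratio = Pos-resp (*-comm _ _) (Pos-* (NonNeg-X≢ p _) (Pos-X 0))
      side : ∀ m → (if m then 1# else q ^ size l + - ratio d l) ↘ q ^ (if m then 0 else size l)
      side true  = ↘-refl NonNeg-1
      side false = ↘-q^- (size l) Pos-ratio

    ↘-letters : ∀ s → h s (letters ds) ↘ h s (letters (xs ++ ys))
    ↘-letters s = ↘-resp
      (reflexive (≡.cong (h s) (≡.sym (Listₚ.concatMap-++ _ xs (d ∷ ys)))))
      (reflexive (≡.cong (h s) (≡.sym (Listₚ.concatMap-++ _ xs ys))))
      (↘-h (NonNeg-letters (distinct-before dist))
        (Allₚ.map⁺ (All.universal (λ k → Pos-* (NonNeg-^ k NonNeg-q) (Pos-X 0)) (upTo (size d))))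
        (NonNeg-letters (distinct-after xs dist)) s)

    weights-before : ∀ j ls → ∏ ls (λ l → (q ^ size l) ^ j) ≈ (q ^ j) ^ sizes ls
    weights-before j []       = refl
    weights-before j (l ∷ ls) = trans (*-cong (^-swap (size l)) (weights-before j ls)) (sym (^-homo-* (q ^ j) (size l) (sizes ls)))
      where
      ^-swap : ∀ b → (q ^ b) ^ j ≈ (q ^ j) ^ b
      ^-swap b = trans (^-assocʳ q b j) (trans (reflexive (≡.cong (q ^_) (ℕₚ.*-comm b j))) (sym (^-assocʳ q j b)))

    weights-after : ∀ j ls → ∏ ls (λ l → q ^ (if mixed d l then 0 else size l) * (q ^ size l) ^ j) ≈ q ^ parallel d ls * (q ^ j) ^ sizes ls
    weights-after j ls = trans (∏-* ls) (*-cong (side ls) (weights-before j ls))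
      where
      side : ∀ ls → ∏ ls (λ l → q ^ (if mixed d l then 0 else size l)) ≈ q ^ parallel d ls
      side []       = refl
      side (l ∷ ls) = trans (*-congˡ (side ls)) (sym (^-homo-* q (if mixed d l then 0 else size l) (parallel d ls)))

    cofactors : ℕ → Carrier
    cofactors j = ∏ xs (cofactorBefore d j) * ∏ ys (λ l → cofactorAfter (mixed d l) d j l)

    B : ℕ
    B = sizes (xs ++ ys)

    limit : ℕ → Carrier
    limit j = q ^ parallel d ys * (q ^ j) ^ B

    -- At x_d = 0 every other item l gives q^{j b_l} through `twist`; one that stands behind d and
    -- is not mixed with it gives another q^{b_l}.
    ↘-cofactors : ∀ j → cofactors j ↘ limit j
    ↘-cofactors j = ↘-resp refl eq (↘-*
      (↘-∏ xs (λ {l} l∈ → ↘-cofactorBefore j {l} (All.lookup (distinct-before dist) l∈)))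
      (↘-∏ ys (λ {l} l∈ → ↘-cofactorAfter (mixed d l) j {l} (All.lookup (distinct-after xs dist) l∈))))
      where
      eq : ∏ xs (λ l → (q ^ size l) ^ j) * ∏ ys (λ l → q ^ (if mixed d l then 0 else size l) * (q ^ size l) ^ j) ≈ limit j
      eq = begin
        _ * _                                             ≈⟨ *-cong (weights-before j xs) (weights-after j ys) ⟩
        (q ^ j) ^ sizes xs * (q ^ parallel d ys * (q ^ j) ^ sizes ys)
          ≈⟨ solve 3 (λ a b c → a ⊠ (b ⊠ c) := b ⊠ (a ⊠ c)) refl _ _ _ ⟩
        q ^ parallel d ys * ((q ^ j) ^ sizes xs * (q ^ j) ^ sizes ys)
          ≈⟨ *-congˡ (^-homo-* (q ^ j) (sizes xs) (sizes ys)) ⟨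
        q ^ parallel d ys * (q ^ j) ^ (sizes xs ℕ.+ sizes ys)
          ≡⟨ ≡.cong (λ n → q ^ parallel d ys * (q ^ j) ^ n) (≡.sym (≡.trans (≡.cong sum (Listₚ.map-++ size xs ys)) (sum-++ (map size xs) (map size ys)))) ⟩
        limit j                                           ∎

    -- Each crossing factor -x_d/x_l is distributed to three places: its sign, its x_d, and its
    -- 1/x_l, which merges with the monomial of l as `shift` prescribes.
    monomial-after : ∀ (j : ℕ) ls →
      ∏ ls (λ l → crossFactor d l * cofactorAfter (mixed d l) d j l) * monomial ls
        ≈ ((- 1#) ^ crossings d ls * X v (+ crossings d ls)) * (monomial (map (shift d) ls) * ∏ ls (λ l → cofactorAfter (mixed d l) d j l))
    monomial-after j [] = sym (trans (*-cong (trans (*-identityˡ _) (X-0 v)) (*-identityˡ _)) refl)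
    monomial-after j (l ∷ ls) = begin
      ((crossFactor d l * g) * P) * (X (var l) (ℤ.- expo l) * monomial ls)
        ≈⟨ solve 5 (λ s g P x m → ((s ⊠ g) ⊠ P) ⊠ (x ⊠ m) := (s ⊠ x) ⊠ g ⊠ (P ⊠ m)) refl _ _ _ _ _ ⟩
      (crossFactor d l * X (var l) (ℤ.- expo l)) * g * (P * monomial ls)
        ≈⟨ *-cong (*-congʳ (cross (mixed d l))) (monomial-after j ls) ⟩
      ((s₁ * X v (+ k₁)) * X (var l) (ℤ.- (expo l ℤ.+ + k₁))) * g * ((s₂ * X v (+ k₂)) * (M * Q))
        ≈⟨ solve 8 (λ s₁ x₁ y g s₂ x₂ M Q → ((s₁ ⊠ x₁) ⊠ y) ⊠ g ⊠ ((s₂ ⊠ x₂) ⊠ (M ⊠ Q)) := ((s₁ ⊠ s₂) ⊠ (x₁ ⊠ x₂)) ⊠ ((y ⊠ M) ⊠ (g ⊠ Q)))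
             refl _ _ _ _ _ _ _ _ ⟩
      ((s₁ * s₂) * (X v (+ k₁) * X v (+ k₂))) * ((X (var l) (ℤ.- (expo l ℤ.+ + k₁)) * M) * (g * Q))
        ≈⟨ *-congʳ (*-cong (^-homo-* (- 1#) k₁ k₂) (X-+ v (+ k₁) (+ k₂))) ⟨
      ((- 1#) ^ (k₁ ℕ.+ k₂) * X v (+ (k₁ ℕ.+ k₂))) * ((X (var l) (ℤ.- (expo l ℤ.+ + k₁)) * M) * (g * Q)) ∎
      where
      k₁ k₂ : ℕ
      k₁ = χ d l
      k₂ = crossings d ls
      s₁ s₂ g P M Q : Carrier
      s₁ = (- 1#) ^ k₁
      s₂ = (- 1#) ^ k₂
      g = cofactorAfter (mixed d l) d j l
      P = ∏ ls (λ l → crossFactor d l * cofactorAfter (mixed d l) d j l)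
      M = monomial (map (shift d) ls)
      Q = ∏ ls (λ l → cofactorAfter (mixed d l) d j l)
      cross : ∀ m → (if m then - ratio d l else 1#) * X (var l) (ℤ.- expo l)
        ≈ ((- 1#) ^ (if m then 1 else 0) * X v (+ (if m then 1 else 0))) * X (var l) (ℤ.- (expo l ℤ.+ + (if m then 1 else 0)))
      cross true = begin
        - (X v (+ 1) * X (var l) -[1+ 0 ]) * X (var l) (ℤ.- expo l)
          ≈⟨ solve 3 (λ a b c → (⊖ (a ⊠ b)) ⊠ c := (((⊖ 𝟙) ⊠ 𝟙) ⊠ a) ⊠ (c ⊠ b)) refl _ _ _ ⟩
        (((- 1#) * 1#) * X v (+ 1)) * (X (var l) (ℤ.- expo l) * X (var l) -[1+ 0 ])
          ≈⟨ *-congˡ (X-+ (var l) _ _) ⟨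
        (((- 1#) * 1#) * X v (+ 1)) * X (var l) (ℤ.- expo l ℤ.+ -[1+ 0 ])
          ≡⟨ ≡.cong (λ z → (((- 1#) * 1#) * X v (+ 1)) * X (var l) z) (≡.sym (ℤₚ.neg-distrib-+ (expo l) (+ 1))) ⟩
        (((- 1#) * 1#) * X v (+ 1)) * X (var l) (ℤ.- (expo l ℤ.+ + 1)) ∎
      cross false = *-cong (sym (trans (*-identityˡ _) (X-0 v))) (reflexive (≡.cong (λ z → X (var l) (ℤ.- z)) (≡.sym (ℤₚ.+-identityʳ (expo l)))))

    constant : ℕ → Carrier
    constant j = ((ΠΔ (xs ++ ys) * κ (size d) j) * (q ^ j) ^ suc r) * (- 1#) ^ c

    Const-constant : ∀ j → Const (constant j)
    Const-constant j = Const-* (Const-* (Const-* (Const-ΠΔ (xs ++ ys)) (Const-κ (size d) j)) (Const-^ (suc r) (Const-^ j Const-q)))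
      (Const-^ c (Const-neg Const-1))

    Const-limit : ∀ j → Const (limit j)
    Const-limit j = Const-* (Const-^ (parallel d ys) Const-q) (Const-^ B (Const-^ j Const-q))

    balance : ℤ
    balance = excess (suc r) f

    environment : Carrier
    environment = (monomial xs * monomial zs) * dysonKernel (xs ++ ys)

    NonNeg-environment : NonNeg v environment
    NonNeg-environment = NonNeg-* (NonNeg-* (NonNeg-monomial (distinct-before dist))
      (NonNeg-∏ zs λ l∈ → nn l∈)) (NonNeg-kernel distinct-rest)
      where
      nn : ∀ {l} → l ∈ zs → NonNeg v (X (var l) (ℤ.- expo l))
      nn l∈ with ∈-map⁻ (shift d) l∈
      ... | l′ , l′∈ , ≡.refl = NonNeg-X≢ (All.lookup (distinct-after xs dist) l′∈) _

    ↘-hh : hh lam (letters ds) ↘ hh lam (letters (xs ++ ys))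
    ↘-hh = ↘-∏ lam (λ {s} _ → ↘-letters s)

    term : ℕ → Carrier
    term j = (monomial ds * hh lam (letters ds)) * (u (f , j) ^ suc r * residue (f , j))

    -- Everything that could be a negative power of x_v is gathered in `X v balance`; the
    -- environment, the symmetric functions and the cofactors are polynomials in x_v.
    term-factor : ∀ j → term j ≈ constant j * (X v balance * (environment * (hh lam (letters ds) * cofactors j)))
    term-factor j = begin
      (monomial ds * H) * (u (f , j) ^ suc r * ((C * κj) * (K * (cb * cy))))
        ≈⟨ *-cong (*-congʳ (∏-++ xs (d ∷ ys))) (*-congʳ (^-distrib-* (q ^ j) (X v (+ 1)) (suc r))) ⟩
      ((monomial xs * (X v (ℤ.- expo d) * monomial ys)) * H) * (((q ^ j) ^ suc r * X v (+ 1) ^ suc r) * ((C * κj) * (K * (cb * cy))))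
        ≈⟨ *-congˡ (*-congʳ (*-congˡ (X-^ v (suc r)))) ⟩
      ((monomial xs * (X v (ℤ.- expo d) * monomial ys)) * H) * (((q ^ j) ^ suc r * X v (+ suc r)) * ((C * κj) * (K * (cb * cy))))
        ≈⟨ solve 11 (λ mx xd my H Q xr C κj K cb cy → ((mx ⊠ (xd ⊠ my)) ⊠ H) ⊠ ((Q ⊠ xr) ⊠ ((C ⊠ κj) ⊠ (K ⊠ (cb ⊠ cy))))
              := (C ⊠ κj ⊠ Q) ⊠ (xr ⊠ xd ⊠ mx ⊠ K ⊠ H ⊠ cb) ⊠ (cy ⊠ my)) refl _ _ _ _ _ _ _ _ _ _ _ ⟩
      (C * κj * (q ^ j) ^ suc r) * (X v (+ suc r) * X v (ℤ.- expo d) * monomial xs * K * H * cb) * (cy * monomial ys)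
        ≈⟨ *-congˡ (monomial-after j ys) ⟩
      (C * κj * (q ^ j) ^ suc r) * (X v (+ suc r) * X v (ℤ.- expo d) * monomial xs * K * H * cb) * (((- 1#) ^ c * X v (+ c)) * (monomial zs * ca))
        ≈⟨ solve 11 (λ A xr xd mx K H cb s xc mz ca → A ⊠ (xr ⊠ xd ⊠ mx ⊠ K ⊠ H ⊠ cb) ⊠ ((s ⊠ xc) ⊠ (mz ⊠ ca))
              := (A ⊠ s) ⊠ (((xr ⊠ xc) ⊠ xd) ⊠ (((mx ⊠ mz) ⊠ K) ⊠ (H ⊠ (cb ⊠ ca))))) refl _ _ _ _ _ _ _ _ _ _ _ ⟩
      constant j * (((X v (+ suc r) * X v (+ c)) * X v (ℤ.- expo d)) * (environment * (H * cofactors j)))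
        ≈⟨ *-congˡ (*-congʳ (trans (X-+ v _ _) (*-congʳ (X-+ v (+ suc r) (+ c))))) ⟨
      constant j * (X v balance * (environment * (H * cofactors j))) ∎
      where
      H C κj K cb cy ca : Carrier
      H = hh lam (letters ds)
      C = ΠΔ (xs ++ ys)
      κj = κ (size d) j
      K = dysonKernel (xs ++ ys)
      cb = ∏ xs (cofactorBefore d j)
      cy = ∏ ys (λ l → crossFactor d l * cofactorAfter (mixed d l) d j l)
      ca = ∏ ys (λ l → cofactorAfter (mixed d l) d j l)

    ct-term-vanish : ∀ j n → balance ≡ + suc n → ct (term j) ≈ 0#
    ct-term-vanish j n e = begin
      ct (term j)                     ≈⟨ ct-cong (term-factor j) ⟩
      ct (constant j * (X v balance * T)) ≈⟨ ct-* (Const-constant j) _ ⟩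
      constant j * ct (X v balance * T)   ≡⟨ ≡.cong (λ z → constant j * ct (X v z * T)) e ⟩
      constant j * ct (X v (+ suc n) * T) ≈⟨ *-congˡ (ct-Pos (Pos-resp (*-comm _ _) (Pos-*
        (NonNeg-* NonNeg-environment (NonNeg-* (nonNegˡ ↘-hh) (nonNegˡ (↘-cofactors j)))) (Pos-X n)))) ⟩
      constant j * 0#                 ≈⟨ zeroʳ _ ⟩
      0#                              ∎
      where
      T : Carrier
      T = environment * (hh lam (letters ds) * cofactors j)

    ct-term-survive : ∀ j → balance ≡ + 0 → ct (term j) ≈ (constant j * limit j) * 𝔇 (reduced f) lam
    ct-term-survive j e = begin
      ct (term j)                                  ≈⟨ ct-cong (term-factor j) ⟩
      ct (constant j * (X v balance * (environment * (H * cofactors j)))) ≈⟨ ct-* (Const-constant j) _ ⟩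
      constant j * ct (X v balance * (environment * (H * cofactors j)))
        ≡⟨ ≡.cong (λ z → constant j * ct (X v z * (environment * (H * cofactors j)))) e ⟩
      constant j * ct (X v (+ 0) * (environment * (H * cofactors j)))
        ≈⟨ *-congˡ (ct-cong (trans (*-congʳ (X-0 v)) (*-identityˡ _))) ⟩
      constant j * ct (environment * (H * cofactors j))
        ≈⟨ *-congˡ (ct-↘ NonNeg-environment (↘-* ↘-hh (↘-cofactors j))) ⟩
      constant j * ct (environment * (hh lam (letters (xs ++ ys)) * limit j))
        ≈⟨ *-congˡ (ct-cong (trans (solve 5 (λ m z K H l → ((m ⊠ z) ⊠ K) ⊠ (H ⊠ l) := l ⊠ ((m ⊠ z) ⊠ (H ⊠ K))) refl _ _ _ _ _)
             (*-congˡ (*-cong (sym (∏-++ xs zs)) (*-cong (reflexive (≡.cong (hh lam) (≡.sym (letters-shift d xs ys)))) (kernel-shift d xs ys)))))) ⟩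
      constant j * ct (limit j * (monomial (xs ++ zs) * (hh lam (letters (xs ++ zs)) * dysonKernel (xs ++ zs))))
        ≈⟨ *-congˡ (ct-* (Const-limit j) _) ⟩
      constant j * (limit j * 𝔇 (reduced f) lam)   ≈⟨ *-assoc _ _ _ ⟨
      (constant j * limit j) * 𝔇 (reduced f) lam   ∎
      where
      H : Carrier
      H = hh lam (letters ds)

    ∑-constants : ∑ (upTo (size d)) (λ j → constant j * limit j) ≈ ΠΔ ds * coefficient (suc r) f
    ∑-constants = begin
      ∑ (upTo (size d)) (λ j → constant j * limit j)
        -- The exponents of q^j add up to N: `suc r` from the power of the letter and `B` from the
        -- cofactors at x_v = 0.
        ≈⟨ ∑-cong (upTo (size d)) (λ {j} _ → trans
             (solve 6 (λ C k a s p b → (((C ⊠ k) ⊠ a) ⊠ s) ⊠ (p ⊠ b) := (C ⊠ (s ⊠ p)) ⊠ ((a ⊠ b) ⊠ k)) refl _ _ _ _ _ _)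
             (*-congˡ (*-congʳ (sym (^-homo-* (q ^ j) (suc r) B))))) ⟩
      ∑ (upTo (size d)) (λ j → (C * (s * p)) * ((q ^ j) ^ (suc r ℕ.+ B) * κ (size d) j)) ≈⟨ *-∑ _ (upTo (size d)) ⟨
      (C * (s * p)) * ∑ (upTo (size d)) (λ j → (q ^ j) ^ (suc r ℕ.+ B) * κ (size d) j)  ≈⟨ *-congˡ (∑-κ (size d) (r ℕ.+ B)) ⟨
      (C * (s * p)) * (Δ (size d) * G)             ≈⟨ *-congʳ (*-congʳ (∏-++ xs ys)) ⟩
      ((ΠΔ xs * ΠΔ ys) * (s * p)) * (Δ (size d) * G)
        ≈⟨ solve 6 (λ a b s p e G → ((a ⊠ b) ⊠ (s ⊠ p)) ⊠ (e ⊠ G) := (a ⊠ (e ⊠ b)) ⊠ (s ⊠ p ⊠ G)) refl _ _ _ _ _ _ ⟩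
      (ΠΔ xs * (Δ (size d) * ΠΔ ys)) * (s * p * G) ≈⟨ *-congʳ (∏-++ xs (d ∷ ys)) ⟨
      ΠΔ ds * coefficient (suc r) f                ∎
      where
      C s p G : Carrier
      C = ΠΔ (xs ++ ys)
      s = (- 1#) ^ c
      p = q ^ parallel d ys
      G = h (suc r ℕ.+ B) (geometric (size d))

    ∑-ct-term : expo d ℤ.≤ + (suc r ℕ.+ c) → ∑ (upTo (size d)) (ct ∘ term) ≈ ΠΔ ds * contribution lam (suc r) f
    -- The last scrutinee says that the balance is nonnegative; a negative balance therefore needs
    -- no clause.
    ∑-ct-term le with balance in eq | balance ℤ.≟ + 0 | ℤₚ.i≤j⇒0≤j-i le
    ... | _ | yes e | _ = begin
      ∑ (upTo (size d)) (ct ∘ term)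
        ≈⟨ ∑-cong (upTo (size d)) (λ {j} _ → trans (ct-term-survive j (≡.trans eq e)) (*-comm _ _)) ⟩
      ∑ (upTo (size d)) (λ j → 𝔇 (reduced f) lam * (constant j * limit j))   ≈⟨ *-∑ _ (upTo (size d)) ⟨
      𝔇 (reduced f) lam * ∑ (upTo (size d)) (λ j → constant j * limit j)     ≈⟨ *-congˡ ∑-constants ⟩
      𝔇 (reduced f) lam * (ΠΔ ds * coefficient (suc r) f)
        ≈⟨ solve 3 (λ D a b → D ⊠ (a ⊠ b) := a ⊠ (b ⊠ D)) refl _ _ _ ⟩
      ΠΔ ds * (coefficient (suc r) f * 𝔇 (reduced f) lam)                    ∎
    ... | + zero  | no ne | _ = contradiction ≡.refl ne
    ... | + suc n | no ne | _ = trans (∑-0 (upTo (size d)) (λ {j} _ → ct-term-vanish j n eq)) (sym (zeroʳ _))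

  ct-0 : ct 0# ≈ 0#
  ct-0 = begin
    ct 0#                          ≈⟨ solve 1 (λ a → a := (a ⊞ a) ⊟ a) refl (ct 0#) ⟩
    (ct 0# + ct 0#) + - ct 0#      ≈⟨ +-congʳ (ct-+ 0# 0#) ⟨
    ct (0# + 0#) + - ct 0#         ≈⟨ +-congʳ (ct-cong (+-identityˡ 0#)) ⟩
    ct 0# + - ct 0#                ≈⟨ -‿inverseʳ _ ⟩
    0#                             ∎

  ct-∑ : {A : Set} (xs : List A) {g : A → Carrier} → ct (∑ xs g) ≈ ∑ xs (ct ∘ g)
  ct-∑ []       = ct-0
  ct-∑ (x ∷ xs) = trans (ct-+ _ _) (+-congˡ (ct-∑ xs))

  -- The bound excludes a pole at x_i = 0 in every summand: a summand either has a positive power of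
  -- x_i in front and dies, or has balance 0 and may be evaluated at x_i = 0. The constants `ΠΔ ds`,
  -- common to both sides, are cancelled last.
  𝔇-step : ∀ {ds} → Admissible ds → ∀ lam r →
    (∀ {f} → f ∈ foci ds → expo (item f) ℤ.≤ + (suc r ℕ.+ crossings (item f) (after f))) →
    𝔇 ds (suc r ∷ lam) ≈ ∑ (foci ds) (contribution lam (suc r))
  𝔇-step {ds} adm lam r bound = cancel (regular-ΠΔ ds) (begin
    ΠΔ ds * ct (monomial ds * ((h (suc r) Y * hh lam Y) * dysonKernel ds))
      ≈⟨ ct-* (Const-ΠΔ ds) _ ⟨
    ct (ΠΔ ds * (monomial ds * ((h (suc r) Y * hh lam Y) * dysonKernel ds)))
      ≈⟨ ct-cong (solve 5 (λ P m h H K → P ⊠ (m ⊠ ((h ⊠ H) ⊠ K)) := (m ⊠ H) ⊠ ((P ⊠ K) ⊠ h)) refl _ _ _ _ _) ⟩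
    ct ((monomial ds * hh lam Y) * ((ΠΔ ds * dysonKernel ds) * h (suc r) Y))
      ≈⟨ ct-cong (trans (*-congˡ (splitting adm r)) (*-∑ _ (foci ds))) ⟩
    ct (∑ (foci ds) (λ f → (monomial ds * hh lam Y) * ∑ (upTo (size (item f))) (λ j → u (f , j) ^ suc r * residue (f , j))))
      ≈⟨ ct-∑ (foci ds) ⟩
    ∑ (foci ds) (λ f → ct ((monomial ds * hh lam Y) * ∑ (upTo (size (item f))) (λ j → u (f , j) ^ suc r * residue (f , j))))
      ≈⟨ ∑-cong (foci ds) (λ {f} f∈ → trans (ct-cong (*-∑ _ (upTo (size (item f))))) (trans (ct-∑ (upTo (size (item f)))) (local f f∈))) ⟩
    ∑ (foci ds) (λ f → ΠΔ ds * contribution lam (suc r) f)      ≈⟨ *-∑ _ (foci ds) ⟨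
    ΠΔ ds * ∑ (foci ds) (contribution lam (suc r))              ∎)
    where
    Y = letters ds
    local : ∀ f → f ∈ foci ds →
      ∑ (upTo (size (item f))) (λ j → ct ((monomial ds * hh lam Y) * (u (f , j) ^ suc r * residue (f , j)))) ≈ ΠΔ ds * contribution lam (suc r) f
    local f f∈ = ≡.subst
      (λ ds → ∑ (upTo (size (item f))) (λ j → ct ((monomial ds * hh lam (letters ds)) * (u (f , j) ^ suc r * residue (f , j)))) ≈ ΠΔ ds * contribution lam (suc r) f)
      (≡.sym (foci-split f∈)) (AtFocus.∑-ct-term f (≡.subst Distinct (foci-split f∈) (distinct adm)) lam r (bound f∈))

-- The total ring of fractions

module TotalFractions (R : CommutativeRing 0ℓ 0ℓ) where
  open RingLemmas R
  open ≈R

  -- Denominators are regular, not merely nonzero: transitivity cancels the middle denominator, and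
  -- products of regular elements stay regular without the ring being a domain.
  record Fraction : Set where
    constructor mkFraction
    field
      num     : Carrier
      den     : Carrier
      regular : Regular den
  open Fraction

  infix 4 _≃_
  -- A record rather than a synonym for the equation, so that both fractions can be inferred from
  -- the type of a proof.
  record _≃_ (x y : Fraction) : Set where
    constructor cross
    field
      uncross : num x * den y ≈ num y * den x
  open _≃_

  ≃-trans : ∀ {x y z} → x ≃ y → y ≃ z → x ≃ z
  ≃-trans {mkFraction a b _} {mkFraction c d r} {mkFraction e f _} (cross p) (cross p′) = cross (cancel r (begin
    d * (a * f)  ≈⟨ solve 3 (λ d a f → d ⊠ (a ⊠ f) := (a ⊠ d) ⊠ f) refl d a f ⟩
    (a * d) * f  ≈⟨ *-congʳ p ⟩
    (c * b) * f  ≈⟨ solve 3 (λ c b f → (c ⊠ b) ⊠ f := (c ⊠ f) ⊠ b) refl c b f ⟩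
    (c * f) * b  ≈⟨ *-congʳ p′ ⟩
    (e * d) * b  ≈⟨ solve 3 (λ e d b → (e ⊠ d) ⊠ b := d ⊠ (e ⊠ b)) refl e d b ⟩
    d * (e * b)  ∎))

  infixl 6 _⊹_
  infixl 7 _⋆_
  _⊹_ _⋆_ : Fraction → Fraction → Fraction
  mkFraction a b r ⊹ mkFraction c d s = mkFraction (a * d + c * b) (b * d) (Regular-* r s)
  mkFraction a b r ⋆ mkFraction c d s = mkFraction (a * c) (b * d) (Regular-* r s)

  ∼_ : Fraction → Fraction
  ∼ mkFraction a b r = mkFraction (- a) b r

  embed : Carrier → Fraction
  embed a = mkFraction a 1# Regular-1

  ⊹-cong : ∀ {x x′ y y′} → x ≃ x′ → y ≃ y′ → x ⊹ y ≃ x′ ⊹ y′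
  ⊹-cong {mkFraction a b _} {mkFraction a′ b′ _} {mkFraction c d _} {mkFraction c′ d′ _} (cross p) (cross p′) = cross (begin
    (a * d + c * b) * (b′ * d′)
      ≈⟨ solve 6 (λ a b b′ c d d′ → (a ⊠ d ⊞ c ⊠ b) ⊠ (b′ ⊠ d′) := (a ⊠ b′) ⊠ (d ⊠ d′) ⊞ (c ⊠ d′) ⊠ (b ⊠ b′)) refl a b b′ c d d′ ⟩
    (a * b′) * (d * d′) + (c * d′) * (b * b′)       ≈⟨ +-cong (*-congʳ p) (*-congʳ p′) ⟩
    (a′ * b) * (d * d′) + (c′ * d) * (b * b′)
      ≈⟨ solve 6 (λ a′ b b′ c′ d d′ → (a′ ⊠ b) ⊠ (d ⊠ d′) ⊞ (c′ ⊠ d) ⊠ (b ⊠ b′) := (a′ ⊠ d′ ⊞ c′ ⊠ b′) ⊠ (b ⊠ d)) refl a′ b b′ c′ d d′ ⟩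
    (a′ * d′ + c′ * b′) * (b * d)                   ∎)

  ⋆-cong : ∀ {x x′ y y′} → x ≃ x′ → y ≃ y′ → x ⋆ y ≃ x′ ⋆ y′
  ⋆-cong {mkFraction a b _} {mkFraction a′ b′ _} {mkFraction c d _} {mkFraction c′ d′ _} (cross p) (cross p′) = cross (begin
    (a * c) * (b′ * d′)     ≈⟨ solve 4 (λ a c b′ d′ → (a ⊠ c) ⊠ (b′ ⊠ d′) := (a ⊠ b′) ⊠ (c ⊠ d′)) refl a c b′ d′ ⟩
    (a * b′) * (c * d′)     ≈⟨ *-cong p p′ ⟩
    (a′ * b) * (c′ * d)     ≈⟨ solve 4 (λ a b c d → (a ⊠ b) ⊠ (c ⊠ d) := (a ⊠ c) ⊠ (b ⊠ d)) refl a′ b c′ d ⟩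
    (a′ * c′) * (b * d)     ∎)

  ∼-cong : ∀ {x x′} → x ≃ x′ → ∼ x ≃ ∼ x′
  ∼-cong {mkFraction a b _} {mkFraction a′ b′ _} (cross p) =
    cross (trans (sym (-‿distribˡ-* a b′)) (trans (-‿cong p) (-‿distribˡ-* a′ b)))

  ⊹-assoc : ∀ x y z → (x ⊹ y) ⊹ z ≃ x ⊹ (y ⊹ z)
  ⊹-assoc (mkFraction a b _) (mkFraction c d _) (mkFraction e f _) = cross
    (solve 6 (λ a b c d e f → ((a ⊠ d ⊞ c ⊠ b) ⊠ f ⊞ e ⊠ (b ⊠ d)) ⊠ (b ⊠ (d ⊠ f))
      := (a ⊠ (d ⊠ f) ⊞ (c ⊠ f ⊞ e ⊠ d) ⊠ b) ⊠ ((b ⊠ d) ⊠ f)) refl a b c d e f)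

  ⊹-comm : ∀ x y → x ⊹ y ≃ y ⊹ x
  ⊹-comm (mkFraction a b _) (mkFraction c d _) = cross
    (solve 4 (λ a b c d → (a ⊠ d ⊞ c ⊠ b) ⊠ (d ⊠ b) := (c ⊠ b ⊞ a ⊠ d) ⊠ (b ⊠ d)) refl a b c d)

  ⊹-identityˡ : ∀ x → embed 0# ⊹ x ≃ x
  ⊹-identityˡ (mkFraction a b _) = cross
    (solve 2 (λ a b → (con (+ 0) ⊠ b ⊞ a ⊠ 𝟙) ⊠ b := a ⊠ (𝟙 ⊠ b)) refl a b)

  ⊹-inverseˡ : ∀ x → ∼ x ⊹ x ≃ embed 0#
  ⊹-inverseˡ (mkFraction a b _) = cross
    (solve 2 (λ a b → ((⊖ a) ⊠ b ⊞ a ⊠ b) ⊠ 𝟙 := con (+ 0) ⊠ (b ⊠ b)) refl a b)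

  ⋆-assoc : ∀ x y z → (x ⋆ y) ⋆ z ≃ x ⋆ (y ⋆ z)
  ⋆-assoc (mkFraction a b _) (mkFraction c d _) (mkFraction e f _) = cross
    (solve 6 (λ a b c d e f → ((a ⊠ c) ⊠ e) ⊠ (b ⊠ (d ⊠ f)) := (a ⊠ (c ⊠ e)) ⊠ ((b ⊠ d) ⊠ f)) refl a b c d e f)

  ⋆-comm : ∀ x y → x ⋆ y ≃ y ⋆ x
  ⋆-comm (mkFraction a b _) (mkFraction c d _) = cross
    (solve 4 (λ a b c d → (a ⊠ c) ⊠ (d ⊠ b) := (c ⊠ a) ⊠ (b ⊠ d)) refl a b c d)

  ⋆-identityˡ : ∀ x → embed 1# ⋆ x ≃ x
  ⋆-identityˡ (mkFraction a b _) = cross (solve 2 (λ a b → (𝟙 ⊠ a) ⊠ b := a ⊠ (𝟙 ⊠ b)) refl a b)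

  ⋆-distribˡ : ∀ x y z → x ⋆ (y ⊹ z) ≃ x ⋆ y ⊹ x ⋆ z
  ⋆-distribˡ (mkFraction a b _) (mkFraction c d _) (mkFraction e f _) = cross
    (solve 6 (λ a b c d e f → (a ⊠ (c ⊠ f ⊞ e ⊠ d)) ⊠ ((b ⊠ d) ⊠ (b ⊠ f))
      := ((a ⊠ c) ⊠ (b ⊠ f) ⊞ (a ⊠ e) ⊠ (b ⊠ d)) ⊠ (b ⊠ (d ⊠ f))) refl a b c d e f)

  fractionRing : CommutativeRing 0ℓ 0ℓ
  fractionRing = record
    { Carrier = Fraction ; _≈_ = _≃_ ; _+_ = _⊹_ ; _*_ = _⋆_ ; -_ = ∼_ ; 0# = embed 0# ; 1# = embed 1#
    ; isCommutativeRing = record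
      { isRing = record
        { +-isAbelianGroup = record
          { isGroup = record
            { isMonoid = record
              { isSemigroup = record
                { isMagma = record
                  { isEquivalence = record { refl = cross refl ; sym = λ p → cross (sym (uncross p)) ; trans = ≃-trans }
                  ; ∙-cong = ⊹-cong }
                ; assoc = ⊹-assoc }
              ; identity = ⊹-identityˡ , λ x → ≃-trans {y = embed 0# ⊹ x} (⊹-comm x (embed 0#)) (⊹-identityˡ x) }
            ; inverse = ⊹-inverseˡ , λ x → ≃-trans {y = (∼ x) ⊹ x} (⊹-comm x (∼ x)) (⊹-inverseˡ x)
            ; ⁻¹-cong = ∼-cong }
          ; comm = ⊹-comm }
        ; *-cong = ⋆-cong
        ; *-assoc = ⋆-assoc
        ; *-identity = ⋆-identityˡ , λ x → ≃-trans {y = embed 1# ⋆ x} (⋆-comm x (embed 1#)) (⋆-identityˡ x)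
        ; distrib = ⋆-distribˡ , λ x y z → ≃-trans (⋆-comm (y ⊹ z) x) (≃-trans (⋆-distribˡ x y z) (⊹-cong (⋆-comm x y) (⋆-comm x z))) }
      ; *-comm = ⋆-comm } }

  embed-cong : ∀ {a b} → a ≈ b → embed a ≃ embed b
  embed-cong p = cross (*-congʳ p)

  embed-injective : ∀ {a b} → embed a ≃ embed b → a ≈ b
  embed-injective (cross p) = trans (sym (*-identityʳ _)) (trans p (*-identityʳ _))

  embed-+ : ∀ a b → embed (a + b) ≃ embed a ⊹ embed b
  embed-+ a b = cross (solve 2 (λ a b → (a ⊞ b) ⊠ (𝟙 ⊠ 𝟙) := (a ⊠ 𝟙 ⊞ b ⊠ 𝟙) ⊠ 𝟙) refl a b)

  embed-* : ∀ a b → embed (a * b) ≃ embed a ⋆ embed b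
  embed-* a b = cross (solve 2 (λ a b → (a ⊠ b) ⊠ (𝟙 ⊠ 𝟙) := (a ⊠ b) ⊠ 𝟙) refl a b)

  reciprocal : ∀ a → Regular a → Fraction
  reciprocal a r = mkFraction 1# a r

  reciprocal-inverse : ∀ a (r : Regular a) → embed a ⋆ reciprocal a r ≃ embed 1#
  reciprocal-inverse a r = cross (solve 1 (λ a → (a ⊠ 𝟙) ⊠ 𝟙 := 𝟙 ⊠ (𝟙 ⊠ a)) refl a)

-- The later modules see fractions only through this interface, so their terms never unfold into
-- numerators and denominators.
record FractionExtension (R : CommutativeRing 0ℓ 0ℓ) : Set₁ where
  private module R = RingLemmas R
  field
    T : CommutativeRing 0ℓ 0ℓ
  private module T = RingLemmas T
  field
    embed              : R.Carrier → T.Carrier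
    embed-cong         : ∀ {a b} → a R.≈ b → embed a T.≈ embed b
    embed-injective    : ∀ {a b} → embed a T.≈ embed b → a R.≈ b
    embed-+            : ∀ a b → embed (a R.+ b) T.≈ embed a T.+ embed b
    embed-*            : ∀ a b → embed (a R.* b) T.≈ embed a T.* embed b
    embed-neg          : ∀ a → embed (R.- a) T.≈ T.- embed a
    embed-0            : embed R.0# T.≈ T.0#
    embed-1            : embed R.1# T.≈ T.1#
    reciprocal         : ∀ a → R.Regular a → T.Carrier
    reciprocal-inverse : ∀ a (r : R.Regular a) → embed a T.* reciprocal a r T.≈ T.1#

totalFractions : ∀ R → FractionExtension R
totalFractions R = record
  { T = fractionRing
  ; embed = embed
  ; embed-cong = embed-cong
  ; embed-injective = embed-injective
  ; embed-+ = embed-+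
  ; embed-* = embed-*
  ; embed-neg = λ _ → cross (RingLemmas.refl R)
  ; embed-0 = cross (RingLemmas.refl R)
  ; embed-1 = cross (RingLemmas.refl R)
  ; reciprocal = reciprocal
  ; reciprocal-inverse = reciprocal-inverse
  }
  where open TotalFractions R

-- Marked elements and signed sums over subsets

ℕ-x∙yz≡y∙xz : ∀ a b c → a ℕ.+ (b ℕ.+ c) ≡ b ℕ.+ (a ℕ.+ c)
ℕ-x∙yz≡y∙xz = x∙yz≈y∙xz
  where open Algebra.Properties.CommutativeSemigroup ℕₚ.+-commutativeSemigroup

module Marked {A : Set} (marked : A → Bool) (size : A → ℕ) where

  unmarked : List A → List A
  unmarked = filterᵇ (not ∘ marked)

  count : List A → ℕ
  count []       = 0
  count (x ∷ xs) = (if marked x then 1 else 0) ℕ.+ count xs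

  total : List A → ℕ
  total xs = sum (map size xs)

  total-++ : ∀ xs ys → total (xs ++ ys) ≡ total xs ℕ.+ total ys
  total-++ xs ys = ≡.trans (≡.cong sum (Listₚ.map-++ size xs ys)) (sum-++ (map size xs) (map size ys))

  total-focus : ∀ xs d ys → total (xs ++ d ∷ ys) ≡ size d ℕ.+ total (xs ++ ys)
  total-focus []       d ys = ≡.refl
  total-focus (x ∷ xs) d ys = ≡.trans (≡.cong (size x ℕ.+_) (total-focus xs d ys))
    (ℕ-x∙yz≡y∙xz (size x) (size d) (total (xs ++ ys)))

  count-focus : ∀ xs d ys → marked d ≡ true → count (xs ++ d ∷ ys) ≡ suc (count (xs ++ ys))
  count-focus []       d ys m rewrite m = ≡.refl
  count-focus (x ∷ xs) d ys m = ≡.trans (≡.cong (k ℕ.+_) (count-focus xs d ys m)) (ℕₚ.+-suc k _)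
    where k = if marked x then 1 else 0

  unmarked-focus : ∀ xs d ys → marked d ≡ true → unmarked (xs ++ d ∷ ys) ≡ unmarked (xs ++ ys)
  unmarked-focus []       d ys m rewrite m = ≡.refl
  unmarked-focus (x ∷ xs) d ys m with marked x
  ... | true  = unmarked-focus xs d ys m
  ... | false = ≡.cong (x ∷_) (unmarked-focus xs d ys m)

  unmarked-count0 : ∀ xs → count xs ≡ 0 → unmarked xs ≡ xs
  unmarked-count0 []       e = ≡.refl
  unmarked-count0 (x ∷ xs) e with marked x
  ... | false = ≡.cong (x ∷_) (unmarked-count0 xs e)

module SubsetSums (T : CommutativeRing 0ℓ 0ℓ) (q : CommutativeRing.Carrier T)
  {A : Set} (marked : A → Bool) (size : A → ℕ) where
  open RingLemmas T
  open CompleteSymmetric T using (_^_; ^-homo-*)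
  open Marked marked size
  open Focus
  open ≈R

  -- With S the set of marked elements, subsetSum 0 A f is the sum over J ⊆ S
  -- of (-1)^|S∖J| q^L f(a_J); n counts the marked elements already passed.
  subsetSum : ℕ → List A → (ℕ → Carrier) → Carrier
  subsetSum n []       f = f 0
  subsetSum n (d ∷ ds) f =
    if marked d then - (q ^ (suc n ℕ.* size d) * subsetSum (suc n) ds f) + subsetSum (suc n) ds (λ x → f (size d ℕ.+ x))
    else q ^ (n ℕ.* size d) * subsetSum n ds f

  subsetSum-cong : ∀ n ds {f g} → (∀ x → x ℕ.≤ total ds → f x ≈ g x) → subsetSum n ds f ≈ subsetSum n ds g
  subsetSum-cong n []       e = e 0 ℕ.z≤n
  subsetSum-cong n (d ∷ ds) e with marked d
  ... | true  = +-cong (-‿cong (*-congˡ (subsetSum-cong (suc n) ds (λ x x≤ → e x (ℕₚ.≤-trans x≤ (ℕₚ.m≤n+m _ (size d)))))))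
                  (subsetSum-cong (suc n) ds (λ x x≤ → e (size d ℕ.+ x) (ℕₚ.+-monoʳ-≤ (size d) x≤)))
  ... | false = *-congˡ (subsetSum-cong n ds (λ x x≤ → e x (ℕₚ.≤-trans x≤ (ℕₚ.m≤n+m _ (size d)))))

  subsetSum-+ : ∀ n ds {f g} → subsetSum n ds (λ x → f x + g x) ≈ subsetSum n ds f + subsetSum n ds g
  subsetSum-+ n []       = refl
  subsetSum-+ n (d ∷ ds) with marked d
  ... | true  = trans (+-cong (-‿cong (*-congˡ (subsetSum-+ (suc n) ds))) (subsetSum-+ (suc n) ds))
                  (solve 5 (λ k a b c d → (⊖ (k ⊠ (a ⊞ b))) ⊞ (c ⊞ d) := (⊖ (k ⊠ a) ⊞ c) ⊞ (⊖ (k ⊠ b) ⊞ d)) refl _ _ _ _ _)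
  ... | false = trans (*-congˡ (subsetSum-+ n ds)) (distribˡ _ _ _)

  subsetSum-* : ∀ c n ds {f} → subsetSum n ds (λ x → c * f x) ≈ c * subsetSum n ds f
  subsetSum-* c n []       = refl
  subsetSum-* c n (d ∷ ds) with marked d
  ... | true  = trans (+-cong (-‿cong (*-congˡ (subsetSum-* c (suc n) ds))) (subsetSum-* c (suc n) ds))
                  (solve 4 (λ k c a b → ⊖ (k ⊠ (c ⊠ a)) ⊞ c ⊠ b := c ⊠ (⊖ (k ⊠ a) ⊞ b)) refl _ _ _ _)
  ... | false = trans (*-congˡ (subsetSum-* c n ds)) (solve 3 (λ k c a → k ⊠ (c ⊠ a) := c ⊠ (k ⊠ a)) refl _ _ _)

  subsetSum-unmarked : ∀ ds {f} → count ds ≡ 0 → subsetSum 0 ds f ≈ f 0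
  subsetSum-unmarked []       e = refl
  subsetSum-unmarked (d ∷ ds) e with marked d
  ... | false = trans (*-identityˡ _) (subsetSum-unmarked ds e)

  -- Raising the count by one multiplies the term of J by q to the total size outside J, the
  -- inserted q^x supplies q^{a_J}, and the product is the same for all J.
  subsetSum-suc : ∀ n ds {f} → subsetSum (suc n) ds (λ x → q ^ x * f x) ≈ q ^ total ds * subsetSum n ds f
  subsetSum-suc n []       = refl
  subsetSum-suc n (d ∷ ds) {f} with marked d
  ... | true  = begin
    - (q ^ (b ℕ.+ suc n ℕ.* b) * subsetSum (2 ℕ.+ n) ds (λ x → q ^ x * f x)) + subsetSum (2 ℕ.+ n) ds (λ x → q ^ (b ℕ.+ x) * f (b ℕ.+ x))
      ≈⟨ +-cong (-‿cong (*-cong (^-homo-* q b (suc n ℕ.* b)) (subsetSum-suc (suc n) ds)))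
           (trans (subsetSum-cong (2 ℕ.+ n) ds (λ x _ → trans (*-congʳ (^-homo-* q b x))
              (solve 3 (λ a c y → (a ⊠ c) ⊠ y := c ⊠ (a ⊠ y)) refl _ _ _)))
             (trans (subsetSum-suc (suc n) ds) (*-congˡ (subsetSum-* (q ^ b) (suc n) ds)))) ⟩
    - ((q ^ b * q ^ (suc n ℕ.* b)) * (q ^ total ds * subsetSum (suc n) ds f)) + q ^ total ds * (q ^ b * subsetSum (suc n) ds (λ x → f (b ℕ.+ x)))
      ≈⟨ solve 5 (λ b k t s s′ → ⊖ ((b ⊠ k) ⊠ (t ⊠ s)) ⊞ t ⊠ (b ⊠ s′) := (b ⊠ t) ⊠ (⊖ (k ⊠ s) ⊞ s′)) refl _ _ _ _ _ ⟩
    (q ^ b * q ^ total ds) * (- (q ^ (suc n ℕ.* b) * subsetSum (suc n) ds f) + subsetSum (suc n) ds (λ x → f (b ℕ.+ x)))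
      ≈⟨ *-congʳ (^-homo-* q b (total ds)) ⟨
    q ^ (b ℕ.+ total ds) * (- (q ^ (suc n ℕ.* b) * subsetSum (suc n) ds f) + subsetSum (suc n) ds (λ x → f (b ℕ.+ x))) ∎
    where b = size d
  ... | false = begin
    q ^ (b ℕ.+ n ℕ.* b) * subsetSum (suc n) ds (λ x → q ^ x * f x)      ≈⟨ *-cong (^-homo-* q b (n ℕ.* b)) (subsetSum-suc n ds) ⟩
    (q ^ b * q ^ (n ℕ.* b)) * (q ^ total ds * subsetSum n ds f)
      ≈⟨ solve 4 (λ b k t s → (b ⊠ k) ⊠ (t ⊠ s) := (b ⊠ t) ⊠ (k ⊠ s)) refl _ _ _ _ ⟩
    (q ^ b * q ^ total ds) * (q ^ (n ℕ.* b) * subsetSum n ds f)         ≈⟨ *-congʳ (^-homo-* q b (total ds)) ⟨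
    q ^ (b ℕ.+ total ds) * (q ^ (n ℕ.* b) * subsetSum n ds f)           ∎
    where b = size d

  -- The first marked element may be moved in or out of J without changing
  -- the exponent, so the terms cancel in pairs.
  subsetSum-q^ : ∀ ds {n} → count ds ≡ suc n → subsetSum 0 ds (q ^_) ≈ 0#
  subsetSum-q^ (d ∷ ds) e with marked d
  ... | true  = begin
    - (q ^ (b ℕ.+ 0) * s) + subsetSum 1 ds (λ x → q ^ (b ℕ.+ x))
      ≈⟨ +-cong (-‿cong (*-congʳ (reflexive (≡.cong (q ^_) (ℕₚ.+-identityʳ b)))))
           (trans (subsetSum-cong 1 ds (λ x _ → ^-homo-* q b x)) (subsetSum-* (q ^ b) 1 ds)) ⟩
    - (q ^ b * s) + q ^ b * s                                         ≈⟨ -‿inverseˡ _ ⟩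
    0#                                                                ∎
    where
    b = size d
    s = subsetSum 1 ds (q ^_)
  ... | false = trans (*-identityˡ _) (subsetSum-q^ ds e)

  when : Bool → Carrier → Carrier
  when m c = if m then c else 0#

  when-cong : ∀ m {c c′} → (m ≡ true → c ≈ c′) → when m c ≈ when m c′
  when-cong true  e = e ≡.refl
  when-cong false e = refl

  when-+ : ∀ m {c c′} → when m (c + c′) ≈ when m c + when m c′
  when-+ true  = refl
  when-+ false = sym (+-identityˡ 0#)

  when-* : ∀ m c {c′} → when m (c * c′) ≈ c * when m c′
  when-* true  c = refl
  when-* false c = sym (zeroʳ c)

  -- The term in which `item f` is removed first: it joins J, and the other elements of J are chosen
  -- from `rest f`.
  removal : ℕ → (ℕ → Carrier) → Focus A → Carrier
  removal n g f = (q ^ total (after f) * (1# + - (q ^ size (item f)))) * subsetSum n (rest f) (λ x → g (size (item f) ℕ.+ x))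

  -- Fix J and let f run through its elements. Of q^{total (after f)}, the part outside J restores
  -- the exponent of J, which lost one count behind f. What remains, q^{later elements of J} (1 -
  -- q^{b_f}), telescopes over f to 1 - q^{a_J}.
  subsetSum-removal : ∀ n ds g →
    ∑ (foci ds) (λ f → when (marked (item f)) (removal n g f)) ≈ subsetSum n ds (λ x → (1# + - (q ^ x)) * g x)
  subsetSum-removal n []       g = sym (trans (*-congʳ (-‿inverseʳ 1#)) (zeroˡ _))
  subsetSum-removal n (d ∷ ds) g with marked d in eq
  ... | false = begin
    0# + ∑ (map (push d) (foci ds)) (λ f → when (marked (item f)) (removal n g f)) ≈⟨ +-identityˡ _ ⟩
    ∑ (map (push d) (foci ds)) (λ f → when (marked (item f)) (removal n g f))      ≈⟨ ∑-map (push d) (foci ds) ⟩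
    ∑ (foci ds) (λ f → when (marked (item f)) (removal n g (push d f)))
      ≈⟨ ∑-cong (foci ds) (λ {f} _ → trans (when-cong (marked (item f)) (λ _ → unfold f)) (when-* (marked (item f)) _)) ⟩
    ∑ (foci ds) (λ f → q ^ (n ℕ.* b) * when (marked (item f)) (removal n g f))     ≈⟨ *-∑ _ (foci ds) ⟨
    q ^ (n ℕ.* b) * ∑ (foci ds) (λ f → when (marked (item f)) (removal n g f))     ≈⟨ *-congˡ (subsetSum-removal n ds g) ⟩
    q ^ (n ℕ.* b) * subsetSum n ds (λ x → (1# + - (q ^ x)) * g x)                  ∎
    where
    b = size d
    unfold : ∀ f → removal n g (push d f) ≈ q ^ (n ℕ.* b) * removal n g f
    unfold f rewrite eq = solve 3 (λ c k s → c ⊠ (k ⊠ s) := k ⊠ (c ⊠ s)) refl _ _ _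
  ... | true = begin
    (q ^ total ds * (1# + - (q ^ b))) * subsetSum n ds g′ + ∑ (map (push d) (foci ds)) (λ f → when (marked (item f)) (removal n g f))
      ≈⟨ +-cong (solve 3 (λ t b s → (t ⊠ b) ⊠ s := b ⊠ (t ⊠ s)) refl _ _ _) (∑-map (push d) (foci ds)) ⟩
    (1# + - (q ^ b)) * (q ^ total ds * subsetSum n ds g′) + ∑ (foci ds) (λ f → when (marked (item f)) (removal n g (push d f)))
      -- The power q^{total ds} that comes with removing d is absorbed by counting d as already
      -- passed, so that all sums run over `ds` with the count `suc n`.
      ≈⟨ +-cong (trans (*-congˡ (sym (subsetSum-suc n ds))) (sym (subsetSum-* _ (suc n) ds)))
           (∑-cong (foci ds) (λ {f} _ → trans (when-cong (marked (item f)) (λ _ → unfold f))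
             (trans (when-+ (marked (item f))) (+-congʳ (when-* (marked (item f)) k))))) ⟩
    subsetSum (suc n) ds (λ x → (1# + - (q ^ b)) * (q ^ x * g′ x))
      + ∑ (foci ds) (λ f → k * when (marked (item f)) (removal (suc n) g f) + when (marked (item f)) (removal (suc n) g′ f))
      ≈⟨ +-congˡ (trans (∑-+ (foci ds)) (+-cong
           (trans (sym (*-∑ k (foci ds))) (*-congˡ (subsetSum-removal (suc n) ds g))) (subsetSum-removal (suc n) ds g′))) ⟩
    subsetSum (suc n) ds (λ x → (1# + - (q ^ b)) * (q ^ x * g′ x)) + (k * P + subsetSum (suc n) ds (λ x → (1# + - (q ^ x)) * g′ x))
      ≈⟨ solve 3 (λ a p c → a ⊞ (p ⊞ c) := p ⊞ (a ⊞ c)) refl _ _ _ ⟩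
    k * P + (subsetSum (suc n) ds (λ x → (1# + - (q ^ b)) * (q ^ x * g′ x)) + subsetSum (suc n) ds (λ x → (1# + - (q ^ x)) * g′ x))
      ≈⟨ +-cong (sym (-‿distribˡ-* _ P)) (trans (sym (subsetSum-+ (suc n) ds)) (subsetSum-cong (suc n) ds (λ x _ → combine x))) ⟩
    - (q ^ (suc n ℕ.* b) * P) + subsetSum (suc n) ds (λ x → (1# + - (q ^ (b ℕ.+ x))) * g (b ℕ.+ x)) ∎
    where
    b = size d
    g′ : ℕ → Carrier
    g′ x = g (b ℕ.+ x)
    k P : Carrier
    k = - (q ^ (suc n ℕ.* b))
    P = subsetSum (suc n) ds (λ x → (1# + - (q ^ x)) * g x)
    combine : ∀ x → (1# + - (q ^ b)) * (q ^ x * g′ x) + (1# + - (q ^ x)) * g′ x ≈ (1# + - (q ^ (b ℕ.+ x))) * g′ x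
    combine x = trans (solve 3 (λ b x y → (𝟙 ⊟ b) ⊠ (x ⊠ y) ⊞ (𝟙 ⊟ x) ⊠ y := (𝟙 ⊟ b ⊠ x) ⊠ y) refl (q ^ b) (q ^ x) (g′ x))
      (*-congʳ (+-congˡ (-‿cong (sym (^-homo-* q b x)))))
    unfold : ∀ f → removal n g (push d f) ≈ k * removal (suc n) g f + removal (suc n) g′ f
    unfold f rewrite eq = trans
      (*-congˡ (+-congˡ (subsetSum-cong (suc n) (rest f) (λ x _ → reflexive (≡.cong g (ℕ-x∙yz≡y∙xz (size (item f)) b x))))))
      (solve 4 (λ c k s s′ → c ⊠ (⊖ (k ⊠ s) ⊞ s′) := (⊖ k) ⊠ (c ⊠ s) ⊞ c ⊠ s′) refl _ _ _ _)

-- Solving the removal recursion in closed form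

module MultinomialRecursion (T : CommutativeRing 0ℓ 0ℓ) (q : CommutativeRing.Carrier T)
  {A : Set} (marked : A → Bool) (size : A → ℕ) where
  open RingLemmas T
  open CompleteSymmetric T using (_^_; ^-homo-*)
  open QPochhammer T q using (poch; poch-last)
  open Marked marked size
  open SubsetSums T q marked size
  open Focus
  open ≈R

  module _ (inv : ℕ → Carrier) (inv-law : ∀ m → (1# + - (q ^ suc m)) * inv (suc m) ≈ 1#) where

    pochInv : ℕ → Carrier
    pochInv zero    = 1#
    pochInv (suc n) = pochInv n * inv (suc n)

    poch-suc : ∀ n → poch q (suc n) ≈ poch q n * (1# + - (q ^ suc n))
    poch-suc n = trans (poch-last q n) (*-congˡ (+-congˡ (-‿cong (*-comm _ _))))

    pochInv-law : ∀ n → poch q n * pochInv n ≈ 1#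
    pochInv-law zero    = *-identityˡ 1#
    pochInv-law (suc n) = begin
      poch q (suc n) * (pochInv n * inv (suc n))                    ≈⟨ *-congʳ (poch-suc n) ⟩
      (poch q n * (1# + - (q ^ suc n))) * (pochInv n * inv (suc n))
        ≈⟨ solve 4 (λ a b c d → (a ⊠ b) ⊠ (c ⊠ d) := (a ⊠ c) ⊠ (b ⊠ d)) refl _ _ _ _ ⟩
      (poch q n * pochInv n) * ((1# + - (q ^ suc n)) * inv (suc n)) ≈⟨ *-cong (pochInv-law n) (inv-law n) ⟩
      1# * 1#                                                       ≈⟨ *-identityˡ 1# ⟩
      1#                                                            ∎

    -- With `inv m` in the role of 1/(1 - q^m), a partial fraction identity in q^x. Its second term
    -- is a multiple of q^x, which is what the vanishing subset sum will remove.
    inv-difference : ∀ x p → inv (x ℕ.+ suc p) * ((1# + - (q ^ x)) * inv (suc p)) ≈ inv (suc p) + - inv (x ℕ.+ suc p) * q ^ x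
    inv-difference x p = begin
      i * ((1# + - (q ^ x)) * j)
        ≈⟨ solve 4 (λ i a p j → i ⊠ ((𝟙 ⊟ a) ⊠ j) := j ⊠ ((𝟙 ⊟ a ⊠ p) ⊠ i) ⊞ (⊖ i ⊠ a) ⊠ ((𝟙 ⊟ p) ⊠ j)) refl i (q ^ x) (q ^ suc p) j ⟩
      j * ((1# + - (q ^ x * q ^ suc p)) * i) + (- i * q ^ x) * ((1# + - (q ^ suc p)) * j)
        ≈⟨ +-cong (*-congˡ (trans (*-congʳ (+-congˡ (-‿cong (sym (^-homo-* q x (suc p)))))) (inv-law′ x p))) (*-congˡ (inv-law p)) ⟩
      j * 1# + (- i * q ^ x) * 1#                  ≈⟨ +-cong (*-identityʳ _) (*-identityʳ _) ⟩
      j + - i * q ^ x                              ∎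
      where
      i j : Carrier
      i = inv (x ℕ.+ suc p)
      j = inv (suc p)
      inv-law′ : ∀ x p → (1# + - (q ^ (x ℕ.+ suc p))) * inv (x ℕ.+ suc p) ≈ 1#
      inv-law′ x p rewrite ℕₚ.+-suc x p = inv-law (x ℕ.+ p)

    -- `G n b` stands for h_n(1, ..., q^{b-1}), and `w` for the total size of the block that is
    -- never touched plus r - 1.
    module _ (w : ℕ) (G : ℕ → ℕ → Carrier) (G-zero : ∀ n → G (suc n) 0 ≈ 0#)
      (G-suc : ∀ n m → poch q n * poch q m * G n (suc m) ≈ poch q (n ℕ.+ m)) where

      -- The q-multinomial coefficient of the statement without the denominators of the untouched
      -- block and of r - 1; these cancel in the quotient.
      multinomial : List A → Carrier
      multinomial ds = poch q (total ds ℕ.+ w) * ∏ ds (pochInv ∘ size)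

      summand : List A → ℕ → Carrier
      summand ds x = (1# + - (q ^ x)) * inv (suc (total ds ℕ.+ w) ∸ x)

      -- `G` is a q-binomial coefficient whose factor (q)_{n+1} meets the (q)_n of the multinomial.
      -- Adjoining an element of size b thus yields the larger multinomial times (1 - q^b)/(1 -
      -- q^{n+1}).
      G-multinomial : ∀ b ds →
        G (suc (total ds ℕ.+ w)) b * multinomial ds
          ≈ (poch q (b ℕ.+ (total ds ℕ.+ w)) * (pochInv b * ∏ ds (pochInv ∘ size))) * ((1# + - (q ^ b)) * inv (suc (total ds ℕ.+ w)))
      -- A variable of size 0 has no letters: `G` vanishes on the left, 1 - q^0 on the right.
      G-multinomial zero    ds = trans (trans (*-congʳ (G-zero _)) (zeroˡ _)) (sym (trans (*-congˡ (trans (*-congʳ (-‿inverseʳ 1#)) (zeroˡ _))) (zeroʳ _)))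
      G-multinomial (suc m) ds = begin
        G (suc n) (suc m) * (poch q n * Π)         ≈⟨ *-congʳ G≈ ⟩
        poch q (suc n ℕ.+ m) * ((pochInv n * inv (suc n)) * pochInv m) * (poch q n * Π)
          ≈⟨ solve 6 (λ a p i b c Π → a ⊠ ((p ⊠ i) ⊠ b) ⊠ (c ⊠ Π) := (c ⊠ p) ⊠ ((a ⊠ (b ⊠ Π)) ⊠ i)) refl _ _ _ _ _ _ ⟩
        (poch q n * pochInv n) * ((poch q (suc n ℕ.+ m) * (pochInv m * Π)) * inv (suc n))
          ≈⟨ *-cong (trans (pochInv-law n) (sym (inv-law m))) (*-congʳ (*-congʳ (reflexive (≡.cong (poch q ∘ suc) (ℕₚ.+-comm n m))))) ⟩
        ((1# + - (q ^ suc m)) * inv (suc m)) * ((poch q (suc m ℕ.+ n) * (pochInv m * Π)) * inv (suc n))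
          ≈⟨ solve 6 (λ e i a b Π j → (e ⊠ i) ⊠ ((a ⊠ (b ⊠ Π)) ⊠ j) := (a ⊠ ((b ⊠ i) ⊠ Π)) ⊠ (e ⊠ j)) refl _ _ _ _ _ _ ⟩
        (poch q (suc m ℕ.+ n) * ((pochInv m * inv (suc m)) * Π)) * ((1# + - (q ^ suc m)) * inv (suc n)) ∎
        where
        n : ℕ
        n = total ds ℕ.+ w
        Π : Carrier
        Π = ∏ ds (pochInv ∘ size)
        G≈ : G (suc n) (suc m) ≈ poch q (suc n ℕ.+ m) * (pochInv (suc n) * pochInv m)
        G≈ = begin
          G (suc n) (suc m)                              ≈⟨ *-identityˡ _ ⟨
          1# * G (suc n) (suc m)
            ≈⟨ *-congʳ (trans (*-cong (pochInv-law (suc n)) (pochInv-law m)) (*-identityˡ 1#)) ⟨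
          ((poch q (suc n) * pochInv (suc n)) * (poch q m * pochInv m)) * G (suc n) (suc m)
            ≈⟨ solve 5 (λ a a′ b b′ g → ((a ⊠ a′) ⊠ (b ⊠ b′)) ⊠ g := ((a ⊠ b) ⊠ g) ⊠ (a′ ⊠ b′)) refl _ _ _ _ _ ⟩
          poch q (suc n) * poch q m * G (suc n) (suc m) * (pochInv (suc n) * pochInv m) ≈⟨ *-congʳ (G-suc (suc n) m) ⟩
          poch q (suc n ℕ.+ m) * (pochInv (suc n) * pochInv m) ∎

      multinomial-focus : ∀ {ds} {f : Focus A} → f ∈ foci ds →
        poch q (size (item f) ℕ.+ (total (rest f) ℕ.+ w)) * (pochInv (size (item f)) * ∏ (rest f) (pochInv ∘ size)) ≈ multinomial ds
      multinomial-focus {ds} {f} f∈ = begin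
        poch q (b ℕ.+ (total (rest f) ℕ.+ w)) * (pochInv b * ∏ (rest f) (pochInv ∘ size))
          ≈⟨ *-cong (reflexive (≡.cong (poch q) (≡.sym (≡.trans (≡.cong (ℕ._+ w) (total-focus xs (item f) ys)) (ℕₚ.+-assoc b _ w)))))
               (trans (*-congˡ (∏-++ xs ys)) (trans (solve 3 (λ a b c → a ⊠ (b ⊠ c) := b ⊠ (a ⊠ c)) refl _ _ _) (sym (∏-++ xs (item f ∷ ys))))) ⟩
        multinomial (xs ++ item f ∷ ys)  ≡⟨ ≡.cong multinomial (≡.sym (foci-split f∈)) ⟩
        multinomial ds                   ∎
        where
        b = size (item f)
        xs = before f
        ys = after f

      -- `𝔈 s A` is a constant term with treated block A and s removals still to come. Only the
      -- recursion and an invariant are assumed, so both parts of the theorem become instances.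
      module _ (ε : Carrier) (𝔈 : ℕ → List A → Carrier) (Invariant : ℕ → List A → Set)
        (Invariant-rest : ∀ {s ds f} → Invariant (suc s) ds → f ∈ foci ds → marked (item f) ≡ true → Invariant s (rest f))
        (recursion : ∀ {s ds} → Invariant (suc s) ds → 𝔈 (suc s) ds ≈ ∑ (foci ds) (λ f → when (marked (item f))
          (ε * (q ^ total (after f) * G (suc (total (rest f) ℕ.+ w)) (size (item f))) * 𝔈 s (rest f))))
        where

        -- By induction, the closed form of `rest f` carries (1 - q^x)/(1 - q^{N-x}), and `G`
        -- contributes 1/(1 - q^N). Their product splits by `inv-difference`: the multiple of q^x
        -- sums to 0 over the subsets, and 1/(1 - q^{N-x}) depends only on the total size of J with
        -- f included. `subsetSum-removal` then carries out the sum over f.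
        closedForm : ∀ s {ds} → Invariant (suc s) ds → count ds ≡ suc s →
          multinomial (unmarked ds) * 𝔈 (suc s) ds ≈ (ε ^ suc s * multinomial ds) * (subsetSum 0 ds (summand ds) * 𝔈 0 (unmarked ds))
        closedForm s {ds} I c = begin
          multinomial (unmarked ds) * 𝔈 (suc s) ds       ≈⟨ *-congˡ (recursion I) ⟩
          multinomial (unmarked ds) * ∑ (foci ds) (λ f → when (marked (item f)) (step f))   ≈⟨ *-∑ _ (foci ds) ⟩
          ∑ (foci ds) (λ f → multinomial (unmarked ds) * when (marked (item f)) (step f))
            ≈⟨ ∑-cong (foci ds) (λ {f} f∈ → trans (sym (when-* (marked (item f)) _))
                 (trans (when-cong (marked (item f)) (term f f∈)) (when-* (marked (item f)) K))) ⟩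
          ∑ (foci ds) (λ f → K * when (marked (item f)) (removal 0 g f))                   ≈⟨ *-∑ K (foci ds) ⟨
          K * ∑ (foci ds) (λ f → when (marked (item f)) (removal 0 g f))                   ≈⟨ *-congˡ (subsetSum-removal 0 ds g) ⟩
          K * subsetSum 0 ds (summand ds)                ≈⟨ solve 3 (λ e d s → (e ⊠ d) ⊠ s := e ⊠ (s ⊠ d)) refl _ _ _ ⟩
          (ε ^ suc s * multinomial ds) * (subsetSum 0 ds (summand ds) * 𝔈 0 (unmarked ds)) ∎
          where
          K : Carrier
          K = (ε ^ suc s * multinomial ds) * 𝔈 0 (unmarked ds)
          g : ℕ → Carrier
          g y = inv (suc (total ds ℕ.+ w) ∸ y)
          coefficientOf step : Focus A → Carrier
          coefficientOf f = q ^ total (after f) * G (suc (total (rest f) ℕ.+ w)) (size (item f))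
          step f = ε * coefficientOf f * 𝔈 s (rest f)

          module _ (f : Focus A) (f∈ : f ∈ foci ds) (m : marked (item f) ≡ true) where
            R = rest f
            b = size (item f)
            N = suc (total R ℕ.+ w)

            unm : unmarked R ≡ unmarked ds
            unm = ≡.trans (≡.sym (unmarked-focus (before f) (item f) (after f) m)) (≡.cong unmarked (≡.sym (foci-split f∈)))

            countR : count R ≡ s
            countR = ℕₚ.suc-injective (≡.trans (≡.sym (≡.trans (≡.cong count (foci-split f∈)) (count-focus (before f) (item f) (after f) m))) c)

            top : suc (total ds ℕ.+ w) ≡ b ℕ.+ N
            top = ≡.trans (≡.cong (λ n → suc (n ℕ.+ w)) (≡.trans (≡.cong total (foci-split f∈)) (total-focus (before f) (item f) (after f))))
              (≡.trans (≡.cong suc (ℕₚ.+-assoc b (total R) w)) (≡.sym (ℕₚ.+-suc b _)))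

            g-shift : ∀ x → g (b ℕ.+ x) ≡ inv (N ∸ x)
            g-shift x = ≡.cong inv (≡.trans (≡.cong (_∸ (b ℕ.+ x)) top) (ℕₚ.[m+n]∸[m+o]≡n∸o b N x))

            combine : ∀ s → count R ≡ s → Invariant s R →
              multinomial (unmarked ds) * 𝔈 s R * inv N
                ≈ (ε ^ s * multinomial R) * (subsetSum 0 R (λ x → g (b ℕ.+ x)) * 𝔈 0 (unmarked ds))
            -- No marked element is left in R, so the subset sum is its single term for the empty
            -- set, which is `inv N`.
            combine zero    e I = begin
              multinomial (unmarked ds) * 𝔈 0 R * inv N     ≡⟨ ≡.cong₂ (λ A B → multinomial A * 𝔈 0 B * inv N) eq (≡.sym eq) ⟩
              multinomial R * 𝔈 0 (unmarked ds) * inv N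
                ≈⟨ solve 3 (λ m e i → m ⊠ e ⊠ i := (𝟙 ⊠ m) ⊠ (i ⊠ e)) refl _ _ _ ⟩
              (1# * multinomial R) * (inv N * 𝔈 0 (unmarked ds))
                ≈⟨ *-congˡ (*-congʳ (trans (subsetSum-unmarked R e) (reflexive (g-shift 0)))) ⟨
              (1# * multinomial R) * (subsetSum 0 R (λ x → g (b ℕ.+ x)) * 𝔈 0 (unmarked ds)) ∎
              where
              eq : unmarked ds ≡ R
              eq = ≡.trans (≡.sym unm) (unmarked-count0 R e)
            combine (suc s) e I = begin
              multinomial (unmarked ds) * 𝔈 (suc s) R * inv N
                ≡⟨ ≡.cong (λ A → multinomial A * 𝔈 (suc s) R * inv N) (≡.sym unm) ⟩
              multinomial (unmarked R) * 𝔈 (suc s) R * inv N            ≈⟨ *-congʳ (closedForm s I e) ⟩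
              (ε ^ suc s * multinomial R) * (subsetSum 0 R (summand R) * 𝔈 0 (unmarked R)) * inv N
                ≈⟨ solve 4 (λ a s d i → a ⊠ (s ⊠ d) ⊠ i := a ⊠ ((i ⊠ s) ⊠ d)) refl _ _ _ _ ⟩
              (ε ^ suc s * multinomial R) * ((inv N * subsetSum 0 R (summand R)) * 𝔈 0 (unmarked R))
                ≈⟨ *-congˡ (*-cong sums (reflexive (≡.cong (𝔈 0) unm))) ⟩
              (ε ^ suc s * multinomial R) * (subsetSum 0 R (λ x → g (b ℕ.+ x)) * 𝔈 0 (unmarked ds)) ∎
              where
              split : ∀ x → x ℕ.≤ total R → inv N * summand R x ≈ g (b ℕ.+ x) + - inv N * q ^ x
              split x x≤ = begin
                inv N * ((1# + - (q ^ x)) * inv (N ∸ x))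
                  ≡⟨ ≡.cong₂ (λ n k → inv n * ((1# + - (q ^ x)) * inv k)) (≡.sym eqN) eqK ⟩
                inv (x ℕ.+ suc p) * ((1# + - (q ^ x)) * inv (suc p))     ≈⟨ inv-difference x p ⟩
                inv (suc p) + - inv (x ℕ.+ suc p) * q ^ x
                  ≡⟨ ≡.cong₂ (λ n k → k + - inv n * q ^ x) eqN (≡.trans (≡.cong inv (≡.sym eqK)) (≡.sym (g-shift x))) ⟩
                g (b ℕ.+ x) + - inv N * q ^ x                            ∎
                where
                p = (total R ℕ.+ w) ∸ x
                x≤′ : x ℕ.≤ total R ℕ.+ w
                x≤′ = ℕₚ.≤-trans x≤ (ℕₚ.m≤m+n _ w)
                eqN : x ℕ.+ suc p ≡ N
                eqN = ≡.trans (ℕₚ.+-suc x p) (≡.cong suc (ℕₚ.m+[n∸m]≡n x≤′))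
                eqK : N ∸ x ≡ suc p
                eqK = ℕₚ.+-∸-assoc 1 x≤′
              sums : inv N * subsetSum 0 R (summand R) ≈ subsetSum 0 R (λ x → g (b ℕ.+ x))
              sums = begin
                inv N * subsetSum 0 R (summand R)                        ≈⟨ subsetSum-* (inv N) 0 R ⟨
                subsetSum 0 R (λ x → inv N * summand R x)                ≈⟨ subsetSum-cong 0 R split ⟩
                subsetSum 0 R (λ x → g (b ℕ.+ x) + - inv N * q ^ x)      ≈⟨ subsetSum-+ 0 R ⟩
                subsetSum 0 R (λ x → g (b ℕ.+ x)) + subsetSum 0 R (λ x → - inv N * q ^ x)
                  ≈⟨ +-congˡ (trans (subsetSum-* (- inv N) 0 R) (trans (*-congˡ (subsetSum-q^ R e)) (zeroʳ _))) ⟩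
                subsetSum 0 R (λ x → g (b ℕ.+ x)) + 0#                   ≈⟨ +-identityʳ _ ⟩
                subsetSum 0 R (λ x → g (b ℕ.+ x))                        ∎

            regroup : multinomial R * coefficientOf f ≈ q ^ total (after f) * (multinomial ds * ((1# + - (q ^ b)) * inv N))
            regroup = begin
              multinomial R * (q ^ total (after f) * G N b)              ≈⟨ solve 3 (λ m t g → m ⊠ (t ⊠ g) := t ⊠ (g ⊠ m)) refl _ _ _ ⟩
              q ^ total (after f) * (G N b * multinomial R)              ≈⟨ *-congˡ (trans (G-multinomial b R) (*-congʳ (multinomial-focus f∈))) ⟩
              q ^ total (after f) * (multinomial ds * ((1# + - (q ^ b)) * inv N)) ∎

            term : multinomial (unmarked ds) * step f ≈ K * removal 0 g f
            -- `combine` needs the factor `inv N` and `regroup` the factor `multinomial R`; both are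
            -- supplied here and removed again as units.
            term = cancelUnit (begin
              (multinomial R * inv N) * (multinomial (unmarked ds) * step f)
                ≈⟨ solve 6 (λ m i u e c d → (m ⊠ i) ⊠ (u ⊠ (e ⊠ c ⊠ d)) := (e ⊠ (u ⊠ d ⊠ i)) ⊠ (m ⊠ c)) refl _ _ _ _ _ _ ⟩
              (ε * (multinomial (unmarked ds) * 𝔈 s R * inv N)) * (multinomial R * coefficientOf f)
                ≈⟨ *-cong (*-congˡ (combine s countR (Invariant-rest I f∈ m))) regroup ⟩
              (ε * ((ε ^ s * multinomial R) * (S * 𝔈 0 (unmarked ds)))) * (q ^ total (after f) * (multinomial ds * ((1# + - (q ^ b)) * inv N)))
                ≈⟨ solve 9 (λ e k m S d t M b i → (e ⊠ ((k ⊠ m) ⊠ (S ⊠ d))) ⊠ (t ⊠ (M ⊠ (b ⊠ i)))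
                     := (m ⊠ i) ⊠ ((((e ⊠ k) ⊠ M) ⊠ d) ⊠ ((t ⊠ b) ⊠ S))) refl _ _ _ _ _ _ _ _ _ ⟩
              (multinomial R * inv N) * (K * removal 0 g f)              ∎)
              where
              S : Carrier
              S = subsetSum 0 R (λ x → g (b ℕ.+ x))
              n = total R ℕ.+ w
              unit : Carrier
              unit = (pochInv n * ∏ R (poch q ∘ size)) * (1# + - (q ^ N))
              unit-law : unit * (multinomial R * inv N) ≈ 1#
              unit-law = begin
                ((pochInv n * ∏ R (poch q ∘ size)) * (1# + - (q ^ N))) * ((poch q n * ∏ R (pochInv ∘ size)) * inv N)
                  ≈⟨ solve 6 (λ p a e P c i → ((p ⊠ a) ⊠ e) ⊠ ((P ⊠ c) ⊠ i) := (P ⊠ p) ⊠ (a ⊠ c) ⊠ (e ⊠ i)) refl _ _ _ _ _ _ ⟩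
                (poch q n * pochInv n) * (∏ R (poch q ∘ size) * ∏ R (pochInv ∘ size)) * ((1# + - (q ^ N)) * inv N)
                  ≈⟨ *-cong (*-cong (pochInv-law n) (trans (sym (∏-* R)) (trans (∏-cong R (λ {l} _ → pochInv-law (size l))) (∏-1 R)))) (inv-law n) ⟩
                1# * 1# * 1#   ≈⟨ trans (*-identityʳ _) (*-identityʳ 1#) ⟩
                1#             ∎
                where
                ∏-1 : ∀ (L : List A) → ∏ L (λ _ → 1#) ≈ 1#
                ∏-1 []      = refl
                ∏-1 (_ ∷ L) = trans (*-identityˡ _) (∏-1 L)
              cancelUnit : ∀ {x y} → (multinomial R * inv N) * x ≈ (multinomial R * inv N) * y → x ≈ y
              cancelUnit {x} {y} p = begin
                x                                        ≈⟨ trans (*-congʳ unit-law) (*-identityˡ x) ⟨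
                (unit * (multinomial R * inv N)) * x     ≈⟨ trans (*-assoc _ _ _) (trans (*-congˡ p) (sym (*-assoc _ _ _))) ⟩
                (unit * (multinomial R * inv N)) * y     ≈⟨ trans (*-congʳ unit-law) (*-identityˡ y) ⟩
                y                                        ∎

-- The Laurent polynomial ring

-- ℤ[q^±, x_1^±, …, x_N^±]: exponent vectors carry the exponent of q first.
-- Two formal sums are identified when all linear functionals agree on them.
module LaurentPolynomials (N : ℕ) where
  open ≡.≡-Reasoning
  open Algebra.Properties.CommutativeSemigroup ℤₚ.+-commutativeSemigroup using () renaming (interchange to +-interchange; x∙yz≈y∙xz to +-leftComm)
  open Algebra.Properties.CommutativeSemigroup ℤₚ.*-commutativeSemigroup using () renaming (x∙yz≈y∙xz to *-leftComm)

  Mon : Set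
  Mon = Vec ℤ (suc N)

  infixl 7 _⊕_
  _⊕_ : ∀ {n} → Vec ℤ n → Vec ℤ n → Vec ℤ n
  _⊕_ = Vec.zipWith ℤ._+_

  𝟎 : ∀ {n} → Vec ℤ n
  𝟎 = Vec.replicate _ (+ 0)

  L : Set
  L = List (ℤ × Mon)

  -- The linear functional with values φ on monomials. Quantifying over all φ replaces collecting
  -- like terms, and the ring axioms become interchanges of finite sums.
  ev : L → (Mon → ℤ) → ℤ
  ev []            φ = + 0
  ev ((c , m) ∷ f) φ = c ℤ.* φ m ℤ.+ ev f φ

  infix 4 _≋_
  record _≋_ (f g : L) : Set where
    constructor functionals
    field
      at : ∀ φ → ev f φ ≡ ev g φ
  open _≋_

  scale : ℤ → Mon → L → L
  scale c m = map (λ { (d , n) → (c ℤ.* d , m ⊕ n) })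

  infixl 7 _⊛_
  _⊛_ : L → L → L
  []            ⊛ g = []
  ((c , m) ∷ f) ⊛ g = scale c m g ++ f ⊛ g

  negate : L → L
  negate = map (λ { (c , m) → (ℤ.- c , m) })

  ev-cong : ∀ f {φ ψ} → (∀ m → φ m ≡ ψ m) → ev f φ ≡ ev f ψ
  ev-cong []            e = ≡.refl
  ev-cong ((c , m) ∷ f) e = ≡.cong₂ (λ x y → c ℤ.* x ℤ.+ y) (e m) (ev-cong f e)

  ev-++ : ∀ f g φ → ev (f ++ g) φ ≡ ev f φ ℤ.+ ev g φ
  ev-++ []            g φ = ≡.sym (ℤₚ.+-identityˡ _)
  ev-++ ((c , m) ∷ f) g φ = ≡.trans (≡.cong (λ x → c ℤ.* φ m ℤ.+ x) (ev-++ f g φ)) (≡.sym (ℤₚ.+-assoc (c ℤ.* φ m) (ev f φ) (ev g φ)))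

  ev-0 : ∀ f → ev f (λ _ → + 0) ≡ + 0
  ev-0 []            = ≡.refl
  ev-0 ((c , m) ∷ f) = ≡.cong₂ ℤ._+_ (ℤₚ.*-zeroʳ c) (ev-0 f)

  ev-+ : ∀ f φ ψ → ev f (λ m → φ m ℤ.+ ψ m) ≡ ev f φ ℤ.+ ev f ψ
  ev-+ []            φ ψ = ≡.refl
  ev-+ ((c , m) ∷ f) φ ψ = ≡.trans (≡.cong₂ ℤ._+_ (ℤₚ.*-distribˡ-+ c (φ m) (ψ m)) (ev-+ f φ ψ))
    (+-interchange (c ℤ.* φ m) (c ℤ.* ψ m) (ev f φ) (ev f ψ))

  ev-* : ∀ c f φ → ev f (λ m → c ℤ.* φ m) ≡ c ℤ.* ev f φ
  ev-* c []            φ = ≡.sym (ℤₚ.*-zeroʳ c)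
  ev-* c ((d , m) ∷ f) φ = ≡.trans (≡.cong₂ ℤ._+_ (*-leftComm d c (φ m)) (ev-* c f φ))
    (≡.sym (ℤₚ.*-distribˡ-+ c (d ℤ.* φ m) (ev f φ)))

  ev-neg : ∀ f φ → ev (negate f) φ ≡ ℤ.- ev f φ
  ev-neg []            φ = ≡.refl
  ev-neg ((c , m) ∷ f) φ = ≡.trans (≡.cong₂ ℤ._+_ (≡.sym (ℤₚ.neg-distribˡ-* c (φ m))) (ev-neg f φ))
    (≡.sym (ℤₚ.neg-distrib-+ (c ℤ.* φ m) (ev f φ)))

  ev-scale : ∀ c m g φ → ev (scale c m g) φ ≡ c ℤ.* ev g (λ n → φ (m ⊕ n))
  ev-scale c m []            φ = ≡.sym (ℤₚ.*-zeroʳ c)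
  ev-scale c m ((d , n) ∷ g) φ = ≡.trans (≡.cong₂ ℤ._+_ (ℤₚ.*-assoc c d _) (ev-scale c m g φ))
    (≡.sym (ℤₚ.*-distribˡ-+ c (d ℤ.* φ (m ⊕ n)) _))

  ev-⊛ : ∀ f g φ → ev (f ⊛ g) φ ≡ ev f (λ m → ev g (λ n → φ (m ⊕ n)))
  ev-⊛ []            g φ = ≡.refl
  ev-⊛ ((c , m) ∷ f) g φ = ≡.trans (ev-++ (scale c m g) (f ⊛ g) φ) (≡.cong₂ ℤ._+_ (ev-scale c m g φ) (ev-⊛ f g φ))

  ev-swap : ∀ f g (φ : Mon → Mon → ℤ) → ev f (λ m → ev g (φ m)) ≡ ev g (λ n → ev f (λ m → φ m n))
  ev-swap []            g φ = ≡.sym (ev-0 g)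
  ev-swap ((c , m) ∷ f) g φ = ≡.trans (≡.cong₂ ℤ._+_ (≡.sym (ev-* c g (φ m))) (ev-swap f g φ))
    (≡.sym (ev-+ g (λ n → c ℤ.* φ m n) (λ n → ev f (λ m → φ m n))))

  ⊕-assoc : (x y z : Mon) → (x ⊕ y) ⊕ z ≡ x ⊕ (y ⊕ z)
  ⊕-assoc = Vecₚ.zipWith-assoc ℤₚ.+-assoc

  ⊕-comm : (x y : Mon) → x ⊕ y ≡ y ⊕ x
  ⊕-comm = Vecₚ.zipWith-comm ℤₚ.+-comm

  ⊕-identityˡ : ∀ {n} (x : Vec ℤ n) → 𝟎 ⊕ x ≡ x
  ⊕-identityˡ = Vecₚ.zipWith-identityˡ ℤₚ.+-identityˡ

  mono : Mon → L
  mono m = (+ 1 , m) ∷ []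

  ev-mono : ∀ m φ → ev (mono m) φ ≡ φ m
  ev-mono m φ = ≡.trans (ℤₚ.+-identityʳ _) (ℤₚ.*-identityˡ _)

  ≋-trans : ∀ {f g h} → f ≋ g → g ≋ h → f ≋ h
  ≋-trans p p′ = functionals (λ φ → ≡.trans (at p φ) (at p′ φ))

  ⊛-comm : ∀ f g → f ⊛ g ≋ g ⊛ f
  ⊛-comm f g = functionals λ φ → begin
    ev (f ⊛ g) φ                             ≡⟨ ev-⊛ f g φ ⟩
    ev f (λ m → ev g (λ n → φ (m ⊕ n)))      ≡⟨ ev-swap f g (λ m n → φ (m ⊕ n)) ⟩
    ev g (λ n → ev f (λ m → φ (m ⊕ n)))      ≡⟨ ev-cong g (λ n → ev-cong f (λ m → ≡.cong φ (⊕-comm m n))) ⟩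
    ev g (λ n → ev f (λ m → φ (n ⊕ m)))      ≡⟨ ev-⊛ g f φ ⟨
    ev (g ⊛ f) φ                             ∎

  ⊛-assoc : ∀ f g h → (f ⊛ g) ⊛ h ≋ f ⊛ (g ⊛ h)
  ⊛-assoc f g h = functionals λ φ → begin
    ev ((f ⊛ g) ⊛ h) φ                                          ≡⟨ ev-⊛ (f ⊛ g) h φ ⟩
    ev (f ⊛ g) (λ m → ev h (λ n → φ (m ⊕ n)))                   ≡⟨ ev-⊛ f g _ ⟩
    ev f (λ l → ev g (λ m → ev h (λ n → φ ((l ⊕ m) ⊕ n))))
      ≡⟨ ev-cong f (λ l → ev-cong g (λ m → ev-cong h (λ n → ≡.cong φ (⊕-assoc l m n)))) ⟩
    ev f (λ l → ev g (λ m → ev h (λ n → φ (l ⊕ (m ⊕ n)))))      ≡⟨ ev-cong f (λ l → ev-⊛ g h (λ m → φ (l ⊕ m))) ⟨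
    ev f (λ l → ev (g ⊛ h) (λ m → φ (l ⊕ m)))                   ≡⟨ ev-⊛ f (g ⊛ h) φ ⟨
    ev (f ⊛ (g ⊛ h)) φ                                          ∎

  ⊛-identityˡ : ∀ f → mono 𝟎 ⊛ f ≋ f
  ⊛-identityˡ f = functionals λ φ → begin
    ev (mono 𝟎 ⊛ f) φ                          ≡⟨ ev-⊛ (mono 𝟎) f φ ⟩
    ev (mono 𝟎) (λ m → ev f (λ n → φ (m ⊕ n))) ≡⟨ ev-mono 𝟎 (λ m → ev f (λ n → φ (m ⊕ n))) ⟩
    ev f (λ n → φ (𝟎 ⊕ n))                     ≡⟨ ev-cong f (λ n → ≡.cong φ (⊕-identityˡ n)) ⟩
    ev f φ                                     ∎

  ⊛-cong : ∀ {f f′ g g′} → f ≋ f′ → g ≋ g′ → f ⊛ g ≋ f′ ⊛ g′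
  ⊛-cong {f} {f′} {g} {g′} p p′ = functionals λ φ → begin
    ev (f ⊛ g) φ                             ≡⟨ ev-⊛ f g φ ⟩
    ev f (λ m → ev g (λ n → φ (m ⊕ n)))      ≡⟨ ev-cong f (λ m → at p′ _) ⟩
    ev f (λ m → ev g′ (λ n → φ (m ⊕ n)))     ≡⟨ at p _ ⟩
    ev f′ (λ m → ev g′ (λ n → φ (m ⊕ n)))    ≡⟨ ev-⊛ f′ g′ φ ⟨
    ev (f′ ⊛ g′) φ                           ∎

  ++-cong : ∀ {f f′ g g′} → f ≋ f′ → g ≋ g′ → f ++ g ≋ f′ ++ g′
  ++-cong {f} {f′} {g} {g′} p p′ = functionals λ φ →
    ≡.trans (ev-++ f g φ) (≡.trans (≡.cong₂ ℤ._+_ (at p φ) (at p′ φ)) (≡.sym (ev-++ f′ g′ φ)))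

  ++-comm : ∀ f g → f ++ g ≋ g ++ f
  ++-comm f g = functionals λ φ → ≡.trans (ev-++ f g φ) (≡.trans (ℤₚ.+-comm (ev f φ) (ev g φ)) (≡.sym (ev-++ g f φ)))

  ++-assoc : ∀ f g h → (f ++ g) ++ h ≋ f ++ (g ++ h)
  ++-assoc f g h = functionals λ φ → ≡.cong (λ l → ev l φ) (Listₚ.++-assoc f g h)

  negate-inverseˡ : ∀ f → negate f ++ f ≋ []
  negate-inverseˡ f = functionals λ φ →
    ≡.trans (ev-++ (negate f) f φ) (≡.trans (≡.cong (ℤ._+ ev f φ) (ev-neg f φ)) (ℤₚ.+-inverseˡ (ev f φ)))

  negate-cong : ∀ {f g} → f ≋ g → negate f ≋ negate g
  negate-cong {f} {g} p = functionals λ φ → ≡.trans (ev-neg f φ) (≡.trans (≡.cong (λ z → ℤ.- z) (at p φ)) (≡.sym (ev-neg g φ)))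

  ⊛-distribˡ : ∀ f g h → f ⊛ (g ++ h) ≋ f ⊛ g ++ f ⊛ h
  ⊛-distribˡ f g h = functionals λ φ → begin
    ev (f ⊛ (g ++ h)) φ                           ≡⟨ ev-⊛ f (g ++ h) φ ⟩
    ev f (λ m → ev (g ++ h) (λ n → φ (m ⊕ n)))    ≡⟨ ev-cong f (λ m → ev-++ g h _) ⟩
    ev f (λ m → ev g (λ n → φ (m ⊕ n)) ℤ.+ ev h (λ n → φ (m ⊕ n)))    ≡⟨ ev-+ f _ _ ⟩
    ev f (λ m → ev g (λ n → φ (m ⊕ n))) ℤ.+ ev f (λ m → ev h (λ n → φ (m ⊕ n)))
      ≡⟨ ≡.cong₂ ℤ._+_ (ev-⊛ f g φ) (ev-⊛ f h φ) ⟨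
    ev (f ⊛ g) φ ℤ.+ ev (f ⊛ h) φ                 ≡⟨ ev-++ (f ⊛ g) (f ⊛ h) φ ⟨
    ev (f ⊛ g ++ f ⊛ h) φ                         ∎

  laurentRing : CommutativeRing 0ℓ 0ℓ
  laurentRing = record
    { Carrier = L ; _≈_ = _≋_ ; _+_ = _++_ ; _*_ = _⊛_ ; -_ = negate ; 0# = [] ; 1# = mono 𝟎
    ; isCommutativeRing = record
      { isRing = record
        { +-isAbelianGroup = record
          { isGroup = record
            { isMonoid = record
              { isSemigroup = record
                { isMagma = record
                  { isEquivalence = record
                    { refl = functionals (λ _ → ≡.refl) ; sym = λ p → functionals (λ φ → ≡.sym (at p φ)) ; trans = ≋-trans }
                  ; ∙-cong = ++-cong }
                ; assoc = ++-assoc }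
              ; identity = (λ _ → functionals (λ _ → ≡.refl)) , λ f → ++-comm f [] }
            ; inverse = negate-inverseˡ , λ f → ≋-trans (++-comm f (negate f)) (negate-inverseˡ f)
            ; ⁻¹-cong = negate-cong }
          ; comm = ++-comm }
        ; *-cong = ⊛-cong
        ; *-assoc = ⊛-assoc
        ; *-identity = ⊛-identityˡ , λ f → ≋-trans (⊛-comm f _) (⊛-identityˡ f)
        ; distrib = ⊛-distribˡ , λ f g h → ≋-trans (⊛-comm (g ++ h) f)
            (≋-trans (⊛-distribˡ f g h) (++-cong (⊛-comm f g) (⊛-comm f h))) }
      ; *-comm = ⊛-comm } }

  mono-⊛ : ∀ m n → mono (m ⊕ n) ≋ mono m ⊛ mono n
  mono-⊛ m n = functionals λ φ → ≡.trans (ev-mono (m ⊕ n) φ)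
    (≡.sym (≡.trans (ev-⊛ (mono m) (mono n) φ) (≡.trans (ev-mono m (λ m → ev (mono n) (λ n → φ (m ⊕ n)))) (ev-mono n (λ n → φ (m ⊕ n))))))

  -- Phrased through the functionals that vanish on P, so that it respects `_≋_`: a list may contain
  -- terms outside P as long as they cancel.
  Supported : (Mon → Set) → L → Set
  Supported P f = ∀ φ → (∀ m → P m → φ m ≡ + 0) → ev f φ ≡ + 0

  module _ {P : Mon → Set} where

    Supported-resp : ∀ {f g} → f ≋ g → Supported P f → Supported P g
    Supported-resp p s φ v = ≡.trans (≡.sym (at p φ)) (s φ v)

    Supported-0 : Supported P []
    Supported-0 φ v = ≡.refl

    Supported-++ : ∀ {f g} → Supported P f → Supported P g → Supported P (f ++ g)
    Supported-++ {f} {g} s s′ φ v = ≡.trans (ev-++ f g φ) (≡.cong₂ ℤ._+_ (s φ v) (s′ φ v))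

    Supported-negate : ∀ {f} → Supported P f → Supported P (negate f)
    Supported-negate {f} s φ v = ≡.trans (ev-neg f φ) (≡.cong (λ z → ℤ.- z) (s φ v))

    Supported-single : ∀ c {m} → P m → Supported P ((c , m) ∷ [])
    Supported-single c {m} p φ v = ≡.trans (ℤₚ.+-identityʳ _) (≡.trans (≡.cong (c ℤ.*_) (v m p)) (ℤₚ.*-zeroʳ c))

  Supported-⊆ : ∀ {P Q f} → (∀ {m} → P m → Q m) → Supported P f → Supported Q f
  Supported-⊆ i s φ v = s φ (λ m p → v m (i p))

  Supported-⊛ : ∀ {P Q S f g} → (∀ {m n} → P m → Q n → S (m ⊕ n)) → Supported P f → Supported Q g → Supported S (f ⊛ g)
  Supported-⊛ {f = f} {g} i s s′ φ v = ≡.trans (ev-⊛ f g φ) (s _ (λ m p → s′ _ (λ n p′ → v _ (i p p′))))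

  single : ∀ {n} → Fin n → ℤ → Vec ℤ n
  single zero    z = z ∷ 𝟎
  single (suc i) z = + 0 ∷ single i z

  single-⊕ : ∀ {n} (i : Fin n) y z → single i (y ℤ.+ z) ≡ single i y ⊕ single i z
  single-⊕ zero    y z = ≡.cong (_ ∷_) (≡.sym (⊕-identityˡ 𝟎))
  single-⊕ (suc i) y z = ≡.cong (_ ∷_) (single-⊕ i y z)

  single-0 : ∀ {n} (i : Fin n) → single i (+ 0) ≡ 𝟎
  single-0 zero    = ≡.refl
  single-0 (suc i) = ≡.cong (_ ∷_) (single-0 i)

  lookup-single : ∀ {n} (i : Fin n) z → lookup (single i z) i ≡ z
  lookup-single zero    z = ≡.refl
  lookup-single (suc i) z = lookup-single i z

  lookup-single-≢ : ∀ {n} {i j : Fin n} → i ≢ j → ∀ z → lookup (single j z) i ≡ + 0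
  lookup-single-≢ {i = zero}  {zero}  p z = contradiction ≡.refl p
  lookup-single-≢ {i = zero}  {suc j} p z = ≡.refl
  lookup-single-≢ {i = suc i} {zero}  p z = Vecₚ.lookup-replicate i (+ 0)
  lookup-single-≢ {i = suc i} {suc j} p z = lookup-single-≢ (p ∘ ≡.cong suc) z

  lookup-⊕ : ∀ (i : Fin (suc N)) m n → lookup (m ⊕ n) i ≡ lookup m i ℤ.+ lookup n i
  lookup-⊕ i m n = Vecₚ.lookup-zipWith ℤ._+_ i m n

  open RingLemmas laurentRing using (Regular; Regular-resp; -‿distribˡ-*)
  open CompleteSymmetric laurentRing using (_^_)
  private module LR = CommutativeRing laurentRing

  module _ (ℓ : Mon → ℤ) (ℓ-⊕ : ∀ m n → ℓ (m ⊕ n) ≡ ℓ m ℤ.+ ℓ n) (τ : Mon) (ℓτ : + 0 ℤ.< ℓ τ) where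

    -- A finitely supported f that is invariant under translation by τ is
    -- killed by pushing any functional beyond the support of f.
    periodic⇒0 : ∀ f → (∀ φ → ev f φ ≡ ev f (λ m → φ (τ ⊕ m))) → ∀ φ → ev f φ ≡ + 0
    periodic⇒0 f per φ = begin
      ev f φ                   ≡⟨ ev-agree f (λ m m≤ → ≡.sym (cut-below (ℤₚ.≤-trans (i≤∣i∣ (ℓ m)) (ℤ.+≤+ m≤)))) bounded ⟩
      ev f cut                 ≡⟨ invariant k ⟩
      ev f (translate k cut)   ≡⟨ ev-agree f (λ m m≤ → translate-above k (far m m≤)) bounded ⟩
      ev f (λ _ → + 0)         ≡⟨ ev-0 f ⟩
      + 0                      ∎
      where
      bound : L → ℕ
      bound []            = 0
      bound ((c , m) ∷ f) = ℤ.∣ ℓ m ∣ ℕ.⊔ bound f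
      b k : ℕ
      b = bound f
      -- A height between -b and b that is raised by at least 2b + 1 exceeds b, where `cut` is zero.
      k = suc (b ℕ.+ b)
      cut : Mon → ℤ
      cut m = if does (ℓ m ℤ.≤? + b) then φ m else + 0
      translate : ℕ → (Mon → ℤ) → Mon → ℤ
      translate zero    ψ m = ψ m
      translate (suc j) ψ m = translate j ψ (τ ⊕ m)
      i≤∣i∣ : ∀ i → i ℤ.≤ + ℤ.∣ i ∣
      i≤∣i∣ (+ n)      = ℤₚ.≤-refl
      i≤∣i∣ -[1+ n ]   = ℤ.-≤+
      Bounded : L → Set
      Bounded = All (λ t → ℤ.∣ ℓ (proj₂ t) ∣ ℕ.≤ b)
      bounded′ : ∀ f → bound f ℕ.≤ b → Bounded f
      bounded′ []            p = []
      bounded′ ((c , m) ∷ f) p = ℕₚ.≤-trans (ℕₚ.m≤m⊔n _ _) p ∷ bounded′ f (ℕₚ.≤-trans (ℕₚ.m≤n⊔m ℤ.∣ ℓ m ∣ _) p)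
      bounded : Bounded f
      bounded = bounded′ f ℕₚ.≤-refl
      ev-agree : ∀ f {ψ χ} → (∀ m → ℤ.∣ ℓ m ∣ ℕ.≤ b → ψ m ≡ χ m) → Bounded f → ev f ψ ≡ ev f χ
      ev-agree []            e []       = ≡.refl
      ev-agree ((c , m) ∷ f) e (p ∷ ps) = ≡.cong₂ (λ x y → c ℤ.* x ℤ.+ y) (e m p) (ev-agree f e ps)
      cut-below : ∀ {m} → ℓ m ℤ.≤ + b → cut m ≡ φ m
      cut-below {m} p with ℓ m ℤ.≤? + b
      ... | yes _ = ≡.refl
      ... | no ¬p = contradiction p ¬p
      cut-above : ∀ {m} → + b ℤ.< ℓ m → cut m ≡ + 0
      cut-above {m} p with ℓ m ℤ.≤? + b
      ... | yes q = contradiction q (ℤₚ.<⇒≱ p)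
      ... | no _  = ≡.refl
      invariant : ∀ j {ψ} → ev f ψ ≡ ev f (translate j ψ)
      invariant zero        = ≡.refl
      invariant (suc j) {ψ} = ≡.trans (invariant j) (per (translate j ψ))
      translate-above : ∀ j {m} → + b ℤ.< ℓ m ℤ.+ + j → translate j cut m ≡ + 0
      translate-above zero    p = cut-above (≡.subst (+ b ℤ.<_) (ℤₚ.+-identityʳ _) p)
      translate-above (suc j) {m} p = translate-above j (ℤₚ.<-≤-trans p (≡.subst₂ ℤ._≤_
        (≡.sym (≡.trans (≡.cong (λ z → ℓ m ℤ.+ z) (ℤₚ.pos-+ 1 j)) (+-leftComm (ℓ m) (+ 1) (+ j))))
        (≡.trans (≡.sym (ℤₚ.+-assoc (ℓ τ) (ℓ m) (+ j))) (≡.cong (ℤ._+ + j) (≡.sym (ℓ-⊕ τ m))))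
        (ℤₚ.+-monoˡ-≤ (ℓ m ℤ.+ + j) (ℤₚ.i<j⇒suc[i]≤j ℓτ))))
      far : ∀ m → ℤ.∣ ℓ m ∣ ℕ.≤ b → + b ℤ.< ℓ m ℤ.+ + k
      far m p = ℤₚ.<-≤-trans (ℤ.+<+ (ℕₚ.n<1+n b)) (≡.subst (ℤ._≤ ℓ m ℤ.+ + k) eq (ℤₚ.+-monoˡ-≤ (+ k) lower))
        where
        lower : ℤ.- + b ℤ.≤ ℓ m
        lower = ≡.subst (ℤ.- + b ℤ.≤_) (ℤₚ.neg-involutive (ℓ m)) (ℤₚ.neg-mono-≤
          (ℤₚ.≤-trans (i≤∣i∣ (ℤ.- ℓ m)) (ℤ.+≤+ (≡.subst (ℕ._≤ b) (≡.sym (ℤₚ.∣-i∣≡∣i∣ (ℓ m))) p))))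
        eq : ℤ.- + b ℤ.+ + k ≡ + suc b
        eq = begin
          ℤ.- + b ℤ.+ + suc (b ℕ.+ b)        ≡⟨ ≡.cong (λ n → ℤ.- + b ℤ.+ + n) (≡.sym (ℕₚ.+-suc b b)) ⟩
          ℤ.- + b ℤ.+ (+ b ℤ.+ + suc b)      ≡⟨ ℤₚ.+-assoc (ℤ.- + b) (+ b) (+ suc b) ⟨
          (ℤ.- + b ℤ.+ + b) ℤ.+ + suc b      ≡⟨ ≡.cong (ℤ._+ + suc b) (ℤₚ.+-inverseˡ (+ b)) ⟩
          + 0 ℤ.+ + suc b                    ≡⟨ ℤₚ.+-identityˡ _ ⟩
          + suc b                            ∎

  negate-translate : Mon → Mon
  negate-translate = Vec.map (λ z → ℤ.- z)

  neg-⊕ : (m n : Mon) → negate-translate m ⊕ (m ⊕ n) ≡ n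
  neg-⊕ m n = ≡.trans (≡.sym (⊕-assoc (negate-translate m) m n))
    (≡.trans (≡.cong (_⊕ n) (Vecₚ.zipWith-inverseˡ ℤₚ.+-inverseˡ m)) (⊕-identityˡ n))

  -- If the binomial kills f, then f is invariant under translation by the quotient τ of the two
  -- monomials. A coordinate in which they differ gives a height that τ raises, after negation if
  -- the sign is wrong, so `periodic⇒0` applies.
  regular-binomial : ∀ {m n} i → lookup m i ≢ lookup n i → Regular (mono m LR.+ LR.- mono n)
  regular-binomial {m} {n} i m≢n {f} p = functionals (by-sign (ℤₚ.<-cmp (lookup n i) (lookup m i)))
    where
    n′ τ : Mon
    n′ = negate-translate n
    τ = n′ ⊕ m
    periodic : ∀ φ → ev f φ ≡ ev f (λ l → φ (τ ⊕ l))
    periodic φ = ℤₚ.i-j≡0⇒i≡j _ _ (≡.trans (≡.cong₂ (λ x y → x ℤ.- y)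
      (ev-cong f (λ l → ≡.cong φ (≡.sym (neg-⊕ n l))))
      (ev-cong f (λ l → ≡.cong φ (⊕-assoc n′ m l)))) (≡.trans (flip (ev f (ψ n)) (ev f (ψ m))) (≡.cong (λ z → ℤ.- z) (≡.trans (≡.sym expand) (at p (λ l → φ (n′ ⊕ l)))))))
      where
      ψ : Mon → Mon → ℤ
      ψ k l = φ (n′ ⊕ (k ⊕ l))
      flip : ∀ a b → a ℤ.- b ≡ ℤ.- (b ℤ.- a)
      flip a b = ≡.sym (≡.trans (ℤₚ.neg-distrib-+ b (ℤ.- a)) (≡.trans (≡.cong (λ z → ℤ.- b ℤ.+ z) (ℤₚ.neg-involutive a)) (ℤₚ.+-comm (ℤ.- b) a)))
      expand : ev ((mono m LR.+ LR.- mono n) ⊛ f) (λ l → φ (n′ ⊕ l)) ≡ ev f (ψ m) ℤ.- ev f (ψ n)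
      expand = ≡.trans (ev-⊛ (mono m LR.+ LR.- mono n) f (λ l → φ (n′ ⊕ l))) (≡.trans (ev-++ (mono m) (negate (mono n)) (λ k → ev f (ψ k)))
        (≡.cong₂ ℤ._+_ (ev-mono m (λ k → ev f (ψ k))) (≡.trans (ev-neg (mono n) (λ k → ev f (ψ k))) (≡.cong (λ z → ℤ.- z) (ev-mono n (λ k → ev f (ψ k)))))))
    lookup-τ : lookup τ i ≡ lookup m i ℤ.- lookup n i
    lookup-τ = ≡.trans (lookup-⊕ i n′ m) (≡.trans (≡.cong (ℤ._+ lookup m i) (Vecₚ.lookup-map i (λ z → ℤ.- z) n)) (ℤₚ.+-comm (ℤ.- lookup n i) (lookup m i)))
    by-sign : Tri (lookup n i ℤ.< lookup m i) (lookup n i ≡ lookup m i) (lookup m i ℤ.< lookup n i) → ∀ φ → ev f φ ≡ + 0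
    by-sign (tri< n<m _ _) = periodic⇒0 (λ l → lookup l i) (lookup-⊕ i) τ
      (≡.subst (+ 0 ℤ.<_) (≡.sym lookup-τ) (≡.subst (ℤ._< lookup m i ℤ.- lookup n i) (ℤₚ.+-inverseʳ (lookup n i)) (ℤₚ.+-monoˡ-< (ℤ.- lookup n i) n<m))) f periodic
    by-sign (tri≈ _ e _)   = contradiction (≡.sym e) m≢n
    by-sign (tri> _ _ m<n) = periodic⇒0 (λ l → ℤ.- lookup l i)
      (λ k l → ≡.trans (≡.cong (λ z → ℤ.- z) (lookup-⊕ i k l)) (ℤₚ.neg-distrib-+ (lookup k i) (lookup l i))) τ
      (≡.subst (λ z → + 0 ℤ.< ℤ.- z) (≡.sym lookup-τ) (ℤₚ.neg-mono-< (≡.subst (lookup m i ℤ.- lookup n i ℤ.<_) (ℤₚ.+-inverseʳ (lookup n i)) (ℤₚ.+-monoˡ-< (ℤ.- lookup n i) m<n)))) f periodic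

  -- The head of the vector, the exponent of q, is free: constant terms are taken in the x_v only.
  isConst? : (m : Mon) → Dec (Vec.tail m ≡ 𝟎)
  isConst? m = Vecₚ.≡-dec ℤ._≟_ (Vec.tail m) 𝟎

  constantTerm : L → L
  constantTerm []            = []
  constantTerm ((c , m) ∷ f) = if does (isConst? m) then (c , m) ∷ constantTerm f else constantTerm f

  -- The transpose of `constantTerm` on functionals. Through it the constant term is seen to be well
  -- defined and additive.
  restrict : (Mon → ℤ) → Mon → ℤ
  restrict φ m = if does (isConst? m) then φ m else + 0

  restrict-yes : ∀ φ {m} → Vec.tail m ≡ 𝟎 → restrict φ m ≡ φ m
  restrict-yes φ {m} p with isConst? m
  ... | yes _ = ≡.refl
  ... | no ¬p = contradiction p ¬p

  restrict-no : ∀ φ {m} → Vec.tail m ≢ 𝟎 → restrict φ m ≡ + 0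
  restrict-no φ {m} ¬p with isConst? m
  ... | yes p = contradiction p ¬p
  ... | no _  = ≡.refl

  ev-constantTerm : ∀ f φ → ev (constantTerm f) φ ≡ ev f (restrict φ)
  ev-constantTerm []            φ = ≡.refl
  ev-constantTerm ((c , m) ∷ f) φ with isConst? m
  ... | yes _ = ≡.cong (λ z → c ℤ.* φ m ℤ.+ z) (ev-constantTerm f φ)
  ... | no  _ = ≡.trans (ev-constantTerm f φ) (≡.sym (≡.trans (≡.cong (ℤ._+ ev f (restrict φ)) (ℤₚ.*-zeroʳ c)) (ℤₚ.+-identityˡ _)))

  IsConst : Mon → Set
  IsConst m = Vec.tail m ≡ 𝟎

  tail-⊕ : (m n : Mon) → Vec.tail (m ⊕ n) ≡ Vec.tail m ⊕ Vec.tail n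
  tail-⊕ (_ ∷ _) (_ ∷ _) = ≡.refl

  constantTerm-cong : ∀ {f g} → f ≋ g → constantTerm f ≋ constantTerm g
  constantTerm-cong {f} {g} p = functionals λ φ → ≡.trans (ev-constantTerm f φ) (≡.trans (at p (restrict φ)) (≡.sym (ev-constantTerm g φ)))

  constantTerm-++ : ∀ f g → constantTerm (f ++ g) ≋ constantTerm f ++ constantTerm g
  constantTerm-++ f g = functionals λ φ → ≡.trans (ev-constantTerm (f ++ g) φ) (≡.trans (ev-++ f g (restrict φ))
    (≡.trans (≡.sym (≡.cong₂ ℤ._+_ (ev-constantTerm f φ) (ev-constantTerm g φ))) (≡.sym (ev-++ (constantTerm f) (constantTerm g) φ))))

  restrict-⊕ : ∀ φ {m} → IsConst m → ∀ n → restrict φ (m ⊕ n) ≡ restrict (λ n → φ (m ⊕ n)) n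
  restrict-⊕ φ {m} p n = by (isConst? n)
    where
    tail≡ : Vec.tail (m ⊕ n) ≡ Vec.tail n
    tail≡ = ≡.trans (tail-⊕ m n) (≡.trans (≡.cong (_⊕ Vec.tail n) p) (⊕-identityˡ _))
    by : Dec (IsConst n) → restrict φ (m ⊕ n) ≡ restrict (λ n → φ (m ⊕ n)) n
    by (yes p′) = ≡.trans (restrict-yes φ {m ⊕ n} (≡.trans tail≡ p′)) (≡.sym (restrict-yes (λ n → φ (m ⊕ n)) {n} p′))
    by (no ¬p)  = ≡.trans (restrict-no φ {m ⊕ n} (λ p′ → ¬p (≡.trans (≡.sym tail≡) p′))) (≡.sym (restrict-no (λ n → φ (m ⊕ n)) {n} ¬p))

  constantTerm-⊛ : ∀ {c} → Supported IsConst c → ∀ f → constantTerm (c ⊛ f) ≋ c ⊛ constantTerm f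
  constantTerm-⊛ {c} s f = functionals λ φ → begin
    ev (constantTerm (c ⊛ f)) φ                               ≡⟨ ev-constantTerm (c ⊛ f) φ ⟩
    ev (c ⊛ f) (restrict φ)                                   ≡⟨ ev-⊛ c f (restrict φ) ⟩
    ev c (λ m → ev f (λ n → restrict φ (m ⊕ n)))              ≡⟨ agree {f = c} s (λ m p → ev-cong f (λ n → restrict-⊕ φ {m} p n)) ⟩
    ev c (λ m → ev f (restrict (λ n → φ (m ⊕ n))))            ≡⟨ ev-cong c (λ m → ev-constantTerm f (λ n → φ (m ⊕ n))) ⟨
    ev c (λ m → ev (constantTerm f) (λ n → φ (m ⊕ n)))        ≡⟨ ev-⊛ c (constantTerm f) φ ⟨
    ev (c ⊛ constantTerm f) φ                                 ∎
    where
    agree : ∀ {P f} → Supported P f → ∀ {φ ψ} → (∀ m → P m → φ m ≡ ψ m) → ev f φ ≡ ev f ψ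
    agree {P} {f} s {φ} {ψ} e = ℤₚ.i-j≡0⇒i≡j _ _ (begin
      ev f φ ℤ.- ev f ψ                               ≡⟨ ≡.cong (λ z → ev f φ ℤ.+ z) (≡.trans (≡.cong (λ z → ℤ.- z) (≡.sym (ℤₚ.*-identityˡ _))) (ℤₚ.neg-distribˡ-* (+ 1) (ev f ψ))) ⟩
      ev f φ ℤ.+ -[1+ 0 ] ℤ.* ev f ψ                  ≡⟨ ≡.cong (λ z → ev f φ ℤ.+ z) (ev-* -[1+ 0 ] f ψ) ⟨
      ev f φ ℤ.+ ev f (λ m → -[1+ 0 ] ℤ.* ψ m)        ≡⟨ ev-+ f φ _ ⟨
      ev f (λ m → φ m ℤ.+ -[1+ 0 ] ℤ.* ψ m)
        ≡⟨ s _ (λ m p → ≡.trans (≡.cong₂ ℤ._+_ (e m p) (≡.trans (≡.sym (ℤₚ.neg-distribˡ-* (+ 1) (ψ m))) (≡.cong (λ z → ℤ.- z) (ℤₚ.*-identityˡ _)))) (ℤₚ.+-inverseʳ (ψ m))) ⟩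
      + 0                                             ∎)

  constantTerm-vanish : ∀ {P f} → (∀ {m} → P m → ¬ IsConst m) → Supported P f → constantTerm f ≋ []
  constantTerm-vanish {f = f} i s = functionals λ φ → ≡.trans (ev-constantTerm f φ) (s (restrict φ) (λ m p → restrict-no φ {m} (i p)))

  IsConst-lookup : ∀ {m} → IsConst m → ∀ i → lookup m (suc i) ≡ + 0
  IsConst-lookup {_ ∷ _} p i = ≡.trans (≡.cong (λ l → lookup l i) p) (Vecₚ.lookup-replicate i (+ 0))

  power : ℕ → Mon
  power k = + k ∷ 𝟎

  q^≋ : ∀ k → mono (power 1) ^ k ≋ mono (power k)
  q^≋ zero    = LR.refl
  q^≋ (suc k) = LR.trans (LR.*-congˡ {mono (power 1)} (q^≋ k)) (LR.trans (LR.sym (mono-⊛ (power 1) (power k)))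
    (LR.reflexive (≡.cong (λ l → mono (+ suc k ∷ l)) (⊕-identityˡ 𝟎))))

  X : Fin N → ℤ → L
  X v z = mono (+ 0 ∷ single v z)

  letter≋ : ∀ v j → mono (power 1) ^ j ⊛ X v (+ 1) ≋ mono (+ j ∷ single v (+ 1))
  letter≋ v j = LR.trans (LR.*-congʳ (q^≋ j)) (LR.trans (LR.sym (mono-⊛ (power j) (+ 0 ∷ single v (+ 1))))
    (LR.reflexive (≡.cong₂ (λ y l → mono (y ∷ l)) (ℤₚ.+-identityʳ (+ j)) (⊕-identityˡ (single v (+ 1))))))

  -- Taking the coefficient of q^k is itself a functional, so equality under all functionals implies
  -- equality of coefficients.
  coefficient≡ : ∀ k p → ev (map (λ { (c , e) → (c , power e) }) p) (λ m → if does (Vec.head m ℤ.≟ + k) then + 1 else + 0) ≡ coeff k p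
  coefficient≡ k []            = ≡.refl
  coefficient≡ k ((c , e) ∷ p) = ≡.cong₂ ℤ._+_ (head≡ (+ e ℤ.≟ + k) (k ℕ.≟ e)) (coefficient≡ k p)
    where
    head≡ : (d : Dec (+ e ≡ + k)) (d′ : Dec (k ≡ e)) → c ℤ.* (if does d then + 1 else + 0) ≡ (if does d′ then c else + 0)
    head≡ (yes _) (yes _) = ℤₚ.*-identityʳ c
    head≡ (yes p) (no ¬p) = contradiction (≡.sym (ℤₚ.+-injective p)) ¬p
    head≡ (no ¬p) (yes p) = contradiction (≡.cong +_ (≡.sym p)) ¬p
    head≡ (no _)  (no _)  = ℤₚ.*-zeroʳ c

  const : ℤ → L
  const c = (c , 𝟎) ∷ []

  open RingLemmas laurentRing using (∑)

  polynomial≋ : ∀ p → ∑ p (λ t → const (proj₁ t) ⊛ mono (power 1) ^ proj₂ t) ≋ map (λ { (c , e) → (c , power e) }) p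
  polynomial≋ []            = LR.refl
  polynomial≋ ((c , e) ∷ p) = ++-cong {g = ∑ p (λ t → const (proj₁ t) ⊛ mono (power 1) ^ proj₂ t)} (LR.trans (LR.*-congˡ {const c} (q^≋ e))
    (LR.reflexive (≡.cong₂ (λ d l → (d , l) ∷ []) (ℤₚ.*-identityʳ c) (⊕-identityˡ (power e))))) (polynomial≋ p)

  laurentSystem : LaurentSystem (Fin N)
  laurentSystem = record
    { R = laurentRing
    ; q = mono (power 1)
    ; qi = mono (-[1+ 0 ] ∷ 𝟎)
    ; q*qi = LR.trans (LR.sym (mono-⊛ (power 1) (-[1+ 0 ] ∷ 𝟎))) (LR.reflexive (≡.cong (λ l → mono (+ 0 ∷ l)) (⊕-identityˡ 𝟎)))
    ; X = X
    ; X-+ = λ v y z → LR.trans (LR.reflexive (≡.cong (λ l → mono (+ 0 ∷ l)) (single-⊕ v y z))) (mono-⊛ (+ 0 ∷ single v y) (+ 0 ∷ single v z))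
    ; X-0 = λ v → LR.reflexive (≡.cong (λ l → mono (+ 0 ∷ l)) (single-0 v))
    ; NonNeg = λ v → Supported (λ m → + 0 ℤ.≤ lookup m (suc v))
    ; Pos = λ v → Supported (λ m → + 0 ℤ.< lookup m (suc v))
    ; NonNeg-resp = Supported-resp
    ; NonNeg-1 = λ {v} → Supported-single (+ 1) (zero-≤ v)
    ; NonNeg-+ = λ {_} {f} {g} → Supported-++ {f = f} {g}
    ; NonNeg-* = λ {v} {f} {g} → Supported-⊛ {f = f} {g} (λ {m} {n} p p′ → ≡.subst (+ 0 ℤ.≤_) (≡.sym (lookup-⊕ (suc v) m n)) (ℤₚ.+-mono-≤ p p′))
    ; NonNeg-neg = λ {_} {f} → Supported-negate {f = f}
    ; NonNeg-q = λ {v} → Supported-single (+ 1) (zero-≤ v)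
    ; NonNeg-qi = λ {v} → Supported-single (+ 1) (zero-≤ v)
    ; NonNeg-X≢ = λ {v} {w} p z → Supported-single (+ 1) (ℤₚ.≤-reflexive (≡.sym (lookup-single-≢ p z)))
    ; Pos⇒NonNeg = λ {v} {f} → Supported-⊆ {f = f} ℤₚ.<⇒≤
    ; Pos-resp = Supported-resp
    ; Pos-0 = λ φ v → ≡.refl
    ; Pos-+ = λ {_} {f} {g} → Supported-++ {f = f} {g}
    ; Pos-* = λ {v} {f} {g} → Supported-⊛ {f = f} {g} (λ {m} {n} p p′ → ≡.subst (+ 0 ℤ.<_) (≡.sym (lookup-⊕ (suc v) m n)) (ℤₚ.+-mono-≤-< p p′))
    ; Pos-X = λ {v} n → Supported-single (+ 1) (≡.subst (+ 0 ℤ.<_) (≡.sym (lookup-single v (+ suc n))) (+<+ (ℕ.s≤s ℕ.z≤n)))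
    ; Const = Supported IsConst
    ; Const-0 = λ φ v → ≡.refl
    ; Const-1 = Supported-single (+ 1) ≡.refl
    ; Const-+ = λ {f} {g} → Supported-++ {f = f} {g}
    ; Const-* = λ {f} {g} → Supported-⊛ {f = f} {g} (λ {m} {n} p p′ → ≡.trans (tail-⊕ m n) (≡.trans (≡.cong₂ _⊕_ p p′) (⊕-identityˡ 𝟎)))
    ; Const-neg = λ {f} → Supported-negate {f = f}
    ; Const-q = Supported-single (+ 1) ≡.refl
    ; Const-qi = Supported-single (+ 1) ≡.refl
    ; ct = constantTerm
    ; ct-cong = constantTerm-cong
    ; ct-+ = constantTerm-++
    ; ct-* = λ {c} s f → constantTerm-⊛ {c} s f
    ; ct-Pos = λ {v} {f} → constantTerm-vanish {f = f} (λ {m} p c → ℤₚ.<⇒≢ p (≡.sym (IsConst-lookup {m} c v)))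
    ; regular-X = λ {v} {w} {j} {k} p → Regular-resp
        (LR.sym (LR.+-cong (letter≋ v j) (LR.-‿cong (letter≋ w k))))
        (regular-binomial {+ j ∷ single v (+ 1)} {+ k ∷ single w (+ 1)} (suc v)
          (λ e → one≢zero (≡.trans (≡.sym (lookup-single v (+ 1))) (≡.trans e (lookup-single-≢ p (+ 1))))))
    ; regular-q = λ {j} {k} p → Regular-resp (LR.sym (LR.+-cong (q^≋ j) (LR.-‿cong (q^≋ k))))
        (regular-binomial {power j} {power k} zero (p ∘ ℤₚ.+-injective))
    ; Degree = λ v z → Supported (λ m → lookup m (suc v) ≡ z)
    ; Degree-1 = λ {v} → Supported-single (+ 1) (Vecₚ.lookup-replicate v (+ 0))
    ; Degree-* = λ {v} {y} {z} {f} {g} → Supported-⊛ {f = f} {g} (λ {m} {n} p p′ → ≡.trans (lookup-⊕ (suc v) m n) (≡.cong₂ ℤ._+_ p p′))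
    ; Degree-X = λ v z → Supported-single (+ 1) (lookup-single v z)
    ; Degree-X≢ = λ p z → Supported-single (+ 1) (lookup-single-≢ p z)
    ; ct-Degree = λ {v} {z} {f} z≢0 → constantTerm-vanish {f = f} (λ {m} p c → z≢0 (≡.trans (≡.sym p) (IsConst-lookup {m} c v)))
    ; ct-1 = functionals λ φ → ≡.trans (ev-constantTerm (mono 𝟎) φ) (≡.cong (λ z → + 1 ℤ.* z ℤ.+ + 0) (restrict-yes φ {𝟎} ≡.refl))
    ; const = const
    ; const-1 = LR.refl
    ; const-neg = λ _ → LR.refl
    ; const-* = λ y z → LR.reflexive (≡.cong (λ l → (y ℤ.* z , l) ∷ []) (≡.sym (⊕-identityˡ 𝟎)))
    ; Const-const = λ z → Supported-single z ≡.refl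
    ; polynomial-injective = λ p p′ e k → ≡.trans (≡.sym (coefficient≡ k p))
        (≡.trans (at (LR.trans (LR.sym (polynomial≋ p)) (LR.trans e (polynomial≋ p′))) _) (coefficient≡ k p′))
    }
    where
    zero-≤ : ∀ (v : Fin N) → + 0 ℤ.≤ lookup {n = N} 𝟎 v
    zero-≤ v = ℤₚ.≤-reflexive (≡.sym (Vecₚ.lookup-replicate v (+ 0)))
    one≢zero : + 1 ≢ + 0
    one≢zero ()

-- Formal sums of the statement as ring elements

module Interpretation {V : Set} (S : LaurentSystem V) where
  open LaurentSystem S
  open RingLemmas R
  open CompleteSymmetric R
  open QPochhammer R q
  open ≈R

  monomialAt : List V → List ℤ → Carrier
  monomialAt []       _        = 1#
  monomialAt (x ∷ xs) []       = 1#
  monomialAt (x ∷ xs) (z ∷ zs) = X x z * monomialAt xs zs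

  module Variables (xs : List V) where

    n : ℕ
    n = length xs

    ⟦_⟧ₜ : LTerm → Carrier
    ⟦ c , e , m ⟧ₜ = (const c * q ^ e) * monomialAt xs m

    ⟦_⟧ : LPoly → Carrier
    ⟦ p ⟧ = ∑ p ⟦_⟧ₜ

    WellFormed : LPoly → Set
    WellFormed = All (λ t → length (proj₂ (proj₂ t)) ≡ n)

    -- With g the identity this covers products of terms, with g the negation the quotients x_i/x_j
    -- of the kernel.
    monomialAt-zipWith : ∀ (xs : List V) (_∙_ : ℤ → ℤ → ℤ) (g : ℤ → ℤ) → (∀ x y z → X x (y ∙ z) ≈ X x y * X x (g z)) →
      ∀ {m m′} → length m ≡ length m′ → monomialAt xs (zipWith _∙_ m m′) ≈ monomialAt xs m * monomialAt xs (map g m′)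
    monomialAt-zipWith []       _∙_ g H e = sym (*-identityˡ _)
    monomialAt-zipWith (x ∷ xs) _∙_ g H {[]}    {[]}      e = sym (*-identityˡ _)
    monomialAt-zipWith (x ∷ xs) _∙_ g H {y ∷ m} {z ∷ m′} e =
      trans (*-cong (H x y z) (monomialAt-zipWith xs _∙_ g H {m} {m′} (ℕₚ.suc-injective e)))
        (solve 4 (λ a b c d → (a ⊠ b) ⊠ (c ⊠ d) := (a ⊠ c) ⊠ (b ⊠ d)) refl _ _ _ _)

    ⟦⟧ₜ-* : ∀ c e m c′ e′ m′ → length m ≡ length m′ →
      ⟦ c ℤ.* c′ , e ℕ.+ e′ , zipWith ℤ._+_ m m′ ⟧ₜ ≈ ⟦ c , e , m ⟧ₜ * ⟦ c′ , e′ , m′ ⟧ₜ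
    ⟦⟧ₜ-* c e m c′ e′ m′ len = begin
      (const (c ℤ.* c′) * q ^ (e ℕ.+ e′)) * monomialAt xs (zipWith ℤ._+_ m m′)
        ≈⟨ *-cong (*-cong (const-* c c′) (^-homo-* q e e′))
             (trans (monomialAt-zipWith xs ℤ._+_ id X-+ len) (*-congˡ (reflexive (≡.cong (monomialAt xs) (Listₚ.map-id m′))))) ⟩
      ((const c * const c′) * (q ^ e * q ^ e′)) * (monomialAt xs m * monomialAt xs m′)
        ≈⟨ solve 6 (λ a b c d e f → ((a ⊠ b) ⊠ (c ⊠ d)) ⊠ (e ⊠ f) := ((a ⊠ c) ⊠ e) ⊠ ((b ⊠ d) ⊠ f)) refl _ _ _ _ _ _ ⟩
      ⟦ c , e , m ⟧ₜ * ⟦ c′ , e′ , m′ ⟧ₜ ∎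

    infix 4 _⊨_
    -- The length condition travels with the value because `zipWith` truncates: exponent vectors of
    -- unequal length would not multiply correctly.
    record _⊨_ (p : LPoly) (v : Carrier) : Set where
      constructor rep
      field
        wf    : WellFormed p
        value : ⟦ p ⟧ ≈ v
    open _⊨_ public

    ⊨-resp : ∀ {p v v′} → v ≈ v′ → p ⊨ v → p ⊨ v′
    ⊨-resp e (rep w s) = rep w (trans s e)

    ⊨-++ : ∀ {p p′ v v′} → p ⊨ v → p′ ⊨ v′ → (p ++ p′) ⊨ (v + v′)
    ⊨-++ {p} {p′} (rep w s) (rep w′ s′) = rep (Allₚ.++⁺ w w′) (trans (∑-++ p p′) (+-cong s s′))

    ⊨-* : ∀ {p p′ v v′} → p ⊨ v → p′ ⊨ v′ → (p *ₗ p′) ⊨ (v * v′)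
    ⊨-* {p} {p′} {v} {v′} (rep w s) (rep w′ s′) = rep (wf-* p w) (trans (sem-* p w) (*-cong s s′))
      where
      wf-* : ∀ p → WellFormed p → WellFormed (p *ₗ p′)
      wf-* []                []       = []
      wf-* ((c , e , m) ∷ p) (l ∷ ls) = Allₚ.++⁺ (Allₚ.map⁺ (All.map (λ l′ →
        ≡.trans (Listₚ.length-zipWith ℤ._+_ m _) (≡.trans (≡.cong₂ ℕ._⊓_ l l′) (ℕₚ.⊓-idem n))) w′)) (wf-* p ls)
      sem-* : ∀ p → WellFormed p → ⟦ p *ₗ p′ ⟧ ≈ ⟦ p ⟧ * ⟦ p′ ⟧
      sem-* []                []       = sym (zeroˡ _)
      sem-* ((c , e , m) ∷ p) (l ∷ ls) = begin
        ⟦ ((c , e , m) ∷ p) *ₗ p′ ⟧               ≈⟨ ∑-++ (map _ p′) (p *ₗ p′) ⟩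
        ⟦ map _ p′ ⟧ + ⟦ p *ₗ p′ ⟧                ≈⟨ +-cong (∑-map _ p′) (sem-* p ls) ⟩
        ∑ p′ (λ t → ⟦ c ℤ.* proj₁ t , e ℕ.+ proj₁ (proj₂ t) , zipWith ℤ._+_ m (proj₂ (proj₂ t)) ⟧ₜ) + ⟦ p ⟧ * ⟦ p′ ⟧
          ≈⟨ +-congʳ (trans (∑-cong p′ (λ {t} t∈ → ⟦⟧ₜ-* c e m _ _ _ (≡.trans l (≡.sym (All.lookup w′ t∈))))) (sym (*-∑ _ p′))) ⟩
        ⟦ c , e , m ⟧ₜ * ⟦ p′ ⟧ + ⟦ p ⟧ * ⟦ p′ ⟧  ≈⟨ distribʳ _ _ _ ⟨
        ⟦ (c , e , m) ∷ p ⟧ * ⟦ p′ ⟧              ∎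

    monomialAt-zero : ∀ (xs : List V) k → monomialAt xs (replicate k (+ 0)) ≈ 1#
    monomialAt-zero []       k       = refl
    monomialAt-zero (x ∷ xs) zero    = refl
    monomialAt-zero (x ∷ xs) (suc k) = trans (*-cong (X-0 x) (monomialAt-zero xs k)) (*-identityˡ 1#)

    ⊨-term : ∀ c e m → length m ≡ n → ((c , e , m) ∷ []) ⊨ ⟦ c , e , m ⟧ₜ
    ⊨-term c e m l = rep (l ∷ []) (+-identityʳ _)

    ⟦1⟧ₜ : ⟦ + 1 , 0 , zeroVec n ⟧ₜ ≈ 1#
    ⟦1⟧ₜ = trans (*-cong (trans (*-identityʳ _) const-1) (monomialAt-zero xs n)) (*-identityˡ 1#)

    ⊨-one : oneₗ n ⊨ 1#
    ⊨-one = ⊨-resp ⟦1⟧ₜ (⊨-term (+ 1) 0 (zeroVec n) (Listₚ.length-replicate n))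

    ⊨-prod : {A : Set} (L : List A) (P : A → LPoly) (f : A → Carrier) → (∀ {x} → x ∈ L → P x ⊨ f x) → prodₗ n (map P L) ⊨ ∏ L f
    ⊨-prod []      P f H = ⊨-one
    ⊨-prod (x ∷ L) P f H = ⊨-* (H (here ≡.refl)) (⊨-prod L P f (H ∘ there))

    ⊨-concatMap : {A : Set} (L : List A) (P : A → LPoly) (f : A → Carrier) → (∀ x → P x ⊨ f x) → concatMap P L ⊨ ∑ L f
    ⊨-concatMap []      P f H = rep [] refl
    ⊨-concatMap (x ∷ L) P f H = ⊨-++ (H x) (⊨-concatMap L P f H)

    ⊨-pow : ∀ {p v} k → p ⊨ v → powₗ n p k ⊨ v ^ k
    ⊨-pow zero    H = ⊨-one
    ⊨-pow (suc k) H = ⊨-* H (⊨-pow k H)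

    -- Reconciles the expansion in powers of the first letter, used by the statement, with the
    -- one-step recursion of `h`.
    h-sum : ∀ r y Y → ∑ (upTo (suc r)) (λ m → y ^ m * h (r ∸ m) Y) ≈ h r (y ∷ Y)
    h-sum zero    y Y = trans (+-identityʳ _) (*-identityˡ _)
    h-sum (suc r) y Y = begin
      1# * h (suc r) Y + ∑ (applyUpTo suc (suc r)) (λ m → y ^ m * h (suc r ∸ m) Y)
        ≈⟨ +-cong (*-identityˡ _) (trans (reflexive (≡.cong (λ L → ∑ L (λ m → y ^ m * h (suc r ∸ m) Y)) (≡.sym (Listₚ.map-upTo suc (suc r)))))
             (∑-map suc (upTo (suc r)))) ⟩
      h (suc r) Y + ∑ (upTo (suc r)) (λ m → (y * y ^ m) * h (r ∸ m) Y)
        ≈⟨ +-congˡ (trans (∑-cong (upTo (suc r)) (λ _ → *-assoc _ _ _)) (sym (*-∑ y (upTo (suc r))))) ⟩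
      h (suc r) Y + y * ∑ (upTo (suc r)) (λ m → y ^ m * h (r ∸ m) Y)   ≈⟨ +-congˡ (*-congˡ (h-sum r y Y)) ⟩
      h (suc r) Y + y * h r (y ∷ Y)                                    ∎

    ⊨-h : ∀ Y → WellFormed Y → ∀ r → hᵣ n r Y ⊨ h r (map ⟦_⟧ₜ Y)
    ⊨-h []                []       zero    = ⊨-one
    ⊨-h []                []       (suc r) = rep [] refl
    ⊨-h ((c , e , m) ∷ Y) (l ∷ ls) r = ⊨-resp (h-sum r _ _)
      (⊨-concatMap (upTo (suc r)) _ _ (λ k → ⊨-* (⊨-pow k (⊨-term c e m l)) (⊨-h Y ls (r ∸ k))))

    nth : ∀ (xs : List V) {i} → i ℕ.< length xs → V
    nth (x ∷ xs) {zero}  p         = x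
    nth (x ∷ xs) {suc i} (ℕ.s≤s p) = nth xs p

    spike : ℤ → ℕ → ℕ → ℤ
    spike z i k = if k ≡ᵇ i then z else + 0

    monomialAt-const0 : ∀ (xs : List V) k → monomialAt xs (applyUpTo (λ _ → + 0) k) ≈ 1#
    monomialAt-const0 []       k       = refl
    monomialAt-const0 (x ∷ xs) zero    = refl
    monomialAt-const0 (x ∷ xs) (suc k) = trans (*-cong (X-0 x) (monomialAt-const0 xs k)) (*-identityˡ 1#)

    monomialAt-spike : ∀ (xs : List V) z {i} (p : i ℕ.< length xs) → monomialAt xs (applyUpTo (spike z i) (length xs)) ≈ X (nth xs p) z
    monomialAt-spike (x ∷ xs) z {zero}  p         = trans (*-congˡ (monomialAt-const0 xs (length xs))) (*-identityʳ _)
    monomialAt-spike (x ∷ xs) z {suc i} (ℕ.s≤s p) = trans (*-cong (X-0 x) (monomialAt-spike xs z p)) (*-identityˡ _)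

    monomialAt-unitVec : ∀ {i} (p : i ℕ.< n) → monomialAt xs (unitVec n i) ≈ X (nth xs p) (+ 1)
    monomialAt-unitVec {i} p = trans (reflexive (≡.cong (monomialAt xs) (Listₚ.map-upTo (spike (+ 1) i) n))) (monomialAt-spike xs (+ 1) p)

    length-unitVec : ∀ i → length (unitVec n i) ≡ n
    length-unitVec i = ≡.trans (Listₚ.length-map (spike (+ 1) i) (upTo n)) (Listₚ.length-upTo n)

    monomialAt-quotient : ∀ {i j} (p : i ℕ.< n) (p′ : j ℕ.< n) →
      monomialAt xs (zipWith ℤ._-_ (unitVec n i) (unitVec n j)) ≈ X (nth xs p) (+ 1) * X (nth xs p′) -[1+ 0 ]
    monomialAt-quotient {i} {j} p p′ = trans
      (monomialAt-zipWith xs ℤ._-_ (λ z → ℤ.- z) (λ x y z → X-+ x y (ℤ.- z)) {unitVec n i} {unitVec n j} (≡.trans (length-unitVec i) (≡.sym (length-unitVec j))))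
      (*-cong (monomialAt-unitVec p) (trans (reflexive (≡.cong (monomialAt xs)
        (≡.trans (≡.sym (Listₚ.map-∘ (upTo n))) (≡.trans (Listₚ.map-cong negSpike (upTo n)) (Listₚ.map-upTo (spike -[1+ 0 ] j) n)))))
        (monomialAt-spike xs -[1+ 0 ] p′)))
      where
      negSpike : ∀ k → ℤ.- spike (+ 1) j k ≡ spike -[1+ 0 ] j k
      negSpike k with k ≡ᵇ j
      ... | true  = ≡.refl
      ... | false = ≡.refl

    ⊨-pochX : ∀ s {i j} (p : i ℕ.< n) (p′ : j ℕ.< n) k →
      pochX n s i j k ⊨ poch (q ^ s * (X (nth xs p) (+ 1) * X (nth xs p′) -[1+ 0 ])) k
    ⊨-pochX s {i} {j} p p′ k = ⊨-resp (poch-∏ k _) (⊨-prod (upTo k) _ _ (λ {t} _ → ⊨-resp (+-cong ⟦1⟧ₜ (factor t))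
      (⊨-++ (⊨-term (+ 1) 0 (zeroVec n) (Listₚ.length-replicate n)) (⊨-term (ℤ.- + 1) (s ℕ.+ t) _
        (≡.trans (Listₚ.length-zipWith ℤ._-_ (unitVec n i) (unitVec n j)) (≡.trans (≡.cong₂ ℕ._⊓_ (length-unitVec i) (length-unitVec j)) (ℕₚ.⊓-idem n)))))))
      where
      z : Carrier
      z = X (nth xs p) (+ 1) * X (nth xs p′) -[1+ 0 ]
      factor : ∀ t → ⟦ ℤ.- + 1 , s ℕ.+ t , zipWith ℤ._-_ (unitVec n i) (unitVec n j) ⟧ₜ ≈ - (q ^ t * (q ^ s * z))
      factor t = trans (*-cong (*-cong (trans (const-neg (+ 1)) (-‿cong const-1)) (^-homo-* q s t)) (monomialAt-quotient p p′))
        (solve 3 (λ a b z → ((⊖ 𝟙) ⊠ (a ⊠ b)) ⊠ z := ⊖ (b ⊠ (a ⊠ z))) refl _ _ _)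

    monomialAt-Degree-≢ : ∀ {v} {ys : List V} → All (v ≢_) ys → ∀ m → Degree v (+ 0) (monomialAt ys m)
    monomialAt-Degree-≢ []       m       = Degree-1
    monomialAt-Degree-≢ (p ∷ ps) []      = Degree-1
    monomialAt-Degree-≢ (p ∷ ps) (z ∷ m) = Degree-* (Degree-X≢ p z) (monomialAt-Degree-≢ ps m)

    record NonzeroDegree (ys : List V) (f : Carrier) : Set where
      constructor nonzeroDegree
      field
        {variable′} : V
        variable∈   : variable′ ∈ ys
        {degree}    : ℤ
        degree≢0    : degree ≢ + 0
        hasDegree   : Degree variable′ degree f

    -- The variables are distinct, so a nonzero exponent cannot be compensated by another entry: it
    -- gives a nonzero degree in its variable, and the term has no constant term.
    isZeroVec-cases : ∀ {ys : List V} → Unique ys → ∀ m → length m ≡ length ys →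
      if isZeroVec m then monomialAt ys m ≈ 1# else NonzeroDegree ys (monomialAt ys m)
    isZeroVec-cases []       []      l = refl
    isZeroVec-cases {x ∷ ys} (p ∷ ps) (z ∷ m) l with z ℤ.≟ + 0
    ... | no z≢0 = nonzeroDegree (here ≡.refl) z≢0
      (≡.subst (λ y → Degree x y (X x z * monomialAt ys m)) (ℤₚ.+-identityʳ z) (Degree-* (Degree-X _ z) (monomialAt-Degree-≢ p m)))
    ... | yes ≡.refl with isZeroVec m | isZeroVec-cases ps m (ℕₚ.suc-injective l)
    ...   | true  | e = trans (*-cong (X-0 _) e) (*-identityˡ 1#)
    ...   | false | nonzeroDegree v∈ z≢0 d = nonzeroDegree (there v∈) z≢0
      (≡.subst (λ y → Degree _ y (X x (+ 0) * monomialAt ys m)) (ℤₚ.+-identityˡ _) (Degree-* (Degree-X≢ (λ e → All.lookup p v∈ (≡.sym e)) (+ 0)) d))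

    Const-q^ : ∀ e → Const (q ^ e)
    Const-q^ zero    = Const-1
    Const-q^ (suc e) = Const-* Const-q (Const-q^ e)

    ct-⟦⟧ₜ : ∀ c e m → ct ⟦ c , e , m ⟧ₜ ≈ (const c * q ^ e) * ct (monomialAt xs m)
    ct-⟦⟧ₜ c e m = ct-* (Const-* (Const-const c) (Const-q^ e)) _

    ct-⟦⟧ : Unique xs → ∀ p → WellFormed p → polynomial (CT p) ≈ ct ⟦ p ⟧
    ct-⟦⟧ u []                []       = sym (begin
      ct 0#                                 ≈⟨ ct-cong (zeroˡ 0#) ⟨
      ct (0# * 0#)                          ≈⟨ ct-* Const-0 0# ⟩
      0# * ct 0#                            ≈⟨ zeroˡ _ ⟩
      0#                                                    ∎)
    ct-⟦⟧ u ((c , e , m) ∷ p) (l ∷ ls) with isZeroVec m | isZeroVec-cases u m l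
    ... | true  | m≈1 = begin
      const c * q ^ e + polynomial (CT p)              ≈⟨ +-cong (*-identityʳ _) refl ⟨
      (const c * q ^ e) * 1# + polynomial (CT p)       ≈⟨ +-cong (*-congˡ (trans (ct-cong m≈1) ct-1)) refl ⟨
      (const c * q ^ e) * ct (monomialAt xs m) + polynomial (CT p) ≈⟨ +-cong (sym (ct-⟦⟧ₜ c e m)) (ct-⟦⟧ u p ls) ⟩
      ct ⟦ c , e , m ⟧ₜ + ct ⟦ p ⟧ ≈⟨ ct-+ _ _ ⟨
      ct (⟦ c , e , m ⟧ₜ + ⟦ p ⟧)           ∎
    ... | false | nonzeroDegree _ z≢0 d = begin
      polynomial (CT p)                                ≈⟨ +-identityˡ _ ⟨
      0# + polynomial (CT p)                           ≈⟨ +-congʳ (trans (*-congˡ (ct-Degree z≢0 d)) (zeroʳ _)) ⟨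
      (const c * q ^ e) * ct (monomialAt xs m) + polynomial (CT p) ≈⟨ +-cong (sym (ct-⟦⟧ₜ c e m)) (ct-⟦⟧ u p ls) ⟩
      ct ⟦ c , e , m ⟧ₜ + ct ⟦ p ⟧ ≈⟨ ct-+ _ _ ⟨
      ct (⟦ c , e , m ⟧ₜ + ⟦ p ⟧)           ∎

-- Identifying `D` with the constant term of a list of items

record Entry (V : Set) : Set where
  constructor mkEntry
  field
    variable′ : V
    part      : ℕ
    exponent  : ℤ
open Entry

firstItem secondItem : {V : Set} → Entry V → Item V
firstItem  (mkEntry x a v) = mkItem x (a ∸ 1) v true
secondItem (mkEntry x a v) = mkItem x a v false

alphabetOf : ℕ → ℕ → List ℕ → List LTerm
alphabetOf n n0 a = concatMap (λ i → map (λ k → (+ 1 , k , unitVec n i)) (upTo (nthD 0 a i ∸ chi n0 i))) (upTo n)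

kernelOf : ℕ → ℕ → List ℕ → LPoly
kernelOf n n0 a = prodₗ n (map (λ { (i , j) → pochX n 0 i j (nthD 0 a i ∸ chi n0 i) *ₗ pochX n 1 j i (nthD 0 a j ∸ chi n0 i) }) (pairsLt n))

-- D with the number of variables decoupled from length a, so that the former
-- can be rewritten.
DOf : ℕ → List ℤ → List ℕ → List ℕ → ℕ → Poly
DOf n v lam a n0 = CT (((+ 1 , 0 , map ℤ.-_ v) ∷ []) *ₗ (hλ n lam (alphabetOf n n0 a) *ₗ kernelOf n n0 a))

module DysonInterpretation {V : Set} (S : LaurentSystem V) (v₀ : V) where
  open LaurentSystem S
  open RingLemmas R
  open CompleteSymmetric R
  open QPochhammer R q
  open DysonProduct S
  open Interpretation S
  open ≈R

  default : Entry V
  default = mkEntry v₀ 0 (+ 0)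

  entryAt : List (Entry V) → ℕ → Entry V
  entryAt = nthD default

  itemAt : ℕ → List (Entry V) → ℕ → Item V
  itemAt n0 Z i = mkItem (variable′ z) (part z ∸ chi n0 i) (exponent z) (i <ᵇ n0)
    where z = entryAt Z i

  itemAt-first-second : ∀ ZF ZS → map (itemAt (length ZF) (ZF ++ ZS)) (upTo (length (ZF ++ ZS))) ≡ map firstItem ZF ++ map secondItem ZS
  itemAt-first-second ZF ZS = ≡.trans (Listₚ.map-upTo _ (length (ZF ++ ZS))) (go ZF)
    where
    seconds : ∀ Z → applyUpTo (itemAt 0 Z) (length Z) ≡ map secondItem Z
    seconds []      = ≡.refl
    seconds (z ∷ Z) = ≡.cong (secondItem z ∷_) (seconds Z)
    go : ∀ ZF → applyUpTo (itemAt (length ZF) (ZF ++ ZS)) (length (ZF ++ ZS)) ≡ map firstItem ZF ++ map secondItem ZS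
    go []       = seconds ZS
    go (z ∷ ZF) = ≡.cong (firstItem z ∷_) (go ZF)

  nthD-part : ∀ Z i → nthD 0 (map part Z) i ≡ part (entryAt Z i)
  nthD-part []      i       = ≡.refl
  nthD-part (z ∷ Z) zero    = ≡.refl
  nthD-part (z ∷ Z) (suc i) = nthD-part Z i

  -- The kernel shortens the exponent of the later index by χ(i ≤ n_0), the item by χ(j ≤ n_0). As i
  -- precedes j, the discrepancy is one for a mixed pair and zero otherwise.
  ∧-not-∸ : ∀ {i j} → i ℕ.< j → ∀ n0 x → x ∸ chi n0 i ≡ (x ∸ chi n0 j) ∸ (if (i <ᵇ n0) ∧ not (j <ᵇ n0) then 1 else 0)
  ∧-not-∸ {i} {j} i<j n0 x with i <ᵇ n0 in eq | j <ᵇ n0 in eq′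
  ... | true  | true  = ≡.refl
  ... | true  | false = ≡.refl
  ... | false | false = ≡.refl
  ... | false | true  = contradiction (≡.trans (≡.sym (T⇒≡ (ℕₚ.<⇒<ᵇ (ℕₚ.<-trans i<j (ℕₚ.<ᵇ⇒< j n0 (≡.subst Bool.T (≡.sym eq′) tt)))))) eq) λ ()
    where
    T⇒≡ : ∀ {b} → Bool.T b → b ≡ true
    T⇒≡ {true} _ = ≡.refl

  pairsLt-suc : ∀ n → pairsLt (suc n) ≡ pairsLt n ++ map (_, n) (upTo n)
  pairsLt-suc n = ≡.trans (≡.cong (concatMap _) (≡.sym (Listₚ.upTo-∷ʳ n)))
    (≡.trans (Listₚ.concatMap-++ (λ j → map (_, j) (upTo j)) (upTo n) (n ∷ [])) (≡.cong (pairsLt n ++_) (Listₚ.++-identityʳ _)))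

  ∈-pairsLt : ∀ n {i j} → (i , j) ∈ pairsLt n → (i ℕ.< j) × (j ℕ.< n)
  ∈-pairsLt (suc n) ij∈ with ∈-++⁻ (pairsLt n) (≡.subst (_ ∈_) (pairsLt-suc n) ij∈)
  ... | inj₁ ij∈′ = proj₁ (∈-pairsLt n ij∈′) , ℕₚ.m<n⇒m<1+n (proj₂ (∈-pairsLt n ij∈′))
  ... | inj₂ ij∈′ with ∈-map⁻ (_, n) ij∈′
  ...   | i , i∈ , ≡.refl = ∈-upTo⁻ i∈ , ℕₚ.n<1+n n

  -- `pairsLt` groups the pairs by their larger index, `dysonKernel` by the smaller one. Appending
  -- an item at the end translates between the two orders.
  kernel-snoc : ∀ ds d → dysonKernel (ds ++ d ∷ []) ≈ dysonKernel ds * ∏ ds (λ l → pair l d)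
  kernel-snoc []       d = refl
  kernel-snoc (x ∷ ds) d = trans (*-cong (∏-++ ds (d ∷ [])) (kernel-snoc ds d))
    (solve 4 (λ a b k p → (a ⊠ (b ⊠ 𝟙)) ⊠ (k ⊠ p) := (a ⊠ k) ⊠ (b ⊠ p)) refl _ _ _ _)

  kernel-pairsLt : ∀ (it : ℕ → Item V) n → ∏ (pairsLt n) (λ ij → pair (it (proj₁ ij)) (it (proj₂ ij))) ≈ dysonKernel (map it (upTo n))
  kernel-pairsLt it zero    = refl
  kernel-pairsLt it (suc n) = begin
    ∏ (pairsLt (suc n)) P                                  ≡⟨ ≡.cong (λ L → ∏ L P) (pairsLt-suc n) ⟩
    ∏ (pairsLt n ++ map (_, n) (upTo n)) P                 ≈⟨ ∏-++ (pairsLt n) _ ⟩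
    ∏ (pairsLt n) P * ∏ (map (_, n) (upTo n)) P            ≈⟨ *-cong (kernel-pairsLt it n) (trans (∏-map (_, n) (upTo n)) (sym (∏-map it (upTo n)))) ⟩
    dysonKernel (map it (upTo n)) * ∏ (map it (upTo n)) (λ l → pair l (it n)) ≈⟨ kernel-snoc (map it (upTo n)) (it n) ⟨
    dysonKernel (map it (upTo n) ++ it n ∷ [])                  ≡⟨ ≡.cong dysonKernel (≡.trans (≡.sym (Listₚ.map-++ it (upTo n) (n ∷ []))) (≡.cong (map it) (Listₚ.upTo-∷ʳ n))) ⟩
    dysonKernel (map it (upTo (suc n)))                         ∎
    where
    P : ℕ × ℕ → Carrier
    P ij = pair (it (proj₁ ij)) (it (proj₂ ij))

  module _ (Z : List (Entry V)) (n0 : ℕ) where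
    private
      xs : List V
      xs = map variable′ Z
      a : List ℕ
      a = map part Z
      it : ℕ → Item V
      it = itemAt n0 Z
    open Variables xs

    nth-variable : ∀ Z {i} (p : i ℕ.< length (map variable′ Z)) → nth (map variable′ Z) p ≡ variable′ (entryAt Z i)
    nth-variable (z ∷ Z) {zero}  p         = ≡.refl
    nth-variable (z ∷ Z) {suc i} (ℕ.s≤s p) = nth-variable Z p

    ⊨-kernel : kernelOf n n0 a ⊨ dysonKernel (map it (upTo n))
    ⊨-kernel = ⊨-resp (kernel-pairsLt it n) (⊨-prod (pairsLt n) _ _ (λ {ij} ij∈ → factor (proj₂ (∈-pairsLt n ij∈)) (proj₁ (∈-pairsLt n ij∈))))
      where
      factor : ∀ {i j} → j ℕ.< n → i ℕ.< j →
        (pochX n 0 i j (nthD 0 a i ∸ chi n0 i) *ₗ pochX n 1 j i (nthD 0 a j ∸ chi n0 i)) ⊨ pair (it i) (it j)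
      factor {i} {j} j<n i<j = ⊨-resp (*-cong eq₁ eq₂) (⊨-* (⊨-pochX 0 i<n j<n (nthD 0 a i ∸ chi n0 i)) (⊨-pochX 1 j<n i<n (nthD 0 a j ∸ chi n0 i)))
        where
        i<n : i ℕ.< n
        i<n = ℕₚ.<-trans i<j j<n
        ratio≡ : ∀ {i j} (p : i ℕ.< n) (p′ : j ℕ.< n) → X (nth xs p) (+ 1) * X (nth xs p′) -[1+ 0 ] ≡ ratio (it i) (it j)
        ratio≡ p p′ = ≡.cong₂ (λ x y → X x (+ 1) * X y -[1+ 0 ]) (nth-variable Z p) (nth-variable Z p′)
        eq₁ : poch (q ^ 0 * (X (nth xs i<n) (+ 1) * X (nth xs j<n) -[1+ 0 ])) (nthD 0 a i ∸ chi n0 i) ≈ poch (ratio (it i) (it j)) (size (it i))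
        eq₁ = trans (reflexive (≡.cong (λ k → poch (q ^ 0 * (X (nth xs i<n) (+ 1) * X (nth xs j<n) -[1+ 0 ])) (k ∸ chi n0 i)) (nthD-part Z i)))
          (poch-cong (size (it i)) (trans (*-identityˡ _) (reflexive (ratio≡ i<n j<n))))
        eq₂ : poch (q ^ 1 * (X (nth xs j<n) (+ 1) * X (nth xs i<n) -[1+ 0 ])) (nthD 0 a j ∸ chi n0 i)
          ≈ poch (q * ratio (it j) (it i)) (size (it j) ∸ χ (it i) (it j))
        eq₂ = trans (reflexive (≡.cong (poch (q ^ 1 * (X (nth xs j<n) (+ 1) * X (nth xs i<n) -[1+ 0 ])))
            (≡.trans (≡.cong (_∸ chi n0 i) (nthD-part Z j)) (∧-not-∸ i<j n0 (part (entryAt Z j))))))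
          (poch-cong (size (it j) ∸ χ (it i) (it j)) (*-cong (*-identityʳ q) (reflexive (ratio≡ j<n i<n))))

    -- The alphabet as pairs of indices, so that each letter can carry the bound on i under which
    -- its variable is defined.
    cells : List (ℕ × ℕ)
    cells = concatMap (λ i → map (i ,_) (upTo (nthD 0 a i ∸ chi n0 i))) (upTo n)

    cells-map : {A : Set} (g : ℕ → ℕ → A) → map (λ c → g (proj₁ c) (proj₂ c)) cells ≡ concatMap (λ i → map (g i) (upTo (nthD 0 a i ∸ chi n0 i))) (upTo n)
    cells-map g = ≡.trans (Listₚ.map-concatMap _ (λ i → map (i ,_) (upTo (nthD 0 a i ∸ chi n0 i))) (upTo n))
      (Listₚ.concatMap-cong (λ i → ≡.sym (Listₚ.map-∘ (upTo (nthD 0 a i ∸ chi n0 i)))) (upTo n))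

    cells-bound : ∀ {c} → c ∈ cells → proj₁ c ℕ.< n
    cells-bound c∈ = All.lookup (all (upTo n) (All.tabulate ∈-upTo⁻)) c∈
      where
      all : ∀ L → All (ℕ._< n) L → All (λ c → proj₁ c ℕ.< n) (concatMap (λ i → map (i ,_) (upTo (nthD 0 a i ∸ chi n0 i))) L)
      all []      []       = []
      all (i ∷ L) (p ∷ ps) = Allₚ.++⁺ (Allₚ.map⁺ (All.universal (λ _ → p) (upTo (nthD 0 a i ∸ chi n0 i)))) (all L ps)

    alphabet-wf : WellFormed (alphabetOf n n0 a)
    alphabet-wf = ≡.subst WellFormed (cells-map (λ i k → (+ 1 , k , unitVec n i)))
      (Allₚ.map⁺ (All.universal (λ c → length-unitVec (proj₁ c)) cells))

    h-alphabet : ∀ r → h r (map ⟦_⟧ₜ (alphabetOf n n0 a)) ≈ h r (letters (map it (upTo n)))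
    h-alphabet r = begin
      h r (map ⟦_⟧ₜ (alphabetOf n n0 a))
        ≡⟨ ≡.cong (λ Y → h r (map ⟦_⟧ₜ Y)) (≡.sym (cells-map (λ i k → (+ 1 , k , unitVec n i)))) ⟩
      h r (map ⟦_⟧ₜ (map (λ c → (+ 1 , proj₂ c , unitVec n (proj₁ c))) cells)) ≡⟨ ≡.cong (h r) (≡.sym (Listₚ.map-∘ cells)) ⟩
      h r (map (λ c → ⟦ + 1 , proj₂ c , unitVec n (proj₁ c) ⟧ₜ) cells)         ≈⟨ h-map-cong cells (λ {c} c∈ → letter≈ c (cells-bound c∈)) r ⟩
      h r (map (λ c → q ^ proj₂ c * X (var (it (proj₁ c))) (+ 1)) cells)       ≡⟨ ≡.cong (h r) (cells-map (λ i k → q ^ k * X (var (it i)) (+ 1))) ⟩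
      h r (concatMap (λ i → map (λ k → q ^ k * X (var (it i)) (+ 1)) (upTo (nthD 0 a i ∸ chi n0 i))) (upTo n))
        ≡⟨ ≡.cong (h r) (Listₚ.concatMap-cong (λ i → ≡.cong (λ s → map (λ k → q ^ k * X (var (it i)) (+ 1)) (upTo (s ∸ chi n0 i))) (nthD-part Z i)) (upTo n)) ⟩
      h r (concatMap (λ i → map (λ k → q ^ k * X (var (it i)) (+ 1)) (upTo (size (it i)))) (upTo n))
        ≡⟨ ≡.cong (h r) (≡.sym (Listₚ.concatMap-map (λ d → map (λ k → q ^ k * X (var d) (+ 1)) (upTo (size d))) it (upTo n))) ⟩
      h r (letters (map it (upTo n)))                                           ∎
      where
      letter≈ : ∀ c → proj₁ c ℕ.< n → ⟦ + 1 , proj₂ c , unitVec n (proj₁ c) ⟧ₜ ≈ q ^ proj₂ c * X (var (it (proj₁ c))) (+ 1)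
      letter≈ (i , k) p = *-cong (trans (*-congʳ const-1) (*-identityˡ _))
        (trans (monomialAt-unitVec p) (reflexive (≡.cong (λ x → X x (+ 1)) (nth-variable Z p))))

    ⊨-hh : ∀ lam → hλ n lam (alphabetOf n n0 a) ⊨ hh lam (letters (map it (upTo n)))
    ⊨-hh lam = ⊨-prod lam _ _ (λ {r} _ → ⊨-resp (h-alphabet r) (⊨-h (alphabetOf n n0 a) alphabet-wf r))

    ⊨-monomial : ((+ 1 , 0 , map ℤ.-_ (map exponent Z)) ∷ []) ⊨ ∏ Z (λ z → X (variable′ z) (ℤ.- exponent z))
    ⊨-monomial = ⊨-resp (trans (*-cong (trans (*-identityʳ _) const-1) (collect Z)) (*-identityˡ _))
      (⊨-term (+ 1) 0 (map ℤ.-_ (map exponent Z))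
        (≡.trans (Listₚ.length-map ℤ.-_ (map exponent Z)) (≡.trans (Listₚ.length-map exponent Z) (≡.sym (Listₚ.length-map variable′ Z)))))
      where
      collect : ∀ Z → monomialAt (map variable′ Z) (map ℤ.-_ (map exponent Z)) ≈ ∏ Z (λ z → X (variable′ z) (ℤ.- exponent z))
      collect []      = refl
      collect (z ∷ Z) = *-congˡ (collect Z)

    polynomial-DOf : Unique xs → ∀ lam → polynomial (DOf n (map exponent Z) lam a n0)
      ≈ ct (∏ Z (λ z → X (variable′ z) (ℤ.- exponent z)) * (hh lam (letters (map it (upTo n))) * dysonKernel (map it (upTo n))))
    polynomial-DOf u lam = trans (ct-⟦⟧ u _ (wf all)) (ct-cong (value all))
      where all = ⊨-* ⊨-monomial (⊨-* (⊨-hh lam) ⊨-kernel)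

  polynomial-D : ∀ ZF ZS → Unique (map variable′ (ZF ++ ZS)) → ∀ lam →
    polynomial (D (map exponent (ZF ++ ZS)) lam (map part (ZF ++ ZS)) (length ZF)) ≈ 𝔇 (map firstItem ZF ++ map secondItem ZS) lam
  polynomial-D ZF ZS u lam = begin
    polynomial (DOf (length (map part Z)) (map exponent Z) lam (map part Z) n0)
      ≡⟨ ≡.cong (λ n → polynomial (DOf n (map exponent Z) lam (map part Z) n0)) (≡.trans (Listₚ.length-map part Z) (≡.sym (Listₚ.length-map variable′ Z))) ⟩
    polynomial (DOf (length (map variable′ Z)) (map exponent Z) lam (map part Z) n0)   ≈⟨ polynomial-DOf Z n0 u lam ⟩
    ct (∏ Z (λ z → X (variable′ z) (ℤ.- exponent z)) * (hh lam (letters ds) * dysonKernel ds))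
      ≡⟨ ≡.cong (λ ds → ct (∏ Z (λ z → X (variable′ z) (ℤ.- exponent z)) * (hh lam (letters ds) * dysonKernel ds))) ds≡ ⟩
    ct (∏ Z (λ z → X (variable′ z) (ℤ.- exponent z)) * (hh lam (letters ds′) * dysonKernel ds′))
      ≈⟨ ct-cong (*-congʳ monomial≈) ⟩
    𝔇 ds′ lam                                                ∎
    where
    Z = ZF ++ ZS
    n0 = length ZF
    ds ds′ : List (Item V)
    ds  = map (itemAt n0 Z) (upTo (length (map variable′ Z)))
    ds′ = map firstItem ZF ++ map secondItem ZS
    ds≡ : ds ≡ ds′
    ds≡ = ≡.trans (≡.cong (λ n → map (itemAt n0 Z) (upTo n)) (Listₚ.length-map variable′ Z)) (itemAt-first-second ZF ZS)
    monomial≈ : ∏ Z (λ z → X (variable′ z) (ℤ.- exponent z)) ≈ monomial ds′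
    monomial≈ = trans (∏-++ ZF ZS) (sym (trans (∏-++ (map firstItem ZF) (map secondItem ZS)) (*-cong (∏-map firstItem ZF) (∏-map secondItem ZS))))

-- Distinguished entries of a concatenation

module FociLemmas {A : Set} where
  open Focus

  appendAfter prependBefore : List A → Focus A → Focus A
  appendAfter   ys f = focus (before f) (item f) (after f ++ ys)
  prependBefore xs f = focus (xs ++ before f) (item f) (after f)

  foci-++ : ∀ (xs ys : List A) → foci (xs ++ ys) ≡ map (appendAfter ys) (foci xs) ++ map (prependBefore xs) (foci ys)
  foci-++ []       ys = ≡.sym (Listₚ.map-id (foci ys))
  foci-++ (x ∷ xs) ys = ≡.cong (focus [] x (xs ++ ys) ∷_) (≡.trans (≡.cong (map (push x)) (foci-++ xs ys))
    (≡.trans (Listₚ.map-++ (push x) (map (appendAfter ys) (foci xs)) _)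
      (≡.cong₂ _++_ (≡.trans (≡.sym (Listₚ.map-∘ (foci xs))) (Listₚ.map-∘ (foci xs))) (≡.sym (Listₚ.map-∘ (foci ys))))))

  item∈ : ∀ {xs : List A} {f} → f ∈ foci xs → item f ∈ xs
  item∈ {xs} f∈ = ≡.subst (_ ∈_) (foci-item xs) (∈-map⁺ item f∈)

  after⊆ : ∀ {xs : List A} {f} → f ∈ foci xs → ∀ {l} → l ∈ after f → l ∈ xs
  after⊆ {f = f} f∈ l∈ = ≡.subst (_ ∈_) (≡.sym (foci-split f∈)) (∈-++⁺ʳ (before f) (there l∈))

  rest⊆ : ∀ {xs : List A} {f} → f ∈ foci xs → ∀ {l} → l ∈ rest f → l ∈ xs
  rest⊆ {f = f} f∈ l∈ with ∈-++⁻ (before f) l∈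
  ... | inj₁ p = ≡.subst (_ ∈_) (≡.sym (foci-split f∈)) (∈-++⁺ˡ p)
  ... | inj₂ p = after⊆ f∈ p

  All-rest : ∀ {P : A → Set} {xs f} → f ∈ foci xs → All P xs → All P (rest f)
  All-rest f∈ ps = All.tabulate (λ l∈ → All.lookup ps (rest⊆ f∈ l∈))

  length-rest : ∀ {xs : List A} {f} → f ∈ foci xs → length xs ≡ suc (length (rest f))
  length-rest {f = f} f∈ = ≡.trans (≡.cong length (foci-split f∈)) (≡.trans (Listₚ.length-++ (before f))
    (≡.trans (ℕₚ.+-suc (length (before f)) _) (≡.cong suc (≡.sym (Listₚ.length-++ (before f))))))

  AllPairs-drop : ∀ {R : A → A → Set} (xs : List A) {d ys} → AllPairs R (xs ++ d ∷ ys) → AllPairs R (xs ++ ys)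
  AllPairs-drop []       (_ ∷ ps) = ps
  AllPairs-drop (x ∷ xs) (p ∷ ps) = Allₚ.++⁺ (Allₚ.++⁻ˡ xs p) (All.tail (Allₚ.++⁻ʳ xs p)) ∷ AllPairs-drop xs ps

-- The recursion for removals from one block

module ClosedForms {V : Set} (S : LaurentSystem V) (_≟_ : DecidableEquality V) (F : FractionExtension (LaurentSystem.R S)) where
  open LaurentSystem S
  module R where
    open RingLemmas R public
    open CompleteSymmetric R public
    open QPochhammer R q public
  open R using (Carrier; _≈_)
  open DysonProduct S
  open DysonStep S _≟_ hiding (u; w)
  open FractionExtension F renaming (T to TR)
  module T where
    open RingLemmas TR public
    open CompleteSymmetric TR public
    open QPochhammer TR (embed q) public
  open T using () renaming (Carrier to Fraction; _≈_ to _≃_)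
  open T.≈R
  open Focus
  open FociLemmas

  embed-^ : ∀ x n → embed (x R.^ n) ≃ embed x T.^ n
  embed-^ x zero    = embed-1
  embed-^ x (suc n) = T.trans (embed-* x (x R.^ n)) (T.*-congˡ {embed x} (embed-^ x n))

  embed-1- : ∀ z → embed (R.1# R.+ R.- z) ≃ T.1# T.+ T.- embed z
  embed-1- z = T.trans (embed-+ R.1# (R.- z)) (T.+-cong embed-1 (embed-neg z))

  embed-poch : ∀ z n → embed (R.poch z n) ≃ T.poch (embed z) n
  embed-poch z zero    = embed-1
  embed-poch z (suc n) = T.trans (embed-* _ _) (T.*-cong (embed-1- z) (T.trans (embed-poch (q R.* z) n) (T.poch-cong n (embed-* q z))))

  embed-∑ : {A : Set} (xs : List A) {f : A → Carrier} → embed (R.∑ xs f) ≃ T.∑ xs (embed ∘ f)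
  embed-∑ []       = embed-0
  embed-∑ (x ∷ xs) {f} = T.trans (embed-+ (f x) _) (T.+-congˡ {embed (f x)} (embed-∑ xs))

  regular-1-q^ : ∀ m → R.Regular (R.1# R.+ R.- (q R.^ suc m))
  regular-1-q^ m = regular-q {0} {suc m} λ ()

  inv : ℕ → Fraction
  -- A default value: 1 - q^0 vanishes and has no reciprocal, and `inv-law` speaks of positive
  -- arguments only.
  inv zero    = T.1#
  inv (suc m) = reciprocal (R.1# R.+ R.- (q R.^ suc m)) (regular-1-q^ m)

  inv-law : ∀ m → (T.1# T.+ T.- (embed q T.^ suc m)) T.* inv (suc m) ≃ T.1#
  inv-law m = T.trans (T.*-congʳ (T.sym (T.trans (embed-1- (q R.^ suc m)) (T.+-congˡ {T.1#} (T.-‿cong (embed-^ q (suc m)))))))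
    (reciprocal-inverse (R.1# R.+ R.- (q R.^ suc m)) (regular-1-q^ m))

  G : ℕ → ℕ → Fraction
  G n b = embed (R.h n (R.geometric b))

  G-zero : ∀ n → G (suc n) 0 ≃ T.0#
  G-zero n = embed-0

  G-suc : ∀ n m → T.poch (embed q) n T.* T.poch (embed q) m T.* G n (suc m) ≃ T.poch (embed q) (n ℕ.+ m)
  G-suc n m = begin
    T.poch (embed q) n T.* T.poch (embed q) m T.* G n (suc m)
      ≈⟨ T.*-congʳ (T.trans (embed-* (R.poch q n) (R.poch q m)) (T.*-cong (embed-poch q n) (embed-poch q m))) ⟨
    embed (R.poch q n R.* R.poch q m) T.* G n (suc m)                  ≈⟨ embed-* _ _ ⟨
    embed (R.poch q n R.* R.poch q m R.* R.h n (R.geometric (suc m)))  ≈⟨ embed-cong (R.h-geometric n m) ⟩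
    embed (R.poch q (n ℕ.+ m))                                         ≈⟨ embed-poch q (n ℕ.+ m) ⟩
    T.poch (embed q) (n ℕ.+ m)                                         ∎

  crossings-++ : ∀ d xs ys → crossings d (xs ++ ys) ≡ crossings d xs ℕ.+ crossings d ys
  crossings-++ d []       ys = ≡.refl
  crossings-++ d (x ∷ xs) ys = ≡.trans (≡.cong (χ d x ℕ.+_) (crossings-++ d xs ys)) (≡.sym (ℕₚ.+-assoc (χ d x) _ _))

  parallel-++ : ∀ d xs ys → parallel d (xs ++ ys) ≡ parallel d xs ℕ.+ parallel d ys
  parallel-++ d []       ys = ≡.refl
  parallel-++ d (x ∷ xs) ys = ≡.trans (≡.cong ((if mixed d x then 0 else size x) ℕ.+_) (parallel-++ d xs ys)) (≡.sym (ℕₚ.+-assoc (if mixed d x then 0 else size x) _ _))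

  IsFirst IsSecond : Item V → Set
  IsFirst  l = first l ≡ true
  IsSecond l = first l ≡ false

  Unmixed Crossed : Item V → Item V → Set
  Unmixed d l = mixed d l ≡ false
  Crossed d l = mixed d l ≡ true

  mixed-first : ∀ d {l} → IsFirst l → Unmixed d l
  mixed-first d e rewrite e with first d
  ... | true  = ≡.refl
  ... | false = ≡.refl

  mixed-second : ∀ {d} → IsSecond d → ∀ l → Unmixed d l
  mixed-second e l rewrite e = ≡.refl

  mixed-first-second : ∀ {d l} → IsFirst d → IsSecond l → Crossed d l
  mixed-first-second e e′ rewrite e | e′ = ≡.refl

  module _ {d : Item V} where

    crossings-unmixed : ∀ {ls} → All (Unmixed d) ls → crossings d ls ≡ 0
    crossings-unmixed []       = ≡.refl
    crossings-unmixed (p ∷ ps) rewrite p = crossings-unmixed ps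

    crossings-crossed : ∀ {ls} → All (Crossed d) ls → crossings d ls ≡ length ls
    crossings-crossed []       = ≡.refl
    crossings-crossed (p ∷ ps) rewrite p = ≡.cong suc (crossings-crossed ps)

    parallel-unmixed : ∀ {ls} → All (Unmixed d) ls → parallel d ls ≡ sizes ls
    parallel-unmixed []       = ≡.refl
    parallel-unmixed (p ∷ ps) rewrite p = ≡.cong (_ ℕ.+_) (parallel-unmixed ps)

    parallel-crossed : ∀ {ls} → All (Crossed d) ls → parallel d ls ≡ 0
    parallel-crossed []       = ≡.refl
    parallel-crossed (p ∷ ps) rewrite p = parallel-crossed ps

    shift-unmixed : ∀ {ls} → All (Unmixed d) ls → map (shift d) ls ≡ ls
    shift-unmixed []       = ≡.refl
    shift-unmixed {l ∷ ls} (p ∷ ps) = ≡.cong₂ _∷_ (≡.cong (λ z → mkItem (var l) (size l) z (first l))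
      (≡.trans (≡.cong (λ m → expo l ℤ.+ + (if m then 1 else 0)) p) (ℤₚ.+-identityʳ (expo l)))) (shift-unmixed ps)

  -- The second block after k removals from the first: every removal crosses all of it once.
  raise : ℕ → List (Item V) → List (Item V)
  raise k = map (λ l → record l { expo = expo l ℤ.+ + k })

  shift-raise : ∀ {d} k {ls} → All (Crossed d) (raise k ls) → map (shift d) (raise k ls) ≡ raise (suc k) ls
  shift-raise k {[]}     []       = ≡.refl
  shift-raise {d} k {l ∷ ls} (p ∷ ps) = ≡.cong₂ _∷_
    (≡.cong (λ z → mkItem (var l) (size l) z (first l)) (≡.trans (≡.cong (λ m → expo l ℤ.+ + k ℤ.+ + (if m then 1 else 0)) p) (≡.trans (ℤₚ.+-assoc (expo l) (+ k) (+ 1)) (≡.cong (λ n → expo l ℤ.+ + n) (ℕₚ.+-comm k 1)))))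
    (shift-raise {d} k {ls} ps)

  raise-0 : ∀ ls → raise 0 ls ≡ ls
  raise-0 []       = ≡.refl
  raise-0 (l ∷ ls) = ≡.cong₂ _∷_ (≡.cong (λ z → mkItem (var l) (size l) z (first l)) (ℤₚ.+-identityʳ (expo l))) (raise-0 ls)

  choose-⇔ : {P Q : Set} (p? : Dec P) (q? : Dec Q) → (P → Q) → (Q → P) → ∀ c c′ → choose p? c c′ ≡ choose q? c c′
  choose-⇔ (yes p) (yes q) f g c c′ = ≡.refl
  choose-⇔ (yes p) (no ¬q) f g c c′ = contradiction (f p) ¬q
  choose-⇔ (no ¬p) (yes q) f g c c′ = contradiction (g q) ¬p
  choose-⇔ (no ¬p) (no ¬q) f g c c′ = ≡.refl

  -‿zero : ∀ y z → y ℤ.- z ≡ + 0 → z ≡ y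
  -‿zero y z e = ≡.sym (ℤₚ.i-j≡0⇒i≡j y z e)

  contribution-zero : ∀ {lam r f} → expo (item f) ℤ.< + (r ℕ.+ crossings (item f) (after f)) → embed (contribution lam r f) ≃ T.0#
  contribution-zero {lam} {r} {f} lt = T.trans (embed-cong (choose-no (excess r f ℤ.≟ + 0) (λ e → ℤₚ.<⇒≢ lt (-‿zero _ _ e)))) embed-0

  whenT : Bool → Fraction → Fraction
  whenT m c = if m then c else T.0#

  contribution-when : ∀ {lam r f} (thr : ℤ) → + (r ℕ.+ crossings (item f) (after f)) ≡ thr →
    embed (contribution lam r f) ≃ whenT (does (expo (item f) ℤ.≟ thr)) (embed (coefficient r f R.* 𝔇 (reduced f) lam))
  contribution-when {lam} {r} {f} thr ≡.refl = T.trans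
    (T.reflexive (≡.cong embed (choose-⇔ (excess r f ℤ.≟ + 0) (expo (item f) ℤ.≟ thr) (-‿zero _ _) (λ e → ≡.trans (≡.cong (λ z → thr ℤ.- z) e) (ℤₚ.+-inverseʳ thr)) _ _)))
    (push-embed (expo (item f) ℤ.≟ thr))
    where
    push-embed : ∀ {P : Set} (p? : Dec P) {c} → embed (choose p? c R.0#) ≃ whenT (does p?) (embed c)
    push-embed (yes _) = T.refl
    push-embed (no _)  = embed-0

  -- Here r is `suc ρ`, and `thr` is the exponent at which the balance of a variable in the treated
  -- block vanishes: r + n - n_0 in the first block, r in the second. Exponents inside the treated
  -- block never change, so the marks persist through all removals.
  module Parts (ρ : ℕ) (lam : List ℕ) (thr : ℤ) where

    marked : Item V → Bool
    marked d = does (expo d ℤ.≟ thr)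

    open Marked marked size using (count; unmarked; total; total-++) public
    open SubsetSums TR (embed q) marked size using (subsetSum; when) public
    open MultinomialRecursion TR (embed q) marked size public

    -- The gap `s₀` in the bound on O is spent one unit per removal: after k removals, k below `s₀`,
    -- the exponents of O have risen by k and are still strictly below r, so no second-block
    -- variable contributes.
    module First (O : List (Item V)) (s₀ : ℕ) (drops : ∀ i → i ℕ.< s₀ → drop i lam ≡ suc ρ ∷ drop (suc i) lam)
      (O-second : All IsSecond O) (O-size : All (λ l → 1 ℕ.≤ size l) O) (O-expo : All (λ l → expo l ℤ.+ + s₀ ℤ.≤ + suc ρ) O)
      (thr≡ : thr ≡ + (suc ρ ℕ.+ length O)) where

      -- Indexed by the removals still to come, as the induction needs; the number already made,
      -- `s₀ ∸ s`, determines how far O is raised and how many parts are gone.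
      𝔈 : ℕ → List (Item V) → Fraction
      𝔈 s A = embed (𝔇 (A ++ raise (s₀ ∸ s) O) (drop (s₀ ∸ s) lam))

      record Invariant (s : ℕ) (A : List (Item V)) : Set where
        field
          bound    : s ℕ.≤ s₀
          firsts   : All IsFirst A
          distinct : Distinct (A ++ O)
          expos    : All (λ l → expo l ℤ.≤ thr) A
      open Invariant

      Invariant-rest : ∀ {s A f} → Invariant (suc s) A → f ∈ foci A → marked (item f) ≡ true → Invariant s (rest f)
      Invariant-rest {s} {A} {f} I f∈ m = record
        { bound = ℕₚ.<⇒≤ (bound I)
        ; firsts = All-rest f∈ (firsts I)
        ; distinct = ≡.subst Distinct (≡.sym (Listₚ.++-assoc (before f) (after f) O)) (AllPairs-drop (before f)
            (≡.subst Distinct (≡.trans (≡.cong (_++ O) (foci-split f∈)) (Listₚ.++-assoc (before f) (item f ∷ after f) O)) (distinct I)))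
        ; expos = All-rest f∈ (expos I)
        }

      w : ℕ
      w = sizes O ℕ.+ ρ

      ε : Fraction
      ε = embed ((R.- R.1#) R.^ length O)

      -- An item of A crosses every item of O and none of A, so its threshold is r + |O| and its
      -- sign is that of |O| crossings. The items of O lie below their own threshold and drop out.
      recursion : ∀ {s A} → Invariant (suc s) A → 𝔈 (suc s) A ≃ T.∑ (foci A) (λ f → when (marked (item f))
        (ε T.* (embed q T.^ total (after f) T.* G (suc (total (rest f) ℕ.+ w)) (size (item f))) T.* 𝔈 s (rest f)))
      recursion {s} {A} I = begin
        embed (𝔇 ds (drop k lam))                               ≡⟨ ≡.cong (λ l → embed (𝔇 ds l)) (drops k (k<s₀)) ⟩
        embed (𝔇 ds (suc ρ ∷ lam′))                             ≈⟨ embed-cong (𝔇-step adm lam′ ρ step-bound) ⟩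
        embed (R.∑ (foci ds) (contribution lam′ (suc ρ)))       ≈⟨ embed-∑ (foci ds) ⟩
        T.∑ (foci ds) c                                         ≡⟨ ≡.cong (λ L → T.∑ L c) (foci-++ A O′) ⟩
        T.∑ (map (appendAfter O′) (foci A) ++ map (prependBefore A) (foci O′)) c
          ≈⟨ T.∑-++ (map (appendAfter O′) (foci A)) (map (prependBefore A) (foci O′)) ⟩
        T.∑ (map (appendAfter O′) (foci A)) c T.+ T.∑ (map (prependBefore A) (foci O′)) c
          ≈⟨ T.+-cong (T.∑-map (appendAfter O′) (foci A)) (T.trans (T.∑-map (prependBefore A) (foci O′)) (T.∑-0 (foci O′) (λ f∈ → vanish f∈))) ⟩
        T.∑ (foci A) (c ∘ appendAfter O′) T.+ T.0#              ≈⟨ T.+-identityʳ _ ⟩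
        T.∑ (foci A) (c ∘ appendAfter O′)                       ≈⟨ T.∑-cong (foci A) (λ f∈ → local f∈) ⟩
        _                                                       ∎
        where
        k : ℕ
        k = s₀ ∸ suc s
        k-suc : s₀ ∸ s ≡ suc k
        k-suc = ℕₚ.+-∸-assoc 1 (bound I)
        k<s₀ : k ℕ.< s₀
        k<s₀ = ≡.subst (ℕ._≤ s₀) k-suc (ℕₚ.m∸n≤m s₀ s)
        lam′ : List ℕ
        lam′ = drop (suc k) lam
        O′ ds : List (Item V)
        O′ = raise k O
        ds = A ++ O′
        c : Focus (Item V) → Fraction
        c f = embed (contribution lam′ (suc ρ) f)
        O′-second : All IsSecond O′
        O′-second = Allₚ.map⁺ O-second
        O′-size : All (λ l → 1 ℕ.≤ size l) O′
        O′-size = Allₚ.map⁺ O-size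
        O′-expo : All (λ l → expo l ℤ.< + suc ρ) O′
        O′-expo = Allₚ.map⁺ (All.map (λ {l} p → ℤₚ.<-≤-trans (ℤₚ.+-monoʳ-< (expo l) (ℤ.+<+ k<s₀)) p) O-expo)
        crossed : ∀ {d} → d ∈ A → All (Crossed d) O′
        crossed {d} d∈ = All.map (λ {l} → mixed-first-second {d} {l} (All.lookup (firsts I) d∈)) O′-second
        unmixed : ∀ d {f} → f ∈ foci A → All (Unmixed d) (after f)
        unmixed d f∈ = All.tabulate (λ {l} l∈ → mixed-first d {l} (All.lookup (firsts I) (after⊆ f∈ l∈)))
        crossings≡ : ∀ {f} → f ∈ foci A → crossings (item f) (after f ++ O′) ≡ length O
        crossings≡ {f} f∈ = ≡.trans (crossings-++ (item f) (after f) O′) (≡.trans (≡.cong₂ ℕ._+_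
          (crossings-unmixed (unmixed (item f) f∈)) (crossings-crossed (crossed (item∈ f∈)))) (Listₚ.length-map _ O))
        adm : Admissible ds
        adm = record
          { distinct = AllPairsₚ.map⁻ {f = var} (≡.subst Unique vars≡ (AllPairsₚ.map⁺ (distinct I)))
          ; nonempty = λ {f} f∈ {l} l∈ m → size≥ (item f) l (after⊆ f∈ l∈) m }
          where
          vars≡ : map var (A ++ O) ≡ map var ds
          vars≡ = ≡.trans (Listₚ.map-++ var A O) (≡.trans (≡.cong (map var A ++_) (Listₚ.map-∘ O)) (≡.sym (Listₚ.map-++ var A O′)))
          size≥ : ∀ d l → l ∈ ds → mixed d l ≡ true → 1 ℕ.≤ size l
          size≥ d l l∈ m with ∈-++⁻ A l∈
          ... | inj₁ l∈A = contradiction (≡.trans (≡.sym m) (mixed-first d {l} (All.lookup (firsts I) l∈A))) λ ()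
          ... | inj₂ l∈O = All.lookup O′-size l∈O
        step-bound : ∀ {f} → f ∈ foci ds → expo (item f) ℤ.≤ + (suc ρ ℕ.+ crossings (item f) (after f))
        step-bound {f} f∈ with ∈-++⁻ (map (appendAfter O′) (foci A)) (≡.subst (f ∈_) (foci-++ A O′) f∈)
        ... | inj₁ g∈ with ∈-map⁻ (appendAfter O′) g∈
        ...   | g , g∈′ , ≡.refl = ≡.subst (expo (item g) ℤ.≤_) (≡.trans thr≡ (≡.cong (λ n → + (suc ρ ℕ.+ n)) (≡.sym (crossings≡ g∈′))))
          (All.lookup (expos I) (item∈ g∈′))
        step-bound {f} f∈ | inj₂ g∈ with ∈-map⁻ (prependBefore A) g∈
        ...   | g , g∈′ , ≡.refl = ℤₚ.≤-trans (ℤₚ.<⇒≤ (All.lookup O′-expo (item∈ g∈′))) (ℤ.+≤+ (ℕₚ.m≤m+n (suc ρ) _))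
        vanish : ∀ {f} → f ∈ foci O′ → c (prependBefore A f) ≃ T.0#
        vanish {f} f∈ = contribution-zero {lam′} {f = prependBefore A f} (ℤₚ.<-≤-trans (All.lookup O′-expo (item∈ f∈)) (ℤ.+≤+ (ℕₚ.m≤m+n (suc ρ) _)))
        local : ∀ {f} → f ∈ foci A → c (appendAfter O′ f) ≃ when (marked (item f))
          (ε T.* (embed q T.^ total (after f) T.* G (suc (total (rest f) ℕ.+ w)) (size (item f))) T.* 𝔈 s (rest f))
        local {f} f∈ = T.trans
          (contribution-when {lam′} {f = F′} thr (≡.trans (≡.cong (λ n → + (suc ρ ℕ.+ n)) (crossings≡ f∈)) (≡.sym thr≡)))
          (when-cong′ (marked d) (begin
            embed (coefficient (suc ρ) F′ R.* 𝔇 (reduced F′) lam′)           ≈⟨ embed-* _ _ ⟩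
            embed (coefficient (suc ρ) F′) T.* embed (𝔇 (reduced F′) lam′)   ≈⟨ T.*-cong coefficient≈ (T.reflexive (≡.cong embed 𝔇≡)) ⟩
            ε T.* (embed q T.^ total (after f) T.* G (suc (total (rest f) ℕ.+ w)) (size d)) T.* 𝔈 s (rest f) ∎))
          where
          d = item f
          F′ = appendAfter O′ f
          when-cong′ : ∀ m {x y} → x ≃ y → whenT m x ≃ when m y
          when-cong′ true  e = e
          when-cong′ false e = T.refl
          reduced≡ : reduced F′ ≡ rest f ++ raise (suc k) O
          reduced≡ = ≡.trans (≡.cong (before f ++_) (≡.trans (Listₚ.map-++ (shift d) (after f) O′)
            (≡.cong₂ _++_ (shift-unmixed {d} (unmixed d f∈)) (shift-raise {d} k {O} (crossed (item∈ f∈)))))) (≡.sym (Listₚ.++-assoc (before f) (after f) _))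
          𝔇≡ : 𝔇 (reduced F′) lam′ ≡ 𝔇 (rest f ++ raise (s₀ ∸ s) O) (drop (s₀ ∸ s) lam)
          𝔇≡ = ≡.trans (≡.cong (λ ds → 𝔇 ds lam′) reduced≡) (≡.cong (λ k → 𝔇 (rest f ++ raise k O) (drop k lam)) (≡.sym k-suc))
          parallel≡ : parallel d (after f ++ O′) ≡ total (after f)
          parallel≡ = ≡.trans (parallel-++ d (after f) O′) (≡.trans (≡.cong₂ ℕ._+_ (parallel-unmixed (unmixed d f∈)) (parallel-crossed (crossed (item∈ f∈)))) (ℕₚ.+-identityʳ _))
          sizes≡ : suc ρ ℕ.+ sizes (rest F′) ≡ suc (total (rest f) ℕ.+ w)
          sizes≡ = ≡.cong suc (≡.trans (ℕₚ.+-comm ρ _) (≡.trans (≡.cong (ℕ._+ ρ) (≡.trans (≡.cong total (≡.sym (Listₚ.++-assoc (before f) (after f) O′)))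
            (≡.trans (total-++ (rest f) O′) (≡.cong (total (rest f) ℕ.+_) (≡.cong sum (≡.sym (Listₚ.map-∘ O))))))) (ℕₚ.+-assoc (total (rest f)) (sizes O) ρ)))
          coefficient≈ : embed (coefficient (suc ρ) F′) ≃ ε T.* (embed q T.^ total (after f) T.* G (suc (total (rest f) ℕ.+ w)) (size d))
          coefficient≈ = begin
            embed ((R.- R.1#) R.^ crossings d (after F′) R.* q R.^ parallel d (after F′) R.* R.h (suc ρ ℕ.+ sizes (rest F′)) (R.geometric (size d)))
              ≡⟨ ≡.cong embed (≡.cong₂ R._*_ (≡.cong₂ (λ x y → (R.- R.1#) R.^ x R.* q R.^ y) (crossings≡ f∈) parallel≡) (≡.cong (λ n → R.h n (R.geometric (size d))) sizes≡)) ⟩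
            embed ((R.- R.1#) R.^ length O R.* q R.^ total (after f) R.* R.h (suc (total (rest f) ℕ.+ w)) (R.geometric (size d)))
              ≈⟨ T.trans (embed-* _ _) (T.*-congʳ (T.trans (embed-* _ _) (T.*-congˡ {ε} (embed-^ q (total (after f)))))) ⟩
            ε T.* embed q T.^ total (after f) T.* G (suc (total (rest f) ℕ.+ w)) (size d)   ≈⟨ T.*-assoc ε _ _ ⟩
            ε T.* (embed q T.^ total (after f) T.* G (suc (total (rest f) ℕ.+ w)) (size d)) ∎

      closed : ∀ s {A} → Invariant (suc s) A → count A ≡ suc s →
        multinomial inv inv-law w G G-zero G-suc (unmarked A) T.* 𝔈 (suc s) A
          ≃ (ε T.^ suc s T.* multinomial inv inv-law w G G-zero G-suc A)
            T.* (subsetSum 0 A (summand inv inv-law w G G-zero G-suc A) T.* 𝔈 0 (unmarked A))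
      closed s = closedForm inv inv-law w G G-zero G-suc ε 𝔈 Invariant Invariant-rest recursion s

    -- `c₀` is the original length of the second block. Its current length enters the threshold r +
    -- |A| of first-block items, which falls by one per removal; the gap `s₀` keeps their exponents
    -- strictly below it up to the last removal.
    module Second (O : List (Item V)) (s₀ c₀ : ℕ) (drops : ∀ i → i ℕ.< s₀ → drop i lam ≡ suc ρ ∷ drop (suc i) lam)
      (O-first : All IsFirst O) (O-expo : All (λ l → expo l ℤ.+ + s₀ ℤ.≤ + (suc ρ ℕ.+ c₀)) O) (thr≡ : thr ≡ + suc ρ) where

      𝔈 : ℕ → List (Item V) → Fraction
      𝔈 s A = embed (𝔇 (O ++ A) (drop (s₀ ∸ s) lam))

      record Invariant (s : ℕ) (A : List (Item V)) : Set where
        field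
          bound    : s ℕ.≤ s₀
          seconds  : All IsSecond A
          nonempty : All (λ l → 1 ℕ.≤ size l) A
          distinct : Distinct (O ++ A)
          expos    : All (λ l → expo l ℤ.≤ thr) A
          length≡  : length A ℕ.+ s₀ ≡ c₀ ℕ.+ s
      open Invariant

      Invariant-rest : ∀ {s A f} → Invariant (suc s) A → f ∈ foci A → marked (item f) ≡ true → Invariant s (rest f)
      Invariant-rest {s} {A} {f} I f∈ m = record
        { bound = ℕₚ.<⇒≤ (bound I)
        ; seconds = All-rest f∈ (seconds I)
        ; nonempty = All-rest f∈ (nonempty I)
        ; distinct = ≡.subst Distinct (Listₚ.++-assoc O (before f) (after f)) (AllPairs-drop (O ++ before f)
            (≡.subst Distinct (≡.trans (≡.cong (O ++_) (foci-split f∈)) (≡.sym (Listₚ.++-assoc O (before f) (item f ∷ after f)))) (distinct I)))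
        ; expos = All-rest f∈ (expos I)
        ; length≡ = ℕₚ.suc-injective (≡.trans (≡.cong (ℕ._+ s₀) (≡.sym (length-rest f∈))) (≡.trans (length≡ I) (ℕₚ.+-suc c₀ s)))
        }

      w : ℕ
      w = sizes O ℕ.+ ρ

      ε : Fraction
      ε = T.1#

      -- A first-block item crosses all of A and stays strictly below r + |A|, so it drops out. An
      -- item of A crosses nothing: it contributes exactly if its exponent is r, without sign and
      -- without shifting any exponent.
      recursion : ∀ {s A} → Invariant (suc s) A → 𝔈 (suc s) A ≃ T.∑ (foci A) (λ f → when (marked (item f))
        (ε T.* (embed q T.^ total (after f) T.* G (suc (total (rest f) ℕ.+ w)) (size (item f))) T.* 𝔈 s (rest f)))
      recursion {s} {A} I = begin
        embed (𝔇 ds (drop k lam))                               ≡⟨ ≡.cong (λ l → embed (𝔇 ds l)) (drops k (k<s₀)) ⟩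
        embed (𝔇 ds (suc ρ ∷ lam′))                             ≈⟨ embed-cong (𝔇-step adm lam′ ρ step-bound) ⟩
        embed (R.∑ (foci ds) (contribution lam′ (suc ρ)))       ≈⟨ embed-∑ (foci ds) ⟩
        T.∑ (foci ds) c                                         ≡⟨ ≡.cong (λ L → T.∑ L c) (foci-++ O A) ⟩
        T.∑ (map (appendAfter A) (foci O) ++ map (prependBefore O) (foci A)) c
          ≈⟨ T.∑-++ (map (appendAfter A) (foci O)) (map (prependBefore O) (foci A)) ⟩
        T.∑ (map (appendAfter A) (foci O)) c T.+ T.∑ (map (prependBefore O) (foci A)) c
          ≈⟨ T.+-cong (T.trans (T.∑-map (appendAfter A) (foci O)) (T.∑-0 (foci O) (λ f∈ → vanish f∈))) (T.∑-map (prependBefore O) (foci A)) ⟩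
        T.0# T.+ T.∑ (foci A) (c ∘ prependBefore O)             ≈⟨ T.+-identityˡ _ ⟩
        T.∑ (foci A) (c ∘ prependBefore O)                      ≈⟨ T.∑-cong (foci A) (λ f∈ → local f∈) ⟩
        _                                                       ∎
        where
        k : ℕ
        k = s₀ ∸ suc s
        k-suc : s₀ ∸ s ≡ suc k
        k-suc = ℕₚ.+-∸-assoc 1 (bound I)
        k<s₀ : k ℕ.< s₀
        k<s₀ = ≡.subst (ℕ._≤ s₀) k-suc (ℕₚ.m∸n≤m s₀ s)
        lam′ : List ℕ
        lam′ = drop (suc k) lam
        ds : List (Item V)
        ds = O ++ A
        c : Focus (Item V) → Fraction
        c f = embed (contribution lam′ (suc ρ) f)
        O-expo′ : All (λ l → expo l ℤ.< + (suc ρ ℕ.+ length A)) O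
        O-expo′ = All.map (λ {l} p → ℤₚ.≰⇒> (λ ge → ℤₚ.<⇒≱ (ℤₚ.≤-<-trans p (ℤ.+<+ lt)) (ℤₚ.+-monoˡ-≤ (+ s₀) ge))) O-expo
          where
          lt : suc ρ ℕ.+ c₀ ℕ.< suc ρ ℕ.+ length A ℕ.+ s₀
          lt = ≡.subst (suc ρ ℕ.+ c₀ ℕ.<_) (≡.trans (≡.cong (suc ρ ℕ.+_) (≡.sym (length≡ I))) (≡.sym (ℕₚ.+-assoc (suc ρ) (length A) s₀)))
            (ℕₚ.+-monoʳ-< (suc ρ) (ℕₚ.m<m+n c₀ (ℕ.s≤s ℕ.z≤n)))
        unmixed : ∀ {d} → d ∈ A → ∀ ls → All (Unmixed d) ls
        unmixed {d} d∈ ls = All.universal (mixed-second {d} (All.lookup (seconds I) d∈)) ls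
        crossings≡ : ∀ {f} → f ∈ foci O → crossings (item f) (after f ++ A) ≡ length A
        crossings≡ {f} f∈ = ≡.trans (crossings-++ (item f) (after f) A) (≡.cong₂ ℕ._+_
          (crossings-unmixed {item f} (All.tabulate (λ {l} l∈ → mixed-first (item f) {l} (All.lookup O-first (after⊆ f∈ l∈)))))
          (crossings-crossed {item f} (All.map (λ {l} → mixed-first-second {item f} {l} (All.lookup O-first (item∈ f∈))) (seconds I))))
        adm : Admissible ds
        adm = record
          { distinct = distinct I
          ; nonempty = λ {f} f∈ {l} l∈ m → size≥ (item f) l (after⊆ f∈ l∈) m }
          where
          size≥ : ∀ d l → l ∈ ds → mixed d l ≡ true → 1 ℕ.≤ size l
          size≥ d l l∈ m with ∈-++⁻ O l∈
          ... | inj₁ l∈O = contradiction (≡.trans (≡.sym m) (mixed-first d {l} (All.lookup O-first l∈O))) λ ()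
          ... | inj₂ l∈A = All.lookup (nonempty I) l∈A
        expo< : ∀ {f} → f ∈ foci O → expo (item f) ℤ.< + (suc ρ ℕ.+ crossings (item f) (after f ++ A))
        expo< {f} f∈ = ≡.subst (λ n → expo (item f) ℤ.< + (suc ρ ℕ.+ n)) (≡.sym (crossings≡ f∈)) (All.lookup O-expo′ (item∈ f∈))
        step-bound : ∀ {f} → f ∈ foci ds → expo (item f) ℤ.≤ + (suc ρ ℕ.+ crossings (item f) (after f))
        step-bound {f} f∈ with ∈-++⁻ (map (appendAfter A) (foci O)) (≡.subst (f ∈_) (foci-++ O A) f∈)
        ... | inj₁ g∈ with ∈-map⁻ (appendAfter A) g∈
        ...   | g , g∈′ , ≡.refl = ℤₚ.<⇒≤ (expo< g∈′)
        step-bound {f} f∈ | inj₂ g∈ with ∈-map⁻ (prependBefore O) g∈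
        ...   | g , g∈′ , ≡.refl = ℤₚ.≤-trans (≡.subst (expo (item g) ℤ.≤_) thr≡ (All.lookup (expos I) (item∈ g∈′))) (ℤ.+≤+ (ℕₚ.m≤m+n (suc ρ) _))
        vanish : ∀ {f} → f ∈ foci O → c (appendAfter A f) ≃ T.0#
        vanish {f} f∈ = contribution-zero {lam′} {f = appendAfter A f} (expo< f∈)
        local : ∀ {f} → f ∈ foci A → c (prependBefore O f) ≃ when (marked (item f))
          (ε T.* (embed q T.^ total (after f) T.* G (suc (total (rest f) ℕ.+ w)) (size (item f))) T.* 𝔈 s (rest f))
        local {f} f∈ = T.trans
          (contribution-when {lam′} {f = F′} thr (≡.trans (≡.cong (λ n → + (suc ρ ℕ.+ n)) crossings0) (≡.trans (≡.cong +_ (ℕₚ.+-identityʳ (suc ρ))) (≡.sym thr≡))))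
          (when-cong′ (marked d) (begin
            embed (coefficient (suc ρ) F′ R.* 𝔇 (reduced F′) lam′)           ≈⟨ embed-* _ _ ⟩
            embed (coefficient (suc ρ) F′) T.* embed (𝔇 (reduced F′) lam′)   ≈⟨ T.*-cong coefficient≈ (T.reflexive (≡.cong embed 𝔇≡)) ⟩
            ε T.* (embed q T.^ total (after f) T.* G (suc (total (rest f) ℕ.+ w)) (size d)) T.* 𝔈 s (rest f) ∎))
          where
          d = item f
          F′ = prependBefore O f
          all : All (Unmixed d) (after f)
          all = unmixed (item∈ f∈) (after f)
          crossings0 : crossings d (after f) ≡ 0
          crossings0 = crossings-unmixed all
          when-cong′ : ∀ m {x y} → x ≃ y → whenT m x ≃ when m y
          when-cong′ true  e = e
          when-cong′ false e = T.refl
          reduced≡ : reduced F′ ≡ O ++ rest f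
          reduced≡ = ≡.trans (≡.cong ((O ++ before f) ++_) (shift-unmixed {d} all)) (Listₚ.++-assoc O (before f) (after f))
          𝔇≡ : 𝔇 (reduced F′) lam′ ≡ 𝔇 (O ++ rest f) (drop (s₀ ∸ s) lam)
          𝔇≡ = ≡.cong₂ 𝔇 reduced≡ (≡.cong (λ k → drop k lam) (≡.sym k-suc))
          sizes≡ : suc ρ ℕ.+ sizes (rest F′) ≡ suc (total (rest f) ℕ.+ w)
          sizes≡ = ≡.cong suc (≡.trans (ℕₚ.+-comm ρ _) (≡.trans (≡.cong (ℕ._+ ρ) (≡.trans (≡.cong total (Listₚ.++-assoc O (before f) (after f)))
            (≡.trans (total-++ O (rest f)) (ℕₚ.+-comm (sizes O) _)))) (ℕₚ.+-assoc (total (rest f)) (sizes O) ρ)))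
          coefficient≈ : embed (coefficient (suc ρ) F′) ≃ ε T.* (embed q T.^ total (after f) T.* G (suc (total (rest f) ℕ.+ w)) (size d))
          coefficient≈ = begin
            embed ((R.- R.1#) R.^ crossings d (after f) R.* q R.^ parallel d (after f) R.* R.h (suc ρ ℕ.+ sizes (rest F′)) (R.geometric (size d)))
              ≡⟨ ≡.cong embed (≡.cong₂ R._*_ (≡.cong₂ (λ x y → (R.- R.1#) R.^ x R.* q R.^ y) crossings0 (parallel-unmixed all)) (≡.cong (λ n → R.h n (R.geometric (size d))) sizes≡)) ⟩
            embed (R.1# R.* q R.^ total (after f) R.* R.h (suc (total (rest f) ℕ.+ w)) (R.geometric (size d)))
              ≈⟨ T.trans (embed-* _ _) (T.*-congʳ (T.trans (embed-* _ _) (T.*-cong embed-1 (embed-^ q (total (after f)))))) ⟩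
            ε T.* embed q T.^ total (after f) T.* G (suc (total (rest f) ℕ.+ w)) (size d)   ≈⟨ T.*-assoc ε _ _ ⟩
            ε T.* (embed q T.^ total (after f) T.* G (suc (total (rest f) ℕ.+ w)) (size d)) ∎

      closed : ∀ s {A} → Invariant (suc s) A → count A ≡ suc s →
        multinomial inv inv-law w G G-zero G-suc (unmarked A) T.* 𝔈 (suc s) A
          ≃ (ε T.^ suc s T.* multinomial inv inv-law w G G-zero G-suc A)
            T.* (subsetSum 0 A (summand inv inv-law w G G-zero G-suc A) T.* 𝔈 0 (unmarked A))
      closed s = closedForm inv inv-law w G G-zero G-suc ε 𝔈 Invariant Invariant-rest recursion s

-- Index lists of the statement as marks along a list

imapFrom : {A B : Set} → (ℕ → A → B) → ℕ → List A → List B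
imapFrom f k []       = []
imapFrom f k (x ∷ xs) = f k x ∷ imapFrom f (suc k) xs

deleteFrom : {A : Set} → List ℕ → ℕ → List A → List A
deleteFrom I k []       = []
deleteFrom I k (x ∷ xs) = if k ∈ᵇ I then deleteFrom I (suc k) xs else x ∷ deleteFrom I (suc k) xs

-- A function is handled through its two defining equations, since the local function it will be
-- applied to cannot be named.
imapFrom-unique : {A B : Set} (f : ℕ → A → B) (g : ℕ → List A → List B) → (∀ k → g k [] ≡ []) → (∀ k x xs → g k (x ∷ xs) ≡ f k x ∷ g (suc k) xs) →
  ∀ k xs → g k xs ≡ imapFrom f k xs
imapFrom-unique f g e₁ e₂ k []       = e₁ k
imapFrom-unique f g e₁ e₂ k (x ∷ xs) = ≡.trans (e₂ k x xs) (≡.cong (f k x ∷_) (imapFrom-unique f g e₁ e₂ (suc k) xs))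

-- The local functions of imap and deleteIdx have no name outside Defs; the
-- underscores in imapGo and deleteGo are solved by unification with them.
mutual
  imapGo : {A B : Set} → (ℕ → A → B) → ℕ → List A → List B
  imapGo = _

  imap≡imapFrom : {A B : Set} (f : ℕ → A → B) → ∀ xs → imap f xs ≡ imapFrom f 0 xs
  imap≡imapFrom f [] = ≡.refl
  -- Abstracting the literal turns every argument of the unknown function into a variable, so that
  -- unification can determine it.
  imap≡imapFrom f (x ∷ xs) with 1
  ... | k = ≡.cong (f 0 x ∷_) (imapFrom-unique f (imapGo f) (λ _ → ≡.refl) (λ _ _ _ → ≡.refl) k xs)

deleteFrom-unique : {A : Set} (I : List ℕ) (g : ℕ → List A → List A) → (∀ k → g k [] ≡ []) →
  (∀ k x xs → g k (x ∷ xs) ≡ (if k ∈ᵇ I then g (suc k) xs else x ∷ g (suc k) xs)) →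
  ∀ k xs → g k xs ≡ deleteFrom I k xs
deleteFrom-unique I g e₁ e₂ k []       = e₁ k
deleteFrom-unique I g e₁ e₂ k (x ∷ xs) = ≡.trans (e₂ k x xs) (≡.cong₂ (λ a b → if k ∈ᵇ I then a else x ∷ b) (deleteFrom-unique I g e₁ e₂ (suc k) xs) (deleteFrom-unique I g e₁ e₂ (suc k) xs))

mutual
  deleteGo : {A : Set} → List ℕ → List A → ℕ → List A → List A
  deleteGo = _

  deleteIdx≡deleteFrom : {A : Set} (I : List ℕ) → ∀ (xs : List A) → deleteIdx I xs ≡ deleteFrom I 0 xs
  deleteIdx≡deleteFrom I [] = ≡.refl
  -- The local function also depends on the whole list as a parameter of its `where` block; that
  -- list is abstracted for the same reason.
  deleteIdx≡deleteFrom I (x ∷ xs) with x ∷ xs | 1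
  ... | ys | k = ≡.cong₂ (λ a b → if 0 ∈ᵇ I then a else x ∷ b)
    (deleteFrom-unique I (deleteGo I ys) (λ _ → ≡.refl) (λ _ _ _ → ≡.refl) k xs) (deleteFrom-unique I (deleteGo I ys) (λ _ → ≡.refl) (λ _ _ _ → ≡.refl) k xs)

≡ᵇ-refl : ∀ k → (k ≡ᵇ k) ≡ true
≡ᵇ-refl zero    = ≡.refl
≡ᵇ-refl (suc k) = ≡ᵇ-refl k

>⇒≡ᵇ-false : ∀ {j k} → k ℕ.< j → (j ≡ᵇ k) ≡ false
>⇒≡ᵇ-false {suc j} {zero}  p         = ≡.refl
>⇒≡ᵇ-false {suc j} {suc k} (ℕ.s≤s p) = >⇒≡ᵇ-false p

<⇒≡ᵇ-false : ∀ {j k} → j ℕ.< k → (j ≡ᵇ k) ≡ false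
<⇒≡ᵇ-false {zero}  {suc k} p         = ≡.refl
<⇒≡ᵇ-false {suc j} {suc k} (ℕ.s≤s p) = <⇒≡ᵇ-false p

∈ᵇ-there : ∀ {j k J} → (j ≡ᵇ k) ≡ false → (j ∈ᵇ (k ∷ J)) ≡ (j ∈ᵇ J)
∈ᵇ-there e rewrite e = ≡.refl

∈ᵇ-here : ∀ k {J} → (k ∈ᵇ (k ∷ J)) ≡ true
∈ᵇ-here k rewrite ≡ᵇ-refl k = ≡.refl

<All⇒∉ᵇ : ∀ {k J} → All (k ℕ.<_) J → (k ∈ᵇ J) ≡ false
<All⇒∉ᵇ []       = ≡.refl
<All⇒∉ᵇ {k} {j ∷ J} (p ∷ ps) = ≡.trans (∈ᵇ-there {k} {j} {J} (<⇒≡ᵇ-false p)) (<All⇒∉ᵇ ps)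

>All⇒∉ᵇ : ∀ {k J} → All (ℕ._< k) J → (k ∈ᵇ J) ≡ false
>All⇒∉ᵇ []       = ≡.refl
>All⇒∉ᵇ {k} {j ∷ J} (p ∷ ps) = ≡.trans (∈ᵇ-there {k} {j} {J} (>⇒≡ᵇ-false p)) (>All⇒∉ᵇ ps)

indicesFrom : ℕ → List Bool → List ℕ
indicesFrom k []       = []
indicesFrom k (b ∷ bs) = if b then k ∷ indicesFrom (suc k) bs else indicesFrom (suc k) bs

-- L_{m,I,J} in a single pass: n counts the marked entries met so far, and an entry outside J is
-- added once for each of them, itself included if marked.
exponentFrom : ℕ → ℕ → List ℕ → List Bool → List ℕ → ℕ
exponentFrom k n J []       _        = 0
exponentFrom k n J (b ∷ bs) []       = 0
exponentFrom k n J (b ∷ bs) (z ∷ zs) = (if k ∈ᵇ J then 0 else n′ ℕ.* z) ℕ.+ exponentFrom (suc k) n′ J bs zs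
  where n′ = if b then suc n else n

sumFrom : ℕ → List ℕ → List ℕ → ℕ
sumFrom k J []       = 0
sumFrom k J (z ∷ zs) = (if k ∈ᵇ J then z else 0) ℕ.+ sumFrom (suc k) J zs

keep : {A : Set} → List Bool → List A → List A
keep []       xs       = xs
keep (b ∷ bs) []       = []
keep (b ∷ bs) (x ∷ xs) = if b then keep bs xs else x ∷ keep bs xs

indicesFrom-≥ : ∀ k bs → All (k ℕ.≤_) (indicesFrom k bs)
indicesFrom-≥ k []           = []
indicesFrom-≥ k (true  ∷ bs) = ℕₚ.≤-refl ∷ All.map ℕₚ.<⇒≤ (indicesFrom-≥ (suc k) bs)
indicesFrom-≥ k (false ∷ bs) = All.map ℕₚ.<⇒≤ (indicesFrom-≥ (suc k) bs)

indicesFrom-< : ∀ k bs → All (ℕ._< k ℕ.+ length bs) (indicesFrom k bs)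
indicesFrom-< k []           = []
indicesFrom-< k (true  ∷ bs) = ℕₚ.m<m+n k (ℕ.s≤s ℕ.z≤n) ∷ ≡.subst (λ m → All (ℕ._< m) (indicesFrom (suc k) bs)) (≡.sym (ℕₚ.+-suc k (length bs))) (indicesFrom-< (suc k) bs)
indicesFrom-< k (false ∷ bs) = ≡.subst (λ m → All (ℕ._< m) (indicesFrom (suc k) bs)) (≡.sym (ℕₚ.+-suc k (length bs))) (indicesFrom-< (suc k) bs)

∈ᵇ-indicesFrom-head : ∀ k b bs → (k ∈ᵇ indicesFrom k (b ∷ bs)) ≡ b
∈ᵇ-indicesFrom-head k true  bs = ∈ᵇ-here k {indicesFrom (suc k) bs}
∈ᵇ-indicesFrom-head k false bs = <All⇒∉ᵇ (indicesFrom-≥ (suc k) bs)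

∈ᵇ-indicesFrom-tail : ∀ {j k} → k ℕ.< j → ∀ b bs → (j ∈ᵇ indicesFrom k (b ∷ bs)) ≡ (j ∈ᵇ indicesFrom (suc k) bs)
∈ᵇ-indicesFrom-tail {j} {k} p true  bs = ∈ᵇ-there {j} {k} {indicesFrom (suc k) bs} (>⇒≡ᵇ-false p)
∈ᵇ-indicesFrom-tail p false bs = ≡.refl

deleteFrom-cong : {A : Set} {I I′ : List ℕ} → ∀ k → (∀ j → k ℕ.≤ j → (j ∈ᵇ I) ≡ (j ∈ᵇ I′)) → ∀ (xs : List A) → deleteFrom I k xs ≡ deleteFrom I′ k xs
deleteFrom-cong k e []       = ≡.refl
deleteFrom-cong {I = I} {I′} k e (x ∷ xs) rewrite e k ℕₚ.≤-refl | deleteFrom-cong {I = I} {I′} (suc k) (λ j p → e j (ℕₚ.<⇒≤ p)) xs = ≡.refl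

deleteFrom-keep : {A : Set} → ∀ k bs (xs : List A) → length bs ≡ length xs → deleteFrom (indicesFrom k bs) k xs ≡ keep bs xs
deleteFrom-keep k []       []       e = ≡.refl
deleteFrom-keep k (b ∷ bs) (x ∷ xs) e
  rewrite ∈ᵇ-indicesFrom-head k b bs
        | deleteFrom-cong {I = indicesFrom k (b ∷ bs)} {indicesFrom (suc k) bs} (suc k) (λ j p → ∈ᵇ-indicesFrom-tail p b bs) xs
        | deleteFrom-keep (suc k) bs xs (ℕₚ.suc-injective e) = ≡.refl

module _ {A : Set} where

  keep-unmarked : {B : Set} (m : A → Bool) (g : A → B) → ∀ xs → keep (map m xs) (map g xs) ≡ map g (filterᵇ (not ∘ m) xs)
  keep-unmarked m g []       = ≡.refl
  keep-unmarked m g (x ∷ xs) with m x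
  ... | true  = keep-unmarked m g xs
  ... | false = ≡.cong (g x ∷_) (keep-unmarked m g xs)

  keep-unmarked-++ : {B : Set} (m : A → Bool) (g : A → B) → ∀ xs ys →
    keep (map m xs ++ map (λ _ → false) ys) (map g xs ++ ys) ≡ map g (filterᵇ (not ∘ m) xs) ++ ys
  keep-unmarked-++ m g []       []       = ≡.refl
  keep-unmarked-++ m g []       (y ∷ ys) = ≡.cong (y ∷_) (keep-unmarked-++ m g [] ys)
  keep-unmarked-++ m g (x ∷ xs) ys with m x
  ... | true  = keep-unmarked-++ m g xs ys
  ... | false = ≡.cong (g x ∷_) (keep-unmarked-++ m g xs ys)

  keep-++-unmarked : {B : Set} (m : A → Bool) (g : A → B) → ∀ ys xs →
    keep (map (λ _ → false) ys ++ map m xs) (ys ++ map g xs) ≡ ys ++ map g (filterᵇ (not ∘ m) xs)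
  keep-++-unmarked m g []       xs = keep-unmarked m g xs
  keep-++-unmarked m g (y ∷ ys) xs = ≡.cong (y ∷_) (keep-++-unmarked m g ys xs)

  indicesFrom-false : ∀ k (xs : List A) bs → indicesFrom k (map (λ _ → false) xs ++ bs) ≡ indicesFrom (k ℕ.+ length xs) bs
  indicesFrom-false k []       bs = ≡.cong (λ j → indicesFrom j bs) (≡.sym (ℕₚ.+-identityʳ k))
  indicesFrom-false k (x ∷ xs) bs = ≡.trans (indicesFrom-false (suc k) xs bs) (≡.cong (λ j → indicesFrom j bs) (≡.sym (ℕₚ.+-suc k (length xs))))

  indicesFrom-++-false : ∀ k bs (xs : List A) → indicesFrom k (bs ++ map (λ _ → false) xs) ≡ indicesFrom k bs
  indicesFrom-++-false k []           []       = ≡.refl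
  indicesFrom-++-false k []           (x ∷ xs) = indicesFrom-++-false (suc k) [] xs
  indicesFrom-++-false k (true  ∷ bs) xs = ≡.cong (k ∷_) (indicesFrom-++-false (suc k) bs xs)
  indicesFrom-++-false k (false ∷ bs) xs = indicesFrom-++-false (suc k) bs xs

length-map-++ : {A B C : Set} (f : A → B) (g : A → C) (xs : List A) {ys : List B} {zs : List C} → length ys ≡ length zs →
  length (map f xs ++ ys) ≡ length (map g xs ++ zs)
length-map-++ f g []       e = e
length-map-++ f g (x ∷ xs) e = ≡.cong suc (length-map-++ f g xs e)

deleteIdx-++ʳ : {A B : Set} (m : A → Bool) (g : A → B) → ∀ xs ys →
  deleteIdx (indicesFrom 0 (map m xs)) (map g xs ++ ys) ≡ map g (filterᵇ (not ∘ m) xs) ++ ys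
deleteIdx-++ʳ m g xs ys = ≡.trans (deleteIdx≡deleteFrom _ (map g xs ++ ys))
  (≡.trans (≡.cong (λ I → deleteFrom I 0 (map g xs ++ ys)) (≡.sym (indicesFrom-++-false 0 (map m xs) ys)))
  (≡.trans (deleteFrom-keep 0 (map m xs ++ map (λ _ → false) ys) (map g xs ++ ys) (length-map-++ m g xs (Listₚ.length-map _ ys)))
    (keep-unmarked-++ m g xs ys)))

deleteIdx-++ˡ : {A B : Set} (m : A → Bool) (g : A → B) → ∀ ys xs →
  deleteIdx (indicesFrom (length ys) (map m xs)) (ys ++ map g xs) ≡ ys ++ map g (filterᵇ (not ∘ m) xs)
deleteIdx-++ˡ m g ys xs = ≡.trans (deleteIdx≡deleteFrom _ (ys ++ map g xs))
  (≡.trans (≡.cong (λ I → deleteFrom I 0 (ys ++ map g xs)) (≡.sym (indicesFrom-false 0 ys (map m xs))))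
  (≡.trans (deleteFrom-keep 0 (map (λ _ → false) ys ++ map m xs) (ys ++ map g xs)
      (≡.subst (λ L → length (map (λ _ → false) ys ++ map m xs) ≡ length (L ++ map g xs)) (Listₚ.map-id ys)
        (length-map-++ (λ _ → false) id ys (≡.trans (Listₚ.length-map m xs) (≡.sym (Listₚ.length-map g xs))))))
    (keep-++-unmarked m g ys xs)))

filterᵇ-indicesFrom : ∀ (p : ℕ → Bool) k (g : ℕ → ℕ) bs n → (∀ i → g i ≡ k ℕ.+ i) → map p (applyUpTo g n) ≡ bs →
  filterᵇ p (applyUpTo g n) ≡ indicesFrom k bs
filterᵇ-indicesFrom p k g .[] zero    e ≡.refl = ≡.refl
filterᵇ-indicesFrom p k g ._  (suc n) e ≡.refl with p (g 0)
... | true  = ≡.cong₂ _∷_ (≡.trans (e 0) (ℕₚ.+-identityʳ k)) (filterᵇ-indicesFrom p (suc k) (g ∘ suc) _ n (λ i → ≡.trans (e (suc i)) (ℕₚ.+-suc k i)) ≡.refl)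
... | false = filterᵇ-indicesFrom p (suc k) (g ∘ suc) _ n (λ i → ≡.trans (e (suc i)) (ℕₚ.+-suc k i)) ≡.refl

sumBelow : ℕ → (ℕ → ℕ) → ℕ
sumBelow zero    f = 0
sumBelow (suc n) f = f 0 ℕ.+ sumBelow n (f ∘ suc)

sumBelow-cong : ∀ n {f g} → (∀ i → f i ≡ g i) → sumBelow n f ≡ sumBelow n g
sumBelow-cong zero    e = ≡.refl
sumBelow-cong (suc n) e = ≡.cong₂ ℕ._+_ (e 0) (sumBelow-cong n (e ∘ suc))

sum-concatMap-upTo : ∀ (f : ℕ → List ℕ) g n → sum (concatMap f (applyUpTo g n)) ≡ sumBelow n (sum ∘ f ∘ g)
sum-concatMap-upTo f g zero    = ≡.refl
sum-concatMap-upTo f g (suc n) = ≡.trans (sum-++ (f (g 0)) _) (≡.cong (sum (f (g 0)) ℕ.+_) (sum-concatMap-upTo f (g ∘ suc) n))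

sum-map-upTo : ∀ (f : ℕ → ℕ) g n → sum (map f (applyUpTo g n)) ≡ sumBelow n (f ∘ g)
sum-map-upTo f g zero    = ≡.refl
sum-map-upTo f g (suc n) = ≡.cong (f (g 0) ℕ.+_) (sum-map-upTo f (g ∘ suc) n)

-- The part of Lsum visible from index k on, when n elements of I precede k.
LsumFrom : ℕ → ℕ → (ℕ → Bool) → (ℕ → Bool) → (ℕ → ℕ) → ℕ
LsumFrom n m mem out b = sumBelow m (λ j → n ℕ.* (if out j then b j else 0) ℕ.+ sumBelow (suc j) (λ i → if mem i ∧ out j then b j else 0))

-- Dropping the first index removes one summand from every inner sum; these summands are what the
-- raised count restores. C is the part of the sequence beyond the range m of the sum.
LsumFrom-exponentFrom : ∀ k n J bs zs (C : List ℕ) {mem out b} → length bs ≡ length zs →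
  (∀ i → mem i ≡ ((k ℕ.+ i) ∈ᵇ indicesFrom k bs)) → (∀ i → out i ≡ not ((k ℕ.+ i) ∈ᵇ J)) → (∀ i → b i ≡ nthD 0 (zs ++ C) i) →
  LsumFrom n (length bs) mem out b ≡ exponentFrom k n J bs zs
LsumFrom-exponentFrom k n J []       []       C e em eo eb = ≡.refl
LsumFrom-exponentFrom k n J (c ∷ bs) (z ∷ zs) C {mem} {out} {b} e em eo eb = ≡.cong₂ ℕ._+_ head tail
  where
  n′ = if c then suc n else n
  mem0 : mem 0 ≡ c
  mem0 = ≡.trans (em 0) (≡.trans (≡.cong (_∈ᵇ indicesFrom k (c ∷ bs)) (ℕₚ.+-identityʳ k)) (∈ᵇ-indicesFrom-head k c bs))
  combine : ∀ n c o x → n ℕ.* (if o then x else 0) ℕ.+ (if c ∧ o then x else 0) ≡ (if c then suc n else n) ℕ.* (if o then x else 0)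
  combine n true  o x = ℕₚ.+-comm _ (if o then x else 0)
  combine n false o x = ℕₚ.+-identityʳ _
  head : n ℕ.* (if out 0 then b 0 else 0) ℕ.+ ((if mem 0 ∧ out 0 then b 0 else 0) ℕ.+ 0) ≡ (if k ∈ᵇ J then 0 else n′ ℕ.* z)
  head rewrite mem0 | eo 0 | ℕₚ.+-identityʳ k | eb 0 | ℕₚ.+-identityʳ (if c ∧ not (k ∈ᵇ J) then z else 0) =
    ≡.trans (combine n c (not (k ∈ᵇ J)) z) (last (k ∈ᵇ J))
    where
    last : ∀ d → n′ ℕ.* (if not d then z else 0) ≡ (if d then 0 else n′ ℕ.* z)
    last true  = ℕₚ.*-zeroʳ n′
    last false = ≡.refl
  tail : sumBelow (length bs) (λ j → n ℕ.* (if out (suc j) then b (suc j) else 0) ℕ.+ sumBelow (suc (suc j)) (λ i → if mem i ∧ out (suc j) then b (suc j) else 0))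
    ≡ exponentFrom (suc k) n′ J bs zs
  tail = ≡.trans (sumBelow-cong (length bs) regroup)
    (LsumFrom-exponentFrom (suc k) n′ J bs zs C {mem ∘ suc} {out ∘ suc} {b ∘ suc} (ℕₚ.suc-injective e)
      (λ i → ≡.trans (em (suc i)) (≡.trans (∈ᵇ-indicesFrom-tail (ℕₚ.m<m+n k (ℕ.s≤s ℕ.z≤n)) c bs) (≡.cong (_∈ᵇ indicesFrom (suc k) bs) (ℕₚ.+-suc k i))))
      (λ i → ≡.trans (eo (suc i)) (≡.cong (λ j → not (j ∈ᵇ J)) (ℕₚ.+-suc k i)))
      (λ i → eb (suc i)))
    where
    regroup : ∀ j → n ℕ.* (if out (suc j) then b (suc j) else 0) ℕ.+ sumBelow (suc (suc j)) (λ i → if mem i ∧ out (suc j) then b (suc j) else 0)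
      ≡ n′ ℕ.* (if out (suc j) then b (suc j) else 0) ℕ.+ sumBelow (suc j) (λ i → if mem (suc i) ∧ out (suc j) then b (suc j) else 0)
    regroup j rewrite mem0 = ≡.trans (≡.sym (ℕₚ.+-assoc (n ℕ.* (if out (suc j) then b (suc j) else 0)) _ _))
      (≡.cong (ℕ._+ sumBelow (suc j) (λ i → if mem (suc i) ∧ out (suc j) then b (suc j) else 0)) (combine n c (out (suc j)) (b (suc j))))

Lsum-exponentFrom : ∀ J bs zs C → length bs ≡ length zs → Lsum (length bs) (indicesFrom 0 bs) J (zs ++ C) ≡ exponentFrom 0 0 J bs zs
Lsum-exponentFrom J bs zs C e = ≡.trans (sum-concatMap-upTo _ id (length bs))
  (≡.trans (sumBelow-cong (length bs) (λ j → sum-map-upTo _ id (suc j)))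
    (LsumFrom-exponentFrom 0 0 J bs zs C {λ i → i ∈ᵇ indicesFrom 0 bs} {λ j → not (j ∈ᵇ J)} {nthD 0 (zs ++ C)} e (λ _ → ≡.refl) (λ _ → ≡.refl) (λ _ → ≡.refl)))

sumIdx-sumFrom : ∀ J zs → sumIdx J zs ≡ sumFrom 0 J zs
sumIdx-sumFrom J zs = ≡.trans (≡.cong sum (imap≡imapFrom (λ k x → if k ∈ᵇ J then x else 0) zs)) (go 0 zs)
  where
  go : ∀ k zs → sum (imapFrom (λ k x → if k ∈ᵇ J then x else 0) k zs) ≡ sumFrom k J zs
  go k []       = ≡.refl
  go k (z ∷ zs) = ≡.cong ((if k ∈ᵇ J then z else 0) ℕ.+_) (go (suc k) zs)

sumFrom-deleteFrom : ∀ I k zs → sumFrom k I zs ℕ.+ sum (deleteFrom I k zs) ≡ sum zs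
sumFrom-deleteFrom I k []       = ≡.refl
sumFrom-deleteFrom I k (z ∷ zs) with k ∈ᵇ I
... | true  = ≡.trans (ℕₚ.+-assoc z _ _) (≡.cong (z ℕ.+_) (sumFrom-deleteFrom I (suc k) zs))
... | false = ≡.trans (ℕ-x∙yz≡y∙xz (sumFrom (suc k) I zs) z _) (≡.cong (z ℕ.+_) (sumFrom-deleteFrom I (suc k) zs))

sumFrom-[] : ∀ k zs → sumFrom k [] zs ≡ 0
sumFrom-[] k []       = ≡.refl
sumFrom-[] k (z ∷ zs) = sumFrom-[] (suc k) zs

sumFrom-≥ : ∀ {J} k zs C → All (ℕ._< k ℕ.+ length zs) J → sumFrom k J (zs ++ C) ≡ sumFrom k J zs
sumFrom-≥ {J} k []       C p = zeros k C (≡.subst (λ m → All (ℕ._< m) J) (ℕₚ.+-identityʳ k) p)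
  where
  zeros : ∀ k C → All (ℕ._< k) J → sumFrom k J C ≡ 0
  zeros k []      p = ≡.refl
  zeros k (c ∷ C) p rewrite >All⇒∉ᵇ p = zeros (suc k) C (All.map ℕₚ.m<n⇒m<1+n p)
sumFrom-≥ {J} k (z ∷ zs) C p = ≡.cong ((if k ∈ᵇ J then z else 0) ℕ.+_)
  (sumFrom-≥ (suc k) zs C (≡.subst (λ m → All (ℕ._< m) J) (ℕₚ.+-suc k (length zs)) p))

sumFrom-< : ∀ {J} k zs C → All (k ℕ.+ length zs ℕ.≤_) J → sumFrom k J (zs ++ C) ≡ sumFrom (k ℕ.+ length zs) J C
sumFrom-< {J} k []       C p = ≡.cong (λ j → sumFrom j J C) (≡.sym (ℕₚ.+-identityʳ k))
sumFrom-< {J} k (z ∷ zs) C p rewrite <All⇒∉ᵇ (All.map (ℕₚ.≤-trans (ℕₚ.m<m+n k (ℕ.s≤s ℕ.z≤n))) p) =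
  ≡.trans (sumFrom-< (suc k) zs C (≡.subst (λ m → All (m ℕ.≤_) J) (ℕₚ.+-suc k (length zs)) p)) (≡.cong (λ j → sumFrom j J C) (≡.sym (ℕₚ.+-suc k (length zs))))

exponentFrom-false : {A : Set} → ∀ k J (g : A → ℕ) xs bs zs →
  exponentFrom k 0 J (map (λ _ → false) xs ++ bs) (map g xs ++ zs) ≡ exponentFrom (k ℕ.+ length xs) 0 J bs zs
exponentFrom-false k J g []       bs zs = ≡.cong (λ j → exponentFrom j 0 J bs zs) (≡.sym (ℕₚ.+-identityʳ k))
exponentFrom-false k J g (x ∷ xs) bs zs = ≡.trans (≡.cong (ℕ._+ exponentFrom (suc k) 0 J (map (λ _ → false) xs ++ bs) (map g xs ++ zs)) (Boolₚ.if-eta (k ∈ᵇ J)))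
  (≡.trans (exponentFrom-false (suc k) J g xs bs zs) (≡.cong (λ j → exponentFrom j 0 J bs zs) (≡.sym (ℕₚ.+-suc k (length xs)))))

module _ {A : Set} where

  subsets-All : ∀ {P : A → Set} S {J} → J ∈ subsets S → All P S → All P J
  subsets-All []      (here ≡.refl) ps = []
  subsets-All (x ∷ S) J∈ (p ∷ ps) with ∈-++⁻ (map (x ∷_) (subsets S)) J∈
  ... | inj₂ J∈′ = subsets-All S J∈′ ps
  ... | inj₁ J∈′ with ∈-map⁻ (x ∷_) J∈′
  ...   | J′ , J′∈ , ≡.refl = p ∷ subsets-All S J′∈ ps

  subsets-length : ∀ (S : List A) {J} → J ∈ subsets S → length J ℕ.≤ length S
  subsets-length []      (here ≡.refl) = ℕ.z≤n
  subsets-length (x ∷ S) J∈ with ∈-++⁻ (map (x ∷_) (subsets S)) J∈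
  ... | inj₂ J∈′ = ℕₚ.m≤n⇒m≤1+n (subsets-length S J∈′)
  ... | inj₁ J∈′ with ∈-map⁻ (x ∷_) J∈′
  ...   | J′ , J′∈ , ≡.refl = ℕ.s≤s (subsets-length S J′∈)

exponentFrom-∷ : ∀ {k} j n J bs zs → k ℕ.< j → exponentFrom j n (k ∷ J) bs zs ≡ exponentFrom j n J bs zs
exponentFrom-∷ j n J []       zs       p = ≡.refl
exponentFrom-∷ j n J (b ∷ bs) []       p = ≡.refl
exponentFrom-∷ {k} j n J (b ∷ bs) (z ∷ zs) p = ≡.cong₂ (λ m e → (if m then 0 else _) ℕ.+ e)
  (∈ᵇ-there {j} {k} {J} (>⇒≡ᵇ-false p)) (exponentFrom-∷ (suc j) _ J bs zs (ℕₚ.m<n⇒m<1+n p))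

sumFrom-∷ : ∀ {k} j J zs → k ℕ.< j → sumFrom j (k ∷ J) zs ≡ sumFrom j J zs
sumFrom-∷ j J []       p = ≡.refl
sumFrom-∷ {k} j J (z ∷ zs) p = ≡.cong₂ (λ m e → (if m then z else 0) ℕ.+ e)
  (∈ᵇ-there {j} {k} {J} (>⇒≡ᵇ-false p)) (sumFrom-∷ (suc j) J zs (ℕₚ.m<n⇒m<1+n p))

-- Signed subset sums over the enumeration `subsets`

module SubsetEnumeration (T : CommutativeRing 0ℓ 0ℓ) (q : CommutativeRing.Carrier T)
  {A : Set} (marked : A → Bool) (size : A → ℕ) where
  open RingLemmas T
  open CompleteSymmetric T using (_^_; ^-homo-*)
  open SubsetSums T q marked size
  open ≈R

  private
    marks : List A → List Bool
    marks = map marked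

  subsetTerm : ℕ → ℕ → List A → (ℕ → Carrier) → List ℕ → Carrier
  subsetTerm k n B f J = (- 1#) ^ (length (indicesFrom k (marks B)) ∸ length J)
    * (q ^ exponentFrom k n J (marks B) (map size B) * f (sumFrom k J (map size B)))

  -- `subsets` splits by whether the first marked index belongs to J, which is the case distinction
  -- defining `subsetSum`. That index is smaller than all later ones, so membership tests further on
  -- do not see it.
  ∑-subsets : ∀ k n B f → ∑ (subsets (indicesFrom k (marks B))) (subsetTerm k n B f) ≈ subsetSum n B f
  ∑-subsets k n [] f = trans (+-identityʳ _) (trans (*-identityˡ _) (*-identityˡ _))
  ∑-subsets k n (c ∷ B) f with marked c
  ... | false = begin
    ∑ (subsets S) (λ J → (- 1#) ^ (length S ∸ length J) * (q ^ ((if k ∈ᵇ J then 0 else n ℕ.* z) ℕ.+ e n J) * f ((if k ∈ᵇ J then z else 0) ℕ.+ s J)))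
      ≈⟨ ∑-cong (subsets S) (λ {J} J∈ → outside J J∈) ⟩
    ∑ (subsets S) (λ J → q ^ (n ℕ.* z) * subsetTerm (suc k) n B f J)   ≈⟨ *-∑ _ (subsets S) ⟨
    q ^ (n ℕ.* z) * ∑ (subsets S) (subsetTerm (suc k) n B f)           ≈⟨ *-congˡ (∑-subsets (suc k) n B f) ⟩
    q ^ (n ℕ.* z) * subsetSum n B f                                    ∎
    where
    z = size c
    S = indicesFrom (suc k) (marks B)
    e : ℕ → List ℕ → ℕ
    e n J = exponentFrom (suc k) n J (marks B) (map size B)
    s : List ℕ → ℕ
    s J = sumFrom (suc k) J (map size B)
    outside : ∀ J → J ∈ subsets S →
      (- 1#) ^ (length S ∸ length J) * (q ^ ((if k ∈ᵇ J then 0 else n ℕ.* z) ℕ.+ e n J) * f ((if k ∈ᵇ J then z else 0) ℕ.+ s J))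
        ≈ q ^ (n ℕ.* z) * subsetTerm (suc k) n B f J
    outside J J∈ rewrite <All⇒∉ᵇ (subsets-All S J∈ (indicesFrom-≥ (suc k) (marks B))) =
      trans (*-congˡ (*-congʳ (^-homo-* q (n ℕ.* z) (e n J))))
        (solve 4 (λ g a b h → g ⊠ ((a ⊠ b) ⊠ h) := a ⊠ (g ⊠ (b ⊠ h))) refl _ _ _ _)
  ... | true = begin
    ∑ (map (k ∷_) (subsets S) ++ subsets S) t
      ≈⟨ ∑-++ (map (k ∷_) (subsets S)) (subsets S) ⟩
    ∑ (map (k ∷_) (subsets S)) t + ∑ (subsets S) t
      ≈⟨ +-cong (trans (∑-map (k ∷_) (subsets S)) (∑-cong (subsets S) (λ {J} J∈ → inside J)))
           (trans (∑-cong (subsets S) (λ {J} J∈ → outside J J∈)) (sym (*-∑ _ (subsets S)))) ⟩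
    ∑ (subsets S) (subsetTerm (suc k) (suc n) B (λ x → f (z ℕ.+ x))) + - (q ^ (suc n ℕ.* z)) * ∑ (subsets S) (subsetTerm (suc k) (suc n) B f)
      ≈⟨ +-cong (∑-subsets (suc k) (suc n) B (λ x → f (z ℕ.+ x))) (*-congˡ (∑-subsets (suc k) (suc n) B f)) ⟩
    subsetSum (suc n) B (λ x → f (z ℕ.+ x)) + - (q ^ (suc n ℕ.* z)) * subsetSum (suc n) B f
      ≈⟨ trans (+-comm _ _) (+-congʳ (sym (-‿distribˡ-* _ _))) ⟩
    - (q ^ (suc n ℕ.* z) * subsetSum (suc n) B f) + subsetSum (suc n) B (λ x → f (z ℕ.+ x)) ∎
    where
    z = size c
    S = indicesFrom (suc k) (marks B)
    e : List ℕ → ℕ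
    e J = exponentFrom (suc k) (suc n) J (marks B) (map size B)
    s : List ℕ → ℕ
    s J = sumFrom (suc k) J (map size B)
    t : List ℕ → Carrier
    t J = (- 1#) ^ (suc (length S) ∸ length J) * (q ^ ((if k ∈ᵇ J then 0 else suc n ℕ.* z) ℕ.+ e J) * f ((if k ∈ᵇ J then z else 0) ℕ.+ s J))
    inside : ∀ J → t (k ∷ J) ≈ subsetTerm (suc k) (suc n) B (λ x → f (z ℕ.+ x)) J
    inside J rewrite ∈ᵇ-here k {J} | exponentFrom-∷ {k} (suc k) (suc n) J (marks B) (map size B) ℕₚ.≤-refl | sumFrom-∷ {k} (suc k) J (map size B) ℕₚ.≤-refl = refl
    outside : ∀ J → J ∈ subsets S → t J ≈ - (q ^ (suc n ℕ.* z)) * subsetTerm (suc k) (suc n) B f J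
    outside J J∈ rewrite <All⇒∉ᵇ (subsets-All S J∈ (indicesFrom-≥ (suc k) (marks B))) | ℕₚ.+-∸-assoc 1 (subsets-length S J∈) =
      trans (*-congˡ (*-congʳ (^-homo-* q (suc n ℕ.* z) (e J))))
        (solve 4 (λ g a b h → ((⊖ 𝟙) ⊠ g) ⊠ ((a ⊠ b) ⊠ h) := (⊖ a) ⊠ (g ⊠ (b ⊠ h))) refl _ _ _ _)

-- Values of the formal fractions in the statement

module FractionValues {V : Set} (S : LaurentSystem V) (_≟_ : DecidableEquality V) (F : FractionExtension (LaurentSystem.R S)) where
  open LaurentSystem S
  open FractionExtension F renaming (T to TR)
  open ClosedForms S _≟_ F
  open R using (Carrier; _≈_)
  open T using () renaming (Carrier to Fraction; _≈_ to _≃_)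
  module RR = R.≈R
  module TT = T.≈R

  polynomial-++ : ∀ p p′ → polynomial (p ++ p′) ≈ polynomial p R.+ polynomial p′
  polynomial-++ p p′ = R.∑-++ p p′

  polynomial-* : ∀ p p′ → polynomial (p *ₚ p′) ≈ polynomial p R.* polynomial p′
  polynomial-* []            p′ = R.sym (R.zeroˡ _)
  polynomial-* ((c , e) ∷ p) p′ = begin
    polynomial (((c , e) ∷ p) *ₚ p′)         ≈⟨ R.∑-++ (map _ p′) (p *ₚ p′) ⟩
    R.∑ (map _ p′) _ R.+ polynomial (p *ₚ p′)  ≈⟨ R.+-cong (R.∑-map _ p′) (polynomial-* p p′) ⟩
    R.∑ p′ (λ t → const (c ℤ.* proj₁ t) R.* q R.^ (e ℕ.+ proj₂ t)) R.+ polynomial p R.* polynomial p′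
      ≈⟨ R.+-congʳ (R.trans (R.∑-cong p′ (λ {t} _ → R.trans (R.*-cong (const-* c (proj₁ t)) (R.^-homo-* q e (proj₂ t)))
           (R.solve 4 (λ a b c d → (a R.⊠ b) R.⊠ (c R.⊠ d) R.:= (a R.⊠ c) R.⊠ (b R.⊠ d)) R.refl _ _ _ _))) (R.sym (R.*-∑ _ p′))) ⟩
    (const c R.* q R.^ e) R.* polynomial p′ R.+ polynomial p R.* polynomial p′  ≈⟨ R.distribʳ _ _ _ ⟨
    polynomial ((c , e) ∷ p) R.* polynomial p′ ∎
    where open R.≈R

  polynomial-const : ∀ c → polynomial (constₚ c) ≈ const c
  polynomial-const c = R.trans (R.+-identityʳ _) (R.*-identityʳ _)

  polynomial-1 : polynomial (constₚ (+ 1)) ≈ R.1#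
  polynomial-1 = R.trans (polynomial-const (+ 1)) const-1

  polynomial-qpow : ∀ m → polynomial (qpow m) ≈ q R.^ m
  polynomial-qpow m = R.trans (R.+-identityʳ _) (R.trans (R.*-congʳ const-1) (R.*-identityˡ _))

  polynomial-oneMinusQ : ∀ m → polynomial (oneMinusQ m) ≈ R.1# R.+ R.- (q R.^ m)
  polynomial-oneMinusQ m = R.+-cong (R.trans (R.*-identityʳ _) const-1)
    (R.trans (R.+-identityʳ _) (R.trans (R.*-congʳ (R.trans (const-neg (+ 1)) (R.-‿cong const-1)))
      (R.trans (R.sym (R.-‿distribˡ-* _ _)) (R.-‿cong (R.*-identityˡ _)))))

  polynomial-prod : {A : Set} (L : List A) (P : A → Poly) (f : A → Carrier) → (∀ x → polynomial (P x) ≈ f x) → polynomial (prodₚ (map P L)) ≈ R.∏ L f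
  polynomial-prod []      P f H = polynomial-1
  polynomial-prod (x ∷ L) P f H = R.trans (polynomial-* (P x) _) (R.*-cong (H x) (polynomial-prod L P f H))

  polynomial-qPoch : ∀ k → polynomial (qPoch k) ≈ R.poch q k
  polynomial-qPoch k = R.trans (polynomial-prod (upTo k) _ _ (λ t → R.trans (polynomial-oneMinusQ (suc t)) (R.+-congˡ (R.-‿cong (R.*-comm _ _)))))
    (R.poch-∏ k q)

  const-signPow : ∀ k → const (signPow k) ≈ (R.- R.1#) R.^ k
  const-signPow zero    = const-1
  const-signPow (suc k) = R.trans (const-neg (signPow k)) (R.trans (R.-‿cong (const-signPow k))
    (R.trans (R.-‿cong (R.sym (R.*-identityˡ _))) (R.-‿distribˡ-* _ _)))

  regular-poch : ∀ k → R.Regular (R.poch q k)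
  regular-poch k = R.Regular-resp (R.poch-∏ k q) (R.Regular-∏ (upTo k) (λ {t} _ → R.Regular-resp (R.+-congˡ (R.-‿cong (R.*-comm _ _))) (regular-1-q^ t)))

  regular-qPoch : ∀ k → R.Regular (polynomial (qPoch k))
  regular-qPoch k = R.Regular-resp (R.sym (polynomial-qPoch k)) (regular-poch k)

  ⟪_⟫ : Poly → Fraction
  ⟪ p ⟫ = embed (polynomial p)

  ⟪⟫-* : ∀ p p′ → ⟪ p *ₚ p′ ⟫ ≃ ⟪ p ⟫ T.* ⟪ p′ ⟫
  ⟪⟫-* p p′ = T.trans (embed-cong (polynomial-* p p′)) (embed-* _ _)

  ⟪⟫-+ : ∀ p p′ → ⟪ p +ₚ p′ ⟫ ≃ ⟪ p ⟫ T.+ ⟪ p′ ⟫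
  ⟪⟫-+ p p′ = T.trans (embed-cong (polynomial-++ p p′)) (embed-+ _ _)

  ⟪⟫-1 : ⟪ constₚ (+ 1) ⟫ ≃ T.1#
  ⟪⟫-1 = T.trans (embed-cong polynomial-1) embed-1

  ⟪⟫-oneMinusQ : ∀ m → ⟪ oneMinusQ m ⟫ ≃ T.1# T.+ T.- (embed q T.^ m)
  ⟪⟫-oneMinusQ m = T.trans (embed-cong (polynomial-oneMinusQ m)) (T.trans (embed-1- (q R.^ m)) (T.+-congˡ (T.-‿cong (embed-^ q m))))

  ⟪⟫-qPoch : ∀ m → ⟪ qPoch m ⟫ ≃ T.poch (embed q) m
  ⟪⟫-qPoch m = T.trans (embed-cong (polynomial-qPoch m)) (embed-poch q m)

  infix 4 _⇝_
  -- The value t of a formal fraction, given by t · den = num: a `Frac` carries no evidence about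
  -- its denominator, so no function can send it to a fraction.
  record _⇝_ (x : Frac) (t : Fraction) : Set where
    constructor val
    field
      regularDen : R.Regular (polynomial (proj₂ x))
      equation   : t T.* ⟪ proj₂ x ⟫ ≃ ⟪ proj₁ x ⟫
  open _⇝_

  ⇝-resp : ∀ {x s t} → s ≃ t → x ⇝ s → x ⇝ t
  ⇝-resp e (val r p) = val r (T.trans (T.*-congʳ (T.sym e)) p)

  ⇝-polyF : ∀ p → polyF p ⇝ ⟪ p ⟫
  ⇝-polyF p = val (R.Regular-resp (R.sym polynomial-1) R.Regular-1) (T.trans (T.*-congˡ ⟪⟫-1) (T.*-identityʳ _))

  Regular-*ₚ : ∀ p p′ → R.Regular (polynomial p) → R.Regular (polynomial p′) → R.Regular (polynomial (p *ₚ p′))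
  Regular-*ₚ p p′ r r′ = R.Regular-resp (R.sym (polynomial-* p p′)) (R.Regular-* r r′)

  ⇝-* : ∀ {x y s t} → x ⇝ s → y ⇝ t → x *f y ⇝ s T.* t
  ⇝-* {a , b} {c , d} {s} {t} (val r p) (val r′ p′) = val (Regular-*ₚ b d r r′) (begin
    (s T.* t) T.* ⟪ b *ₚ d ⟫                 ≈⟨ T.*-congˡ (⟪⟫-* b d) ⟩
    (s T.* t) T.* (⟪ b ⟫ T.* ⟪ d ⟫)
      ≈⟨ T.solve 4 (λ a b c d → (a T.⊠ b) T.⊠ (c T.⊠ d) T.:= (a T.⊠ c) T.⊠ (b T.⊠ d)) T.refl _ _ _ _ ⟩
    (s T.* ⟪ b ⟫) T.* (t T.* ⟪ d ⟫)          ≈⟨ T.*-cong p p′ ⟩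
    ⟪ a ⟫ T.* ⟪ c ⟫                          ≈⟨ ⟪⟫-* a c ⟨
    ⟪ a *ₚ c ⟫                               ∎)
    where open TT

  ⇝-/ : ∀ {x y s t t′} → x ⇝ s → y ⇝ t → R.Regular (polynomial (proj₁ y)) → t′ T.* t ≃ T.1# → x /f y ⇝ s T.* t′
  ⇝-/ {a , b} {c , d} {s} {t} {t′} (val r p) (val r′ p′) rc e = val (Regular-*ₚ b c r rc) (begin
    (s T.* t′) T.* ⟪ b *ₚ c ⟫                ≈⟨ T.*-congˡ (⟪⟫-* b c) ⟩
    (s T.* t′) T.* (⟪ b ⟫ T.* ⟪ c ⟫)         ≈⟨ T.*-congˡ (T.*-congˡ p′) ⟨
    (s T.* t′) T.* (⟪ b ⟫ T.* (t T.* ⟪ d ⟫))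
      ≈⟨ T.solve 5 (λ s t′ b t d → (s T.⊠ t′) T.⊠ (b T.⊠ (t T.⊠ d)) T.:= (t′ T.⊠ t) T.⊠ ((s T.⊠ b) T.⊠ d)) T.refl _ _ _ _ _ ⟩
    (t′ T.* t) T.* ((s T.* ⟪ b ⟫) T.* ⟪ d ⟫) ≈⟨ T.*-cong e (T.*-congʳ p) ⟩
    T.1# T.* (⟪ a ⟫ T.* ⟪ d ⟫)               ≈⟨ T.*-identityˡ _ ⟩
    ⟪ a ⟫ T.* ⟪ d ⟫                          ≈⟨ ⟪⟫-* a d ⟨
    ⟪ a *ₚ d ⟫                               ∎)
    where open TT

  ⇝-+ : ∀ {x y s t} → x ⇝ s → y ⇝ t → x +f y ⇝ s T.+ t
  ⇝-+ {a , b} {c , d} {s} {t} (val r p) (val r′ p′) = val (Regular-*ₚ b d r r′) (begin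
    (s T.+ t) T.* ⟪ b *ₚ d ⟫                 ≈⟨ T.*-congˡ (⟪⟫-* b d) ⟩
    (s T.+ t) T.* (⟪ b ⟫ T.* ⟪ d ⟫)
      ≈⟨ T.solve 4 (λ s t b d → (s T.⊞ t) T.⊠ (b T.⊠ d) T.:= (s T.⊠ b) T.⊠ d T.⊞ (t T.⊠ d) T.⊠ b) T.refl _ _ _ _ ⟩
    (s T.* ⟪ b ⟫) T.* ⟪ d ⟫ T.+ (t T.* ⟪ d ⟫) T.* ⟪ b ⟫   ≈⟨ T.+-cong (T.*-congʳ p) (T.*-congʳ p′) ⟩
    ⟪ a ⟫ T.* ⟪ d ⟫ T.+ ⟪ c ⟫ T.* ⟪ b ⟫      ≈⟨ T.+-cong (⟪⟫-* a d) (⟪⟫-* c b) ⟨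
    ⟪ a *ₚ d ⟫ T.+ ⟪ c *ₚ b ⟫                ≈⟨ ⟪⟫-+ (a *ₚ d) (c *ₚ b) ⟨
    ⟪ a *ₚ d +ₚ c *ₚ b ⟫                     ∎)
    where open TT

  ⇝-sumF : {A : Set} (L : List A) (P : A → Frac) (f : A → Fraction) → (∀ x → P x ⇝ f x) → sumF (map P L) ⇝ T.∑ L f
  ⇝-sumF []      P f H = ⇝-resp embed-0 (⇝-polyF [])
  ⇝-sumF (x ∷ L) P f H = ⇝-+ (H x) (⇝-sumF L P f H)

  -- The cross-multiplied equation is verified among fractions and pulled back along two injective
  -- maps, first to the Laurent ring and then to coefficients.
  ⇝⇒≈f : ∀ {x} p → x ⇝ ⟪ p ⟫ → polyF p ≈f x
  ⇝⇒≈f {a , b} p (val r e) = polynomial-injective (p *ₚ b) (a *ₚ constₚ (+ 1)) (embed-injective (begin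
    ⟪ p *ₚ b ⟫                    ≈⟨ ⟪⟫-* p b ⟩
    ⟪ p ⟫ T.* ⟪ b ⟫               ≈⟨ e ⟩
    ⟪ a ⟫                         ≈⟨ T.*-identityʳ _ ⟨
    ⟪ a ⟫ T.* T.1#                ≈⟨ T.*-congˡ ⟪⟫-1 ⟨
    ⟪ a ⟫ T.* ⟪ constₚ (+ 1) ⟫    ≈⟨ ⟪⟫-* a (constₚ (+ 1)) ⟨
    ⟪ a *ₚ constₚ (+ 1) ⟫         ∎))
    where open TT

  module Formula (ρ : ℕ) (lam : List ℕ) (thr : ℤ) where
    open Parts ρ lam thr
    open SubsetEnumeration TR (embed q) marked size
    open TT

    ι ι⁻¹ : ℕ → Fraction
    ι   = T.poch (embed q)
    ι⁻¹ = pochInv inv inv-law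

    ∏-ι : ∀ L → T.∏ L ι T.* T.∏ L ι⁻¹ ≃ T.1#
    ∏-ι []      = T.*-identityˡ _
    ∏-ι (x ∷ L) = T.trans (T.solve 4 (λ a b c d → (a T.⊠ b) T.⊠ (c T.⊠ d) T.:= (a T.⊠ c) T.⊠ (b T.⊠ d)) T.refl _ _ _ _)
      (T.trans (T.*-cong (pochInv-law inv inv-law x) (∏-ι L)) (T.*-identityˡ _))

    ⟪⟫-prod-qPoch : ∀ L → ⟪ prodₚ (map qPoch L) ⟫ ≃ T.∏ L ι
    ⟪⟫-prod-qPoch []      = ⟪⟫-1
    ⟪⟫-prod-qPoch (x ∷ L) = T.trans (⟪⟫-* (qPoch x) _) (T.*-cong (⟪⟫-qPoch x) (⟪⟫-prod-qPoch L))

    regular-prod-qPoch : ∀ L → R.Regular (polynomial (prodₚ (map qPoch L)))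
    regular-prod-qPoch []      = R.Regular-resp (R.sym polynomial-1) R.Regular-1
    regular-prod-qPoch (x ∷ L) = Regular-*ₚ (qPoch x) _ (regular-qPoch x) (regular-prod-qPoch L)

    multinomialValue multinomialInverse : ℕ → List ℕ → Fraction
    multinomialValue   n L = ι n T.* T.∏ L ι⁻¹
    multinomialInverse n L = ι⁻¹ n T.* T.∏ L ι

    multinomialInverse-law : ∀ n L → multinomialInverse n L T.* multinomialValue n L ≃ T.1#
    multinomialInverse-law n L = begin
      (ι⁻¹ n T.* T.∏ L ι) T.* (ι n T.* T.∏ L ι⁻¹)
        ≈⟨ T.solve 4 (λ a b c d → (a T.⊠ b) T.⊠ (c T.⊠ d) T.:= (c T.⊠ a) T.⊠ (b T.⊠ d)) T.refl _ _ _ _ ⟩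
      (ι n T.* ι⁻¹ n) T.* (T.∏ L ι T.* T.∏ L ι⁻¹)   ≈⟨ T.*-cong (pochInv-law inv inv-law n) (∏-ι L) ⟩
      T.1# T.* T.1#                                 ≈⟨ T.*-identityˡ _ ⟩
      T.1#                                          ∎

    ⇝-qMultinom : ∀ n L → qMultinom n L ⇝ multinomialValue n L
    ⇝-qMultinom n L = val (regular-prod-qPoch L) (begin
      (ι n T.* T.∏ L ι⁻¹) T.* ⟪ prodₚ (map qPoch L) ⟫  ≈⟨ T.*-congˡ (⟪⟫-prod-qPoch L) ⟩
      (ι n T.* T.∏ L ι⁻¹) T.* T.∏ L ι
        ≈⟨ T.solve 3 (λ a b c → (a T.⊠ b) T.⊠ c T.:= a T.⊠ (c T.⊠ b)) T.refl _ _ _ ⟩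
      ι n T.* (T.∏ L ι T.* T.∏ L ι⁻¹)                  ≈⟨ T.trans (T.*-congˡ (∏-ι L)) (T.*-identityʳ _) ⟩
      ι n                                              ≈⟨ ⟪⟫-qPoch n ⟨
      ⟪ qPoch n ⟫                                      ∎)

    ⇝-ratio : ∀ x k → (oneMinusQ x , oneMinusQ (suc k)) ⇝ (T.1# T.+ T.- (embed q T.^ x)) T.* inv (suc k)
    ⇝-ratio x k = val (R.Regular-resp (R.sym (polynomial-oneMinusQ (suc k))) (regular-1-q^ k)) (begin
      ((T.1# T.+ T.- (embed q T.^ x)) T.* inv (suc k)) T.* ⟪ oneMinusQ (suc k) ⟫  ≈⟨ T.*-congˡ (⟪⟫-oneMinusQ (suc k)) ⟩
      ((T.1# T.+ T.- (embed q T.^ x)) T.* inv (suc k)) T.* (T.1# T.+ T.- (embed q T.^ suc k))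
        ≈⟨ T.solve 3 (λ a b c → (a T.⊠ b) T.⊠ c T.:= a T.⊠ (c T.⊠ b)) T.refl _ _ _ ⟩
      (T.1# T.+ T.- (embed q T.^ x)) T.* ((T.1# T.+ T.- (embed q T.^ suc k)) T.* inv (suc k))
        ≈⟨ T.trans (T.*-congˡ (inv-law k)) (T.*-identityʳ _) ⟩
      T.1# T.+ T.- (embed q T.^ x)                     ≈⟨ ⟪⟫-oneMinusQ x ⟨
      ⟪ oneMinusQ x ⟫                                  ∎)

    sign : ℕ → Fraction
    sign k = (T.- T.1#) T.^ k

    embed-sign : ∀ k → embed ((R.- R.1#) R.^ k) ≃ sign k
    embed-sign k = T.trans (embed-^ (R.- R.1#) k) (pow k)
      where
      pow : ∀ k → embed (R.- R.1#) T.^ k ≃ sign k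
      pow zero    = T.refl
      pow (suc k) = T.*-cong (T.trans (embed-neg R.1#) (T.-‿cong embed-1)) (pow k)

    ⟪⟫-sign-qpow : ∀ k m → ⟪ constₚ (signPow k) *ₚ qpow m ⟫ ≃ sign k T.* embed q T.^ m
    ⟪⟫-sign-qpow k m = T.trans (⟪⟫-* (constₚ (signPow k)) (qpow m)) (T.*-cong
      (T.trans (embed-cong (R.trans (polynomial-const (signPow k)) (const-signPow k))) (embed-sign k))
      (T.trans (embed-cong (polynomial-qpow m)) (embed-^ q m)))

    ∑-filterᵇ : {A : Set} (p : A → Bool) (L : List A) {g : A → Fraction} → (∀ {x} → x ∈ L → p x ≡ false → g x ≃ T.0#) →
      T.∑ (filterᵇ p L) g ≃ T.∑ L g
    ∑-filterᵇ p []      H = T.refl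
    ∑-filterᵇ p (x ∷ L) H with p x in eq
    ... | true  = T.+-congˡ (∑-filterᵇ p L (H ∘ there))
    ... | false = T.trans (∑-filterᵇ p L (H ∘ there)) (T.sym (T.trans (T.+-congʳ (H (here ≡.refl) eq)) (T.+-identityˡ _)))

    -- The data common to both parts of the theorem: A is the block from which variables are
    -- removed, O the other block, `k` the index at which A begins and `m` the range of the exponent
    -- sum.
    record Shape : Set where
      field
        A O        : List (Item V)
        at         : List ℕ
        k m        : ℕ
        εz         : ℤ
        Dpoly Dsub : Poly
      I : List ℕ
      I = indicesFrom k (map marked A)
      w : ℕ
      w = total O ℕ.+ ρ
      M₁ M₂ Σ₁ : Fraction
      M₁ = multinomial inv inv-law w G G-zero G-suc A
      M₂ = multinomial inv inv-law w G G-zero G-suc (unmarked A)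
      Σ₁ = subsetSum 0 A (summand inv inv-law w G G-zero G-suc A)

    -- The index-based quantities of the statement equal their mark-based counterparts on A, and the
    -- closed form holds. From here on both parts are evaluated by one computation.
    record Configuration (shape : Shape) : Set where
      open Shape shape
      field
        sum-at  : sum at ≡ total A ℕ.+ total O
        ∏-at    : T.∏ at ι⁻¹ ≃ T.∏ A (ι⁻¹ ∘ size) T.* T.∏ O (ι⁻¹ ∘ size)
        sum-del : sum (deleteIdx I at) ≡ total (unmarked A) ℕ.+ total O
        ∏-del   : T.∏ (deleteIdx I at) ι⁻¹ ≃ T.∏ (unmarked A) (ι⁻¹ ∘ size) T.* T.∏ O (ι⁻¹ ∘ size)
        Lsum≡   : ∀ {J} → J ∈ subsets I → Lsum m I J at ≡ exponentFrom k 0 J (map marked A) (map size A)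
        sumIdx≡ : ∀ {J} → J ∈ subsets I → sumIdx J at ≡ sumFrom k J (map size A)
        closed  : M₂ T.* ⟪ Dpoly ⟫ ≃ (embed (const εz) T.* M₁) T.* (Σ₁ T.* ⟪ Dsub ⟫)

    module Evaluate {shape : Shape} (C : Configuration shape) where
      open Shape shape
      open Configuration C

      numerator : Fraction
      numerator = multinomialValue (sum at ℕ.+ ρ) (at ++ ρ ∷ [])

      n₂ : ℕ
      n₂ = sum (deleteIdx I at) ℕ.+ ρ

      L₂ : List ℕ
      L₂ = deleteIdx I at ++ ρ ∷ []

      fx : ℕ → Fraction
      fx x = (T.1# T.+ T.- (embed q T.^ x)) T.* inv (suc (sum at ∸ x ℕ.+ ρ))

      value : List ℕ → Fraction
      value J = (sign (length I ∸ length J) T.* embed q T.^ Lsum m I J at) T.* (fx (sumIdx J at) T.* ⟪ Dsub ⟫)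

      ∑-value : T.∑ (nonemptySubsets I) value ≃ subsetSum 0 A (summand inv inv-law w G G-zero G-suc A) T.* ⟪ Dsub ⟫
      ∑-value = begin
        T.∑ (nonemptySubsets I) value     ≈⟨ ∑-filterᵇ _ (subsets I) (λ {J} _ → empty J) ⟩
        T.∑ (subsets I) value             ≈⟨ T.∑-cong (subsets I) (λ {J} J∈ → rewriteTerm J J∈) ⟩
        T.∑ (subsets I) (λ J → ⟪ Dsub ⟫ T.* subsetTerm k 0 A fx J)   ≈⟨ T.*-∑ _ (subsets I) ⟨
        ⟪ Dsub ⟫ T.* T.∑ (subsets I) (subsetTerm k 0 A fx)           ≈⟨ T.*-comm _ _ ⟩
        T.∑ (subsets I) (subsetTerm k 0 A fx) T.* ⟪ Dsub ⟫           ≈⟨ T.*-congʳ (∑-subsets k 0 A fx) ⟩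
        subsetSum 0 A fx T.* ⟪ Dsub ⟫     ≈⟨ T.*-congʳ (SubsetSums.subsetSum-cong TR (embed q) marked size 0 A summand≈) ⟩
        subsetSum 0 A (summand inv inv-law w G G-zero G-suc A) T.* ⟪ Dsub ⟫ ∎
        where
        -- The empty set may be added to the range of summation: its factor 1 - q^{a_J} is 1 - q^0 =
        -- 0.
        empty : ∀ J → not (length J ≡ᵇ 0) ≡ false → value J ≃ T.0#
        empty [] _ = T.trans (T.*-congˡ (T.trans (T.*-congʳ (T.trans (T.*-congʳ zero≈) (T.zeroˡ _))) (T.zeroˡ _))) (T.zeroʳ _)
          where
          zero≈ : T.1# T.+ T.- (embed q T.^ sumIdx [] at) ≃ T.0#
          zero≈ = T.trans (T.reflexive (≡.cong (λ x → T.1# T.+ T.- (embed q T.^ x)) (≡.trans (sumIdx-sumFrom [] at) (sumFrom-[] 0 at)))) (T.-‿inverseʳ T.1#)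
        rewriteTerm : ∀ J → J ∈ subsets I → value J ≃ ⟪ Dsub ⟫ T.* subsetTerm k 0 A fx J
        rewriteTerm J J∈ = T.trans
          (T.reflexive (≡.cong₂ (λ e x → (sign (length I ∸ length J) T.* embed q T.^ e) T.* (fx x T.* ⟪ Dsub ⟫)) (Lsum≡ J∈) (sumIdx≡ J∈)))
          (T.solve 4 (λ g e f d → (g T.⊠ e) T.⊠ (f T.⊠ d) T.:= d T.⊠ (g T.⊠ (e T.⊠ f))) T.refl _ _ _ _)
        summand≈ : ∀ x → x ℕ.≤ total A → fx x ≃ summand inv inv-law w G G-zero G-suc A x
        summand≈ x x≤ = T.*-congˡ (T.reflexive (≡.cong inv (≡.sym (≡.trans
          (≡.cong (λ n → suc n ∸ x) (≡.sym (≡.trans (≡.cong (ℕ._+ ρ) sum-at) (ℕₚ.+-assoc (total A) (total O) ρ))))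
          (≡.trans (ℕₚ.+-∸-assoc 1 (ℕₚ.≤-trans x≤′ (ℕₚ.m≤m+n (sum at) ρ))) (≡.cong suc (ℕₚ.+-∸-comm ρ x≤′)))))))
          where
          x≤′ : x ℕ.≤ sum at
          x≤′ = ≡.subst (x ℕ.≤_) (≡.sym sum-at) (ℕₚ.≤-trans x≤ (ℕₚ.m≤m+n (total A) (total O)))

      -- The denominators shared by both multinomial coefficients: those of the untouched block and
      -- of r - 1.
      common : Fraction
      common = T.∏ O (ι⁻¹ ∘ size) T.* ι⁻¹ ρ

      numerator≈ : numerator ≃ M₁ T.* common
      numerator≈ = T.trans (T.*-cong (T.reflexive (≡.cong ι (≡.trans (≡.cong (ℕ._+ ρ) sum-at) (ℕₚ.+-assoc (total A) (total O) ρ))))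
          (T.trans (T.∏-++ at (ρ ∷ [])) (T.*-congʳ ∏-at)))
        (T.solve 4 (λ i a o r → i T.⊠ ((a T.⊠ o) T.⊠ (r T.⊠ T.𝟙)) T.:= (i T.⊠ a) T.⊠ (o T.⊠ r)) T.refl _ _ _ _)

      denominator≈ : multinomialValue n₂ L₂ ≃ M₂ T.* common
      denominator≈ = T.trans (T.*-cong (T.reflexive (≡.cong ι (≡.trans (≡.cong (ℕ._+ ρ) sum-del) (ℕₚ.+-assoc (total (unmarked A)) (total O) ρ))))
          (T.trans (T.∏-++ (deleteIdx I at) (ρ ∷ [])) (T.*-congʳ ∏-del)))
        (T.solve 4 (λ i a o r → i T.⊠ ((a T.⊠ o) T.⊠ (r T.⊠ T.𝟙)) T.:= (i T.⊠ a) T.⊠ (o T.⊠ r)) T.refl _ _ _ _)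

      rhs : Fraction
      rhs = embed (const εz) T.* ((numerator T.* multinomialInverse n₂ L₂) T.* T.∑ (nonemptySubsets I) value)

      rhs≈ : ⟪ Dpoly ⟫ ≃ rhs
      rhs≈ = begin
        ⟪ Dpoly ⟫                                                     ≈⟨ T.trans (T.*-congʳ (multinomialInverse-law n₂ L₂)) (T.*-identityˡ _) ⟨
        (multinomialInverse n₂ L₂ T.* multinomialValue n₂ L₂) T.* ⟪ Dpoly ⟫ ≈⟨ T.*-congʳ (T.*-congˡ denominator≈) ⟩
        (multinomialInverse n₂ L₂ T.* (M₂ T.* common)) T.* ⟪ Dpoly ⟫
          ≈⟨ T.solve 4 (λ i m c d → (i T.⊠ (m T.⊠ c)) T.⊠ d T.:= (i T.⊠ c) T.⊠ (m T.⊠ d)) T.refl _ _ _ _ ⟩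
        (multinomialInverse n₂ L₂ T.* common) T.* (M₂ T.* ⟪ Dpoly ⟫)  ≈⟨ T.*-congˡ closed ⟩
        (multinomialInverse n₂ L₂ T.* common) T.* ((embed (const εz) T.* M₁) T.* (Σ₁ T.* ⟪ Dsub ⟫))
          ≈⟨ T.solve 5 (λ i c e m s → (i T.⊠ c) T.⊠ ((e T.⊠ m) T.⊠ s) T.:= e T.⊠ (((m T.⊠ c) T.⊠ i) T.⊠ s)) T.refl _ _ _ _ _ ⟩
        embed (const εz) T.* (((M₁ T.* common) T.* multinomialInverse n₂ L₂) T.* (Σ₁ T.* ⟪ Dsub ⟫))
          ≈⟨ T.*-congˡ (T.*-cong (T.*-congʳ numerator≈) ∑-value) ⟨
        rhs                                                           ∎

      sum-∸ : sum at ∸ sumIdx I at ≡ sum (deleteIdx I at)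
      sum-∸ = ≡.trans (≡.cong₂ (λ s x → s ∸ x) (≡.sym (sumFrom-deleteFrom I 0 at)) (sumIdx-sumFrom I at))
        (≡.trans (ℕₚ.m+n∸m≡n (sumFrom 0 I at) _) (≡.cong sum (≡.sym (deleteIdx≡deleteFrom I at))))

      pred≡ : ∀ n → n ℕ.+ suc ρ ∸ 1 ≡ n ℕ.+ ρ
      pred≡ n = ≡.cong (_∸ 1) (ℕₚ.+-suc n ρ)

      ⇝-rhsFormula : rhsFormula εz m I at (suc ρ) Dsub ⇝ rhs
      ⇝-rhsFormula = ⇝-* (⇝-resp (embed-cong (polynomial-const εz)) (⇝-polyF (constₚ εz)))
        (⇝-* (⇝-/ top bottom (regular-qPoch (sum at ∸ sumIdx I at ℕ.+ suc ρ ∸ 1)) (multinomialInverse-law n₂ L₂))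
          (⇝-sumF (nonemptySubsets I) _ value (λ J → ⇝-* (⇝-resp (⟪⟫-sign-qpow (length I ∸ length J) (Lsum m I J at)) (⇝-polyF (constₚ (signPow (length I ∸ length J)) *ₚ qpow (Lsum m I J at))))
            (⇝-* (≡.subst (λ n → (oneMinusQ (sumIdx J at) , oneMinusQ n) ⇝ fx (sumIdx J at)) (≡.sym (ℕₚ.+-suc (sum at ∸ sumIdx J at) ρ)) (⇝-ratio (sumIdx J at) (sum at ∸ sumIdx J at ℕ.+ ρ)))
              (⇝-polyF Dsub)))))
        where
        top : qMultinom (sum at ℕ.+ suc ρ ∸ 1) (at ++ ρ ∷ []) ⇝ numerator
        top = ≡.subst (λ n → qMultinom n (at ++ ρ ∷ []) ⇝ numerator) (≡.sym (pred≡ (sum at))) (⇝-qMultinom (sum at ℕ.+ ρ) (at ++ ρ ∷ []))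
        bottom : qMultinom (sum at ∸ sumIdx I at ℕ.+ suc ρ ∸ 1) L₂ ⇝ multinomialValue n₂ L₂
        bottom = ≡.subst (λ n → qMultinom n L₂ ⇝ multinomialValue n₂ L₂)
          (≡.sym (≡.trans (pred≡ _) (≡.cong (ℕ._+ ρ) sum-∸))) (⇝-qMultinom n₂ L₂)

      formula : polyF Dpoly ≈f rhsFormula εz m I at (suc ρ) Dsub
      formula = ⇝⇒≈f Dpoly (⇝-resp (T.sym rhs≈) ⇝-rhsFormula)

-- Maxima, parts of λ, and sequences split into two blocks

maxL-nothing : ∀ L → maxL L ≡ nothing → L ≡ []
maxL-nothing []       e = ≡.refl
maxL-nothing (x ∷ xs) e with maxL xs
maxL-nothing (x ∷ xs) () | nothing
maxL-nothing (x ∷ xs) () | just _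

maxL-≤ : ∀ L {m} → maxL L ≡ just m → All (ℤ._≤ m) L
maxL-≤ (x ∷ xs) e with maxL xs in eq
maxL-≤ (x ∷ xs) ≡.refl | nothing with maxL-nothing xs eq
... | ≡.refl = ℤₚ.≤-refl ∷ []
maxL-≤ (x ∷ xs) ≡.refl | just m = ℤₚ.i≤i⊔j x m ∷ All.map (λ p → ℤₚ.≤-trans p (ℤₚ.i≤j⊔i x m)) (maxL-≤ xs eq)

maxL-∈ : ∀ L {m} → maxL L ≡ just m → m ∈ L
maxL-∈ (x ∷ xs) e with maxL xs in eq
maxL-∈ (x ∷ xs) ≡.refl | nothing = here ≡.refl
maxL-∈ (x ∷ xs) ≡.refl | just m with ℤₚ.⊔-sel x m
... | inj₁ e = here e
... | inj₂ e = there (≡.subst (_∈ xs) (≡.sym e) (maxL-∈ xs eq))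

-- If r lies in S, then r ≤ max S ≤ max S + s ≤ max F ≤ r, so it lies in F as well. The two
-- conclusions say that the set of removed indices is nonempty and that the other block keeps the
-- distance s.
maxL-dominates : ∀ F S s {r} → All (ℤ._≤ r) F → All (ℤ._≤ r) S → r ∈ F ⊎ r ∈ S →
  maxL F ≥∞ (maxL S +∞ (+ s)) → r ∈ F × All (λ x → x ℤ.+ + s ℤ.≤ r) S
maxL-dominates F S s {r} F≤ S≤ r∈ dom with maxL F in eF | maxL S in eS
... | just f | just m = r∈F r∈ , All.map (λ p → ℤₚ.≤-trans (ℤₚ.+-monoˡ-≤ (+ s) p) (ℤₚ.≤-trans dom f≤r)) (maxL-≤ S eS)
  where
  f≤r : f ℤ.≤ r
  f≤r = All.lookup F≤ (maxL-∈ F eF)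
  r∈F : r ∈ F ⊎ r ∈ S → r ∈ F
  r∈F (inj₁ p) = p
  r∈F (inj₂ p) = ≡.subst (_∈ F) (ℤₚ.≤-antisym f≤r (ℤₚ.≤-trans (All.lookup (maxL-≤ S eS) p) (ℤₚ.≤-trans (ℤₚ.i≤i+j m (+ s)) dom))) (maxL-∈ F eF)
... | just f | nothing with maxL-nothing S eS | r∈
...   | ≡.refl | inj₁ p = p , []
maxL-dominates F S s F≤ S≤ r∈ () | nothing | just m
maxL-dominates F S s F≤ S≤ r∈ dom | nothing | nothing with maxL-nothing F eF | maxL-nothing S eS | r∈
... | ≡.refl | ≡.refl | inj₁ ()
... | ≡.refl | ≡.refl | inj₂ ()

-- The default value 0 is not a successor, so the index must lie inside the list.
drop-nthD : ∀ lam i {x} → nthD 0 lam i ≡ suc x → drop i lam ≡ suc x ∷ drop (suc i) lam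
drop-nthD (y ∷ lam) zero    e = ≡.cong (_∷ lam) e
drop-nthD (y ∷ lam) (suc i) e = drop-nthD lam i e

imapFrom-suc : {A B : Set} (f : ℕ → A → B) → ∀ k xs → imapFrom f (suc k) xs ≡ imapFrom (f ∘ suc) k xs
imapFrom-suc f k []       = ≡.refl
imapFrom-suc f k (x ∷ xs) = ≡.cong (f (suc k) x ∷_) (imapFrom-suc f (suc k) xs)

imapFrom-first-second : {A B C : Set} (f : Bool → A → B) (g : C → A) → ∀ xs ys →
  imapFrom (λ i → f (i <ᵇ length xs)) 0 (map g (xs ++ ys)) ≡ map (f true ∘ g) xs ++ map (f false ∘ g) ys
imapFrom-first-second f g (x ∷ xs) ys = ≡.cong (f true (g x) ∷_)
  (≡.trans (imapFrom-suc (λ i → f (i <ᵇ suc (length xs))) 0 (map g (xs ++ ys))) (imapFrom-first-second f g xs ys))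
imapFrom-first-second f g []       ys = seconds 0 ys
  where
  seconds : ∀ k ys → imapFrom (λ i → f (i <ᵇ 0)) k (map g ys) ≡ map (f false ∘ g) ys
  seconds k []       = ≡.refl
  seconds k (y ∷ ys) = ≡.cong (f false (g y) ∷_) (seconds (suc k) ys)

imap-first-second : {A B C : Set} (f : Bool → A → B) (g : C → A) → ∀ xs ys →
  imap (λ i → f (i <ᵇ length xs)) (map g (xs ++ ys)) ≡ map (f true ∘ g) xs ++ map (f false ∘ g) ys
imap-first-second f g xs ys = ≡.trans (imap≡imapFrom (λ i → f (i <ᵇ length xs)) (map g (xs ++ ys))) (imapFrom-first-second f g xs ys)

upTo-first-second : {A B C : Set} (d : A) (f : Bool → A → B) (g : C → A) → ∀ xs ys →
  map (λ i → f (i <ᵇ length xs) (nthD d (map g (xs ++ ys)) i)) (upTo (length (xs ++ ys))) ≡ map (f true ∘ g) xs ++ map (f false ∘ g) ys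
upTo-first-second d f g xs ys = ≡.trans (Listₚ.map-upTo _ (length (xs ++ ys))) (go xs)
  where
  seconds : ∀ ys → applyUpTo (λ i → f false (nthD d (map g ys) i)) (length ys) ≡ map (f false ∘ g) ys
  seconds []       = ≡.refl
  seconds (y ∷ ys) = ≡.cong (f false (g y) ∷_) (seconds ys)
  go : ∀ xs → applyUpTo (λ i → f (i <ᵇ length xs) (nthD d (map g (xs ++ ys)) i)) (length (xs ++ ys)) ≡ map (f true ∘ g) xs ++ map (f false ∘ g) ys
  go []       = seconds ys
  go (x ∷ xs) = ≡.cong (f true (g x) ∷_) (go xs)

upTo-first : {A B C : Set} (d : A) (f : A → B) (g : C → A) → ∀ xs ys →
  map (λ i → f (nthD d (map g (xs ++ ys)) i)) (upTo (length xs)) ≡ map (f ∘ g) xs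
upTo-first d f g xs ys = ≡.trans (Listₚ.map-upTo _ (length xs)) (go xs)
  where
  go : ∀ xs → applyUpTo (λ i → f (nthD d (map g (xs ++ ys)) i)) (length xs) ≡ map (f ∘ g) xs
  go []       = ≡.refl
  go (x ∷ xs) = ≡.cong (f (g x) ∷_) (go xs)

upTo-second : {A C : Set} (d : A) (g : C → A) → ∀ xs ys →
  map (λ i → nthD d (map g (xs ++ ys)) (length xs ℕ.+ i)) (upTo (length ys)) ≡ map g ys
upTo-second d g xs ys = ≡.trans (Listₚ.map-upTo _ (length ys)) (go xs)
  where
  seconds : ∀ ys → applyUpTo (nthD d (map g ys)) (length ys) ≡ map g ys
  seconds []       = ≡.refl
  seconds (y ∷ ys) = ≡.cong (g y ∷_) (seconds ys)
  go : ∀ xs → applyUpTo (λ i → nthD d (map g (xs ++ ys)) (length xs ℕ.+ i)) (length ys) ≡ map g ys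
  go []       = seconds ys
  go (x ∷ xs) = go xs

⌊⌋-⇔ : {P Q : Set} (p? : Dec P) (q? : Dec Q) → (P → Q) → (Q → P) → ⌊ p? ⌋ ≡ does q?
⌊⌋-⇔ (yes p) (yes q) f g = ≡.refl
⌊⌋-⇔ (yes p) (no ¬q) f g = contradiction (f p) ¬q
⌊⌋-⇔ (no ¬p) (yes q) f g = contradiction (g q) ¬p
⌊⌋-⇔ (no ¬p) (no ¬q) f g = ≡.refl

module _ {A : Set} (p : A → Bool) where

  All-filterᵇ : ∀ {P : A → Set} {xs} → All P xs → All P (filterᵇ p xs)
  All-filterᵇ []                    = []
  All-filterᵇ {xs = x ∷ xs} (q ∷ qs) with p x
  ... | true  = q ∷ All-filterᵇ qs
  ... | false = All-filterᵇ qs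

  AllPairs-filterᵇ-++ : ∀ {R : A → A → Set} xs {ys} → AllPairs R (xs ++ ys) → AllPairs R (filterᵇ p xs ++ ys)
  AllPairs-filterᵇ-++ []       qs = qs
  AllPairs-filterᵇ-++ (x ∷ xs) (q ∷ qs) with p x
  ... | true  = Allₚ.++⁺ (All-filterᵇ (Allₚ.++⁻ˡ xs q)) (Allₚ.++⁻ʳ xs q) ∷ AllPairs-filterᵇ-++ xs qs
  ... | false = AllPairs-filterᵇ-++ xs qs

  AllPairs-++-filterᵇ : ∀ {R : A → A → Set} xs {ys} → AllPairs R (xs ++ ys) → AllPairs R (xs ++ filterᵇ p ys)
  AllPairs-++-filterᵇ (x ∷ xs) (q ∷ qs) = Allₚ.++⁺ (Allₚ.++⁻ˡ xs q) (All-filterᵇ (Allₚ.++⁻ʳ xs q)) ∷ AllPairs-++-filterᵇ xs qs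
  AllPairs-++-filterᵇ {R} [] qs = go qs
    where
    go : ∀ {ys} → AllPairs R ys → AllPairs R (filterᵇ p ys)
    go []                     = []
    go {y ∷ ys} (q ∷ qs) with p y
    ... | true  = All-filterᵇ q ∷ go qs
    ... | false = go qs

  filterᵇ-map : {B : Set} (g : B → A) → ∀ xs → filterᵇ p (map g xs) ≡ map g (filterᵇ (p ∘ g) xs)
  filterᵇ-map g []       = ≡.refl
  filterᵇ-map g (x ∷ xs) with p (g x)
  ... | true  = ≡.cong (g x ∷_) (filterᵇ-map g xs)
  ... | false = filterᵇ-map g xs

open Algebra.Properties.Group (AbelianGroup.group ℤₚ.+-0-abelianGroup) using (∙-cancelʳ)

-- Assembling the two parts of the theorem

module Assembly {V : Set} (S : LaurentSystem V) (_≟_ : DecidableEquality V) (v₀ : V) (F : FractionExtension (LaurentSystem.R S)) where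
  open LaurentSystem S
  open FractionExtension F renaming (T to TR)
  open ClosedForms S _≟_ F
  open FractionValues S _≟_ F
  open DysonInterpretation S v₀ using (polynomial-D)
  open DysonStep S _≟_ using (Distinct)
  open DysonProduct S using (𝔇; sizes)
  open T using () renaming (Carrier to Fraction; _≈_ to _≃_)
  open Entry

  DistinctEntries : List (Entry V) → Set
  DistinctEntries = AllPairs (λ y z → variable′ y ≢ variable′ z)

  dysonOf : List (Entry V) → List (Entry V) → List ℕ → Poly
  dysonOf ZF ZS lam = D (map exponent (ZF ++ ZS)) lam (map part (ZF ++ ZS)) (length ZF)

  ⟪dysonOf⟫ : ∀ ZF ZS → DistinctEntries (ZF ++ ZS) → ∀ lam → ⟪ dysonOf ZF ZS lam ⟫ ≃ embed (𝔇 (map firstItem ZF ++ map secondItem ZS) lam)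
  ⟪dysonOf⟫ ZF ZS dist lam = embed-cong (polynomial-D ZF ZS (AllPairsₚ.map⁺ dist) lam)

  distinct-items : ∀ ZF ZS → DistinctEntries (ZF ++ ZS) → Distinct (map firstItem ZF ++ map secondItem ZS)
  distinct-items ZF ZS dist = AllPairsₚ.map⁻ {f = var} (≡.subst Unique vars (AllPairsₚ.map⁺ dist))
    where
    vars : map variable′ (ZF ++ ZS) ≡ map var (map firstItem ZF ++ map secondItem ZS)
    vars = ≡.trans (Listₚ.map-++ variable′ ZF ZS) (≡.sym (≡.trans (Listₚ.map-++ var (map firstItem ZF) (map secondItem ZS))
      (≡.cong₂ _++_ (≡.sym (Listₚ.map-∘ ZF)) (≡.sym (Listₚ.map-∘ ZS)))))

  raiseEntries : ℕ → List (Entry V) → List (Entry V)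
  raiseEntries k = map (λ z → mkEntry (variable′ z) (part z) (exponent z ℤ.+ + k))

  secondItem-raise : ∀ k ZS → map secondItem (raiseEntries k ZS) ≡ raise k (map secondItem ZS)
  secondItem-raise k []       = ≡.refl
  secondItem-raise k (z ∷ ZS) = ≡.cong (_ ∷_) (secondItem-raise k ZS)

  distinct-raise : ∀ k ZF {ZS} → DistinctEntries (ZF ++ ZS) → DistinctEntries (ZF ++ raiseEntries k ZS)
  distinct-raise k ZF {ZS} dist = AllPairsₚ.map⁻ {f = variable′} (≡.subst Unique vars (AllPairsₚ.map⁺ dist))
    where
    vars : map variable′ (ZF ++ ZS) ≡ map variable′ (ZF ++ raiseEntries k ZS)
    vars = ≡.trans (Listₚ.map-++ variable′ ZF ZS) (≡.trans (≡.cong (map variable′ ZF ++_) (Listₚ.map-∘ ZS))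
      (≡.sym (Listₚ.map-++ variable′ ZF (raiseEntries k ZS))))

  module _ (ρ : ℕ) (lam : List ℕ) (thr : ℤ) (s : ℕ) (drops : ∀ i → i ℕ.< suc s → drop i lam ≡ suc ρ ∷ drop (suc i) lam) (ZF ZS : List (Entry V))
    (dist : DistinctEntries (ZF ++ ZS)) (parts : All (λ z → 1 ℕ.≤ part z) ZS) where
    open Parts ρ lam thr
    open Formula ρ lam thr

    private
      AF AS : List (Item V)
      AF = map firstItem ZF
      AS = map secondItem ZS

    length-marks : ∀ (A : List (Item V)) → length (map marked A) ≡ length (map size A)
    length-marks A = ≡.trans (Listₚ.length-map marked A) (≡.sym (Listₚ.length-map size A))

    module FirstPart (thr≡ : thr ≡ + (suc ρ ℕ.+ length ZS)) (count≡ : count AF ≡ suc s)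
      (expos : All (λ z → exponent z ℤ.≤ thr) ZF) (low : All (λ z → exponent z ℤ.+ + suc s ℤ.≤ + suc ρ) ZS) where

      ZF′ ZS′ : List (Entry V)
      ZF′ = filterᵇ (not ∘ marked ∘ firstItem) ZF
      ZS′ = raiseEntries (suc s) ZS

      module P = First AS (suc s) drops (Allₚ.map⁺ (All.universal (λ _ → ≡.refl) ZS)) (Allₚ.map⁺ parts) (Allₚ.map⁺ low)
        (≡.trans thr≡ (≡.cong (λ n → + (suc ρ ℕ.+ n)) (≡.sym (Listₚ.length-map secondItem ZS))))

      shape : Shape
      shape = record { A = AF ; O = AS ; at = map size (AF ++ AS) ; k = 0 ; m = length ZF ; εz = signPow (suc s ℕ.* length ZS)
        ; Dpoly = dysonOf ZF ZS lam ; Dsub = dysonOf ZF′ ZS′ (drop (suc s) lam) }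
      open Shape shape

      at≡ : at ≡ map size AF ++ map size AS
      at≡ = Listₚ.map-++ size AF AS

      delete≡ : deleteIdx I at ≡ map size (unmarked AF) ++ map size AS
      delete≡ = ≡.trans (≡.cong (deleteIdx I) at≡) (deleteIdx-++ʳ marked size AF (map size AS))

      ∏-++-map : (xs ys : List (Item V)) → T.∏ (map size xs ++ map size ys) ι⁻¹ ≃ T.∏ xs (ι⁻¹ ∘ size) T.* T.∏ ys (ι⁻¹ ∘ size)
      ∏-++-map xs ys = T.trans (T.∏-++ (map size xs) (map size ys)) (T.*-cong (T.∏-map size xs) (T.∏-map size ys))

      invariant : P.Invariant (suc s) AF
      invariant = record
        { bound = ℕₚ.≤-refl
        ; firsts = Allₚ.map⁺ (All.universal (λ _ → ≡.refl) ZF)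
        ; distinct = distinct-items ZF ZS dist
        ; expos = Allₚ.map⁺ expos }

      𝔈-start : P.𝔈 (suc s) AF ≃ ⟪ Dpoly ⟫
      𝔈-start = T.trans (T.reflexive (≡.cong embed (≡.trans (≡.cong (λ k → 𝔇 (AF ++ raise k AS) (drop k lam)) (ℕₚ.n∸n≡0 s))
        (≡.cong (λ O → 𝔇 (AF ++ O) lam) (raise-0 AS))))) (T.sym (⟪dysonOf⟫ ZF ZS dist lam))

      𝔈-end : P.𝔈 0 (unmarked AF) ≃ ⟪ Dsub ⟫
      𝔈-end = T.trans (T.reflexive (≡.cong embed (≡.cong₂ (λ A O → 𝔇 (A ++ O) (drop (suc s) lam))
          (filterᵇ-map (not ∘ marked) firstItem ZF) (≡.sym (secondItem-raise (suc s) ZS)))))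
        (T.sym (⟪dysonOf⟫ ZF′ ZS′ (distinct-raise (suc s) ZF′ (AllPairs-filterᵇ-++ _ ZF dist)) (drop (suc s) lam)))

      ε-power : P.ε T.^ suc s ≃ embed (const εz)
      ε-power = T.trans (T.sym (embed-^ _ (suc s))) (embed-cong (R.trans (^-assocʳ (R.- R.1#) (length AS) (suc s))
        (R.trans (R.reflexive (≡.cong ((R.- R.1#) R.^_) (≡.trans (≡.cong (ℕ._* suc s) (Listₚ.length-map secondItem ZS)) (ℕₚ.*-comm (length ZS) (suc s)))))
          (R.sym (const-signPow (suc s ℕ.* length ZS))))))
        where open Algebra.Properties.Semiring.Exp R.semiring using (^-assocʳ)

      configuration : Configuration shape
      configuration = record
        { sum-at = total-++ AF AS
        ; ∏-at = T.trans (T.reflexive (≡.cong (λ L → T.∏ L ι⁻¹) at≡)) (∏-++-map AF AS)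
        ; sum-del = ≡.trans (≡.cong sum (≡.trans delete≡ (≡.sym (Listₚ.map-++ size (unmarked AF) AS)))) (total-++ (unmarked AF) AS)
        ; ∏-del = T.trans (T.reflexive (≡.cong (λ L → T.∏ L ι⁻¹) delete≡)) (∏-++-map (unmarked AF) AS)
        ; Lsum≡ = λ {J} _ → ≡.trans (≡.cong₂ (λ m L → Lsum m I J L) (≡.sym (≡.trans (Listₚ.length-map marked AF) (Listₚ.length-map firstItem ZF))) at≡)
            (Lsum-exponentFrom J (map marked AF) (map size AF) (map size AS) (length-marks AF))
        ; sumIdx≡ = λ {J} J∈ → ≡.trans (sumIdx-sumFrom J at) (≡.trans (≡.cong (sumFrom 0 J) at≡)
            (sumFrom-≥ 0 (map size AF) (map size AS)
              (≡.subst (λ n → All (ℕ._< n) J) (length-marks AF) (subsets-All I J∈ (indicesFrom-< 0 (map marked AF))))))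
        ; closed = T.trans (T.*-congˡ (T.sym 𝔈-start)) (T.trans (P.closed s invariant count≡)
            (T.*-cong (T.*-congʳ ε-power) (T.*-congˡ 𝔈-end)))
        }

      result : polyF (dysonOf ZF ZS lam) ≈f
        rhsFormula (signPow (suc s ℕ.* length ZS)) (length ZF) (indicesFrom 0 (map marked AF)) (map size (AF ++ AS)) (suc ρ) (dysonOf ZF′ ZS′ (drop (suc s) lam))
      result = Evaluate.formula configuration

    module SecondPart (thr≡ : thr ≡ + suc ρ) (count≡ : count AS ≡ suc s)
      (expos : All (λ z → exponent z ℤ.≤ thr) ZS) (low : All (λ z → exponent z ℤ.+ + suc s ℤ.≤ + (suc ρ ℕ.+ length ZS)) ZF) where

      ZS′ : List (Entry V)
      ZS′ = filterᵇ (not ∘ marked ∘ secondItem) ZS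

      module P = Second AF (suc s) (length ZS) drops (Allₚ.map⁺ (All.universal (λ _ → ≡.refl) ZF)) (Allₚ.map⁺ low) thr≡

      shape : Shape
      shape = record { A = AS ; O = AF ; at = map size (AF ++ AS) ; k = length ZF ; m = length (ZF ++ ZS) ; εz = + 1
        ; Dpoly = dysonOf ZF ZS lam ; Dsub = dysonOf ZF ZS′ (drop (suc s) lam) }
      open Shape shape

      at≡ : at ≡ map size AF ++ map size AS
      at≡ = Listₚ.map-++ size AF AS

      length-AF : length (map size AF) ≡ length ZF
      length-AF = ≡.trans (Listₚ.length-map size AF) (Listₚ.length-map firstItem ZF)

      delete≡ : deleteIdx I at ≡ map size AF ++ map size (unmarked AS)
      delete≡ = ≡.trans (≡.cong₂ (λ k L → deleteIdx (indicesFrom k (map marked AS)) L) (≡.sym length-AF) at≡) (deleteIdx-++ˡ marked size (map size AF) AS)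

      ∏-++-map : (xs ys : List (Item V)) → T.∏ (map size xs ++ map size ys) ι⁻¹ ≃ T.∏ ys (ι⁻¹ ∘ size) T.* T.∏ xs (ι⁻¹ ∘ size)
      ∏-++-map xs ys = T.trans (T.∏-++ (map size xs) (map size ys)) (T.trans (T.*-cong (T.∏-map size xs) (T.∏-map size ys)) (T.*-comm _ _))

      invariant : P.Invariant (suc s) AS
      invariant = record
        { bound = ℕₚ.≤-refl
        ; seconds = Allₚ.map⁺ (All.universal (λ _ → ≡.refl) ZS)
        ; nonempty = Allₚ.map⁺ parts
        ; distinct = distinct-items ZF ZS dist
        ; expos = Allₚ.map⁺ expos
        ; length≡ = ≡.cong (ℕ._+ suc s) (Listₚ.length-map secondItem ZS) }

      𝔈-start : P.𝔈 (suc s) AS ≃ ⟪ Dpoly ⟫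
      𝔈-start = T.trans (T.reflexive (≡.cong (λ k → embed (𝔇 (AF ++ AS) (drop k lam))) (ℕₚ.n∸n≡0 s))) (T.sym (⟪dysonOf⟫ ZF ZS dist lam))

      𝔈-end : P.𝔈 0 (unmarked AS) ≃ ⟪ Dsub ⟫
      𝔈-end = T.trans (T.reflexive (≡.cong (λ A → embed (𝔇 (AF ++ A) (drop (suc s) lam))) (filterᵇ-map (not ∘ marked) secondItem ZS)))
        (T.sym (⟪dysonOf⟫ ZF ZS′ (AllPairs-++-filterᵇ _ ZF dist) (drop (suc s) lam)))

      1-power : ∀ n → T.1# T.^ n ≃ T.1#
      1-power zero    = T.refl
      1-power (suc n) = T.trans (T.*-identityˡ _) (1-power n)

      -- In the second part the exponent sum runs over all n indices, so the marks are padded with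
      -- `false` along the first block.
      bs : List Bool
      bs = map (λ _ → false) AF ++ map marked AS

      I≡ : indicesFrom 0 bs ≡ I
      I≡ = ≡.trans (indicesFrom-false 0 AF (map marked AS)) (≡.cong (λ k → indicesFrom k (map marked AS)) (Listₚ.length-map firstItem ZF))

      length-bs : length bs ≡ length (map size AF ++ map size AS)
      length-bs = length-map-++ (λ _ → false) size AF (length-marks AS)

      configuration : Configuration shape
      configuration = record
        { sum-at = ≡.trans (total-++ AF AS) (ℕₚ.+-comm (total AF) (total AS))
        ; ∏-at = T.trans (T.reflexive (≡.cong (λ L → T.∏ L ι⁻¹) at≡)) (∏-++-map AF AS)
        ; sum-del = ≡.trans (≡.cong sum (≡.trans delete≡ (≡.sym (Listₚ.map-++ size AF (unmarked AS)))))
            (≡.trans (total-++ AF (unmarked AS)) (ℕₚ.+-comm (total AF) _))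
        ; ∏-del = T.trans (T.reflexive (≡.cong (λ L → T.∏ L ι⁻¹) delete≡)) (∏-++-map AF (unmarked AS))
        ; Lsum≡ = λ {J} _ → ≡.trans (≡.trans
            (≡.cong₂ (λ m L → Lsum m I J L)
              (≡.sym (≡.trans length-bs (≡.trans (≡.cong length (≡.sym at≡)) (≡.trans (Listₚ.length-map size (AF ++ AS)) length-items))))
              (≡.trans at≡ (≡.sym (Listₚ.++-identityʳ _))))
            (≡.cong (λ I → Lsum (length bs) I J ((map size AF ++ map size AS) ++ [])) (≡.sym I≡)))
            (≡.trans (Lsum-exponentFrom J bs (map size AF ++ map size AS) [] length-bs)
              (≡.trans (exponentFrom-false 0 J size AF (map marked AS) (map size AS))
                (≡.cong (λ k → exponentFrom k 0 J (map marked AS) (map size AS)) (Listₚ.length-map firstItem ZF))))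
        ; sumIdx≡ = λ {J} J∈ → ≡.trans (sumIdx-sumFrom J at) (≡.trans (≡.cong (sumFrom 0 J) at≡)
            (≡.trans (sumFrom-< 0 (map size AF) (map size AS)
              (≡.subst (λ n → All (n ℕ.≤_) J) (≡.sym length-AF) (subsets-All I J∈ (indicesFrom-≥ (length ZF) (map marked AS)))))
              (≡.cong (λ k → sumFrom k J (map size AS)) length-AF)))
        ; closed = T.trans (T.*-congˡ (T.sym 𝔈-start)) (T.trans (P.closed s invariant count≡)
            (T.*-cong (T.*-congʳ (T.trans (1-power (suc s)) (T.sym (T.trans (embed-cong const-1) embed-1)))) (T.*-congˡ 𝔈-end)))
        }
        where
        length-items : length (AF ++ AS) ≡ length (ZF ++ ZS)
        length-items = ≡.trans (Listₚ.length-++ AF) (≡.trans (≡.cong₂ ℕ._+_ (Listₚ.length-map firstItem ZF) (Listₚ.length-map secondItem ZS)) (≡.sym (Listₚ.length-++ ZF)))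

      result : polyF (dysonOf ZF ZS lam) ≈f
        rhsFormula (+ 1) (length (ZF ++ ZS)) (indicesFrom (length ZF) (map marked AS)) (map size (AF ++ AS)) (suc ρ) (dysonOf ZF ZS′ (drop (suc s) lam))
      result = Evaluate.formula configuration

  length-indicesFrom : ∀ {A : Set} (m : A → Bool) (sz : A → ℕ) k xs → length (indicesFrom k (map m xs)) ≡ Marked.count m sz xs
  length-indicesFrom m sz k []       = ≡.refl
  length-indicesFrom m sz k (x ∷ xs) with m x
  ... | true  = ≡.cong suc (length-indicesFrom m sz (suc k) xs)
  ... | false = length-indicesFrom m sz (suc k) xs

  count-filterᵇ : ∀ {A B : Set} (m : A → Bool) (sz : A → ℕ) (g : B → A) xs →
    Marked.count m sz (map g xs) ℕ.+ length (filterᵇ (not ∘ m ∘ g) xs) ≡ length xs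
  count-filterᵇ m sz g []       = ≡.refl
  count-filterᵇ m sz g (x ∷ xs) with m (g x)
  ... | true  = ≡.cong suc (count-filterᵇ m sz g xs)
  ... | false = ≡.trans (ℕₚ.+-suc _ _) (≡.cong suc (count-filterᵇ m sz g xs))

  count-pos : ∀ {A : Set} (m : A → Bool) (sz : A → ℕ) {xs x} → x ∈ xs → m x ≡ true → ∃ λ s → Marked.count m sz xs ≡ suc s
  count-pos m sz {x ∷ xs} (here ≡.refl) e rewrite e = _ , ≡.refl
  count-pos m sz {y ∷ xs} (there x∈)    e with m y
  ... | true  = _ , ≡.refl
  ... | false = count-pos m sz x∈ e

  does-true : ∀ {P : Set} (p? : Dec P) → P → does p? ≡ true
  does-true (yes _) p = ≡.refl
  does-true (no ¬p) p = contradiction p ¬p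

  module Recursion (ZF ZS : List (Entry V)) (dist : DistinctEntries (ZF ++ ZS)) (parts : All (λ z → 1 ℕ.≤ part z) (ZF ++ ZS)) (lam : List ℕ) (ρ : ℕ) where

    private
      a : List ℕ
      a = map part (ZF ++ ZS)
      v : List ℤ
      v = map exponent (ZF ++ ZS)
      n n0 c : ℕ
      n  = length a
      n0 = length ZF
      c  = length ZS
      r : ℤ
      r = + suc ρ
      AF AS : List (Item V)
      AF = map firstItem ZF
      AS = map secondItem ZS

    n≡ : n ≡ n0 ℕ.+ c
    n≡ = ≡.trans (Listₚ.length-map part (ZF ++ ZS)) (Listₚ.length-++ ZF)

    n∸n0≡ : n ∸ n0 ≡ c
    n∸n0≡ = ≡.trans (≡.cong (_∸ n0) n≡) (ℕₚ.m+n∸m≡n n0 c)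

    lower : ℤ → ℤ
    lower x = x ℤ.- + n ℤ.+ + n0

    lower-+ : ∀ x → lower x ℤ.+ + c ≡ x
    lower-+ x = ≡-Reasoning.begin
      x ℤ.- + n ℤ.+ + n0 ℤ.+ + c        ≡-Reasoning.≡⟨ ℤₚ.+-assoc (x ℤ.- + n) (+ n0) (+ c) ⟩
      x ℤ.- + n ℤ.+ (+ (n0 ℕ.+ c))      ≡-Reasoning.≡⟨ ≡.cong (λ k → x ℤ.- + n ℤ.+ + k) (≡.sym n≡) ⟩
      x ℤ.- + n ℤ.+ + n                 ≡-Reasoning.≡⟨ ℤₚ.+-assoc x (ℤ.- + n) (+ n) ⟩
      x ℤ.+ (ℤ.- + n ℤ.+ + n)           ≡-Reasoning.≡⟨ ≡.cong (λ y → x ℤ.+ y) (ℤₚ.+-inverseˡ (+ n)) ⟩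
      x ℤ.+ + 0                         ≡-Reasoning.≡⟨ ℤₚ.+-identityʳ x ⟩
      x                                 ≡-Reasoning.∎
      where module ≡-Reasoning = ≡.≡-Reasoning

    lower-≤ : ∀ {x y} → lower x ℤ.≤ y → x ℤ.≤ y ℤ.+ + c
    lower-≤ {x} {y} p = ≡.subst (ℤ._≤ y ℤ.+ + c) (lower-+ x) (ℤₚ.+-monoˡ-≤ (+ c) p)

    firstVals≡ : firstVals n n0 v ≡ map (lower ∘ exponent) ZF
    firstVals≡ = upTo-first (+ 0) lower exponent ZF ZS

    secondVals≡ : secondVals n n0 v ≡ map exponent ZS
    secondVals≡ = ≡.trans (≡.cong (λ k → map (λ i → nthD (+ 0) v (n0 ℕ.+ i)) (upTo k)) n∸n0≡) (upTo-second (+ 0) exponent ZF ZS)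

    tildeA≡ : tildeA n0 a ≡ map size (AF ++ AS)
    tildeA≡ = ≡.trans (imap-first-second (λ b x → x ∸ (if b then 1 else 0)) part ZF ZS)
      (≡.sym (≡.trans (Listₚ.map-++ size AF AS) (≡.cong₂ _++_ (≡.sym (Listₚ.map-∘ ZF)) (≡.sym (Listₚ.map-∘ ZS)))))

    indices≡ : ∀ (f : Bool → ℤ → Bool) → filterᵇ (λ i → f (i <ᵇ n0) (nthD (+ 0) v i)) (upTo n)
      ≡ indicesFrom 0 (map (f true ∘ exponent) ZF ++ map (f false ∘ exponent) ZS)
    indices≡ f = filterᵇ-indicesFrom (λ i → f (i <ᵇ n0) (nthD (+ 0) v i)) 0 id _ n (λ _ → ≡.refl)
      (≡.trans (≡.cong (λ k → map (λ i → f (i <ᵇ n0) (nthD (+ 0) v i)) (upTo k)) (Listₚ.length-map part (ZF ++ ZS))) (upTo-first-second (+ 0) f exponent ZF ZS))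

    rhs-cong : ∀ {εz εz′ m m′ ta ta′ d d′ ℓ ℓ′ e e′ k k′} I → εz ≡ εz′ → m ≡ m′ → ta ≡ ta′ → d ≡ d′ → ℓ ≡ ℓ′ → e ≡ e′ → k ≡ k′ →
      rhsFormula εz m I ta (suc ρ) (D d (drop ℓ lam) e k) ≡ rhsFormula εz′ m′ I ta′ (suc ρ) (D d′ (drop ℓ′ lam) e′ k′)
    rhs-cong I ≡.refl ≡.refl ≡.refl ≡.refl ≡.refl ≡.refl ≡.refl = ≡.refl

    module _ (mx : maxL (firstVals n n0 v ++ secondVals n n0 v) ≡ just r) where

      bounds : All (ℤ._≤ r) (firstVals n n0 v ++ secondVals n n0 v)
      bounds = maxL-≤ _ mx

      attained : r ∈ firstVals n n0 v ⊎ r ∈ secondVals n n0 v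
      attained = ∈-++⁻ (firstVals n n0 v) (maxL-∈ _ mx)

      module Case₁ where
        thr : ℤ
        -- With c = n - n_0, the condition v_i - n + n_0 = r that defines S_1 becomes v_i = r + c.
        thr = + (suc ρ ℕ.+ c)
        open Parts ρ lam thr using (marked)

        I : List ℕ
        I = indicesFrom 0 (map marked AF)

        S₁≡I : S₁ n n0 v r ≡ I
        S₁≡I = ≡.trans (indices≡ (λ b x → b ∧ ⌊ lower x ℤ.≟ r ⌋))
          (≡.trans (indicesFrom-++-false 0 (map (λ z → ⌊ lower (exponent z) ℤ.≟ r ⌋) ZF) ZS)
            (≡.cong (indicesFrom 0) (≡.trans (Listₚ.map-cong (λ z → same (exponent z)) ZF) (Listₚ.map-∘ ZF))))
          where
          same : ∀ x → ⌊ lower x ℤ.≟ r ⌋ ≡ does (x ℤ.≟ thr)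
          same x = ⌊⌋-⇔ (lower x ℤ.≟ r) (x ℤ.≟ thr) (λ e → ≡.trans (≡.sym (lower-+ x)) (≡.cong (ℤ._+ + c) e))
            (λ e → ∙-cancelʳ (+ c) (lower x) r (≡.trans (lower-+ x) e))

        -- Stated for an arbitrary index list, so that it is proved for the list read off the marks
        -- and then transported to `S₁`, without rewriting inside the formula.
        Claim : List ℕ → Set
        Claim J = maxL (firstVals n n0 v) ≥∞ (maxL (secondVals n n0 v) +∞ + length J) →
          (∀ i → i ℕ.< length J → + nthD 0 lam i ≡ r) →
          polyF (D v lam a n0) ≈f rhsFormula (signPow (length J ℕ.* (n ∸ n0))) n0 J (tildeA n0 a) (suc ρ)
            (D (deleteIdx J (addAlpha n0 (length J) v)) (drop (length J) lam) (deleteIdx J a) (n0 ∸ length J))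

        claim : Claim I
        claim dom lams = ≡.subst (polyF (D v lam a n0) ≈f_) (rhs-cong I
            (≡.cong signPow (≡.sym (≡.cong₂ ℕ._*_ ℓ≡ n∸n0≡))) (≡.refl {x = n0}) (≡.sym tildeA≡) (≡.sym exponents≡) (≡.sym ℓ≡) (≡.sym parts≡) (≡.sym length≡)) FP.result
          where
          dominated : r ∈ firstVals n n0 v × All (λ x → x ℤ.+ + length I ℤ.≤ r) (secondVals n n0 v)
          dominated = maxL-dominates (firstVals n n0 v) (secondVals n n0 v) (length I)
            (Allₚ.++⁻ˡ (firstVals n n0 v) bounds) (Allₚ.++⁻ʳ (firstVals n n0 v) bounds) attained dom
          positive : ∃ λ s → Marked.count marked size AF ≡ suc s
          positive with ∈-map⁻ (lower ∘ exponent) (≡.subst (r ∈_) firstVals≡ (proj₁ dominated))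
          ... | z , z∈ , e = count-pos marked size (∈-map⁺ firstItem z∈) (does-true (exponent z ℤ.≟ thr) (≡.trans (≡.sym (lower-+ (exponent z))) (≡.cong (ℤ._+ + c) (≡.sym e))))
          s : ℕ
          s = proj₁ positive
          ℓ≡ : length I ≡ suc s
          ℓ≡ = ≡.trans (length-indicesFrom marked size 0 AF) (proj₂ positive)
          module FP = FirstPart ρ lam thr s (λ i i< → drop-nthD lam i (ℤₚ.+-injective (lams i (≡.subst (i ℕ.<_) (≡.sym ℓ≡) i<)))) ZF ZS dist (Allₚ.++⁻ʳ ZF parts)
            ≡.refl (proj₂ positive)
            (All.map (λ {z} p → lower-≤ {exponent z} p) (Allₚ.map⁻ (≡.subst (All (ℤ._≤ r)) firstVals≡ (Allₚ.++⁻ˡ (firstVals n n0 v) bounds))))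
            (Allₚ.map⁻ (≡.subst₂ (λ L k → All (λ x → x ℤ.+ + k ℤ.≤ r) L) secondVals≡ ℓ≡ (proj₂ dominated)))
          m : Entry V → Bool
          m = marked ∘ firstItem
          I≡ : I ≡ indicesFrom 0 (map m ZF)
          I≡ = ≡.cong (indicesFrom 0) (≡.sym (Listₚ.map-∘ ZF))
          exponents≡ : deleteIdx I (addAlpha n0 (length I) v) ≡ map exponent (FP.ZF′ ++ FP.ZS′)
          exponents≡ = ≡.trans (≡.cong₂ deleteIdx I≡ (≡.trans (≡.cong (λ k → addAlpha n0 k v) ℓ≡)
              (imap-first-second (λ b x → if b then x else x ℤ.+ + suc s) exponent ZF ZS)))
            (≡.trans (deleteIdx-++ʳ m exponent ZF (map (λ z → exponent z ℤ.+ + suc s) ZS))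
              (≡.sym (≡.trans (Listₚ.map-++ exponent FP.ZF′ FP.ZS′) (≡.cong (map exponent FP.ZF′ ++_) (≡.sym (Listₚ.map-∘ ZS))))))
          parts≡ : deleteIdx I a ≡ map part (FP.ZF′ ++ FP.ZS′)
          parts≡ = ≡.trans (≡.cong₂ deleteIdx I≡ (Listₚ.map-++ part ZF ZS))
            (≡.trans (deleteIdx-++ʳ m part ZF (map part ZS))
              (≡.sym (≡.trans (Listₚ.map-++ part FP.ZF′ FP.ZS′) (≡.cong (map part FP.ZF′ ++_) (≡.sym (Listₚ.map-∘ ZS))))))
          length≡ : n0 ∸ length I ≡ length FP.ZF′
          length≡ = ≡.trans (≡.cong₂ _∸_ (≡.sym (count-filterᵇ marked size firstItem ZF)) (length-indicesFrom marked size 0 AF))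
            (ℕₚ.m+n∸m≡n (Marked.count marked size AF) (length FP.ZF′))

      module Case₂ where
        open Parts ρ lam r using (marked)

        I : List ℕ
        I = indicesFrom n0 (map marked AS)

        S₂≡I : S₂ n n0 v r ≡ I
        S₂≡I = ≡.trans (indices≡ (λ b x → not b ∧ ⌊ x ℤ.≟ r ⌋))
          (≡.trans (indicesFrom-false 0 ZF (map (λ z → ⌊ exponent z ℤ.≟ r ⌋) ZS))
            (≡.cong (indicesFrom n0) (≡.trans (Listₚ.map-cong (λ z → ⌊⌋-⇔ (exponent z ℤ.≟ r) (exponent z ℤ.≟ r) id id) ZS) (Listₚ.map-∘ ZS))))

        Claim : List ℕ → Set
        Claim J = maxL (secondVals n n0 v) ≥∞ (maxL (firstVals n n0 v) +∞ + length J) →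
          (∀ i → i ℕ.< length J → + nthD 0 lam i ≡ r) →
          polyF (D v lam a n0) ≈f rhsFormula (+ 1) n J (tildeA n0 a) (suc ρ)
            (D (deleteIdx J v) (drop (length J) lam) (deleteIdx J a) n0)

        claim : Claim I
        claim dom lams = ≡.subst (polyF (D v lam a n0) ≈f_) (rhs-cong I (≡.refl {x = + 1}) (≡.sym (Listₚ.length-map part (ZF ++ ZS))) (≡.sym tildeA≡)
            (≡.sym (delete≡ exponent)) (≡.sym ℓ≡) (≡.sym (delete≡ part)) (≡.refl {x = n0})) SP.result
          where
          dominated : r ∈ secondVals n n0 v × All (λ x → x ℤ.+ + length I ℤ.≤ r) (firstVals n n0 v)
          dominated = maxL-dominates (secondVals n n0 v) (firstVals n n0 v) (length I)
            (Allₚ.++⁻ʳ (firstVals n n0 v) bounds) (Allₚ.++⁻ˡ (firstVals n n0 v) bounds) (swap attained) dom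
          positive : ∃ λ s → Marked.count marked size AS ≡ suc s
          positive with ∈-map⁻ exponent (≡.subst (r ∈_) secondVals≡ (proj₁ dominated))
          ... | z , z∈ , e = count-pos marked size (∈-map⁺ secondItem z∈) (does-true (exponent z ℤ.≟ r) (≡.sym e))
          s : ℕ
          s = proj₁ positive
          ℓ≡ : length I ≡ suc s
          ℓ≡ = ≡.trans (length-indicesFrom marked size n0 AS) (proj₂ positive)
          raise-lower : ∀ {x} → lower x ℤ.+ + suc s ℤ.≤ r → x ℤ.+ + suc s ℤ.≤ + (suc ρ ℕ.+ c)
          raise-lower {x} p = ≡.subst (ℤ._≤ + (suc ρ ℕ.+ c)) eq (ℤₚ.+-monoˡ-≤ (+ c) p)
            where
            eq : lower x ℤ.+ + suc s ℤ.+ + c ≡ x ℤ.+ + suc s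
            eq = ≡.trans (ℤₚ.+-assoc (lower x) (+ suc s) (+ c)) (≡.trans (≡.cong (λ y → lower x ℤ.+ y) (ℤₚ.+-comm (+ suc s) (+ c)))
              (≡.trans (≡.sym (ℤₚ.+-assoc (lower x) (+ c) (+ suc s))) (≡.cong (ℤ._+ + suc s) (lower-+ x))))
          module SP = SecondPart ρ lam r s (λ i i< → drop-nthD lam i (ℤₚ.+-injective (lams i (≡.subst (i ℕ.<_) (≡.sym ℓ≡) i<)))) ZF ZS dist (Allₚ.++⁻ʳ ZF parts)
            ≡.refl (proj₂ positive)
            (Allₚ.map⁻ (≡.subst (All (ℤ._≤ r)) secondVals≡ (Allₚ.++⁻ʳ (firstVals n n0 v) bounds)))
            (All.map (λ {z} → raise-lower {exponent z}) (Allₚ.map⁻ (≡.subst₂ (λ L k → All (λ x → x ℤ.+ + k ℤ.≤ r) L) firstVals≡ ℓ≡ (proj₂ dominated))))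
          m : Entry V → Bool
          m = marked ∘ secondItem
          delete≡ : {B : Set} (g : Entry V → B) → deleteIdx I (map g (ZF ++ ZS)) ≡ map g (ZF ++ SP.ZS′)
          delete≡ g = ≡.trans (≡.cong₂ deleteIdx (≡.cong₂ indicesFrom (≡.sym (Listₚ.length-map g ZF)) (≡.sym (Listₚ.map-∘ ZS))) (Listₚ.map-++ g ZF ZS))
            (≡.trans (deleteIdx-++ˡ m g (map g ZF) ZS) (≡.sym (Listₚ.map-++ g ZF SP.ZS′)))

    recursion : (mx : maxL (firstVals n n0 v ++ secondVals n n0 v) ≡ just r) → Case₁.Claim mx (S₁ n n0 v r) × Case₂.Claim mx (S₂ n n0 v r)
    recursion mx = ≡.subst (Case₁.Claim mx) (≡.sym (Case₁.S₁≡I mx)) (Case₁.claim mx) , ≡.subst (Case₂.Claim mx) (≡.sym (Case₂.S₂≡I mx)) (Case₂.claim mx)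

-- From sequences to entries, and the theorem

module _ {V : Set} where
  open Entry

  entries : List V → List ℕ → List ℤ → List (Entry V)
  entries (x ∷ xs) (a ∷ as) (v ∷ vs) = mkEntry x a v ∷ entries xs as vs
  entries _        _        _        = []

  entries-variable : ∀ xs as vs → length xs ≡ length as → length vs ≡ length as → map variable′ (entries xs as vs) ≡ xs
  entries-variable []       []       []       e e′ = ≡.refl
  entries-variable (x ∷ xs) (a ∷ as) (v ∷ vs) e e′ = ≡.cong (x ∷_) (entries-variable xs as vs (ℕₚ.suc-injective e) (ℕₚ.suc-injective e′))

  entries-part : ∀ xs as vs → length xs ≡ length as → length vs ≡ length as → map part (entries xs as vs) ≡ as
  entries-part []       []       []       e e′ = ≡.refl
  entries-part (x ∷ xs) (a ∷ as) (v ∷ vs) e e′ = ≡.cong (a ∷_) (entries-part xs as vs (ℕₚ.suc-injective e) (ℕₚ.suc-injective e′))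

  entries-exponent : ∀ xs as vs → length xs ≡ length as → length vs ≡ length as → map exponent (entries xs as vs) ≡ vs
  entries-exponent []       []       []       e e′ = ≡.refl
  entries-exponent (x ∷ xs) (a ∷ as) (v ∷ vs) e e′ = ≡.cong (v ∷_) (entries-exponent xs as vs (ℕₚ.suc-injective e) (ℕₚ.suc-injective e′))

open import Data.Nat using (_≤_; _<_; _*_; _∸_)
open import Data.Integer using (∣_∣)
open import Data.Nat.ListAction using (sum)

-- The conclusion as a predicate in a, v and n_0: `transport` can then replace the projections of a
-- list of entries by the given sequences by matching on equalities.
RecursionAt : List ℕ → List ℤ → ℕ → List ℕ → ℤ → Set
RecursionAt a v n0 lam r =
  maxL (firstVals (length a) n0 v ++ secondVals (length a) n0 v) ≡ just r →
  (maxL (firstVals (length a) n0 v) ≥∞ (maxL (secondVals (length a) n0 v) +∞ + length (S₁ (length a) n0 v r)) →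
    (∀ i → i < length (S₁ (length a) n0 v r) → + nthD 0 lam i ≡ r) →
    polyF (D v lam a n0)
      ≈f rhsFormula (signPow (length (S₁ (length a) n0 v r) * (length a ∸ n0))) n0 (S₁ (length a) n0 v r) (tildeA n0 a) ∣ r ∣
           (D (deleteIdx (S₁ (length a) n0 v r) (addAlpha n0 (length (S₁ (length a) n0 v r)) v))
              (drop (length (S₁ (length a) n0 v r)) lam) (deleteIdx (S₁ (length a) n0 v r) a) (n0 ∸ length (S₁ (length a) n0 v r))))
  ×
  (maxL (secondVals (length a) n0 v) ≥∞ (maxL (firstVals (length a) n0 v) +∞ + length (S₂ (length a) n0 v r)) →
    (∀ i → i < length (S₂ (length a) n0 v r) → + nthD 0 lam i ≡ r) →
    polyF (D v lam a n0)
      ≈f rhsFormula (+ 1) (length a) (S₂ (length a) n0 v r) (tildeA n0 a) ∣ r ∣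
           (D (deleteIdx (S₂ (length a) n0 v r) v) (drop (length (S₂ (length a) n0 v r)) lam) (deleteIdx (S₂ (length a) n0 v r) a) n0))

recursionAt : ∀ a v n0 → 1 ≤ length a → n0 ≤ length a → All (1 ≤_) a → length v ≡ length a → ∀ lam ρ → RecursionAt a v n0 lam (+ suc ρ)
recursionAt a@(_ ∷ as) v n0 1≤n n0≤n pos len lam ρ = transport part≡ exponent≡ length≡
  where
  open Entry
  -- As a is nonempty, `Fin (length a)` has the element `zero`, which serves as the default variable
  -- for lookups.
  open Assembly (LaurentPolynomials.laurentSystem (length a)) Finₚ._≟_ (zero {length as}) (totalFractions (LaurentPolynomials.laurentRing (length a)))
  Z ZF ZS : List (Entry (Fin (length a)))
  Z  = entries (allFin (length a)) a v
  ZF = take n0 Z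
  ZS = drop n0 Z
  length-fin : length (allFin (length a)) ≡ length a
  length-fin = Listₚ.length-tabulate (λ i → i)
  Z≡ : ZF ++ ZS ≡ Z
  Z≡ = Listₚ.take++drop≡id n0 Z
  part≡ : map part (ZF ++ ZS) ≡ a
  part≡ = ≡.trans (≡.cong (map part) Z≡) (entries-part (allFin (length a)) a v length-fin len)
  exponent≡ : map exponent (ZF ++ ZS) ≡ v
  exponent≡ = ≡.trans (≡.cong (map exponent) Z≡) (entries-exponent (allFin (length a)) a v length-fin len)
  length≡ : length ZF ≡ n0
  length≡ = ≡.trans (Listₚ.length-take n0 Z) (ℕₚ.m≤n⇒m⊓n≡m (≡.subst (n0 ≤_)
    (≡.trans (≡.cong length (≡.sym (≡.trans (≡.cong (map part) (≡.sym Z≡)) part≡))) (Listₚ.length-map part Z)) n0≤n))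
  distinct : DistinctEntries (ZF ++ ZS)
  distinct = AllPairsₚ.map⁻ {f = variable′} (≡.subst Unique
    (≡.sym (≡.trans (≡.cong (map variable′) Z≡) (entries-variable (allFin (length a)) a v length-fin len))) (allFin⁺ (length a)))
  transport : ∀ {a v n0} → map part (ZF ++ ZS) ≡ a → map exponent (ZF ++ ZS) ≡ v → length ZF ≡ n0 → RecursionAt a v n0 lam (+ suc ρ)
  transport ≡.refl ≡.refl ≡.refl = Recursion.recursion ZF ZS distinct (Allₚ.map⁻ (≡.subst (All (1 ≤_)) (≡.sym part≡) pos)) lam ρ

theorem1p3 : (a : List ℕ) (v : List ℤ) (n0 : ℕ) (lam : List ℕ) (r : ℤ) →
    1 ≤ length a → n0 ≤ length a → All (1 ≤_) a → length v ≡ length a →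
    Partition lam → + sum lam ≡ sumℤ v →
    maxL (firstVals (length a) n0 v ++ secondVals (length a) n0 v) ≡ just r →
    + 1 ℤ.≤ r →
    (maxL (firstVals (length a) n0 v)
        ≥∞ (maxL (secondVals (length a) n0 v) +∞ + length (S₁ (length a) n0 v r)) →
      (∀ i → i < length (S₁ (length a) n0 v r) → + nthD 0 lam i ≡ r) →
      polyF (D v lam a n0)
        ≈f rhsFormula (signPow (length (S₁ (length a) n0 v r) * (length a ∸ n0))) n0
             (S₁ (length a) n0 v r) (tildeA n0 a) ∣ r ∣
             (D (deleteIdx (S₁ (length a) n0 v r) (addAlpha n0 (length (S₁ (length a) n0 v r)) v))
                (drop (length (S₁ (length a) n0 v r)) lam)
                (deleteIdx (S₁ (length a) n0 v r) a)
                (n0 ∸ length (S₁ (length a) n0 v r))))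
    ×
    (maxL (secondVals (length a) n0 v)
        ≥∞ (maxL (firstVals (length a) n0 v) +∞ + length (S₂ (length a) n0 v r)) →
      (∀ i → i < length (S₂ (length a) n0 v r) → + nthD 0 lam i ≡ r) →
      polyF (D v lam a n0)
        ≈f rhsFormula (+ 1) (length a)
             (S₂ (length a) n0 v r) (tildeA n0 a) ∣ r ∣
             (D (deleteIdx (S₂ (length a) n0 v r) v)
                (drop (length (S₂ (length a) n0 v r)) lam)
                (deleteIdx (S₂ (length a) n0 v r) a)
                n0))
-- A positive r is `suc ρ`, where ρ is the entry r - 1 of the multinomial coefficients; `∣ r ∣`
-- computes to `suc ρ`.
theorem1p3 a v n0 lam (+ suc ρ)   1≤n n0≤n pos len _ _ mx _           = recursionAt a v n0 1≤n n0≤n pos len lam ρ mx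
theorem1p3 a v n0 lam (+ zero)    1≤n n0≤n pos len _ _ mx (ℤ.+≤+ ())
theorem1p3 a v n0 lam -[1+ _ ]    1≤n n0≤n pos len _ _ mx ()
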